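{- If $P \subset \mathbb{R}^d$ is a reflexive and locally anti-blocking polytope, then $P$ has a regular and unimodular triangulation. In particular, the $h^*$-vector of $P$ is unimodal.
   Context: A polytope $Q\subset\mathbb{R}^d_+$ is anti-blocking if $\mathbf{q}\in Q$ and $0\le p_i\le q_i$ for all $i$ imply $\mathbf{p}\in Q$. $P$ is locally anti-blocking if $(\sigma P)\cap\mathbb{R}^d_+$ is anti-blocking for every $\sigma\in\{ -1,+1\}^d$, where $\sigma P$ is the image of $P$ under coordinatewise sign changes by $\sigma$. A $d$-dimensional lattice polytope with $0$ in its interior is reflexive if its polar dual is a lattice polytope. A triangulation is unimodular if all its maximal simplices have normalized volume $1$, and regular if it is induced by a height function on its vertices (lower faces of the lifted polytope). The $h^*$-vector $(h^*_0,\dots,h^*_d)$ of a lattice $d$-polytope $P$ is defined by $1+\sum_{t\ge1}|tP\cap\mathbb{Z}^d|z^t = \sum_i h^*_iz^i/(1-z)^{d+1}$; it is unimodal if $h^*_0\le\cdots\le h^*_k\ge\cdots\ge h^*_d$ for some $k$.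
   Formalization: The points of the polytope, of its polar dual and of the simplices, and the heights, range over rational rather than real vectors and numbers; for lattice polytopes this is equivalent to the real statement. -}

module Defs where

open import Data.Nat as ℕ using (ℕ; zero; suc)
open import Data.Nat.Combinatorics using (_C_)
open import Data.Integer as ℤ using (ℤ; +_)
open import Data.Rational as ℚ using (ℚ; 0ℚ; 1ℚ)
open import Data.Fin using (Fin; zero; suc; toℕ; punchIn)
open import Data.Vec using (Vec; []; _∷_; lookup; map; zipWith; replicate; tabulate)
open import Data.List using (List; length)
open import Data.List.Membership.Propositional using (_∈_)
open import Data.List.Relation.Unary.Unique.Propositional using (Unique)
open import Data.Bool using (Bool; true; false)
open import Data.Product using (Σ; ∃; _×_)
open import Relation.Binary.PropositionalEquality using (_≡_; _≢_)
open import Relation.Nullary using (¬_)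

-- Points: rational points of ℝ^d are Vec ℚ d, lattice points Vec ℤ d.

Pt : ℕ → Set
Pt d = Vec ℚ d

LPt : ℕ → Set
LPt d = Vec ℤ d

embed : ∀ {d} → LPt d → Pt d
embed = map (λ z → z ℚ./ 1)

sumF : ∀ {k} → (Fin k → ℚ) → ℚ
sumF {zero}  f = 0ℚ
sumF {suc k} f = f zero ℚ.+ sumF (λ i → f (suc i))

sumZ : ∀ {k} → (Fin k → ℤ) → ℤ
sumZ {zero}  f = + 0
sumZ {suc k} f = f zero ℤ.+ sumZ (λ i → f (suc i))

sumV : ∀ {d k} → (Fin k → Pt d) → Pt d
sumV {d} {zero}  f = replicate d 0ℚ
sumV {d} {suc k} f = zipWith ℚ._+_ (f zero) (sumV (λ i → f (suc i)))

scale : ∀ {d} → ℚ → Pt d → Pt d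
scale a = map (a ℚ.*_)

dot : ∀ {d} → Pt d → Pt d → ℚ
dot []       []       = 0ℚ
dot (x ∷ xs) (y ∷ ys) = x ℚ.* y ℚ.+ dot xs ys

InConvSupp : ∀ {d k} → (Fin k → Pt d) → (Fin k → Set) → Pt d → Set
InConvSupp {d} {k} W ok x =
  Σ (Fin k → ℚ) λ c →
    (∀ i → 0ℚ ℚ.≤ c i) × (sumF c ≡ 1ℚ) ×
    (sumV (λ i → scale (c i) (W i)) ≡ x) ×
    (∀ i → c i ≢ 0ℚ → ok i)

record ⊤' : Set where

InConv : ∀ {d k} → (Fin k → Pt d) → Pt d → Set
InConv W x = InConvSupp W (λ _ → ⊤') x

-- A lattice polytope P = conv(V 0, …, V (n-1)) with V i ∈ ℤ^d.
-- Membership of a (rational) point in P: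
InP : ∀ {d n} → (Fin n → LPt d) → Pt d → Set
InP V x = InConv (λ i → embed (V i)) x

InDil : ∀ {d n} → ℕ → (Fin n → LPt d) → Pt d → Set
InDil t V x = InConv (λ i → scale (+ t ℚ./ 1) (embed (V i))) x

ZeroInInterior : ∀ {d n} → (Fin n → LPt d) → Set
ZeroInInterior {d} V =
  Σ ℚ λ ε → (0ℚ ℚ.< ε) ×
    (∀ (x : Pt d) → (∀ j → ℚ.∣ lookup x j ∣ ℚ.≤ ε) → InP V x)

InPolar : ∀ {d n} → (Fin n → LPt d) → Pt d → Set
InPolar {d} V y = ∀ (x : Pt d) → InP V x → dot x y ℚ.≤ 1ℚ

IsLatticePolytope : ∀ {d} → (Pt d → Set) → Set
IsLatticePolytope {d} S =
  Σ ℕ λ m → Σ (Fin m → LPt d) λ W →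
    ∀ (y : Pt d) → (S y → InP W y) × (InP W y → S y)

Reflexive : ∀ {d n} → (Fin n → LPt d) → Set
Reflexive V = ZeroInInterior V × IsLatticePolytope (InPolar V)

flipSign : ∀ {d} → (Fin d → Bool) → Pt d → Pt d
flipSign σ x = tabulate λ j → f (σ j) (lookup x j)
  where
  f : Bool → ℚ → ℚ
  f true  a = ℚ.- a
  f false a = a

AntiBlocking : ∀ {d} → (Pt d → Set) → Set
AntiBlocking {d} Q =
  ∀ (q p : Pt d) → Q q → (∀ j → 0ℚ ℚ.≤ lookup p j) →
    (∀ j → lookup p j ℚ.≤ lookup q j) → Q p

NonNeg : ∀ {d} → Pt d → Set
NonNeg x = ∀ j → 0ℚ ℚ.≤ lookup x j

-- (σP) ∩ ℝ^d_+ ; note x ∈ σP ⇔ σx ∈ P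
LocallyAntiBlocking : ∀ {d n} → (Fin n → LPt d) → Set
LocallyAntiBlocking {d} V =
  ∀ (σ : Fin d → Bool) →
    AntiBlocking (λ x → InP V (flipSign σ x) × NonNeg x)

altSign : ℕ → ℤ → ℤ
altSign zero          a = a
altSign (suc zero)    a = ℤ.- a
altSign (suc (suc k)) a = altSign k a

det : ∀ n → (Fin n → Fin n → ℤ) → ℤ
det zero    M = + 1
det (suc n) M =
  sumZ λ j → altSign (toℕ j)
    (M zero j ℤ.* det n (λ r c → M (suc r) (punchIn j c)))

Simplex : ℕ → Set
Simplex d = Fin (suc d) → LPt d

edgeMatrix : ∀ {d} → Simplex d → Fin d → Fin d → ℤ
edgeMatrix S r c = lookup (S (suc r)) c ℤ.- lookup (S zero) c

normVol : ∀ {d} → Simplex d → ℕ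
normVol {d} S = ℤ.∣ det d (edgeMatrix S) ∣

simplexPts : ∀ {d} → Simplex d → Fin (suc d) → Pt d
simplexPts S i = embed (S i)

IsTriangulation : ∀ {d n N} → (Fin n → LPt d) → (Fin N → Simplex d) → Set
IsTriangulation {d} V T =
  (∀ i → normVol (T i) ≢ 0) ×
  -- each simplex lies in P (its vertices do; P is convex)
  (∀ i k → InP V (embed (T i k))) ×
  (∀ (x : Pt d) → InP V x → ∃ λ i → InConv (simplexPts (T i)) x) ×
  -- any two simplices intersect in a common face:
  -- conv(T i) ∩ conv(T j) ⊆ conv(common vertices)
  (∀ i j (x : Pt d) → InConv (simplexPts (T i)) x → InConv (simplexPts (T j)) x →
     InConvSupp (simplexPts (T i)) (λ k → ∃ λ l → T i k ≡ T j l) x)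

Unimodular : ∀ {d N} → (Fin N → Simplex d) → Set
Unimodular T = ∀ i → normVol (T i) ≡ 1

-- Regular: there is a height function ω on the vertices such that every
-- simplex is (the projection of) a lower face of the lifted configuration:
-- some affine function agrees with ω on its vertices and lies strictly
-- below ω at every other vertex of the triangulation.
Regular : ∀ {d N} → (Fin N → Simplex d) → Set
Regular {d} {N} T =
  Σ (LPt d → ℚ) λ ω →
    ∀ i → Σ (Pt d) λ a → Σ ℚ λ b →
      (∀ k → dot a (embed (T i k)) ℚ.+ b ≡ ω (T i k)) ×
      (∀ j l → (∀ k → T j l ≢ T i k) →
         dot a (embed (T j l)) ℚ.+ b ℚ.< ω (T j l))

CountsLatticePts : ∀ {d n} → (Fin n → LPt d) → ℕ → ℕ → Set
CountsLatticePts {d} V t N =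
  Σ (List (LPt d)) λ xs → Unique xs × (length xs ≡ N) ×
    (∀ (z : LPt d) → (z ∈ xs → InDil t V (embed z)) × (InDil t V (embed z) → z ∈ xs))

IsEhrhart : ∀ {d n} → (Fin n → LPt d) → (ℕ → ℕ) → Set
IsEhrhart V L = (L 0 ≡ 1) × (∀ t → CountsLatticePts V (suc t) (L (suc t)))

-- coefficients of (1-z)^{d+1} Σ_t L(t) z^t :
-- h*_i = Σ_{j=0}^{i} (-1)^j C(d+1, j) L(i-j)
hstar : ℕ → (ℕ → ℕ) → ℕ → ℤ
hstar d L i = sumZ {suc i} λ j →
  altSign (toℕ j) (+ ((suc d) C (toℕ j)) ℤ.* + L (i ℕ.∸ toℕ j))

Unimodal : ℕ → (ℕ → ℤ) → Set
Unimodal d h =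
  Σ ℕ λ k → (k ℕ.≤ d) ×
    (∀ i → suc i ℕ.≤ k → h i ℤ.≤ h (suc i)) ×
    (∀ i → k ℕ.≤ i → suc i ℕ.≤ d → h (suc i) ℤ.≤ h i)

{-# OPTIONS --safe #-}
-- Reflexivity and local anti-blocking force the lattice vertices V of P and W of P° into {-1,0,1}^d, and both
-- families are closed under truncation to coordinate subsets.  In the part of an orthant σ where a fixed dual
-- point u₀ is maximal, the functionals σ_k x_k and u₀ − u take only the values 0 and 1 on the lattice points of
-- P on the corresponding face.  Hence pulling these points in any order yields unimodular simplices, and
-- ‖x‖₁ + 1, perturbed lexicographically, is a height function inducing the resulting triangulation.
--
-- The h*-vector of P is then the h-vector of a complete simplicial fan.  A generic vector w partitions the faces
-- into intervals [R(F), F], with h_i the number of facets F with |R(F)| = i; replacing w by −w exchanges R(F)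
-- with its complement in F, so h is symmetric.  For h_m ≤ h_{m+1} when 2m < d, multiplication by a generic
-- linear form must be injective on degree m of the Artinian reduction of the Stanley–Reisner ring by generic
-- linear forms over 𝔽₂[x]: this is the anisotropy argument of Papadakis and Petrotou.  If ℓu = 0, contracting
-- the Frobenius twist of the degree functional with ℓ and all the parameters and evaluating at u² gives 0; the
-- coefficients of the linear forms are independent over squares, so every value of the degree functional on
-- a product of u with a monomial vanishes, and u = 0 because the pairing of R(F) with F ∖ R(F) is triangular.

module Submission where

open import Defs
open import Data.Nat as ℕ using (ℕ; zero; suc; z≤n; s≤s)
import Data.Nat.Properties as ℕₚ
open import Data.Fin as Fin using (Fin; zero; suc)
open import Data.Vec as Vec using (Vec; []; _∷_; lookup)
open import Data.List as List using (List; []; _∷_)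
open import Data.Product using (Σ; ∃; _×_; _,_; proj₁; proj₂)
open import Data.Sum using (_⊎_; inj₁; inj₂)
open import Function using (_∘_)
open import Relation.Nullary using (¬_; Dec; yes; no; contradiction)

-- The algebra stays over a domain: inverse matrices give way to nonzero solutions of homogeneous
-- systems with fewer equations than unknowns, so linear dependences carry denominators. The degree
-- functional arises in this way. Pairs of a facet `F` and an exponent vector of size d - |R(F)|
-- index the face monomials of degree d, and they also index equations which together say that a
-- functional vanishes on the multiples of the parameters. A pair with exponent zero imposes no such
-- condition, and such a pair exists, so fewer equations than unknowns remain. The degrees in the
-- anisotropy argument have to match: the Frobenius twist lives in degree 2d and u² in degree 2m, so
-- 2d - 2m forms must be contracted. These are the d parameters, ℓ, and d - 2m - 1 further generic
-- forms that only fill up the degree. On the geometric side a single order on facets, by the value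
-- at `w` of the linear pieces of the convex function, drives both the spanning argument and the
-- triangularity of the pairing.

-- Linear algebra over a domain, without fractions

module LinAlg where
  open import Level using (0ℓ)
  open import Algebra.Bundles using (CommutativeRing)
  open import Data.Fin using (punchIn)
  open import Data.Fin.Properties using (any?; punchInᵢ≢i)
  open import Data.Vec.Functional using (insertAt)
  open import Data.Vec.Functional.Properties using (insertAt-lookup; insertAt-punchIn)
  open import Relation.Nullary.Decidable using (¬?; decidable-stable)
  open import Relation.Binary.PropositionalEquality as ≡ using (_≢_)

  -- Zero is decidable because elimination has to search for a pivot.
  record Domain : Set₁ where
    field
      commutativeRing : CommutativeRing 0ℓ 0ℓ
    open CommutativeRing commutativeRing public hiding (zero)
    field
      zero?    : ∀ x → Dec (x ≈ 0#)
      no-zero-divisors : ∀ {x y} → x * y ≈ 0# → x ≈ 0# ⊎ y ≈ 0#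
      1≉0      : ¬ 1# ≈ 0#

  module LinearAlgebra (D : Domain) where
    open Domain D
    import Algebra.Properties.Semiring.Sum semiring as S
    open import Algebra.Properties.Ring ring using (-‿distribʳ-*; -‿distribˡ-*)
    open import Relation.Binary.Reasoning.Setoid setoid
    open import Algebra.Solver.Ring.NaturalCoefficients.Default commutativeSemiring
      using (solve; _:*_; _:+_; _:=_)

    abstract
      sum : ∀ {n} → (Fin n → Carrier) → Carrier
      sum = S.sum

      sum-nil : (t : Fin 0 → Carrier) → sum t ≈ 0#
      sum-nil t = refl

      sum-suc : ∀ {n} (t : Fin (suc n) → Carrier) → sum t ≈ t zero + sum (t ∘ suc)
      sum-suc t = refl

      sum-cong : ∀ {n} {s t : Fin n → Carrier} → (∀ i → s i ≈ t i) → sum s ≈ sum t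
      sum-cong = S.sum-cong-≋

      sum-+ : ∀ {n} (s t : Fin n → Carrier) → sum (λ i → s i + t i) ≈ sum s + sum t
      sum-+ = S.∑-distrib-+

      sum-comm : ∀ {m n} (f : Fin m → Fin n → Carrier) →
        sum (λ i → sum (f i)) ≈ sum (λ j → sum (λ i → f i j))
      sum-comm = S.∑-comm

      sum-remove : ∀ {n} (t : Fin (suc n) → Carrier) i → sum t ≈ t i + sum (λ j → t (punchIn i j))
      sum-remove t i = S.sum-remove {i = i} t

      sum-*ˡ : ∀ {n} x (t : Fin n → Carrier) → x * sum t ≈ sum (λ i → x * t i)
      sum-*ˡ = S.*-distribˡ-sum

      sum-*ʳ : ∀ {n} x (t : Fin n → Carrier) → sum t * x ≈ sum (λ i → t i * x)
      sum-*ʳ = S.*-distribʳ-sum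

      sum-zero : ∀ {n} {t : Fin n → Carrier} → (∀ i → t i ≈ 0#) → sum t ≈ 0#
      sum-zero {n} h = trans (S.sum-cong-≋ h) (S.sum-replicate-zero n)

    sum-single : ∀ {n} (t : Fin n → Carrier) i → (∀ j → j ≢ i → t j ≈ 0#) → sum t ≈ t i
    sum-single {suc n} t i h = trans (sum-remove t i)
      (trans (+-congˡ (sum-zero (λ j → h (punchIn i j) (punchInᵢ≢i i j)))) (+-identityʳ _))

    -- Fraction-free Gaussian elimination.
    wide-kernel : ∀ {k n} → k ℕ.< n → (M : Fin k → Fin n → Carrier) →
      Σ (Fin n → Carrier) λ c → (∃ λ j → ¬ c j ≈ 0#) × (∀ i → sum (λ j → M i j * c j) ≈ 0#)
    wide-kernel {zero} {suc n} _ M = (λ _ → 1#) , (zero , 1≉0) , λ ()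
    wide-kernel {suc k} {suc n} (ℕ.s≤s k<n) M with any? (λ j → ¬? (zero? (M zero j)))
    ... | no all0 = let c , nz , eqs = wide-kernel (ℕₚ.m≤n⇒m≤1+n k<n) (M ∘ suc) in
          c , nz , λ { zero → sum-zero (λ j → trans (*-congʳ (decidable-stable (zero? _) (λ ne → all0 (j , ne)))) (zeroˡ _))
                     ; (suc i) → eqs i }
    ... | yes (p , Mp≉0) = c , (punchIn p (proj₁ nz) , c≉0) , λ { zero → eq₀ ; (suc i) → eqₛ i }
      where
      M' : Fin k → Fin n → Carrier
      M' i l = M zero p * M (suc i) (punchIn p l) + - M (suc i) p * M zero (punchIn p l)
      rec = wide-kernel k<n M'
      c' = proj₁ rec
      nz = proj₁ (proj₂ rec)
      eqs = proj₂ (proj₂ rec)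
      s = sum (λ l → M zero (punchIn p l) * c' l)
      c : Fin (suc n) → Carrier
      c = insertAt (λ l → M zero p * c' l) p (- s)
      c≉0 : ¬ c (punchIn p (proj₁ nz)) ≈ 0#
      c≉0 e with no-zero-divisors (trans (reflexive (≡.sym (insertAt-punchIn _ p (- s) (proj₁ nz)))) e)
      ... | inj₁ e₁ = Mp≉0 e₁
      ... | inj₂ e₂ = proj₂ nz e₂
      expand : ∀ (r : Fin (suc n) → Carrier) →
        sum (λ j → r j * c j) ≈ r p * - s + sum (λ l → r (punchIn p l) * (M zero p * c' l))
      expand r = trans (sum-remove _ p) (+-cong
        (*-congˡ (reflexive (insertAt-lookup (λ l → M zero p * c' l) p (- s))))
        (sum-cong (λ l → *-congˡ (reflexive (insertAt-punchIn (λ l → M zero p * c' l) p (- s) l)))))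
      cancel : ∀ a b → b ≈ a * s → a * - s + b ≈ 0#
      cancel a b e = trans (+-cong (sym (-‿distribʳ-* a s)) e) (-‿inverseˡ _)
      eq₀ : sum (λ j → M zero j * c j) ≈ 0#
      eq₀ = trans (expand (M zero)) (cancel _ _ (sym (trans (sum-*ˡ (M zero p) _) (sum-cong
        (λ l → solve 3 (λ a b c → a :* (b :* c) := b :* (a :* c)) refl (M zero p) (M zero (punchIn p l)) (c' l))))))
      eqₛ : ∀ i → sum (λ j → M (suc i) j * c j) ≈ 0#
      eqₛ i = begin
        sum (λ j → M (suc i) j * c j) ≈⟨ expand (M (suc i)) ⟩
        M (suc i) p * - s + sum (λ l → M (suc i) (punchIn p l) * (M zero p * c' l))
          ≈⟨ +-congʳ (trans (sym (-‿distribʳ-* _ s)) (trans (-‿distribˡ-* _ s) (sum-*ˡ _ _))) ⟩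
        sum (λ l → - M (suc i) p * (M zero (punchIn p l) * c' l)) + sum (λ l → M (suc i) (punchIn p l) * (M zero p * c' l))
          ≈⟨ sum-+ (λ l → - M (suc i) p * (M zero (punchIn p l) * c' l)) _ ⟨
        sum (λ l → - M (suc i) p * (M zero (punchIn p l) * c' l) + M (suc i) (punchIn p l) * (M zero p * c' l))
          ≈⟨ sum-cong (λ l → solve 5 (λ a b c d e → a :* (b :* c) :+ d :* (e :* c) := (e :* d :+ a :* b) :* c) refl
               (- M (suc i) p) (M zero (punchIn p l)) (c' l) (M (suc i) (punchIn p l)) (M zero p)) ⟩
        sum (λ l → M' i l * c' l) ≈⟨ eqs i ⟩
        0# ∎

-- Polynomial rings over 𝔽₂ in which odd and even parts separate

module PolynomialRings where
  open import Level using (0ℓ)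
  open import Algebra.Bundles using (CommutativeRing)
  open import Data.Bool using (Bool; true; false; not; _xor_)
  import Data.Bool.Properties as Bₚ
  open import Relation.Binary.PropositionalEquality as ≡ using (_≡_; _≢_)
  open LinAlg

  -- The features of 𝔽₂[x₁,…,x_q] that are needed: Even i z says that only even powers of the i-th
  -- variable occur in z, so extract says that the odd and the even part of a polynomial are independent.
  record GenericDomain (q : ℕ) : Set₁ where
    field
      domain : Domain
    open Domain domain public
    field
      char2   : ∀ x → x + x ≈ 0#
      var     : Fin q → Carrier
      Even    : Fin q → Carrier → Set
      even-≈  : ∀ i {x y} → x ≈ y → Even i x → Even i y
      even-+  : ∀ i {x y} → Even i x → Even i y → Even i (x + y)
      even-*  : ∀ i {x y} → Even i x → Even i y → Even i (x * y)
      even-sq : ∀ i x → Even i (x * x)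
      even-var : ∀ {i j} → i ≢ j → Even i (var j)
      extract : ∀ i {z} → Even i z → Even i (var i * z) → z ≈ 0#

    even-0 : ∀ i → Even i 0#
    even-0 i = even-≈ i (zeroˡ 0#) (even-sq i 0#)

    even-1 : ∀ i → Even i 1#
    even-1 i = even-≈ i (*-identityˡ 1#) (even-sq i 1#)

  𝔽₂ : GenericDomain 0
  𝔽₂ = record
    { domain = record
      { commutativeRing = Bₚ.xor-∧-commutativeRing
      ; zero? = λ x → x Bₚ.≟ false
      ; no-zero-divisors = λ { {false} _ → inj₁ ≡.refl ; {true} e → inj₂ e }
      ; 1≉0 = λ () }
    ; char2 = Bₚ.xor-same
    ; var = λ ()
    ; Even = λ ()
    ; even-≈ = λ () ; even-+ = λ () ; even-* = λ () ; even-sq = λ ()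
    ; even-var = λ { {()} } ; extract = λ () }

  parity : ℕ → Bool
  parity zero = false
  parity (suc n) = not (parity n)

  module Polynomials {q : ℕ} (G : GenericDomain q) where
    open GenericDomain G
    open import Relation.Binary.Reasoning.Setoid setoid
    open import Algebra.Solver.Ring.NaturalCoefficients.Default commutativeSemiring
      using (solve; _:*_; _:+_; _:=_)

    Seq : Set
    Seq = ℕ → Carrier

    -- The Cauchy product, by recursion along the first factor: with f = f(0) + X f', the product is
    -- f(0) g + X (f' g).
    conv : Seq → Seq → Seq
    conv f g zero = f 0 * g 0
    conv f g (suc n) = f 0 * g (suc n) + conv (f ∘ suc) g n

    conv-cong : ∀ {f f' g g'} → (∀ n → f n ≈ f' n) → (∀ n → g n ≈ g' n) → ∀ n → conv f g n ≈ conv f' g' n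
    conv-cong p r zero = *-cong (p 0) (r 0)
    conv-cong p r (suc n) = +-cong (*-cong (p 0) (r (suc n))) (conv-cong (p ∘ suc) r n)

    conv-zero : ∀ {f} g → (∀ n → f n ≈ 0#) → ∀ n → conv f g n ≈ 0#
    conv-zero g p zero = trans (*-congʳ (p 0)) (zeroˡ _)
    conv-zero g p (suc n) = trans (+-cong (trans (*-congʳ (p 0)) (zeroˡ _)) (conv-zero g (p ∘ suc) n)) (+-identityˡ _)

    conv-sucʳ : ∀ f g n → conv f g (suc n) ≈ f (suc n) * g 0 + conv f (g ∘ suc) n
    conv-sucʳ f g zero = +-comm _ _
    conv-sucʳ f g (suc n) = begin
      f 0 * g (2 ℕ.+ n) + conv (f ∘ suc) g (suc n) ≈⟨ +-congˡ (conv-sucʳ (f ∘ suc) g n) ⟩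
      f 0 * g (2 ℕ.+ n) + (f (2 ℕ.+ n) * g 0 + conv (f ∘ suc) (g ∘ suc) n)
        ≈⟨ solve 3 (λ a b c → a :+ (b :+ c) := b :+ (a :+ c)) refl _ _ _ ⟩
      f (2 ℕ.+ n) * g 0 + (f 0 * g (2 ℕ.+ n) + conv (f ∘ suc) (g ∘ suc) n) ∎

    conv-comm : ∀ f g n → conv f g n ≈ conv g f n
    conv-comm f g zero = *-comm _ _
    conv-comm f g (suc n) = trans (+-cong (*-comm _ _) (conv-comm (f ∘ suc) g n)) (sym (conv-sucʳ g f n))

    conv-distribʳ : ∀ f g h n → conv (λ k → f k + g k) h n ≈ conv f h n + conv g h n
    conv-distribʳ f g h zero = distribʳ _ _ _
    conv-distribʳ f g h (suc n) = trans (+-congˡ (conv-distribʳ (f ∘ suc) (g ∘ suc) h n))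
      (solve 5 (λ a b c d e → (a :+ b) :* c :+ (d :+ e) := (a :* c :+ d) :+ (b :* c :+ e)) refl _ _ _ _ _)

    conv-scale : ∀ a f g n → conv (λ k → a * f k) g n ≈ a * conv f g n
    conv-scale a f g zero = *-assoc _ _ _
    conv-scale a f g (suc n) = trans (+-congˡ (conv-scale a (f ∘ suc) g n))
      (solve 4 (λ a b c d → a :* b :* c :+ a :* d := a :* (b :* c :+ d)) refl _ _ _ _)

    conv-assoc : ∀ f g h n → conv (conv f g) h n ≈ conv f (conv g h) n
    conv-assoc f g h zero = *-assoc _ _ _
    conv-assoc f g h (suc n) = begin
      f 0 * g 0 * h (suc n) + conv (λ k → f 0 * g (suc k) + conv (f ∘ suc) g k) h n
        ≈⟨ +-congˡ (trans (conv-distribʳ _ (conv (f ∘ suc) g) h n) (+-cong (conv-scale (f 0) (g ∘ suc) h n) (conv-assoc (f ∘ suc) g h n))) ⟩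
      f 0 * g 0 * h (suc n) + (f 0 * conv (g ∘ suc) h n + conv (f ∘ suc) (conv g h) n)
        ≈⟨ solve 5 (λ a b c d e → a :* b :* c :+ (a :* d :+ e) := a :* (b :* c :+ d) :+ e) refl _ _ _ _ _ ⟩
      f 0 * (g 0 * h (suc n) + conv (g ∘ suc) h n) + conv (f ∘ suc) (conv g h) n ∎

    constant : Carrier → Seq
    constant a zero = a
    constant a (suc n) = 0#

    conv-constant : ∀ a g n → conv (constant a) g n ≈ a * g n
    conv-constant a g zero = refl
    conv-constant a g (suc n) = trans (+-congˡ (conv-zero g (λ _ → refl) n)) (+-identityʳ _)

    shift : Seq
    shift zero = 0#
    shift (suc n) = constant 1# n

    conv-shift : ∀ g n → conv shift g (suc n) ≈ g n
    conv-shift g n = trans (+-cong (zeroˡ _) (trans (conv-cong (λ _ → refl) (λ _ → refl) n) (conv-constant 1# g n)))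
      (trans (+-identityˡ _) (*-identityˡ _))

    -- The bound need not be sharp, since equality compares coefficients only; its purpose is to
    -- make equality with zero decidable.
    record Poly : Set where
      constructor poly
      field
        coef   : Seq
        bound  : ℕ
        vanish : ∀ n → bound ℕ.≤ n → coef n ≈ 0#
    open Poly

    conv-vanish : ∀ {f g} b c → (∀ n → b ℕ.≤ n → f n ≈ 0#) → (∀ n → c ℕ.≤ n → g n ≈ 0#) →
      ∀ n → b ℕ.+ c ℕ.≤ n → conv f g n ≈ 0#
    conv-vanish {g = g} zero c p r n _ = conv-zero g (λ k → p k z≤n) n
    conv-vanish (suc b) c p r (suc n) (s≤s le) = trans (+-cong
      (trans (*-congˡ (r (suc n) (ℕₚ.m≤n⇒m≤1+n (ℕₚ.≤-trans (ℕₚ.m≤n+m c b) le)))) (zeroʳ _))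
      (conv-vanish b c (λ k → p (suc k) ∘ s≤s) r n le)) (+-identityˡ _)

    _⊕_ _⊛_ : Poly → Poly → Poly
    f ⊕ g = poly (λ n → coef f n + coef g n) (bound f ℕ.⊔ bound g) λ n le → trans (+-cong
      (vanish f n (ℕₚ.≤-trans (ℕₚ.m≤m⊔n _ _) le)) (vanish g n (ℕₚ.≤-trans (ℕₚ.m≤n⊔m (bound f) _) le))) (+-identityˡ _)
    f ⊛ g = poly (conv (coef f) (coef g)) (bound f ℕ.+ bound g) (conv-vanish (bound f) (bound g) (vanish f) (vanish g))

    ⊝_ : Poly → Poly
    ⊝ f = poly (λ n → - coef f n) (bound f) λ n le → trans (-‿cong (vanish f n le)) (trans (sym (+-identityˡ _)) (-‿inverseʳ 0#))

    const : Carrier → Poly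
    const a = poly (constant a) 1 λ { (suc n) _ → refl }

    X : Poly
    X = poly shift 2 λ { (suc (suc n)) _ → refl ; (suc zero) (s≤s ()) }

    polyRing : CommutativeRing 0ℓ 0ℓ
    polyRing = record
      { Carrier = Poly
      ; _≈_ = λ f g → ∀ n → coef f n ≈ coef g n
      ; _+_ = _⊕_ ; _*_ = _⊛_ ; -_ = ⊝_ ; 0# = const 0# ; 1# = const 1#
      ; isCommutativeRing = record
        { isRing = record
          { +-isAbelianGroup = record
            { isGroup = record
              { isMonoid = record
                { isSemigroup = record
                  { isMagma = record
                    { isEquivalence = record { refl = λ _ → refl ; sym = λ p n → sym (p n) ; trans = λ p r n → trans (p n) (r n) }
                    ; ∙-cong = λ p r n → +-cong (p n) (r n) }
                  ; assoc = λ f g h n → +-assoc _ _ _ }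
                ; identity = (λ f → λ { zero → +-identityˡ _ ; (suc n) → +-identityˡ _ }) ,
                             (λ f → λ { zero → +-identityʳ _ ; (suc n) → +-identityʳ _ }) }
              ; inverse = (λ f → λ { zero → -‿inverseˡ _ ; (suc n) → -‿inverseˡ _ }) ,
                          (λ f → λ { zero → -‿inverseʳ _ ; (suc n) → -‿inverseʳ _ })
              ; ⁻¹-cong = λ p n → -‿cong (p n) }
            ; comm = λ f g n → +-comm _ _ }
          ; *-cong = conv-cong
          ; *-assoc = λ f g h → conv-assoc (coef f) (coef g) (coef h)
          ; *-identity = one , λ f n → trans (conv-comm (coef f) (constant 1#) n) (one f n)
          ; distrib = (λ f g h n → trans (conv-comm (coef f) _ n) (trans (conv-distribʳ (coef g) (coef h) (coef f) n)
                         (+-cong (conv-comm (coef g) _ n) (conv-comm (coef h) _ n)))) ,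
                      λ f g h → conv-distribʳ (coef g) (coef h) (coef f) }
        ; *-comm = λ f g → conv-comm (coef f) (coef g) } }
      where
      one : ∀ f n → conv (constant 1#) (coef f) n ≈ coef f n
      one f n = trans (conv-constant 1# (coef f) n) (*-identityˡ _)

    Order : Seq → Set
    Order f = ∃ λ i → (¬ f i ≈ 0#) × (∀ j → j ℕ.< i → f j ≈ 0#)

    order : ∀ b f → (∀ n → b ℕ.≤ n → f n ≈ 0#) → (∀ n → f n ≈ 0#) ⊎ Order f
    order zero f p = inj₁ (λ n → p n z≤n)
    order (suc b) f p with zero? (f 0)
    ... | no f0≉0 = inj₂ (0 , f0≉0 , λ j ())
    ... | yes f0≈0 with order b (f ∘ suc) (λ n → p (suc n) ∘ s≤s)
    ...   | inj₁ all0 = inj₁ λ { zero → f0≈0 ; (suc n) → all0 n }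
    ...   | inj₂ (i , fi , lt) = inj₂ (suc i , fi , λ { zero _ → f0≈0 ; (suc j) (s≤s l) → lt j l })

    -- The initial zeros of `f` are a factor X^i. Removing it brings a nonzero coefficient to the
    -- front, as `conv-cancel` requires.
    conv-drop : ∀ i f g → (∀ j → j ℕ.< i → f j ≈ 0#) → ∀ n → conv f g (i ℕ.+ n) ≈ conv (λ k → f (i ℕ.+ k)) g n
    conv-drop zero f g p n = refl
    conv-drop (suc i) f g p n = trans (+-cong (trans (*-congʳ (p 0 (s≤s z≤n))) (zeroˡ _))
      (conv-drop i (f ∘ suc) g (λ j → p (suc j) ∘ s≤s) n)) (+-identityˡ _)

    -- Comparing constant coefficients gives g(0) = 0; a factor X then splits off `g` and the
    -- argument repeats.
    conv-cancel : ∀ f g → ¬ f 0 ≈ 0# → (∀ n → conv f g n ≈ 0#) → ∀ n → g n ≈ 0#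
    conv-cancel f g f0 p = λ { zero → g0 ; (suc n) → conv-cancel f (g ∘ suc) f0
        (λ k → trans (sym (trans (conv-sucʳ f g k) (trans (+-congʳ (trans (*-congˡ g0) (zeroʳ _))) (+-identityˡ _)))) (p (suc k))) n }
      where
      g0 : g 0 ≈ 0#
      g0 with no-zero-divisors (p 0)
      ... | inj₁ e = contradiction e f0
      ... | inj₂ e = e

    const-0 : ∀ {f : Seq} → (∀ n → f n ≈ 0#) → ∀ n → f n ≈ constant 0# n
    const-0 p zero = p 0
    const-0 p (suc n) = p (suc n)

    0-const : ∀ {f : Seq} → (∀ n → f n ≈ constant 0# n) → ∀ n → f n ≈ 0#
    0-const p zero = p 0
    0-const p (suc n) = p (suc n)

    polyDomain : Domain
    polyDomain = record
      { commutativeRing = polyRing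
      ; zero? = isZero
      ; no-zero-divisors = λ {f} {g} → nzd f g
      ; 1≉0 = λ e → 1≉0 (e 0) }
      where
      isZero : ∀ f → Dec (∀ n → coef f n ≈ constant 0# n)
      isZero f with order (bound f) (coef f) (vanish f)
      ... | inj₁ all0 = yes (const-0 all0)
      ... | inj₂ (i , fi , _) = no λ all0 → fi (0-const all0 i)
      nzd : ∀ f g → (∀ n → conv (coef f) (coef g) n ≈ constant 0# n) →
        (∀ n → coef f n ≈ constant 0# n) ⊎ (∀ n → coef g n ≈ constant 0# n)
      nzd f g p with order (bound f) (coef f) (vanish f)
      ... | inj₁ all0 = inj₁ (const-0 all0)
      ... | inj₂ (i , fi , lt) = inj₂ (const-0 (conv-cancel (λ k → coef f (i ℕ.+ k)) (coef g)
              (λ e → fi (≡.subst (λ k → coef f k ≈ 0#) (ℕₚ.+-identityʳ i) e))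
              (λ n → trans (sym (conv-drop i (coef f) (coef g) lt n)) (0-const p (i ℕ.+ n)))))

    -- Nonzero coefficients occur only in degrees of parity `b`, where `false` means even.
    Supp : Bool → Seq → Set
    Supp b f = ∀ n → parity n ≡ not b → f n ≈ 0#

    conv-supp : ∀ b c {f g} → Supp b f → Supp c g → Supp (b xor c) (conv f g)
    conv-supp b c p r zero e = go b c p r e
      where
      go : ∀ b c {f g} → Supp b f → Supp c g → false ≡ not (b xor c) → f 0 * g 0 ≈ 0#
      go true false p r e = trans (*-congʳ (p 0 ≡.refl)) (zeroˡ _)
      go false true p r e = trans (*-congˡ (r 0 ≡.refl)) (zeroʳ _)
      go true true p r ()
      go false false p r ()
    conv-supp true c p r (suc n) e = trans (+-cong (trans (*-congʳ (p 0 ≡.refl)) (zeroˡ _))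
      (conv-supp false c (λ k e' → p (suc k) (≡.cong not e')) r n (Bₚ.not-injective e))) (+-identityˡ _)
    conv-supp false c p r (suc n) e = trans (+-cong (trans (*-congˡ (r (suc n) e)) (zeroʳ _))
      (conv-supp true c (λ k e' → p (suc k) (≡.cong not e')) r n
        (≡.trans (Bₚ.not-injective e) (≡.sym (Bₚ.not-involutive c))))) (+-identityˡ _)

    -- In characteristic 2, (f(0) + X g)² = f(0)² + X² g², because the mixed term occurs twice.
    conv-square : ∀ f n → conv f f (suc (suc n)) ≈ conv (f ∘ suc) (f ∘ suc) n
    conv-square f n = begin
      f 0 * f (2 ℕ.+ n) + conv (f ∘ suc) f (suc n) ≈⟨ +-congˡ (conv-sucʳ (f ∘ suc) f n) ⟩
      f 0 * f (2 ℕ.+ n) + (f (2 ℕ.+ n) * f 0 + conv (f ∘ suc) (f ∘ suc) n)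
        ≈⟨ solve 3 (λ a b c → a :* b :+ (b :* a :+ c) := (a :* b :+ a :* b) :+ c) refl _ _ _ ⟩
      (f 0 * f (2 ℕ.+ n) + f 0 * f (2 ℕ.+ n)) + conv (f ∘ suc) (f ∘ suc) n
        ≈⟨ trans (+-congʳ (char2 _)) (+-identityˡ _) ⟩
      conv (f ∘ suc) (f ∘ suc) n ∎

    conv-square₁ : ∀ f → conv f f 1 ≈ 0#
    conv-square₁ f = trans (+-congˡ (*-comm _ _)) (char2 _)

    square-supp : ∀ f → Supp false (conv f f)
    square-supp f (suc zero) _ = conv-square₁ f
    square-supp f (suc (suc n)) e = trans (conv-square f n)
      (square-supp (f ∘ suc) n (≡.trans (≡.sym (Bₚ.not-involutive _)) e))

    square-even : ∀ i f n → Even i (conv f f n)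
    square-even i f zero = even-sq i (f 0)
    square-even i f (suc zero) = even-≈ i (sym (conv-square₁ f)) (even-0 i)
    square-even i f (suc (suc n)) = even-≈ i (sym (conv-square f n)) (square-even i (f ∘ suc) n)

    conv-even : ∀ i {f g} → (∀ n → Even i (f n)) → (∀ n → Even i (g n)) → ∀ n → Even i (conv f g n)
    conv-even i p r zero = even-* i (p 0) (r 0)
    conv-even i p r (suc n) = even-+ i (even-* i (p 0) (r (suc n))) (conv-even i (p ∘ suc) r n)

    constant-even : ∀ i {a} → Even i a → ∀ n → Even i (constant a n)
    constant-even i e zero = e
    constant-even i e (suc n) = even-0 i

    polynomials : GenericDomain (suc q)
    polynomials = record
      { domain = polyDomain
      ; char2 = λ f → const-0 (λ n → char2 (coef f n))
      ; var = λ { zero → X ; (suc j) → const (var j) }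
      ; Even = λ { zero f → Supp false (coef f) ; (suc i) f → ∀ n → Even i (coef f n) }
      ; even-≈ = λ { zero e p n h → trans (sym (e n)) (p n h) ; (suc i) e p n → even-≈ i (e n) (p n) }
      ; even-+ = λ { zero p r n h → trans (+-cong (p n h) (r n h)) (+-identityˡ _) ; (suc i) p r n → even-+ i (p n) (r n) }
      ; even-* = λ { zero p r → conv-supp false false p r ; (suc i) p r → conv-even i p r }
      ; even-sq = λ { zero f → square-supp (coef f) ; (suc i) f → square-even i (coef f) }
      ; even-var = λ {i} {j} → evar i j
      ; extract = λ { zero {z} p r → const-0 (λ n → ext (coef z) p r n (parity n) ≡.refl)
                    ; (suc i) {z} p r → const-0 (λ n → extract i (p n) (even-≈ i (conv-constant (var i) (coef z) n) (r n))) } }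
      where
      -- The odd coefficients of `z` vanish by `p`; the even ones are the odd coefficients of X z
      -- and vanish by `r`.
      ext : ∀ z → Supp false z → Supp false (conv shift z) → ∀ n b → parity n ≡ b → z n ≈ 0#
      ext z p r n true e = p n e
      ext z p r n false e = trans (sym (conv-shift z n)) (r (suc n) (≡.cong not e))
      evar : ∀ i j → i ≢ j → _
      evar zero zero ne = contradiction ≡.refl ne
      evar zero (suc j) ne (suc n) e = refl
      evar (suc i) zero ne zero = even-0 i
      evar (suc i) zero ne (suc n) = constant-even i (even-1 i) n
      evar (suc i) (suc j) ne = constant-even i (even-var (ne ∘ ≡.cong suc))

  𝔽₂[_] : ∀ q → GenericDomain q
  𝔽₂[ zero ] = 𝔽₂
  𝔽₂[ suc q ] = Polynomials.polynomials 𝔽₂[ q ]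

-- Integer vectors, scalar products and inequalities

module IntegerVectors where
  open import Data.Integer as ℤ using (ℤ; +_; 0ℤ; 1ℤ; _+_; _*_; -_; _-_; _≤_; _<_; +≤+; +<+)
  import Data.Integer.Properties as ℤₚ
  open import Data.Integer.Tactic.RingSolver using (solve-∀)
  open import Data.Fin using (punchIn)
  open import Data.Vec using (map; zipWith; replicate; tabulate)
  open import Data.Vec.Properties using (lookup-replicate; tabulate∘lookup; tabulate-cong)
  open import Relation.Binary.PropositionalEquality using (_≡_; _≢_; refl; sym; trans; cong; cong₂; subst)
  open LinAlg

  ℤ-domain : Domain
  ℤ-domain = record
    { commutativeRing = ℤₚ.+-*-commutativeRing
    ; zero? = ℤ._≟ 0ℤ
    ; no-zero-divisors = λ {x} e → ℤₚ.i*j≡0⇒i≡0∨j≡0 x e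
    ; 1≉0 = λ () }

  module ∑ℤ = LinearAlgebra ℤ-domain
  open ∑ℤ public using () renaming (sum to ∑)

  0≤* : ∀ {x y} → 0ℤ ≤ x → 0ℤ ≤ y → 0ℤ ≤ x * y
  0≤* {+ m} {+ n} _ _ = subst (0ℤ ≤_) (ℤₚ.pos-* m n) (+≤+ z≤n)

  0<* : ∀ {x y} → 0ℤ < x → 0ℤ < y → 0ℤ < x * y
  0<* {+ suc m} {+ suc n} _ _ = +<+ (s≤s z≤n)
  0<* {+ zero} (+<+ ()) _
  0<* {+ suc m} {+ zero} _ (+<+ ())

  0≤+ : ∀ {x y} → 0ℤ ≤ x → 0ℤ ≤ y → 0ℤ ≤ x + y
  0≤+ p q = ℤₚ.+-mono-≤ p q

  0<+ : ∀ {x y} → 0ℤ < x → 0ℤ ≤ y → 0ℤ < x + y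
  0<+ p q = ℤₚ.+-mono-<-≤ p q

  <⇒0< : ∀ {x y} → x < y → 0ℤ < y - x
  <⇒0< {x} {y} p = subst (_< y - x) (ℤₚ.+-inverseʳ x) (ℤₚ.+-monoˡ-< (- x) p)

  0<⇒< : ∀ {x y} → 0ℤ < y - x → x < y
  0<⇒< {x} {y} p = subst (x <_) (cancel x y) (subst (_< x + (y - x)) (ℤₚ.+-identityʳ x) (ℤₚ.+-monoʳ-< x p))
    where
    cancel : ∀ x y → x + (y - x) ≡ y
    cancel = solve-∀

  *-sub : ∀ x y z → x * (y - z) ≡ x * y - x * z
  *-sub = solve-∀

  ≮0⇒0≤ : ∀ {x} → ¬ x < 0ℤ → 0ℤ ≤ x
  ≮0⇒0≤ = ℤₚ.≮⇒≥

  ∑-mono : ∀ {n} {s t : Fin n → ℤ} → (∀ i → s i ≤ t i) → ∑ s ≤ ∑ t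
  ∑-mono {zero} {s} {t} p = ℤₚ.≤-reflexive (trans (∑ℤ.sum-nil s) (sym (∑ℤ.sum-nil t)))
  ∑-mono {suc n} {s} {t} p rewrite ∑ℤ.sum-suc s | ∑ℤ.sum-suc t = ℤₚ.+-mono-≤ (p zero) (∑-mono (p ∘ suc))

  ∑-nonneg : ∀ {n} {t : Fin n → ℤ} → (∀ i → 0ℤ ≤ t i) → 0ℤ ≤ ∑ t
  ∑-nonneg {n} {t} p = subst (_≤ ∑ t) (∑ℤ.sum-zero {n} {λ _ → 0ℤ} (λ _ → refl)) (∑-mono p)

  ∑-term≤ : ∀ {n} {t : Fin n → ℤ} → (∀ i → 0ℤ ≤ t i) → ∀ i → t i ≤ ∑ t
  ∑-term≤ {suc n} {t} p i rewrite ∑ℤ.sum-remove t i =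
    subst (_≤ t i + ∑ (λ j → t (punchIn i j))) (ℤₚ.+-identityʳ (t i)) (ℤₚ.+-monoʳ-≤ (t i) (∑-nonneg (λ j → p (punchIn i j))))

  ∑-zero-terms : ∀ {n} {t : Fin n → ℤ} → (∀ i → 0ℤ ≤ t i) → ∑ t ≤ 0ℤ → ∀ i → t i ≡ 0ℤ
  ∑-zero-terms p q i = ℤₚ.≤-antisym (ℤₚ.≤-trans (∑-term≤ p i) q) (p i)

  ∑-neg : ∀ {n} (t : Fin n → ℤ) → ∑ (λ i → - t i) ≡ - ∑ t
  ∑-neg t = trans (∑ℤ.sum-cong (λ i → sym (ℤₚ.-1*i≡-i (t i)))) (trans (sym (∑ℤ.sum-*ˡ (- 1ℤ) t)) (ℤₚ.-1*i≡-i _))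

  ∑-sub : ∀ {n} (s t : Fin n → ℤ) → ∑ (λ i → s i - t i) ≡ ∑ s - ∑ t
  ∑-sub s t = trans (∑ℤ.sum-+ s (λ i → - t i)) (cong (λ x → ∑ s + x) (∑-neg t))

  bounded : ∀ {n} (g : Fin n → ℕ) → ∃ λ K → ∀ i → g i ℕ.< K
  bounded {zero} g = 0 , λ ()
  bounded {suc n} g = let K , p = bounded (g ∘ suc) in
    suc (g zero) ℕ.⊔ K , λ { zero → ℕₚ.m≤m⊔n (suc (g zero)) K ; (suc i) → ℕₚ.≤-trans (p i) (ℕₚ.m≤n⊔m (suc (g zero)) K) }

  infixl 7 _∙_ _⊡_
  infixl 6 _⊞_

  _∙_ : ∀ {d} → Vec ℤ d → Vec ℤ d → ℤ
  [] ∙ [] = 0ℤ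
  (x ∷ xs) ∙ (y ∷ ys) = x * y + xs ∙ ys

  _⊞_ : ∀ {d} → Vec ℤ d → Vec ℤ d → Vec ℤ d
  _⊞_ = zipWith _+_

  _⊡_ : ∀ {d} → ℤ → Vec ℤ d → Vec ℤ d
  a ⊡ x = map (a *_) x

  𝟘 : ∀ {d} → Vec ℤ d
  𝟘 = replicate _ 0ℤ

  unit : ∀ {d} → Fin d → Vec ℤ d
  unit zero = 1ℤ ∷ 𝟘
  unit (suc k) = 0ℤ ∷ unit k

  ∙-comm : ∀ {d} (x y : Vec ℤ d) → x ∙ y ≡ y ∙ x
  ∙-comm [] [] = refl
  ∙-comm (x ∷ xs) (y ∷ ys) = cong₂ _+_ (ℤₚ.*-comm x y) (∙-comm xs ys)

  ∙-⊞ : ∀ {d} (u x y : Vec ℤ d) → u ∙ (x ⊞ y) ≡ u ∙ x + u ∙ y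
  ∙-⊞ [] [] [] = refl
  ∙-⊞ (u ∷ us) (x ∷ xs) (y ∷ ys) = trans (cong (λ t → u * (x + y) + t) (∙-⊞ us xs ys)) (rearr u x y (us ∙ xs) (us ∙ ys))
    where
    rearr : ∀ a b c d e → a * (b + c) + (d + e) ≡ a * b + d + (a * c + e)
    rearr = solve-∀

  ∙-⊡ : ∀ {d} (u : Vec ℤ d) a x → u ∙ (a ⊡ x) ≡ a * (u ∙ x)
  ∙-⊡ [] a [] = sym (ℤₚ.*-zeroʳ a)
  ∙-⊡ (u ∷ us) a (x ∷ xs) = trans (cong (λ t → u * (a * x) + t) (∙-⊡ us a xs)) (rearr u a x (us ∙ xs))
    where
    rearr : ∀ u a x y → u * (a * x) + a * y ≡ a * (u * x + y)
    rearr = solve-∀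

  ∙-𝟘 : ∀ {d} (u : Vec ℤ d) → u ∙ 𝟘 ≡ 0ℤ
  ∙-𝟘 [] = refl
  ∙-𝟘 (u ∷ us) rewrite ∙-𝟘 us = trans (ℤₚ.+-identityʳ _) (ℤₚ.*-zeroʳ u)

  ⊞-∙ : ∀ {d} (u w x : Vec ℤ d) → (u ⊞ w) ∙ x ≡ u ∙ x + w ∙ x
  ⊞-∙ u w x = trans (∙-comm _ x) (trans (∙-⊞ x u w) (cong₂ _+_ (∙-comm x u) (∙-comm x w)))

  ⊡-∙ : ∀ {d} a (u x : Vec ℤ d) → (a ⊡ u) ∙ x ≡ a * (u ∙ x)
  ⊡-∙ a u x = trans (∙-comm _ x) (trans (∙-⊡ x a u) (cong (a *_) (∙-comm x u)))

  𝟘-∙ : ∀ {d} (u : Vec ℤ d) → 𝟘 ∙ u ≡ 0ℤ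
  𝟘-∙ u = trans (∙-comm _ u) (∙-𝟘 u)

  unit-∙ : ∀ {d} (k : Fin d) x → unit k ∙ x ≡ lookup x k
  unit-∙ zero (x ∷ xs) rewrite 𝟘-∙ xs = trans (ℤₚ.+-identityʳ _) (ℤₚ.*-identityˡ x)
  unit-∙ (suc k) (x ∷ xs) = trans (ℤₚ.+-identityˡ _) (unit-∙ k xs)

  lookup-unit-same : ∀ {d} (j : Fin d) → lookup (unit j) j ≡ 1ℤ
  lookup-unit-same zero = refl
  lookup-unit-same (suc j) = lookup-unit-same j

  lookup-unit-other : ∀ {d} {i j : Fin d} → i ≢ j → lookup (unit i) j ≡ 0ℤ
  lookup-unit-other {i = zero} {zero} ne = contradiction refl ne
  lookup-unit-other {i = zero} {suc j} ne = lookup-replicate j 0ℤ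
  lookup-unit-other {i = suc i} {zero} ne = refl
  lookup-unit-other {i = suc i} {suc j} ne = lookup-unit-other (ne ∘ cong suc)

  lookup-ext : ∀ {A : Set} {d} {x y : Vec A d} → (∀ k → lookup x k ≡ lookup y k) → x ≡ y
  lookup-ext {x = x} {y} h = trans (sym (tabulate∘lookup x)) (trans (tabulate-cong h) (tabulate∘lookup y))

  -- Testing with unit vectors suffices. Vector identities below are proved through arbitrary
  -- functionals, so that they become identities between scalar sums.
  ∙-ext : ∀ {d} {x y : Vec ℤ d} → (∀ u → u ∙ x ≡ u ∙ y) → x ≡ y
  ∙-ext {x = x} {y} h = lookup-ext λ k → trans (sym (unit-∙ k x)) (trans (h (unit k)) (unit-∙ k y))

  ∙-tabulate : ∀ {d} (g : Fin d → ℤ) (z : Vec ℤ d) → tabulate g ∙ z ≡ ∑ (λ k → g k * lookup z k)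
  ∙-tabulate g [] = sym (∑ℤ.sum-nil _)
  ∙-tabulate g (z ∷ zs) = trans (cong (λ t → g zero * z + t) (∙-tabulate (g ∘ suc) zs)) (sym (∑ℤ.sum-suc _))

  ∙-∑ : ∀ {d} (x z : Vec ℤ d) → x ∙ z ≡ ∑ (λ k → lookup x k * lookup z k)
  ∙-∑ x z = trans (cong (_∙ z) (sym (tabulate∘lookup x))) (∙-tabulate (lookup x) z)

  abstract
    comb : ∀ {k d} → (Fin k → ℤ) → (Fin k → Vec ℤ d) → Vec ℤ d
    comb {zero} c v = 𝟘
    comb {suc k} c v = (c zero ⊡ v zero) ⊞ comb (c ∘ suc) (v ∘ suc)

    comb-nil : ∀ {d} c (v : Fin 0 → Vec ℤ d) → comb c v ≡ 𝟘
    comb-nil c v = refl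

    comb-suc : ∀ {k d} c (v : Fin (suc k) → Vec ℤ d) → comb c v ≡ (c zero ⊡ v zero) ⊞ comb (c ∘ suc) (v ∘ suc)
    comb-suc c v = refl

    ∙-comb : ∀ {k d} (u : Vec ℤ d) (c : Fin k → ℤ) v → u ∙ comb c v ≡ ∑ (λ j → c j * (u ∙ v j))
    ∙-comb {zero} u c v = trans (∙-𝟘 u) (sym (∑ℤ.sum-nil _))
    ∙-comb {suc k} u c v = trans (∙-⊞ u _ _) (trans (cong₂ _+_ (∙-⊡ u (c zero) (v zero)) (∙-comb u (c ∘ suc) (v ∘ suc))) (sym (∑ℤ.sum-suc _)))

  comb-∙ : ∀ {k d} (u : Vec ℤ d) (c : Fin k → ℤ) v → comb c v ∙ u ≡ ∑ (λ j → c j * (v j ∙ u))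
  comb-∙ u c v = trans (∙-comm _ u) (trans (∙-comb u c v) (∑ℤ.sum-cong λ j → cong (c j *_) (∙-comm u (v j))))

  comb-cong : ∀ {k d} {c c' : Fin k → ℤ} (v : Fin k → Vec ℤ d) → (∀ j → c j ≡ c' j) → comb c v ≡ comb c' v
  comb-cong v h = ∙-ext λ u → trans (∙-comb u _ v) (trans (∑ℤ.sum-cong λ j → cong (_* (u ∙ v j)) (h j)) (sym (∙-comb u _ v)))

  comb-units : ∀ {d} (z : Vec ℤ d) → comb (lookup z) unit ≡ z
  comb-units z = lookup-ext λ k → trans (sym (unit-∙ k _)) (trans (∙-comb (unit k) _ unit)
    (trans (∑ℤ.sum-cong λ j → trans (ℤₚ.*-comm (lookup z j) _) (cong (_* lookup z j) (∙-comm (unit k) (unit j))))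
    (trans (∑ℤ.sum-cong λ j → cong (_* lookup z j) (unit-∙ j (unit k)))
    (trans (sym (∙-∑ (unit k) z)) (unit-∙ k z)))))

-- Complete fans, generic vectors and the partition of face monomials into intervals

module Fans where
  open import Data.Integer as ℤ using (ℤ; +_; -[1+_]; 0ℤ; 1ℤ; _+_; _*_; -_; _-_; _≤_; _<_; +≤+; +<+; ∣_∣)
  import Data.Integer.Properties as ℤₚ
  open import Data.Integer.Tactic.RingSolver using (solve-∀)
  open import Data.Fin using (_≟_; combine; remQuot)
  open import Data.Fin.Properties using (any?; all?; remQuot-combine)
  open import Relation.Nullary.Decidable using (_→-dec_; ¬?; decidable-stable)
  open import Relation.Binary.PropositionalEquality using (_≡_; _≢_; refl; sym; trans; cong; cong₂; subst)
  open import Relation.Binary.Definitions using (Tri; tri<; tri≈; tri>)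
  open IntegerVectors

  -- A complete unimodular simplicial fan with rays v, together with a strictly
  -- convex piecewise linear function: a F is its linear piece on the cone F.
  record Fan (d n N : ℕ) : Set where
    field
      v : Fin n → Vec ℤ d
      f : Fin N → Fin d → Fin n
      c : Fin N → Fin d → Vec ℤ d
      c-same  : ∀ F j → c F j ∙ v (f F j) ≡ 1ℤ
      c-other : ∀ F {i j} → i ≢ j → c F i ∙ v (f F j) ≡ 0ℤ
      c-span  : ∀ F z → comb (λ j → c F j ∙ z) (v ∘ f F) ≡ z
      ω : Fin n → ℤ
      a : Fin N → Vec ℤ d
      a-eq : ∀ F j → a F ∙ v (f F j) ≡ ω (f F j)
      a-lt : ∀ F k → (∀ j → f F j ≢ k) → a F ∙ v k < ω k
      cover : ∀ z → ∃ λ F → ∀ j → 0ℤ ≤ c F j ∙ z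
      f-set : ∀ {F F'} → (∀ j → ∃ λ i → f F' i ≡ f F j) → F ≡ F'

  -- A positive integer `x` is at least 1, so `K` only has to exceed the absolute value of `y`.
  large : ∀ K x y → ∣ y ∣ ℕ.< K → 0ℤ < x → 0ℤ < + K * x + y
  large K (+ zero) y _ (+<+ ())
  large K (+ suc x) (+ y) lt _ = 0<+ (0<* {+ K} (+<+ (ℕₚ.≤-trans (s≤s z≤n) lt)) (+<+ (s≤s z≤n))) (+≤+ z≤n)
  large K (+ suc x) -[1+ y ] lt _ = ℤₚ.<-≤-trans (<⇒0< {+ suc y} {+ K} (+<+ lt))
    (ℤₚ.+-monoˡ-≤ -[1+ y ] (ℤₚ.≤-trans (+≤+ (ℕₚ.m≤m*n K (suc x))) (ℤₚ.≤-reflexive (ℤₚ.pos-* K (suc x)))))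

  -- Large multiples of z dominate w on finitely many functionals.
  perturb′ : ∀ {d m} (u : Fin m → Vec ℤ d) z w → ∃ λ K → ∀ i →
    (0ℤ < u i ∙ z → 0ℤ < u i ∙ ((+ K ⊡ z) ⊞ w)) ×
    (u i ∙ z < 0ℤ → u i ∙ ((+ K ⊡ z) ⊞ w) < 0ℤ) ×
    (u i ∙ z ≡ 0ℤ → u i ∙ ((+ K ⊡ z) ⊞ w) ≡ u i ∙ w)
  perturb′ u z w = K , λ i → pos i , neg i , zer i
    where
    K = proj₁ (bounded (λ i → ∣ u i ∙ w ∣))
    eq : ∀ i → u i ∙ ((+ K ⊡ z) ⊞ w) ≡ + K * (u i ∙ z) + u i ∙ w
    eq i = trans (∙-⊞ (u i) _ w) (cong (_+ u i ∙ w) (∙-⊡ (u i) (+ K) z))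
    negate : ∀ k x y → + k * (- x) + - y ≡ - (+ k * x + y)
    negate k = lemma (+ k)
      where lemma : ∀ a b e → a * (- b) + - e ≡ - (a * b + e)
            lemma = solve-∀
    bd = proj₂ (bounded (λ i → ∣ u i ∙ w ∣))
    pos : ∀ i → _ → _
    pos i h = subst (0ℤ <_) (sym (eq i)) (large K _ _ (bd i) h)
    neg : ∀ i → _ → _
    neg i h = subst (_< 0ℤ) (sym (eq i)) (ℤₚ.neg-cancel-< (subst (0ℤ <_) (negate K (u i ∙ z) (u i ∙ w))
      (large K _ (- (u i ∙ w)) (subst (ℕ._< K) (sym (ℤₚ.∣-i∣≡∣i∣ (u i ∙ w))) (bd i)) (ℤₚ.neg-mono-< h))))
    zer : ∀ i → _ → _
    zer i h = trans (eq i) (trans (cong (λ t → + K * t + u i ∙ w) h)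
      (trans (cong (_+ u i ∙ w) (ℤₚ.*-zeroʳ (+ K))) (ℤₚ.+-identityˡ _)))

  -- Opaque, like the other primed constructions below: conversion checking must not unfold the witnesses.
  abstract
    perturb : ∀ {d m} (u : Fin m → Vec ℤ d) z w → ∃ λ K → ∀ i →
      (0ℤ < u i ∙ z → 0ℤ < u i ∙ ((+ K ⊡ z) ⊞ w)) ×
      (u i ∙ z < 0ℤ → u i ∙ ((+ K ⊡ z) ⊞ w) < 0ℤ) ×
      (u i ∙ z ≡ 0ℤ → u i ∙ ((+ K ⊡ z) ⊞ w) ≡ u i ∙ w)
    perturb = perturb′

  nonzero-coordinate : ∀ {d} (u : Vec ℤ d) → u ≢ 𝟘 → ∃ λ k → lookup u k ≢ 0ℤ
  nonzero-coordinate [] ne = contradiction refl ne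
  nonzero-coordinate (x ∷ u) ne with x ℤ.≟ 0ℤ
  ... | no x≢0 = zero , x≢0
  ... | yes refl = let k , p = nonzero-coordinate u (ne ∘ cong (0ℤ ∷_)) in suc k , p

  -- A vector off all hyperplanes is built one hyperplane at a time; adding a large multiple of `z`
  -- then makes the nonzero signs of `z` prevail.
  generic′ : ∀ {d m} (u : Fin m → Vec ℤ d) → (∀ i → u i ≢ 𝟘) → ∀ z → ∃ λ w → ∀ i →
    u i ∙ w ≢ 0ℤ × (0ℤ < u i ∙ z → 0ℤ < u i ∙ w) × (u i ∙ z < 0ℤ → u i ∙ w < 0ℤ)
  generic′ {d} {m} u nz z = (+ K ⊡ z) ⊞ w₀ , prop
    where
    avoid : ∀ {m} (u : Fin m → Vec ℤ d) → (∀ i → u i ≢ 𝟘) → ∃ λ w → ∀ i → u i ∙ w ≢ 0ℤ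
    avoid {zero} u nz = 𝟘 , λ ()
    avoid {suc m} u nz with avoid (u ∘ suc) (nz ∘ suc)
    ... | w , p with u zero ∙ w ℤ.≟ 0ℤ
    ...   | no ne = w , λ { zero → ne ; (suc i) → p i }
    -- Here `w` lies on the new hyperplane. A unit vector in a nonzero coordinate of `u zero` moves
    -- it off, and the large multiple of `w` keeps it off the others.
    ...   | yes e = (+ K ⊡ w) ⊞ unit k , λ
              { zero h → proj₂ nc (trans (sym (unit-∙ k (u zero))) (trans (∙-comm (unit k) (u zero)) (trans (sym (proj₂ (proj₂ (pp zero)) e)) h)))
              ; (suc i) h → trichotomy i h (ℤₚ.<-cmp (u (suc i) ∙ w) 0ℤ) }
      where
      nc = nonzero-coordinate (u zero) (nz zero)
      k = proj₁ nc
      K = proj₁ (perturb u w (unit k))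
      pp = proj₂ (perturb u w (unit k))
      trichotomy : ∀ i → u (suc i) ∙ ((+ K ⊡ w) ⊞ unit k) ≡ 0ℤ → Tri _ _ _ → _
      trichotomy i h (tri< lt _ _) = ℤₚ.<-irrefl h (proj₁ (proj₂ (pp (suc i))) lt)
      trichotomy i h (tri≈ _ eq _) = p i eq
      trichotomy i h (tri> _ _ gt) = ℤₚ.<-irrefl (sym h) (proj₁ (pp (suc i)) gt)
    w₀ = proj₁ (avoid u nz)
    K = proj₁ (perturb u z w₀)
    pp = proj₂ (perturb u z w₀)
    prop : ∀ i → u i ∙ ((+ K ⊡ z) ⊞ w₀) ≢ 0ℤ × _ × _
    prop i = nonzero (ℤₚ.<-cmp (u i ∙ z) 0ℤ) , proj₁ (pp i) , proj₁ (proj₂ (pp i))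
      where
      nonzero : Tri _ _ _ → _
      nonzero (tri< lt _ _) h = ℤₚ.<-irrefl h (proj₁ (proj₂ (pp i)) lt)
      nonzero (tri≈ _ eq _) h = proj₂ (avoid u nz) i (trans (sym (proj₂ (proj₂ (pp i)) eq)) h)
      nonzero (tri> _ _ gt) h = ℤₚ.<-irrefl (sym h) (proj₁ (pp i) gt)

  abstract
    generic : ∀ {d m} (u : Fin m → Vec ℤ d) → (∀ i → u i ≢ 𝟘) → ∀ z → ∃ λ w → ∀ i →
      u i ∙ w ≢ 0ℤ × (0ℤ < u i ∙ z → 0ℤ < u i ∙ w) × (u i ∙ z < 0ℤ → u i ∙ w < 0ℤ)
    generic = generic′

  Mon : ℕ → Set
  Mon n = Vec ℕ n

  module FanProperties {d n N : ℕ} (fan : Fan d n N) where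
    open Fan fan

    In : Fin N → Fin n → Set
    In F k = ∃ λ j → f F j ≡ k

    In? : ∀ F k → Dec (In F k)
    In? F k = any? (λ j → f F j ≟ k)

    f-inj : ∀ F {i j} → f F i ≡ f F j → i ≡ j
    f-inj F {i} {j} e with i ≟ j
    ... | yes p = p
    ... | no ne with trans (sym (c-same F i)) (trans (cong (λ k → c F i ∙ v k) e) (c-other F ne))
    ...   | ()

    c≢𝟘 : ∀ F j → c F j ≢ 𝟘
    c≢𝟘 F j e with trans (sym (c-same F j)) (trans (cong (_∙ v (f F j)) e) (𝟘-∙ (v (f F j))))
    ... | ()

    a-le : ∀ F k → a F ∙ v k ≤ ω k
    a-le F k with In? F k
    ... | yes (j , refl) = ℤₚ.≤-reflexive (a-eq F j)
    ... | no nin = ℤₚ.<⇒≤ (a-lt F k (λ j e → nin (j , e)))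

    a-tight : ∀ F k → a F ∙ v k ≡ ω k → In F k
    a-tight F k e with In? F k
    ... | yes p = p
    ... | no nin = contradiction (a-lt F k (λ j e → nin (j , e))) (ℤₚ.<-irrefl e)

    a-span : ∀ F z F' → a F' ∙ z ≡ ∑ (λ j → (c F j ∙ z) * (a F' ∙ v (f F j)))
    a-span F z F' = trans (cong (a F' ∙_) (sym (c-span F z))) (∙-comb (a F') _ _)

    -- Through this map monomials are located by cones; it is injective on face monomials.
    pt : Mon n → Vec ℤ d
    pt m = comb (λ k → + lookup m k) v

    Face : Fin N → Mon n → Set
    Face F m = ∀ k → lookup m k ≢ 0 → In F k

    Face? : ∀ F m → Dec (Face F m)
    Face? F m = all? (λ k → ¬? (lookup m k ℕ.≟ 0) →-dec In? F k)

    pt-coef : ∀ F m → Face F m → ∀ j → c F j ∙ pt m ≡ + lookup m (f F j)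
    pt-coef F m face j = trans (∙-comb (c F j) _ v) (trans (∑ℤ.sum-single _ (f F j) others)
        (trans (cong (+ lookup m (f F j) *_) (c-same F j)) (ℤₚ.*-identityʳ _)))
      where
      others : ∀ k → k ≢ f F j → + lookup m k * (c F j ∙ v k) ≡ 0ℤ
      others k ne with lookup m k ℕ.≟ 0
      ... | yes e rewrite e = refl
      ... | no m≢0 with face k m≢0
      ...   | i , refl = trans (cong (+ lookup m (f F i) *_) (c-other F (λ e → ne (cong (f F) (sym e))))) (ℤₚ.*-zeroʳ (+ lookup m (f F i)))

    -- Both representations of the same point have the same ω-weight, so the linear piece of
    -- the second cone is tight on the support of the first.
    face-transfer : ∀ {F₁ F₂} m → Face F₁ m → (∀ j → 0ℤ ≤ c F₂ j ∙ pt m) → Face F₂ m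
    face-transfer {F₁} {F₂} m face₁ nonneg k m≢0 = a-tight F₂ k (sym (ℤₚ.i-j≡0⇒i≡j (ω k) _ (cancel (ℤₚ.i*j≡0⇒i≡0∨j≡0 (+ lookup m k) zeroterm))))
      where
      weight : ∑ (λ k → + lookup m k * ω k) ≡ a F₁ ∙ pt m
      weight = sym (trans (∙-comb (a F₁) _ v) (∑ℤ.sum-cong tight))
        where
        tight : ∀ k → + lookup m k * (a F₁ ∙ v k) ≡ + lookup m k * ω k
        tight k with lookup m k ℕ.≟ 0
        ... | yes e rewrite e = refl
        ... | no m≢0 with face₁ k m≢0
        ...   | j , refl = cong (+ lookup m (f F₁ j) *_) (a-eq F₁ j)
      le : a F₁ ∙ pt m ≤ a F₂ ∙ pt m
      le = ℤₚ.≤-trans (ℤₚ.≤-reflexive (a-span F₂ (pt m) F₁)) (ℤₚ.≤-trans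
        (∑-mono (λ j → ℤₚ.*-monoˡ-≤-nonNeg (c F₂ j ∙ pt m) {{ℤ.nonNegative (nonneg j)}} (a-le F₁ (f F₂ j))))
        (ℤₚ.≤-reflexive (trans (∑ℤ.sum-cong (λ j → cong ((c F₂ j ∙ pt m) *_) (sym (a-eq F₂ j)))) (sym (a-span F₂ (pt m) F₂)))))
      total : ∑ (λ k → + lookup m k * (ω k - a F₂ ∙ v k)) ≤ 0ℤ
      total = subst (_≤ 0ℤ) (sym (trans (∑ℤ.sum-cong (λ k → *-sub (+ lookup m k) (ω k) (a F₂ ∙ v k)))
        (trans (∑-sub _ _) (cong₂ _-_ weight (sym (∙-comb (a F₂) _ v)))))) (ℤₚ.i≤j⇒i-j≤0 le)
      zeroterm = ∑-zero-terms (λ k → 0≤* {+ lookup m k} (+≤+ z≤n) (ℤₚ.i≤j⇒0≤j-i (a-le F₂ k))) total k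
      cancel : + lookup m k ≡ 0ℤ ⊎ ω k - a F₂ ∙ v k ≡ 0ℤ → ω k - a F₂ ∙ v k ≡ 0ℤ
      cancel (inj₁ e) = contradiction (ℤₚ.+-injective e) m≢0
      cancel (inj₂ e) = e

    face-ext : ∀ {F m m'} → Face F m → Face F m' → (∀ j → lookup m (f F j) ≡ lookup m' (f F j)) → m ≡ m'
    face-ext {F} {m} {m'} face face' h = lookup-ext same
      where
      same : ∀ k → lookup m k ≡ lookup m' k
      same k with In? F k
      ... | yes (j , refl) = h j
      ... | no nin = trans (decidable-stable (lookup m k ℕ.≟ 0) (nin ∘ face k)) (sym (decidable-stable (lookup m' k ℕ.≟ 0) (nin ∘ face' k)))

    -- Equality of the points makes the coordinates of `pt m` in the cone `F'` nonnegative, so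
    -- `face-transfer` puts both supports into `F'`, where coordinates determine the monomial.
    pt-injective : ∀ {F F' m m'} → Face F m → Face F' m' → pt m ≡ pt m' → m ≡ m'
    pt-injective {F} {F'} {m} {m'} face face' e = face-ext face'm face' λ j → ℤₚ.+-injective
        (trans (sym (pt-coef F' m face'm j)) (trans (cong (c F' j ∙_) e) (pt-coef F' m' face' j)))
      where
      face'm : Face F' m
      face'm = face-transfer m face λ j → subst (0ℤ ≤_) (sym (trans (cong (c F' j ∙_) e) (pt-coef F' m' face' j))) (+≤+ z≤n)

    Generic : Vec ℤ d → Set
    Generic w = ∀ F j → c F j ∙ w ≢ 0ℤ

    -- For a face monomial of `F` this says that `pt m`, moved slightly in direction `w`, stays in
    -- the cone `F`. Equivalently, `m` is a multiple of the squarefree monomial of R(F).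
    Low : Vec ℤ d → Fin N → Mon n → Set
    Low w F m = ∀ j → c F j ∙ w < 0ℤ → lookup m (f F j) ≢ 0

    functional : Fin (N ℕ.* d) → Vec ℤ d
    functional i = c (proj₁ (remQuot {N} d i)) (proj₂ (remQuot {N} d i))

    functional-combine : ∀ F j → functional (combine F j) ≡ c F j
    functional-combine F j = cong (λ p → c (proj₁ p) (proj₂ p)) (remQuot-combine {N} {d} F j)

    generic-near′ : ∀ z → ∃ λ w → Generic w × (∀ F j → c F j ∙ z < 0ℤ → c F j ∙ w < 0ℤ)
    generic-near′ z = let w , p = generic functional (λ i → c≢𝟘 _ _) z in
      w , (λ F j e → proj₁ (p (combine F j)) (trans (cong (_∙ w) (functional-combine F j)) e)) ,
      λ F j lt → subst (λ u → u ∙ w < 0ℤ) (functional-combine F j)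
        (proj₂ (proj₂ (p (combine F j))) (subst (λ u → u ∙ z < 0ℤ) (sym (functional-combine F j)) lt))

    abstract
      generic-near : ∀ z → ∃ λ w → Generic w × (∀ F j → c F j ∙ z < 0ℤ → c F j ∙ w < 0ℤ)
      generic-near = generic-near′

    -- A cone containing K pt m + w for large K works: its functionals are nonnegative on `pt m`,
    -- and nonnegative on `w` wherever they vanish on `pt m`.
    locate′ : ∀ w → Generic w → ∀ {F₁} m → Face F₁ m → ∃ λ F → Face F m × Low w F m
    locate′ w gen {F₁} m face₁ = F , face , low
      where
      K = proj₁ (perturb functional (pt m) w)
      z = (+ K ⊡ pt m) ⊞ w
      pp : ∀ F j → _
      pp F j = subst (λ u → (0ℤ < u ∙ pt m → 0ℤ < u ∙ z) × (u ∙ pt m < 0ℤ → u ∙ z < 0ℤ) × (u ∙ pt m ≡ 0ℤ → u ∙ z ≡ u ∙ w))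
        (functional-combine F j) (proj₂ (perturb functional (pt m) w) (combine F j))
      F = proj₁ (cover z)
      nonneg : ∀ j → 0ℤ ≤ c F j ∙ pt m
      nonneg j = ≮0⇒0≤ λ lt → ℤₚ.≤⇒≯ (proj₂ (cover z) j) (proj₁ (proj₂ (pp F j)) lt)
      face : Face F m
      face = face-transfer m face₁ nonneg
      low : Low w F m
      low j lt e = ℤₚ.≤⇒≯ (subst (0ℤ ≤_) (proj₂ (proj₂ (pp F j)) (trans (pt-coef F m face j) (cong +_ e))) (proj₂ (cover z) j)) lt

    abstract
      locate : ∀ w → Generic w → ∀ {F₁} m → Face F₁ m → ∃ λ F → Face F m × Low w F m
      locate = locate′

    val : Vec ℤ d → Fin N → ℤ
    val w F = a F ∙ w

    -- The difference of the values is the sum, over the rays of `F`, of the coordinate of `w` times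
    -- the gap between ω and the linear piece of `F'`. A ray with negative coordinate belongs to the
    -- support of `m`, hence to `F'`, and has gap zero; a ray outside `F'` contributes a positive
    -- term.
    lower : ∀ w → Generic w → ∀ {F F'} m → Low w F m → Face F' m → F' ≢ F → val w F' < val w F
    lower w gen {F} {F'} m low face' ne = 0<⇒< (subst (0ℤ <_) diff
        (ℤₚ.<-≤-trans strict (∑-term≤ nonneg j₀)))
      where
      term : Fin d → ℤ
      term j = (c F j ∙ w) * (ω (f F j) - a F' ∙ v (f F j))
      diff : ∑ term ≡ val w F - val w F'
      diff = trans (∑ℤ.sum-cong (λ j → *-sub (c F j ∙ w) (ω (f F j)) (a F' ∙ v (f F j)))) (trans (∑-sub _ _)
        (cong₂ _-_ (trans (∑ℤ.sum-cong (λ j → cong ((c F j ∙ w) *_) (sym (a-eq F j)))) (sym (a-span F w F))) (sym (a-span F w F'))))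
      nonneg : ∀ j → 0ℤ ≤ term j
      nonneg j with c F j ∙ w ℤₚ.<? 0ℤ
      ... | no ≮ = 0≤* (≮0⇒0≤ ≮) (ℤₚ.i≤j⇒0≤j-i (a-le F' _))
      ... | yes lt with face' (f F j) (low j lt)
      ...   | i , e = ℤₚ.≤-reflexive (sym (trans (cong (c F j ∙ w *_) (ℤₚ.i≡j⇒i-j≡0 {ω (f F j)} (sym (subst (λ k → a F' ∙ v k ≡ ω k) e (a-eq F' i))))) (ℤₚ.*-zeroʳ (c F j ∙ w))))
      outside : ∃ λ j → ¬ In F' (f F j)
      outside with any? (λ j → ¬? (In? F' (f F j)))
      ... | yes p = p
      ... | no all = contradiction (sym (f-set (λ j → decidable-stable (In? F' (f F j)) (λ nin → all (j , nin))))) ne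
      j₀ = proj₁ outside
      pos : 0ℤ < c F j₀ ∙ w
      pos = ℤₚ.≤∧≢⇒< (≮0⇒0≤ (λ lt → proj₂ outside (face' _ (low j₀ lt)))) (gen F j₀ ∘ sym)
      strict : 0ℤ < term j₀
      strict = 0<* pos (<⇒0< (a-lt F' _ (λ i e → proj₂ outside (i , e))))

    locate-unique : ∀ w → Generic w → ∀ {F F'} m → Face F m → Low w F m → Face F' m → Low w F' m → F ≡ F'
    locate-unique w gen {F} {F'} m face low face' low' with F ≟ F'
    ... | yes e = e
    ... | no ne = contradiction (lower w gen m low face' (ne ∘ sym)) (ℤₚ.<-asym (lower w gen m low' face ne))

-- Monomials as exponent vectors

module Monomials where
  open import Data.Bool using (Bool; true; false; not; _∧_)
  import Data.Bool.Properties as Bₚ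
  open import Data.Nat using (_+_; ⌊_/2⌋)
  open import Data.Fin using (_≟_)
  open import Data.Fin.Properties using (suc-injective)
  open import Data.Vec using (map; zipWith; replicate; updateAt)
  open import Data.Vec.Properties using (lookup-zipWith; lookup∘updateAt; lookup∘updateAt′; updateAt-commutes; zipWith-comm; zipWith-assoc; lookup-replicate)
  open import Data.List using (_++_)
  open import Data.List.Membership.Propositional using (_∈_)
  open import Data.List.Membership.Propositional.Properties using (∈-map⁺; ∈-map⁻; ∈-++⁺ˡ; ∈-++⁺ʳ; ∈-++⁻; ∈-lookup)
  open import Data.List.Relation.Unary.Unique.Propositional using (Unique)
  import Data.List.Relation.Unary.Unique.Propositional.Properties as Uₚ
  open import Data.List.Relation.Unary.AllPairs using ([]; _∷_)
  open import Data.List.Relation.Unary.All as All using (All)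
  open import Relation.Binary.PropositionalEquality using (_≡_; _≢_; refl; sym; trans; cong; cong₂; subst)
  open PolynomialRings using (parity)
  open Fans using (Mon)

  size : ∀ {n} → Mon n → ℕ
  size = Vec.sum

  inc : ∀ {n} → Fin n → Mon n → Mon n
  inc k m = updateAt m k suc

  infixl 6 _⊕_
  _⊕_ : ∀ {n} → Mon n → Mon n → Mon n
  _⊕_ = zipWith _+_

  𝟎 : ∀ {n} → Mon n
  𝟎 = replicate _ 0

  inc-comm : ∀ {n} (j k : Fin n) m → inc j (inc k m) ≡ inc k (inc j m)
  inc-comm j k m with j ≟ k
  ... | yes refl = refl
  ... | no ne = updateAt-commutes j k ne m

  size-inc : ∀ {n} (k : Fin n) m → size (inc k m) ≡ suc (size m)
  size-inc zero (x ∷ m) = refl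
  size-inc (suc k) (x ∷ m) = trans (cong (x +_) (size-inc k m)) (ℕₚ.+-suc x (size m))

  size-⊕ : ∀ {n} (a b : Mon n) → size (a ⊕ b) ≡ size a + size b
  size-⊕ [] [] = refl
  size-⊕ (x ∷ a) (y ∷ b) = trans (cong (x + y +_) (size-⊕ a b))
    (trans (ℕₚ.+-assoc x y _) (trans (cong (x +_) (trans (sym (ℕₚ.+-assoc y _ _)) (trans (cong (_+ size b) (ℕₚ.+-comm y (size a))) (ℕₚ.+-assoc (size a) y _)))) (sym (ℕₚ.+-assoc x _ _))))

  size-𝟎 : ∀ n → size (𝟎 {n}) ≡ 0
  size-𝟎 zero = refl
  size-𝟎 (suc n) = size-𝟎 n

  ⊕-comm : ∀ {n} (a b : Mon n) → a ⊕ b ≡ b ⊕ a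
  ⊕-comm = zipWith-comm ℕₚ.+-comm

  ⊕-assoc : ∀ {n} (a b c : Mon n) → (a ⊕ b) ⊕ c ≡ a ⊕ (b ⊕ c)
  ⊕-assoc = zipWith-assoc ℕₚ.+-assoc

  𝟎-⊕ : ∀ {n} (a : Mon n) → 𝟎 ⊕ a ≡ a
  𝟎-⊕ [] = refl
  𝟎-⊕ (x ∷ a) = cong (x ∷_) (𝟎-⊕ a)

  inc-⊕ : ∀ {n} k (a b : Mon n) → inc k a ⊕ b ≡ inc k (a ⊕ b)
  inc-⊕ zero (x ∷ a) (y ∷ b) = refl
  inc-⊕ (suc k) (x ∷ a) (y ∷ b) = cong (_ ∷_) (inc-⊕ k a b)

  ⊕-double : ∀ {n} (a b : Mon n) → (a ⊕ a) ⊕ (b ⊕ b) ≡ (a ⊕ b) ⊕ (a ⊕ b)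
  ⊕-double a b = trans (⊕-assoc a a _) (trans (cong (a ⊕_) (trans (sym (⊕-assoc a b b)) (⊕-comm (a ⊕ b) b))) (sym (⊕-assoc a b _)))

  evenᵇ : ∀ {n} → Mon n → Bool
  evenᵇ [] = true
  evenᵇ (x ∷ m) = not (parity x) ∧ evenᵇ m

  half : ∀ {n} → Mon n → Mon n
  half = map ⌊_/2⌋

  even-inc² : ∀ {n} (k : Fin n) m → evenᵇ (inc k (inc k m)) ≡ evenᵇ m
  even-inc² zero (x ∷ m) = cong (λ b → not b ∧ evenᵇ m) (Bₚ.not-involutive (parity x))
  even-inc² (suc k) (x ∷ m) = cong (not (parity x) ∧_) (even-inc² k m)

  half-inc² : ∀ {n} (k : Fin n) m → half (inc k (inc k m)) ≡ inc k (half m)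
  half-inc² zero (x ∷ m) = refl
  half-inc² (suc k) (x ∷ m) = cong (⌊ x /2⌋ ∷_) (half-inc² k m)

  parity-double : ∀ x → parity (x + x) ≡ false
  parity-double zero = refl
  parity-double (suc x) = trans (cong (not ∘ parity) (ℕₚ.+-suc x x)) (trans (Bₚ.not-involutive _) (parity-double x))

  even-double : ∀ {n} (m : Mon n) → evenᵇ (m ⊕ m) ≡ true
  even-double [] = refl
  even-double (x ∷ m) rewrite parity-double x = even-double m

  half-double : ∀ {n} (m : Mon n) → half (m ⊕ m) ≡ m
  half-double [] = refl
  half-double (x ∷ m) = cong₂ _∷_ (sym (ℕₚ.n≡⌊n+n/2⌋ x)) (half-double m)

  lookup-inc-≢0 : ∀ {n} (k : Fin n) m → lookup (inc k m) k ≢ 0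
  lookup-inc-≢0 k m e with trans (sym e) (lookup∘updateAt k m)
  ... | ()

  lookup-inc-mono : ∀ {n} (j k : Fin n) m → lookup m k ≢ 0 → lookup (inc j m) k ≢ 0
  lookup-inc-mono j k m ne with k ≟ j
  ... | yes refl = lookup-inc-≢0 j m
  ... | no k≢j = ne ∘ trans (sym (lookup∘updateAt′ k j k≢j m))

  lookup-half : ∀ {n} (k : Fin n) m → evenᵇ m ≡ true → lookup m k ≢ 0 → lookup (half m) k ≢ 0
  lookup-half zero (suc zero ∷ m) ()
  lookup-half zero (zero ∷ m) e ne _ = ne refl
  lookup-half zero (suc (suc x) ∷ m) e ne ()
  lookup-half (suc k) (x ∷ m) e ne = lookup-half k m (go (parity x) e) ne
    where
    go : ∀ b → not b ∧ evenᵇ m ≡ true → evenᵇ m ≡ true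
    go false p = p

  lookup-⊕-≢0ˡ : ∀ {n} (k : Fin n) a b → lookup a k ≢ 0 → lookup (a ⊕ b) k ≢ 0
  lookup-⊕-≢0ˡ k a b ne e = ne (ℕₚ.m+n≡0⇒m≡0 (lookup a k) (trans (sym (lookup-zipWith _+_ k a b)) e))

  lookup-⊕-≢0ʳ : ∀ {n} (k : Fin n) a b → lookup b k ≢ 0 → lookup (a ⊕ b) k ≢ 0
  lookup-⊕-≢0ʳ k a b ne e = ne (ℕₚ.m+n≡0⇒n≡0 (lookup a k) (trans (sym (lookup-zipWith _+_ k a b)) e))

  uninc : ∀ {n} (k : Fin n) m → lookup m k ≢ 0 → ∃ λ m' → inc k m' ≡ m
  uninc zero (zero ∷ m) ne = contradiction refl ne
  uninc zero (suc x ∷ m) ne = x ∷ m , refl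
  uninc (suc k) (x ∷ m) ne = let m' , e = uninc k m ne in x ∷ m' , cong (x ∷_) e

  positive-size : ∀ {n} (m : Mon n) {s} → size m ≡ suc s → ∃ λ k → lookup m k ≢ 0
  positive-size (suc x ∷ m) e = zero , λ ()
  positive-size (zero ∷ m) e = let k , ne = positive-size m e in suc k , ne

  incs : ∀ {k n} → (Fin k → Fin n) → Mon n → Mon n
  incs {zero} I m = m
  incs {suc k} I m = incs (I ∘ suc) (inc (I zero) m)

  -- Spells a monomial as a word in the variables, the form in which iterated contractions see it.
  -- The monomial `g` accumulates the letters already used.
  decompose : ∀ {n} k (m : Mon n) → size m ≡ k → ∀ g → ∃ λ (I : Fin k → Fin n) → incs I g ≡ m ⊕ g
  decompose zero m e g = (λ ()) , sym (trans (cong (_⊕ g) (zero-size m e)) (𝟎-⊕ g))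
    where
    zero-size : ∀ {n} (m : Mon n) → size m ≡ 0 → m ≡ 𝟎
    zero-size [] _ = refl
    zero-size (zero ∷ m) e = cong (0 ∷_) (zero-size m e)
  decompose (suc k) m e g with positive-size m e
  ... | j , ne with uninc j m ne
  ...   | m' , refl with decompose k m' (ℕₚ.suc-injective (trans (sym (size-inc j m')) e)) (inc j g)
  ...     | I , eq = (λ { zero → j ; (suc i) → I i }) ,
            trans eq (trans (⊕-comm m' _) (trans (inc-⊕ j g m') (trans (cong (inc j) (⊕-comm g m')) (sym (inc-⊕ j m' g)))))

  sumℕ : ∀ {k} → (Fin k → ℕ) → ℕ
  sumℕ {zero} α = 0
  sumℕ {suc k} α = α zero + sumℕ (α ∘ suc)

  sumℕ-+ : ∀ {k} (α β : Fin k → ℕ) → sumℕ (λ j → α j + β j) ≡ sumℕ α + sumℕ β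
  sumℕ-+ {zero} α β = refl
  sumℕ-+ {suc k} α β rewrite sumℕ-+ (α ∘ suc) (β ∘ suc) =
    trans (ℕₚ.+-assoc (α zero) _ _) (trans (cong (α zero +_) (trans (sym (ℕₚ.+-assoc (β zero) _ _))
      (trans (cong (_+ sumℕ (β ∘ suc)) (ℕₚ.+-comm (β zero) (sumℕ (α ∘ suc)))) (ℕₚ.+-assoc (sumℕ (α ∘ suc)) _ _)))) (sym (ℕₚ.+-assoc (α zero) _ _)))

  sumℕ-1 : ∀ k → sumℕ {k} (λ _ → 1) ≡ k
  sumℕ-1 zero = refl
  sumℕ-1 (suc k) = cong suc (sumℕ-1 k)

  size-sumℕ : ∀ {k} (α : Vec ℕ k) → sumℕ (lookup α) ≡ size α
  size-sumℕ [] = refl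
  size-sumℕ (x ∷ α) = cong (x +_) (size-sumℕ α)

  mono : ∀ {d n} → (Fin d → Fin n) → (Fin d → ℕ) → Mon n
  mono {zero} f α = 𝟎
  mono {suc d} f α = updateAt (mono (f ∘ suc) (α ∘ suc)) (f zero) (α zero +_)

  size-addAt : ∀ {n} (k : Fin n) x m → size (updateAt m k (x +_)) ≡ x + size m
  size-addAt zero x (y ∷ m) = ℕₚ.+-assoc x y _
  size-addAt (suc k) x (y ∷ m) = trans (cong (y +_) (size-addAt k x m))
    (trans (sym (ℕₚ.+-assoc y x _)) (trans (cong (_+ size m) (ℕₚ.+-comm y x)) (ℕₚ.+-assoc x y _)))

  size-mono : ∀ {d n} (f : Fin d → Fin n) α → size (mono f α) ≡ sumℕ α
  size-mono {zero} {n} f α = size-𝟎 n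
  size-mono {suc d} f α = trans (size-addAt (f zero) (α zero) (mono (f ∘ suc) (α ∘ suc))) (cong (α zero +_) (size-mono (f ∘ suc) (α ∘ suc)))

  mono-out : ∀ {d n} (f : Fin d → Fin n) α k → (∀ j → f j ≢ k) → lookup (mono f α) k ≡ 0
  mono-out {zero} f α k h = lookup-replicate k 0
  mono-out {suc d} f α k h = trans (lookup∘updateAt′ k (f zero) (h zero ∘ sym) (mono (f ∘ suc) (α ∘ suc))) (mono-out (f ∘ suc) (α ∘ suc) k (h ∘ suc))

  mono-in : ∀ {d n} (f : Fin d → Fin n) α → (∀ {i j} → f i ≡ f j → i ≡ j) → ∀ j → lookup (mono f α) (f j) ≡ α j
  mono-in {suc d} f α inj zero = trans (lookup∘updateAt (f zero) {α zero +_} (mono (f ∘ suc) (α ∘ suc))) (trans (cong (α zero +_)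
    (mono-out (f ∘ suc) (α ∘ suc) (f zero) (λ j e → contradiction (inj e) λ ()))) (ℕₚ.+-identityʳ _))
  mono-in {suc d} f α inj (suc j) = trans (lookup∘updateAt′ (f (suc j)) (f zero) (λ e → contradiction (inj e) λ ()) (mono (f ∘ suc) (α ∘ suc)))
    (mono-in (f ∘ suc) (α ∘ suc) (λ e → suc-injective (inj e)) j)

  module _ {A : Set} (B : ℕ → List A) where

    bump : ∀ {k} → A × Vec ℕ (suc k) → A × Vec ℕ (suc k)
    bump (x , y ∷ α) = x , suc y ∷ α

    pad : ∀ {k} → A × Vec ℕ k → A × Vec ℕ (suc k)
    pad (x , α) = x , 0 ∷ α

    -- Pairs of an element of B s and an exponent vector of size t - s.
    enum : ∀ k → ℕ → List (A × Vec ℕ k)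
    enum zero t = List.map (_, []) (B t)
    enum (suc k) zero = List.map pad (enum k zero)
    enum (suc k) (suc t) = List.map bump (enum (suc k) t) ++ List.map pad (enum k (suc t))

    ∈-enum⁺ : ∀ k {s x} (α : Vec ℕ k) → x ∈ B s → (x , α) ∈ enum k (s + size α)
    ∈-enum⁺ zero {s} [] h = ∈-map⁺ (_, []) (subst (λ t → _ ∈ B t) (sym (ℕₚ.+-identityʳ s)) h)
    ∈-enum⁺ (suc k) {s} {x} (zero ∷ α) h = go (s + size α) (∈-enum⁺ k α h)
      where
      go : ∀ t → (x , α) ∈ enum k t → (x , 0 ∷ α) ∈ enum (suc k) t
      go zero p = ∈-map⁺ pad p
      go (suc t) p = ∈-++⁺ʳ (List.map bump (enum (suc k) t)) (∈-map⁺ pad p)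
    ∈-enum⁺ (suc k) {s} {x} (suc y ∷ α) h = subst (λ t → (x , suc y ∷ α) ∈ enum (suc k) t) (sym (ℕₚ.+-suc s (y + size α)))
      (∈-++⁺ˡ (∈-map⁺ bump (∈-enum⁺ (suc k) (y ∷ α) h)))

    ∈-enum⁻ : ∀ k {t x} {α : Vec ℕ k} → (x , α) ∈ enum k t → ∃ λ s → x ∈ B s × s + size α ≡ t
    ∈-enum⁻ zero {t} p with ∈-map⁻ (_, []) p
    ... | _ , q , refl = t , q , ℕₚ.+-identityʳ t
    ∈-enum⁻ (suc k) {zero} p with ∈-map⁻ pad p
    ... | _ , q , refl = ∈-enum⁻ k q
    ∈-enum⁻ (suc k) {suc t} p with ∈-++⁻ (List.map bump (enum (suc k) t)) p
    ... | inj₁ p' with ∈-map⁻ bump p'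
    ...   | (x , y ∷ α) , q , refl = let s , h , e = ∈-enum⁻ (suc k) q in s , h , trans (ℕₚ.+-suc s _) (cong suc e)
    ∈-enum⁻ (suc k) {suc t} p | inj₂ p' with ∈-map⁻ pad p'
    ... | _ , q , refl = ∈-enum⁻ k q

    enum-unique : (∀ t → Unique (B t)) → ∀ k t → Unique (enum k t)
    enum-unique u zero t = Uₚ.map⁺ (cong proj₁) (u t)
    enum-unique u (suc k) zero = Uₚ.map⁺ pad-inj (enum-unique u k zero)
      where
      pad-inj : ∀ {p q : A × Vec ℕ k} → pad p ≡ pad q → p ≡ q
      pad-inj refl = refl
    enum-unique u (suc k) (suc t) = Uₚ.++⁺ (Uₚ.map⁺ bump-inj (enum-unique u (suc k) t)) (Uₚ.map⁺ pad-inj (enum-unique u k (suc t))) disjoint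
      where
      pad-inj : ∀ {p q : A × Vec ℕ k} → pad p ≡ pad q → p ≡ q
      pad-inj refl = refl
      bump-inj : ∀ {p q : A × Vec ℕ (suc k)} → bump p ≡ bump q → p ≡ q
      bump-inj {_ , _ ∷ _} {_ , _ ∷ _} refl = refl
      disjoint : ∀ {p} → p ∈ List.map bump (enum (suc k) t) × p ∈ List.map pad (enum k (suc t)) → _
      disjoint (p , q) with ∈-map⁻ bump p | ∈-map⁻ pad q
      ... | (_ , _ ∷ _) , _ , refl | _ , _ , ()

  lookup-unique : ∀ {A : Set} {xs : List A} → Unique xs → ∀ i j → List.lookup xs i ≡ List.lookup xs j → i ≡ j
  lookup-unique (_ ∷ u) zero zero e = refl
  lookup-unique {xs = x ∷ xs} (px ∷ u) zero (suc j) e = contradiction e (All.lookup px (∈-lookup j))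
  lookup-unique {xs = x ∷ xs} (px ∷ u) (suc i) zero e = contradiction (sym e) (All.lookup px (∈-lookup i))
  lookup-unique (_ ∷ u) (suc i) (suc j) e = cong suc (lookup-unique u i j e)

-- Contraction of functionals by generic linear forms

module Contractions where
  open import Data.Fin using (_≟_; punchIn; punchOut; combine)
  open import Data.Fin.Properties using (any?; punchInᵢ≢i; punchIn-punchOut; combine-injectiveˡ; combine-injectiveʳ; punchIn-injective; suc-injective)
  open import Data.Vec.Properties using (≡-dec; lookup∘updateAt)
  open import Relation.Binary.PropositionalEquality as ≡ using (_≡_; _≢_)
  open LinAlg
  open PolynomialRings
  open Fans using (Mon)
  open Monomials

  module Operators {q n : ℕ} (G : GenericDomain (q ℕ.* n)) where
    open GenericDomain G public
    open LinearAlgebra domain public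
    open import Relation.Binary.Reasoning.Setoid setoid
    open import Algebra.Solver.Ring.NaturalCoefficients.Default commutativeSemiring
      using (solve; _:*_; _:+_; _:=_)

    -- Without row `i₀` the system is wide. For a regular matrix the solution is proportional to a
    -- column of the adjugate.
    cofactor : ∀ {s} (M : Fin s → Fin s → Carrier) i₀ → Σ (Fin s → Carrier) λ x →
      (∃ λ j → ¬ x j ≈ 0#) × (∀ i → i ≢ i₀ → sum (λ j → M i j * x j) ≈ 0#)
    cofactor {suc s} M i₀ = let x , nz , eqs = wide-kernel (ℕₚ.n<1+n s) (M ∘ punchIn i₀) in
      x , nz , λ i ne → ≡.subst (λ i → sum (λ j → M i j * x j) ≈ 0#) (punchIn-punchOut (ne ∘ ≡.sym)) (eqs (punchOut (ne ∘ ≡.sym)))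

    ≈-of-sum : ∀ {x y} → x + y ≈ 0# → x ≈ y
    ≈-of-sum {x} {y} e = begin
      x ≈⟨ +-identityʳ x ⟨
      x + 0# ≈⟨ +-congˡ (char2 y) ⟨
      x + (y + y) ≈⟨ +-assoc x y y ⟨
      (x + y) + y ≈⟨ +-congʳ e ⟩
      0# + y ≈⟨ +-identityˡ y ⟩
      y ∎

    cancel-≉ : ∀ {x y} → ¬ x ≈ 0# → x * y ≈ 0# → y ≈ 0#
    cancel-≉ nx e with no-zero-divisors e
    ... | inj₁ p = contradiction p nx
    ... | inj₂ p = p

    *-≉ : ∀ {x y} → ¬ x ≈ 0# → ¬ y ≈ 0# → ¬ x * y ≈ 0#
    *-≉ nx ny e = ny (cancel-≉ nx e)

    0*ˡ : ∀ {x y} → x ≈ 0# → x * y ≈ 0#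
    0*ˡ e = trans (*-congʳ e) (zeroˡ _)

    0*ʳ : ∀ {x y} → y ≈ 0# → x * y ≈ 0#
    0*ʳ e = trans (*-congˡ e) (zeroʳ _)

    -- In characteristic 2 the off-diagonal terms cancel in pairs.
    sum-symmetric : ∀ {k} (s : Fin k → Fin k → Carrier) → (∀ i j → s i j ≈ s j i) →
      sum (λ i → sum (s i)) ≈ sum (λ i → s i i)
    sum-symmetric {zero} s sy = trans (sum-nil _) (sym (sum-nil _))
    sum-symmetric {suc k} s sy = begin
      sum (λ i → sum (s i)) ≈⟨ sum-suc _ ⟩
      sum (s zero) + sum (λ i → sum (s (suc i))) ≈⟨ +-cong (sum-suc (s zero)) (sum-cong (λ i → sum-suc (s (suc i)))) ⟩
      (s zero zero + row₀) + sum (λ i → s (suc i) zero + sum (λ j → s (suc i) (suc j)))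
        ≈⟨ +-congˡ (trans (sum-+ _ (λ i → sum (λ j → s (suc i) (suc j)))) (+-cong (sum-cong (λ i → sy (suc i) zero))
             (sum-symmetric (λ i j → s (suc i) (suc j)) (λ i j → sy (suc i) (suc j))))) ⟩
      (s zero zero + row₀) + (row₀ + rest) ≈⟨ solve 3 (λ a b c → (a :+ b) :+ (b :+ c) := a :+ ((b :+ b) :+ c)) refl _ _ _ ⟩
      s zero zero + ((row₀ + row₀) + rest) ≈⟨ +-congˡ (trans (+-congʳ (char2 row₀)) (+-identityˡ rest)) ⟩
      s zero zero + rest ≈⟨ sum-suc _ ⟨
      sum (λ i → s i i) ∎
      where
      row₀ = sum (λ j → s zero (suc j))
      rest = sum (λ i → s (suc i) (suc i))

    sum-square : ∀ {k} (t : Fin k → Carrier) → sum t * sum t ≈ sum (λ i → t i * t i)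
    sum-square t = trans (sum-*ʳ (sum t) t) (trans (sum-cong (λ i → sum-*ˡ (t i) t)) (sum-symmetric (λ i j → t i * t j) (λ i j → *-comm _ _)))

    even-sum : ∀ {k} i {t : Fin k → Carrier} → (∀ j → Even i (t j)) → Even i (sum t)
    even-sum {zero} i {t} h = even-≈ i (sym (sum-nil t)) (even-0 i)
    even-sum {suc k} i {t} h = even-≈ i (sym (sum-suc t)) (even-+ i (h zero) (even-sum i (h ∘ suc)))

    -- In characteristic 2 the j-th term equals the sum of the others. That sum is even in the
    -- variable `x j`, since the other variables and all coefficients are, so `extract` applies.
    extract-sum : ∀ {k} (x : Fin k → Fin (q ℕ.* n)) → (∀ {i j} → x i ≡ x j → i ≡ j) → (Z : Fin k → Carrier) →
      (∀ i j → Even (x i) (Z j)) → sum (λ j → var (x j) * Z j) ≈ 0# → ∀ j → Z j ≈ 0#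
    extract-sum {suc k} x inj Z ev e j = extract (x j) (ev j j) (even-≈ (x j) (sym (≈-of-sum (trans (sym (sum-remove _ j)) e)))
      (even-sum (x j) (λ i → even-* (x j) (even-var (λ eq → punchInᵢ≢i j i (≡.sym (inj eq)))) (ev j (punchIn j i)))))

    Fun : Set
    Fun = Mon n → Carrier

    -- The variables of the domain form a generic matrix with q rows, each read as a linear form in
    -- the n variables of the face ring.
    row : Fin q → Fin n → Carrier
    row ρ k = var (combine ρ k)

    -- The transpose of multiplication by the linear form a on the dual of the polynomial ring.
    T : (Fin n → Carrier) → Fun → Fun
    T a φ m = sum (λ k → a k * φ (inc k m))

    Null : Fun → Set
    Null φ = ∀ m → φ m ≈ 0#

    T-cong : ∀ a {φ ψ : Fun} → (∀ m → φ m ≈ ψ m) → ∀ m → T a φ m ≈ T a ψ m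
    T-cong a h m = sum-cong (λ k → *-congˡ (h (inc k m)))

    T-null : ∀ a {φ} → Null φ → Null (T a φ)
    T-null a h m = sum-zero (λ k → 0*ʳ (h (inc k m)))

    T-T : ∀ a b (φ : Fun) m → T a (T b φ) m ≈ sum (λ j → sum (λ k → (a j * b k) * φ (inc k (inc j m))))
    T-T a b φ m = sum-cong (λ j → trans (sum-*ˡ (a j) _) (sum-cong (λ k → sym (*-assoc _ _ _))))

    T-comm : ∀ a b (φ : Fun) m → T a (T b φ) m ≈ T b (T a φ) m
    T-comm a b φ m = trans (T-T a b φ m) (trans (sum-comm _) (trans (sum-cong λ k → sum-cong λ j →
      *-cong (*-comm (a j) (b k)) (reflexive (≡.cong φ (inc-comm k j m)))) (sym (T-T b a φ m))))

    -- The square of a linear form is the sum of the squares of its terms in characteristic 2.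
    T-square : ∀ a (φ : Fun) m → T a (T a φ) m ≈ sum (λ k → (a k * a k) * φ (inc k (inc k m)))
    T-square a φ m = trans (T-T a a φ m) (sum-symmetric _ (λ j k → *-cong (*-comm (a j) (a k)) (reflexive (≡.cong φ (inc-comm k j m)))))

    T-linear : ∀ {s} a (κ : Fin s → Carrier) (ψ : Fin s → Fun) m →
      T a (λ m → sum (λ i → κ i * ψ i m)) m ≈ sum (λ i → κ i * T a (ψ i) m)
    T-linear a κ ψ m = trans (sum-cong (λ k → trans (sum-*ˡ (a k) _) (sum-cong (λ i →
        solve 3 (λ a b c → a :* (b :* c) := b :* (a :* c)) refl _ _ _))))
      (trans (sum-comm _) (sum-cong (λ i → sym (sum-*ˡ (κ i) _))))

    Tn : ∀ {k} → (Fin k → Fin q) → Fun → Fun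
    Tn {zero} ρ φ = φ
    Tn {suc k} ρ φ = T (row (ρ zero)) (Tn (ρ ∘ suc) φ)

    Tn-null : ∀ {k} (ρ : Fin k → Fin q) {φ} → Null φ → Null (Tn ρ φ)
    Tn-null {zero} ρ h = h
    Tn-null {suc k} ρ h = T-null _ (Tn-null (ρ ∘ suc) h)

    T-Tn : ∀ {k} a (ρ : Fin k → Fin q) φ m → T a (Tn ρ φ) m ≈ Tn ρ (T a φ) m
    T-Tn {zero} a ρ φ m = refl
    T-Tn {suc k} a ρ φ m = trans (T-comm a (row (ρ zero)) (Tn (ρ ∘ suc) φ) m) (T-cong _ (T-Tn a (ρ ∘ suc) φ) m)

    -- Contractions commute, so the one that kills `φ` may act first.
    Tn-kill : ∀ {k} (ρ : Fin k → Fin q) l {φ} → Null (T (row (ρ l)) φ) → Null (Tn ρ φ)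
    Tn-kill {suc k} ρ zero {φ} h m = trans (T-Tn _ (ρ ∘ suc) φ m) (Tn-null (ρ ∘ suc) h m)
    Tn-kill {suc k} ρ (suc l) h m = T-null _ (Tn-kill (ρ ∘ suc) l h) m

    -- Row `ρ l` is already among the contracted ones, so it acts twice in total.
    T-Tn-kill : ∀ {k} (ρ : Fin k → Fin q) l {φ} → Null (T (row (ρ l)) (T (row (ρ l)) φ)) → Null (T (row (ρ l)) (Tn ρ φ))
    T-Tn-kill ρ l {φ} h m = trans (T-Tn _ ρ φ m) (Tn-kill ρ l h m)

    Vanishes : (Mon n → Set) → Fun → Set
    Vanishes P φ = ∀ m → P m → φ m ≈ 0#

    T-vanishes : ∀ {P} → (∀ k m → P m → P (inc k m)) → ∀ a {φ} → Vanishes P φ → Vanishes P (T a φ)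
    T-vanishes up a h m p = sum-zero (λ k → 0*ʳ (h _ (up k m p)))

    Tn-vanishes : ∀ {P} → (∀ k m → P m → P (inc k m)) → ∀ {k} (ρ : Fin k → Fin q) {φ} → Vanishes P φ → Vanishes P (Tn ρ φ)
    Tn-vanishes up {zero} ρ h = h
    Tn-vanishes up {suc k} ρ h = T-vanishes up _ (Tn-vanishes up (ρ ∘ suc) h)

    Tn-shift : ∀ {k s} (ρ : Fin k → Fin q) (κ : Fin s → Carrier) (h : Fin s → Mon n) φ m →
      Tn ρ (λ m → sum (λ i → κ i * φ (m ⊕ h i))) m ≈ sum (λ i → κ i * Tn ρ φ (m ⊕ h i))
    Tn-shift {zero} ρ κ h φ m = refl
    Tn-shift {suc k} ρ κ h φ m = trans (T-cong _ (Tn-shift (ρ ∘ suc) κ h φ) m)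
      (trans (T-linear _ κ (λ i m → Tn (ρ ∘ suc) φ (m ⊕ h i)) m)
        (sum-cong (λ i → *-congˡ (sum-cong (λ k → *-congˡ (reflexive (≡.cong (Tn (ρ ∘ suc) φ) (inc-⊕ k m (h i)))))))))

    EvenFun : Fun → Set
    EvenFun φ = ∀ i m → Even i (φ m)

    Tn-even : ∀ {k} (ρ : Fin k → Fin q) ρ₀ → (∀ l → ρ l ≢ ρ₀) → ∀ {φ} → EvenFun φ → ∀ j m → Even (combine ρ₀ j) (Tn ρ φ m)
    Tn-even {zero} ρ ρ₀ ne h j m = h _ m
    Tn-even {suc k} ρ ρ₀ ne {φ} h j m = even-sum _ (λ i → even-* _
      (even-var (λ e → ne zero (≡.sym (combine-injectiveˡ ρ₀ j (ρ zero) i e))))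
      (Tn-even (ρ ∘ suc) ρ₀ (ne ∘ suc) {φ} h j _))

    -- `Tn ρ φ m` is the sum over words `I` of a product of one entry from each row, times
    -- `φ (incs I m)`. The rows are distinct and the values of `φ` are even in every variable, so no
    -- two products can interfere; the rows are split off one at a time.
    Tn-extract : ∀ {k} (ρ : Fin k → Fin q) → (∀ {i j} → ρ i ≡ ρ j → i ≡ j) → ∀ {φ} → EvenFun φ →
      ∀ m → Tn ρ φ m ≈ 0# → ∀ (I : Fin k → Fin n) → φ (incs I m) ≈ 0#
    Tn-extract {zero} ρ inj h m e I = e
    Tn-extract {suc k} ρ inj {φ} h m e I = Tn-extract (ρ ∘ suc) (λ e → suc-injective (inj e)) {φ} h (inc (I zero) m)
      (extract-sum (combine (ρ zero)) (λ {i} {j} → combine-injectiveʳ (ρ zero) i (ρ zero) j) (λ j → Tn (ρ ∘ suc) φ (inc j m))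
        (λ i j → Tn-even (ρ ∘ suc) (ρ zero) (λ l e → contradiction (inj e) λ ()) {φ} h i (inc j m)) e (I zero)) (I ∘ suc)

    δ : Mon n → Fun
    δ m₀ m with ≡-dec ℕ._≟_ m₀ m
    ... | yes _ = 1#
    ... | no _ = 0#

    δ-same : ∀ m → δ m m ≈ 1#
    δ-same m with ≡-dec ℕ._≟_ m m
    ... | yes _ = refl
    ... | no ne = contradiction ≡.refl ne

    δ-other : ∀ m₀ m → m₀ ≢ m → δ m₀ m ≈ 0#
    δ-other m₀ m ne with ≡-dec ℕ._≟_ m₀ m
    ... | yes e = contradiction e ne
    ... | no _ = refl

    δ-even : ∀ m₀ → EvenFun (δ m₀)
    δ-even m₀ i m with ≡-dec ℕ._≟_ m₀ m
    ... | yes _ = even-1 i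
    ... | no _ = even-0 i

    -- A left kernel vector of a square generic matrix would make its permanent, which is its
    -- determinant in characteristic 2, vanish.
    generic-independent : ∀ {k} (ρ : Fin k → Fin q) → (∀ {i j} → ρ i ≡ ρ j → i ≡ j) →
      (g : Fin k → Fin n) → (∀ {i j} → g i ≡ g j → i ≡ j) → (x : Fin k → Carrier) →
      (∀ l → sum (λ i → row (ρ i) (g l) * x i) ≈ 0#) → ∀ i₀ → x i₀ ≈ 0#
    generic-independent {suc k} ρ ρ-inj g g-inj x eqs i₀ with zero? (x i₀)
    ... | yes e = e
    ... | no x≉0 = contradiction (trans (sym (δ-same top)) (trans (reflexive (≡.cong (δ top) (≡.sym hit))) vanish)) 1≉0
      where
      top : Mon n
      top = mono g (λ _ → 1)
      others : Fin k → Fin q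
      others = ρ ∘ punchIn i₀
      -- `T (row (ρ i)) Y 𝟎` is the permanent of the matrix with row `i₀` replaced by row `i`. For i
      -- ≠ i₀ a row is repeated, and the permanent vanishes since `top` is squarefree.
      Y : Fun
      Y = Tn others (δ top)
      small : ∀ j m → top ≢ inc j (inc j m)
      small j m e with any? (λ i → g i ≟ j)
      ... | yes (i , ≡.refl) = contradiction (≡.trans (≡.sym (mono-in g (λ _ → 1) g-inj i)) (≡.trans (≡.cong (λ t → lookup t (g i)) e)
              (≡.trans (lookup∘updateAt (g i) {suc} (inc (g i) m)) (≡.cong suc (lookup∘updateAt (g i) {suc} m))))) (λ ())
      ... | no nin = lookup-inc-≢0 j (inc j m) (≡.trans (≡.cong (λ t → lookup t j) (≡.sym e)) (mono-out g (λ _ → 1) j (λ i e' → nin (i , e'))))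
      square : ∀ a → Null (T a (T a (δ top)))
      square a m = trans (T-square a (δ top) m) (sum-zero (λ j → 0*ʳ (δ-other top _ (small j m))))
      outside : ∀ j → (∀ i → g i ≢ j) → ∀ m → Y (inc j m) ≈ 0#
      outside j nin m = Tn-vanishes {λ m → lookup m j ≢ 0} (λ i m → lookup-inc-mono i j m) others {δ top}
        (λ m ne → δ-other top m (λ e → ne (≡.trans (≡.cong (λ t → lookup t j) (≡.sym e)) (mono-out g (λ _ → 1) j nin)))) _ (lookup-inc-≢0 j m)
      combination : sum (λ i → x i * T (row (ρ i)) Y 𝟎) ≈ 0#
      combination = trans (sum-cong (λ i → sum-*ˡ (x i) _)) (trans (sum-comm _) (sum-zero column))
        where
        column : ∀ j → sum (λ i → x i * (row (ρ i) j * Y (inc j 𝟎))) ≈ 0#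
        column j with any? (λ l → g l ≟ j)
        ... | yes (l , ≡.refl) = trans (sum-cong (λ i → solve 3 (λ a b c → a :* (b :* c) := (b :* a) :* c) refl _ _ _))
                (trans (sym (sum-*ʳ _ _)) (0*ˡ (eqs l)))
        ... | no nin = sum-zero (λ i → 0*ʳ (0*ʳ (outside j (λ l e → nin (l , e)) 𝟎)))
      isolate : x i₀ * T (row (ρ i₀)) Y 𝟎 ≈ 0#
      isolate = trans (sym (sum-single _ i₀ (λ i ne → 0*ʳ (≡.subst (λ i → T (row (ρ i)) Y 𝟎 ≈ 0#) (punchIn-punchOut (ne ∘ ≡.sym))
        (T-Tn-kill others (punchOut (ne ∘ ≡.sym)) {δ top} (square _) 𝟎))))) combination
      first : Fin (suc k) → Fin q
      first zero = ρ i₀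
      first (suc l) = others l
      first-inj : ∀ {i j} → first i ≡ first j → i ≡ j
      first-inj {zero} {zero} _ = ≡.refl
      first-inj {zero} {suc j} e = contradiction (≡.sym (ρ-inj e)) (punchInᵢ≢i i₀ j)
      first-inj {suc i} {zero} e = contradiction (ρ-inj e) (punchInᵢ≢i i₀ i)
      first-inj {suc i} {suc j} e = ≡.cong suc (punchIn-injective i₀ i j (ρ-inj e))
      dec = decompose (suc k) top (≡.trans (size-mono g (λ _ → 1)) (sumℕ-1 (suc k))) 𝟎
      hit : incs (proj₁ dec) 𝟎 ≡ top
      hit = ≡.trans (proj₂ dec) (≡.trans (⊕-comm top 𝟎) (𝟎-⊕ top))
      vanish : δ top (incs (proj₁ dec) 𝟎) ≈ 0#
      vanish = Tn-extract {suc k} first first-inj {δ top} (δ-even top) 𝟎 (cancel-≉ x≉0 isolate) (proj₁ dec)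

-- Restriction sets of facets

module FaceMonomials where
  open import Data.Integer as ℤ using (ℤ; +_; -[1+_]; 0ℤ; 1ℤ)
  import Data.Integer.Properties as ℤₚ
  open import Data.Fin.Properties using (any?)
  open import Data.Vec.Properties using (lookup-zipWith; lookup-replicate)
  open import Data.List using (filter; allFin)
  open import Data.List.Membership.Propositional using (_∈_)
  open import Data.List.Membership.Propositional.Properties using (∈-filter⁺; ∈-filter⁻; ∈-allFin; ∈-lookup)
  open import Data.List.Relation.Unary.Unique.Propositional using (Unique)
  import Data.List.Relation.Unary.Unique.Propositional.Properties as Uₚ
  open import Relation.Nullary.Decidable using (decidable-stable)
  open import Relation.Binary.Structures using (IsStrictPartialOrder)
  open import Relation.Binary.PropositionalEquality as ≡ using (_≡_; _≢_)
  open IntegerVectors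
  open Fans
  open Monomials

  isNeg : ℤ → ℕ
  isNeg (+ _) = 0
  isNeg -[1+ _ ] = 1

  isNeg-neg : ∀ {x} → x ℤ.< 0ℤ → isNeg x ≡ 1
  isNeg-neg { -[1+ _ ]} _ = ≡.refl
  isNeg-neg {+ _} (ℤ.+<+ ())

  neg-isNeg : ∀ {x} → isNeg x ≢ 0 → x ℤ.< 0ℤ
  neg-isNeg {+ _} ne = contradiction ≡.refl ne
  neg-isNeg { -[1+ _ ]} _ = ℤ.-<+

  isNeg≤1 : ∀ x → isNeg x ℕ.≤ 1
  isNeg≤1 (+ _) = z≤n
  isNeg≤1 -[1+ _ ] = s≤s z≤n

  isNeg-sum : ∀ x → x ≢ 0ℤ → isNeg x ℕ.+ isNeg (ℤ.- x) ≡ 1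
  isNeg-sum (+ zero) ne = contradiction ≡.refl ne
  isNeg-sum (+ suc _) ne = ≡.refl
  isNeg-sum -[1+ _ ] ne = ≡.refl

  sumℕ-full : ∀ {k} {α : Fin k → ℕ} → (∀ j → α j ℕ.≤ 1) → sumℕ α ≡ k → ∀ j → α j ≡ 1
  sumℕ-full {suc k} {α} le e j = go (α zero) ≡.refl (le zero) j
    where
    bound : ∀ {k} {α : Fin k → ℕ} → (∀ j → α j ℕ.≤ 1) → sumℕ α ℕ.≤ k
    bound {zero} le = z≤n
    bound {suc k} le = ℕₚ.+-mono-≤ (le zero) (bound (le ∘ suc))
    go : ∀ a → α zero ≡ a → a ℕ.≤ 1 → ∀ j → α j ≡ 1
    go zero e₀ _ j = contradiction (≡.subst (λ a → a ℕ.+ sumℕ (α ∘ suc) ≡ suc k) e₀ e) (λ e' → ℕₚ.<-irrefl e' (s≤s (bound (le ∘ suc))))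
    go (suc zero) e₀ _ zero = e₀
    go (suc zero) e₀ _ (suc j) = sumℕ-full (le ∘ suc) (ℕₚ.suc-injective (≡.subst (λ a → a ℕ.+ sumℕ (α ∘ suc) ≡ suc k) e₀ e)) j
    go (suc (suc _)) _ (s≤s ()) j

  minus : ∀ {d} → Vec ℤ d → Vec ℤ d
  minus w = (ℤ.- 1ℤ) ⊡ w

  ∙-minus : ∀ {d} (u w : Vec ℤ d) → u ∙ minus w ≡ ℤ.- (u ∙ w)
  ∙-minus u w = ≡.trans (∙-⊡ u (ℤ.- 1ℤ) w) (ℤₚ.-1*i≡-i (u ∙ w))

  module FanMonomials {d n N : ℕ} (fan : Fan d n N) where
    open Fan fan public
    open FanProperties fan public

    full : Fin N → Mon n
    full F = mono (f F) (λ _ → 1)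

    -- The restriction set of F in the shelling by decreasing val w; level w i therefore has h_i elements.
    restriction : Vec ℤ d → Fin N → Mon n
    restriction w F = mono (f F) (λ j → isNeg (c F j ∙ w))

    mono-face : ∀ F α → Face F (mono (f F) α)
    mono-face F α k ne = decidable-stable (In? F k) (λ nin → ne (mono-out (f F) α k (λ j e → nin (j , e))))

    mono-lookup : ∀ F α j → lookup (mono (f F) α) (f F j) ≡ α j
    mono-lookup F α = mono-in (f F) α (f-inj F)

    restriction-low : ∀ w F → Low w F (restriction w F)
    restriction-low w F j lt e with ≡.trans (≡.sym e) (≡.trans (mono-lookup F _ j) (isNeg-neg lt))
    ... | ()

    low-of-≥ : ∀ w F m → (∀ j → isNeg (c F j ∙ w) ℕ.≤ lookup m (f F j)) → Low w F m
    low-of-≥ w F m h j lt e = contradiction (≡.subst₂ ℕ._≤_ (isNeg-neg lt) e (h j)) (λ ())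

    minus-generic : ∀ w → Generic w → Generic (minus w)
    minus-generic w gen F j e = gen F j (ℤₚ.neg-injective (≡.trans (≡.sym (∙-minus (c F j) w)) e))

    ⊕-face : ∀ {F} m m' → Face F m → Face F m' → Face F (m ⊕ m')
    ⊕-face {F} m m' face face' k ne with lookup m k ℕ.≟ 0
    ... | no ne' = face k ne'
    ... | yes e = face' k (λ e' → ne (≡.trans (lookup-zipWith ℕ._+_ k m m') (≡.cong₂ ℕ._+_ e e')))

    restriction-complement : ∀ w → Generic w → ∀ F → restriction (minus w) F ⊕ restriction w F ≡ full F
    restriction-complement w gen F = face-ext {F} (⊕-face {F} (restriction (minus w) F) (restriction w F) (mono-face F (λ j → isNeg (c F j ∙ minus w))) (mono-face F (λ j → isNeg (c F j ∙ w)))) (mono-face F (λ _ → 1)) λ j →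
      ≡.trans (lookup-zipWith ℕ._+_ (f F j) (restriction (minus w) F) (restriction w F))
      (≡.trans (≡.cong₂ ℕ._+_ (mono-lookup F _ j) (mono-lookup F _ j))
      (≡.trans (≡.cong (λ x → isNeg x ℕ.+ isNeg (c F j ∙ w)) (∙-minus (c F j) w))
      (≡.trans (ℕₚ.+-comm (isNeg (ℤ.- (c F j ∙ w))) _) (≡.trans (isNeg-sum (c F j ∙ w) (gen F j)) (≡.sym (mono-lookup F _ j))))))

    size-full : ∀ F → size (full F) ≡ d
    size-full F = ≡.trans (size-mono (f F) _) (sumℕ-1 d)

    size-complement : ∀ w → Generic w → ∀ F → size (restriction (minus w) F) ℕ.+ size (restriction w F) ≡ d
    size-complement w gen F = ≡.trans (≡.sym (size-⊕ (restriction (minus w) F) (restriction w F)))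
      (≡.trans (≡.cong size (restriction-complement w gen F)) (size-full F))

    all-negative : ∀ w F → size (restriction w F) ≡ d → ∀ j → c F j ∙ w ℤ.< 0ℤ
    all-negative w F e j = neg-isNeg (λ e₀ → contradiction (≡.trans (≡.sym e₀)
      (sumℕ-full (λ j → isNeg≤1 (c F j ∙ w)) (≡.trans (≡.sym (size-mono (f F) _)) e) j)) (λ ()))

    restriction-full : ∀ w F → (∀ j → c F j ∙ w ℤ.< 0ℤ) → restriction w F ≡ full F
    restriction-full w F h = face-ext {F} (mono-face F (λ j → isNeg (c F j ∙ w))) (mono-face F (λ _ → 1)) λ j →
      ≡.trans (mono-lookup F _ j) (≡.trans (isNeg-neg (h j)) (≡.sym (mono-lookup F _ j)))

    𝟎-face : ∀ F → Face F 𝟎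
    𝟎-face F k ne = contradiction (lookup-replicate k 0) ne

    -- Negative coordinates throughout mean that -w lies in the interior of the cone, which thus
    -- locates the monomial 1 with respect to `minus w`.
    all-negative-unique : ∀ w → Generic w → ∀ {F F'} → (∀ j → c F j ∙ w ℤ.< 0ℤ) → (∀ j → c F' j ∙ w ℤ.< 0ℤ) → F ≡ F'
    all-negative-unique w gen {F} {F'} h h' = locate-unique (minus w) (minus-generic w gen) 𝟎 (𝟎-face F) (low h) (𝟎-face F') (low h')
      where
      low : ∀ {F} → (∀ j → c F j ∙ w ℤ.< 0ℤ) → Low (minus w) F 𝟎
      low {F} h j lt = contradiction (≡.subst (ℤ._< 0ℤ) (∙-minus (c F j) w) lt) (ℤₚ.<-asym (ℤₚ.neg-mono-< (h j)))

    NonFace : Mon n → Set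
    NonFace m = ∀ F → ¬ Face F m

    nonface-inc : ∀ k m → NonFace m → NonFace (inc k m)
    nonface-inc k m nf F face = nf F (λ i ne → face i (lookup-inc-mono k i m ne))

    face⊎nonface : ∀ m → (∃ λ F → Face F m) ⊎ NonFace m
    face⊎nonface m with any? (λ F → Face? F m)
    ... | yes p = inj₁ p
    ... | no np = inj₂ (λ F face → np (F , face))

    -- A strict partial order on a finite set is well-founded in both directions: `span` needs
    -- descending induction, `independent` ascending.
    val-spo : ∀ w → IsStrictPartialOrder _≡_ (λ F F' → val w F ℤ.< val w F')
    val-spo w = record
      { isEquivalence = ≡.isEquivalence
      ; irrefl = λ { ≡.refl → ℤₚ.<-irrefl ≡.refl }
      ; trans = ℤₚ.<-trans
      ; <-resp-≈ = (λ { ≡.refl p → p }) , (λ { ≡.refl p → p }) }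

    level : Vec ℤ d → ℕ → List (Fin N)
    level w s = filter (λ F → size (restriction w F) ℕ.≟ s) (allFin N)

    level-unique : ∀ w s → Unique (level w s)
    level-unique w s = Uₚ.filter⁺ (λ F → size (restriction w F) ℕ.≟ s) (Uₚ.allFin⁺ N)

    ∈-level : ∀ w F → F ∈ level w (size (restriction w F))
    ∈-level w F = ∈-filter⁺ (λ F' → size (restriction w F') ℕ.≟ size (restriction w F)) (∈-allFin F) ≡.refl

    level-size : ∀ w s i → size (restriction w (List.lookup (level w s) i)) ≡ s
    level-size w s i = proj₂ (∈-filter⁻ (λ F → size (restriction w F) ℕ.≟ s) {xs = allFin N} (∈-lookup {xs = level w s} i))

-- Injectivity of multiplication by a generic form below the middle degree

module LefschetzProperty where
  open import Data.Bool using (true; false; if_then_else_)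
  open import Data.Integer as ℤ using (ℤ; +_; 0ℤ)
  import Data.Integer.Properties as ℤₚ
  open import Data.Fin using (_≟_; _↑ʳ_)
  open import Data.Fin.Properties using (any?; ↑ʳ-injective; suc-injective)
  open import Data.Fin.Induction using (spo-wellFounded; spo-noetherian)
  open import Data.Vec.Properties using (lookup∘updateAt; lookup∘updateAt′)
  open import Data.List using (length; allFin)
  open import Data.List.Membership.Propositional using (_∈_)
  open import Data.List.Membership.Propositional.Properties using (∈-filter⁻; ∈-lookup)
  open import Data.List.Relation.Unary.Any using (index)
  open import Data.List.Relation.Unary.Any.Properties using (lookup-index)
  open import Induction.WellFounded using (module All)
  open import Relation.Nullary.Decidable using (¬?; decidable-stable)
  open import Relation.Binary.PropositionalEquality as ≡ using (_≡_; _≢_)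
  open PolynomialRings
  open IntegerVectors
  open Fans
  open Monomials
  open Contractions
  open FaceMonomials

  module Lefschetz {d n N : ℕ} (fan : Fan d n N) (r' : ℕ) (G : GenericDomain (suc (r' ℕ.+ d) ℕ.* n)) where
    open FanMonomials fan
    open Operators {suc (r' ℕ.+ d)} {n} G
    open import Relation.Binary.Reasoning.Setoid setoid
    open import Algebra.Solver.Ring.NaturalCoefficients.Default commutativeSemiring
      using (solve; _:*_; _:+_; _:=_)

    -- Row 0 is the multiplier ℓ, the last d rows are the parameters, and the r' rows between them
    -- are the forms that fill up the degree.
    θ-row : Fin d → Fin (suc (r' ℕ.+ d))
    θ-row i = suc (r' ↑ʳ i)

    θ : Fin d → Fin n → Carrier
    θ i = row (θ-row i)

    -- Functionals on the Stanley–Reisner ring modulo θ.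
    Good : Fun → Set
    Good φ = Vanishes NonFace φ × (∀ i → Null (T (θ i) φ))

    -- Modulo θ, a variable of F is a combination of the variables outside F.
    relation′ : ∀ F j → Σ Carrier λ p → (¬ p ≈ 0#) × Σ (Fin n → Carrier) λ β → (∀ k → In F k → β k ≈ 0#) ×
      (∀ φ → Good φ → ∀ m → p * φ (inc (f F j) m) ≈ sum (λ k → β k * φ (inc k m)))
    relation′ F j = γ (f F j) , p≉0 , β , β-in , rel
      where
      -- A combination of the parameters with coefficient 0 at the variables of `F` other than
      -- `f F j`. If its coefficient at `f F j` were also 0, the columns of `F` would contradict
      -- `generic-independent`.
      cof = cofactor (λ l i → θ i (f F l)) j
      x = proj₁ cof
      γ : Fin n → Carrier
      γ k = sum (λ i → θ i k * x i)
      γ-other : ∀ l → l ≢ j → γ (f F l) ≈ 0#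
      γ-other = proj₂ (proj₂ cof)
      p≉0 : ¬ γ (f F j) ≈ 0#
      p≉0 e = proj₂ (proj₁ (proj₂ cof)) (generic-independent θ-row (λ e → ↑ʳ-injective r' _ _ (suc-injective e)) (f F) (f-inj F) x all (proj₁ (proj₁ (proj₂ cof))))
        where
        all : ∀ l → γ (f F l) ≈ 0#
        all l with l ≟ j
        ... | yes ≡.refl = e
        ... | no ne = γ-other l ne
      β : Fin n → Carrier
      β k with f F j ≟ k
      ... | yes _ = 0#
      ... | no _ = γ k
      β-in : ∀ k → In F k → β k ≈ 0#
      β-in k (l , e) with f F j ≟ k
      ... | yes _ = refl
      ... | no ne = ≡.subst (λ k → γ k ≈ 0#) e (γ-other l (λ l≡j → ne (≡.trans (≡.cong (f F) (≡.sym l≡j)) e)))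
      rel : ∀ φ → Good φ → ∀ m → γ (f F j) * φ (inc (f F j) m) ≈ sum (λ k → β k * φ (inc k m))
      rel φ (_ , θφ) m = ≈-of-sum (begin
        γ (f F j) * φ (inc (f F j) m) + sum (λ k → β k * φ (inc k m))
          ≈⟨ +-congʳ (trans (*-congʳ (sym pick-same)) (sym (sum-single (λ k → pick k * φ (inc k m)) (f F j) (λ k ne → 0*ˡ (pick-other k ne))))) ⟩
        sum (λ k → pick k * φ (inc k m)) + sum (λ k → β k * φ (inc k m))
          ≈⟨ sum-+ _ _ ⟨
        sum (λ k → pick k * φ (inc k m) + β k * φ (inc k m))
          ≈⟨ sum-cong (λ k → trans (sym (distribʳ _ _ _)) (*-congʳ (split k))) ⟩
        sum (λ k → γ k * φ (inc k m))
          ≈⟨ sum-cong (λ k → trans (sum-*ʳ _ _) (sum-cong (λ i → solve 3 (λ a b c → a :* b :* c := b :* (a :* c)) refl _ _ _))) ⟩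
        sum (λ k → sum (λ i → x i * (θ i k * φ (inc k m)))) ≈⟨ sum-comm _ ⟩
        sum (λ i → sum (λ k → x i * (θ i k * φ (inc k m)))) ≈⟨ sum-cong (λ i → sum-*ˡ (x i) _) ⟨
        sum (λ i → x i * T (θ i) φ m) ≈⟨ sum-zero (λ i → 0*ʳ (θφ i m)) ⟩
        0# ∎)
        where
        pick : Fin n → Carrier
        pick k with f F j ≟ k
        ... | yes _ = γ k
        ... | no _ = 0#
        pick-same : pick (f F j) ≈ γ (f F j)
        pick-same with f F j ≟ f F j
        ... | yes _ = refl
        ... | no ne = contradiction ≡.refl ne
        pick-other : ∀ k → k ≢ f F j → pick k ≈ 0#
        pick-other k ne with f F j ≟ k
        ... | yes e = contradiction (≡.sym e) ne
        ... | no _ = refl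
        split : ∀ k → pick k + β k ≈ γ k
        split k with f F j ≟ k
        ... | yes _ = +-identityʳ _
        ... | no _ = +-identityˡ _

    abstract
      relation : ∀ F j → Σ Carrier λ p → (¬ p ≈ 0#) × Σ (Fin n → Carrier) λ β → (∀ k → In F k → β k ≈ 0#) ×
        (∀ φ → Good φ → ∀ m → p * φ (inc (f F j) m) ≈ sum (λ k → β k * φ (inc k m)))
      relation = relation′

    iter : ℕ → (Fin n → Carrier) → Fun → Fun
    iter zero a φ = φ
    iter (suc x) a φ = T a (iter x a φ)

    iter-cong : ∀ x a {φ ψ : Fun} → (∀ m → φ m ≈ ψ m) → ∀ m → iter x a φ m ≈ iter x a ψ m
    iter-cong zero a h = h
    iter-cong (suc x) a h = T-cong a (iter-cong x a h)

    T-iter : ∀ a x b φ m → T a (iter x b φ) m ≈ iter x b (T a φ) m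
    T-iter a zero b φ m = refl
    T-iter a (suc x) b φ m = trans (T-comm a b (iter x b φ) m) (T-cong b (T-iter a x b φ) m)

    pow : ∀ {k} → (Fin k → Fin n → Carrier) → Vec ℕ k → Fun → Fun
    pow A [] φ = φ
    pow A (x ∷ α) φ = iter x (A zero) (pow (A ∘ suc) α φ)

    T-pow : ∀ {k} a (A : Fin k → Fin n → Carrier) α φ m → T a (pow A α φ) m ≈ pow A α (T a φ) m
    T-pow a A [] φ m = refl
    T-pow a A (x ∷ α) φ m = trans (T-iter a x (A zero) _ m) (iter-cong x (A zero) (T-pow a (A ∘ suc) α φ) m)

    pow-inc : ∀ {k} (A : Fin k → Fin n → Carrier) i α φ m → pow A (inc i α) φ m ≈ pow A α (T (A i) φ) m
    pow-inc A zero (x ∷ α) φ m = T-pow (A zero) A (x ∷ α) φ m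
    pow-inc A (suc i) (x ∷ α) φ m = iter-cong x (A zero) (pow-inc (A ∘ suc) i α φ) m

    pow-zero : ∀ {k} (A : Fin k → Fin n → Carrier) φ m → pow A 𝟎 φ m ≈ φ m
    pow-zero {zero} A φ m = refl
    pow-zero {suc k} A φ m = pow-zero (A ∘ suc) φ m

    pow-linear : ∀ {k s} (A : Fin k → Fin n → Carrier) α (κ : Fin s → Carrier) (ψ : Fin s → Fun) m →
      pow A α (λ m → sum (λ i → κ i * ψ i m)) m ≈ sum (λ i → κ i * pow A α (ψ i) m)
    pow-linear A [] κ ψ m = refl
    pow-linear A (x ∷ α) κ ψ m = trans (iter-cong x (A zero) (pow-linear (A ∘ suc) α κ ψ) m) (go x m)
      where
      go : ∀ x m → iter x (A zero) (λ m → sum (λ i → κ i * pow (A ∘ suc) α (ψ i) m)) m ≈ sum (λ i → κ i * iter x (A zero) (pow (A ∘ suc) α (ψ i)) m)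
      go zero m = refl
      go (suc x) m = trans (T-cong (A zero) (go x) m) (T-linear (A zero) κ (λ i → iter x (A zero) (pow (A ∘ suc) α (ψ i))) m)

    Hom : ℕ → Fun → Set
    Hom k φ = ∀ m → size m ≢ k → φ m ≈ 0#

    module Spanning (w : Vec ℤ d) (gen : Generic w) where

      r : Fin N → Mon n
      r = restriction w

      -- Over a domain rather than its fraction field, a linear dependence carries a denominator p.
      Span : ℕ → (Fun → Carrier) → Set
      Span s e = Σ Carrier λ p → (¬ p ≈ 0#) × Σ (Fin N → Carrier) λ M → (∀ F → size (r F) ≢ s → M F ≈ 0#) ×
        (∀ φ → Good φ → p * e φ ≈ sum (λ F → M F * φ (r F)))

      span-zero : ∀ {s} {e : Fun → Carrier} → (∀ φ → Good φ → e φ ≈ 0#) → Span s e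
      span-zero h = 1# , 1≉0 , (λ _ → 0#) , (λ _ _ → refl) , λ φ g → trans (0*ʳ (h φ g)) (sym (sum-zero (λ F → zeroˡ (φ (r F)))))

      swap : ∀ x y z → x * (y * z) ≈ y * (x * z)
      swap x y z = trans (sym (*-assoc x y z)) (trans (*-congʳ (*-comm x y)) (*-assoc y x z))

      span-scale : ∀ {s} {e : Fun → Carrier} a → Span s e → Span s (λ φ → a * e φ)
      span-scale {s} {e} a (p , np , M , M0 , eq) = p , np , (λ F → a * M F) , (λ F ne → 0*ʳ (M0 F ne)) , λ φ g →
        trans (swap p a (e φ)) (trans (*-congˡ (eq φ g)) (trans (sum-*ˡ a (λ F → M F * φ (r F))) (sum-cong (λ F → sym (*-assoc a (M F) (φ (r F)))))))

      span-+ : ∀ {s} {e e' : Fun → Carrier} → Span s e → Span s e' → Span s (λ φ → e φ + e' φ)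
      span-+ {s} {e} {e'} (p , np , M , M0 , eq) (p' , np' , M' , M0' , eq') = p * p' , *-≉ np np' , (λ F → p' * M F + p * M' F) ,
        (λ F ne → trans (+-cong (0*ʳ (M0 F ne)) (0*ʳ (M0' F ne))) (+-identityˡ 0#)) , λ φ g → begin
          p * p' * (e φ + e' φ) ≈⟨ distribˡ (p * p') (e φ) (e' φ) ⟩
          p * p' * e φ + p * p' * e' φ ≈⟨ +-cong (trans (*-assoc p p' (e φ)) (swap p p' (e φ))) (*-assoc p p' (e' φ)) ⟩
          p' * (p * e φ) + p * (p' * e' φ) ≈⟨ +-cong (trans (*-congˡ (eq φ g)) (sum-*ˡ p' (λ F → M F * φ (r F)))) (trans (*-congˡ (eq' φ g)) (sum-*ˡ p (λ F → M' F * φ (r F)))) ⟩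
          sum (λ F → p' * (M F * φ (r F))) + sum (λ F → p * (M' F * φ (r F))) ≈⟨ sum-+ (λ F → p' * (M F * φ (r F))) (λ F → p * (M' F * φ (r F))) ⟨
          sum (λ F → p' * (M F * φ (r F)) + p * (M' F * φ (r F)))
            ≈⟨ sum-cong (λ F → trans (+-cong (sym (*-assoc p' (M F) (φ (r F)))) (sym (*-assoc p (M' F) (φ (r F))))) (sym (distribʳ (φ (r F)) (p' * M F) (p * M' F)))) ⟩
          sum (λ F → (p' * M F + p * M' F) * φ (r F)) ∎

      span-cong : ∀ {s} {e e' : Fun → Carrier} → (∀ φ → Good φ → e' φ ≈ e φ) → Span s e → Span s e'
      span-cong h (p , np , M , M0 , eq) = p , np , M , M0 , λ φ g → trans (*-congˡ (h φ g)) (eq φ g)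

      span-sum : ∀ {k s} {e : Fin k → Fun → Carrier} → (∀ i → Span s (e i)) → Span s (λ φ → sum (λ i → e i φ))
      span-sum {zero} {s} {e} h = span-zero (λ φ g → sum-nil (λ i → e i φ))
      span-sum {suc k} {s} {e} h = span-cong {e = λ φ → e zero φ + sum (λ i → e (suc i) φ)} (λ φ g → sum-suc (λ i → e i φ))
        (span-+ {e = e zero} {e' = λ φ → sum (λ i → e (suc i) φ)} (h zero) (span-sum {e = e ∘ suc} (h ∘ suc)))

      span-divide : ∀ {s} {e : Fun → Carrier} a → ¬ a ≈ 0# → Span s (λ φ → a * e φ) → Span s e
      span-divide {s} {e} a na (p , np , M , M0 , eq) = p * a , *-≉ np na , M , M0 , λ φ g → trans (*-assoc p a (e φ)) (eq φ g)

      indicator : Fin N → Fin N → Carrier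
      indicator F F' with F' ≟ F
      ... | yes _ = 1#
      ... | no _ = 0#

      indicator-same : ∀ F → indicator F F ≈ 1#
      indicator-same F with F ≟ F
      ... | yes _ = refl
      ... | no ne = contradiction ≡.refl ne

      indicator-other : ∀ F F' → F' ≢ F → indicator F F' ≈ 0#
      indicator-other F F' ne with F' ≟ F
      ... | yes e = contradiction e ne
      ... | no _ = refl

      span-restriction : ∀ F → Span (size (r F)) (λ φ → φ (r F))
      span-restriction F = 1# , 1≉0 , indicator F , (λ F' ne → indicator-other F F' (λ F'≡F → ne (≡.cong (size ∘ r) F'≡F))) , λ φ g → begin
        1# * φ (r F) ≈⟨ *-congʳ (indicator-same F) ⟨
        indicator F F * φ (r F) ≈⟨ sum-single (λ F' → indicator F F' * φ (r F')) F (λ F' ne → 0*ˡ (indicator-other F F' ne)) ⟨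
        sum (λ F' → indicator F F' * φ (r F')) ∎

      -- `Low` makes the exponents of `m` on the facet at least those of R(F). Where they differ
      -- there is surplus, and one factor can go without leaving the interval.
      reducible : ∀ F m j → Low w F m → lookup m (f F j) ≢ lookup (r F) (f F j) → ∃ λ m' → inc (f F j) m' ≡ m × Low w F m'
      reducible F m j low differs = m' , m≡ , low'
        where
        rj : lookup (r F) (f F j) ≡ isNeg (c F j ∙ w)
        rj = mono-lookup F (λ j → isNeg (c F j ∙ w)) j
        mj≢0 : lookup m (f F j) ≢ 0
        mj≢0 e with c F j ∙ w ℤₚ.<? 0ℤ
        ... | yes lt = low j lt e
        ... | no ≮ = differs (≡.trans e (≡.sym (≡.trans rj (decidable-stable (isNeg (c F j ∙ w) ℕ.≟ 0) (λ ne → ≮ (neg-isNeg ne))))))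
        m' : Mon n
        m' = proj₁ (uninc (f F j) m mj≢0)
        m≡ : inc (f F j) m' ≡ m
        m≡ = proj₂ (uninc (f F j) m mj≢0)
        low' : Low w F m'
        low' i lt e with i ≟ j
        ... | yes ≡.refl = differs (≡.trans (≡.trans (≡.cong (λ t → lookup t (f F i)) (≡.sym m≡)) (≡.trans (lookup∘updateAt (f F i) {suc} m') (≡.cong suc e))) (≡.sym (≡.trans rj (isNeg-neg lt))))
        ... | no ne = low i lt (≡.trans (≡.cong (λ t → lookup t (f F i)) (≡.sym m≡)) (≡.trans (lookup∘updateAt′ (f F i) (f F j) (ne ∘ f-inj F) m') e))

      Spanned : Fin N → Set
      Spanned F = ∀ m → Face F m → Low w F m → Span (size m) (λ φ → φ m)

      -- The facet locating `inc k m` contains `k`, so it is not `F`; it also contains the support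
      -- of `m`, and `lower` gives it a smaller value.
      span-outside : ∀ F → (∀ {F'} → val w F' ℤ.< val w F → Spanned F') → ∀ m → Low w F m → ∀ k → ¬ In F k → Span (suc (size m)) (λ φ → φ (inc k m))
      span-outside F IH m low k k∉F with face⊎nonface (inc k m)
      ... | inj₂ nf = span-zero (λ φ g → proj₁ g (inc k m) nf)
      ... | inj₁ (F₁ , face₁) with locate w gen (inc k m) face₁
      ...   | F' , face' , low' = ≡.subst (λ s → Span s (λ φ → φ (inc k m))) (size-inc k m)
                (IH (lower w gen m low (λ i ne → face' i (lookup-inc-mono k i m ne)) F'≢F) (inc k m) face' low')
        where
        F'≢F : F' ≢ F
        F'≢F e = k∉F (≡.subst (λ F → In F k) e (face' k (lookup-inc-≢0 k m)))

      -- A monomial other than R(F) has a surplus variable of `F`, which `relation` trades for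
      -- variables outside `F`; all resulting monomials belong to facets of smaller value.
      span-located : ∀ F → (∀ {F'} → val w F' ℤ.< val w F → Spanned F') → Spanned F
      span-located F IH m face low with any? (λ j → ¬? (lookup m (f F j) ℕ.≟ lookup (r F) (f F j)))
      ... | no same = ≡.subst (λ m → Span (size m) (λ φ → φ m)) (≡.sym m≡r) (span-restriction F)
        where
        m≡r : m ≡ r F
        m≡r = face-ext {F} face (mono-face F (λ j → isNeg (c F j ∙ w))) (λ j → decidable-stable (lookup m (f F j) ℕ.≟ lookup (r F) (f F j)) (λ ne → same (j , ne)))
      ... | yes (j , differs) with reducible F m j low differs | relation F j
      ...   | m' , m≡ , low' | p , np , β , β-in , rel = span-divide {e = λ φ → φ m} p np
                (span-cong {e = λ φ → sum (λ k → β k * φ (inc k m'))} {e' = λ φ → p * φ m}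
                  (λ φ g → trans (*-congˡ (reflexive (≡.cong φ (≡.sym m≡)))) (rel φ g m'))
                  (≡.subst (λ s → Span s (λ φ → sum (λ k → β k * φ (inc k m')))) (≡.trans (≡.sym (size-inc (f F j) m')) (≡.cong size m≡))
                    (span-sum {e = λ k φ → β k * φ (inc k m')} term)))
        where
        term : ∀ k → Span (suc (size m')) (λ φ → β k * φ (inc k m'))
        term k with In? F k
        ... | yes k∈F = span-zero (λ φ g → 0*ˡ (β-in k k∈F))
        ... | no k∉F = span-scale {e = λ φ → φ (inc k m')} (β k) (span-outside F IH m' low' k k∉F)

      span′ : ∀ m → Span (size m) (λ φ → φ m)
      span′ m with face⊎nonface m
      ... | inj₂ nf = span-zero (λ φ g → proj₁ g m nf)
      ... | inj₁ (F₁ , face₁) with locate w gen m face₁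
      ...   | F , face , low = All.wfRec (spo-wellFounded (val-spo w)) _ Spanned span-located F m face low

      abstract
        span : ∀ m → Span (size m) (λ φ → φ m)
        span = span′

      -- Mutual induction with `vanish` on the degree: contraction by `θ i` lowers the degree and
      -- raises one exponent of α. Once all contractions by θ are known to vanish, `span` reduces
      -- the vanishing of a functional to its values at the R(F). So finitely many equations express
      -- being a functional modulo θ.
      good-if : ∀ k {φ} → Vanishes NonFace φ → Hom k φ →
        (∀ F α → size α ≢ 0 → size (r F) ℕ.+ size α ≡ k → pow θ α φ (r F) ≈ 0#) → ∀ i → Null (T (θ i) φ)
      vanish : ∀ k {ψ} → Vanishes NonFace ψ → Hom k ψ →
        (∀ F α → size (r F) ℕ.+ size α ≡ k → pow θ α ψ (r F) ≈ 0#) → Null ψ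

      good-if zero {φ} nf hom h i m = sum-zero (λ k → 0*ʳ (hom (inc k m) (λ e → contradiction (≡.trans (≡.sym (size-inc k m)) e) (λ ()))))
      good-if (suc k) {φ} nf hom h i = vanish k {T (θ i) φ} (T-vanishes nonface-inc (θ i) nf)
        (λ m ne → sum-zero (λ j → 0*ʳ (hom (inc j m) (λ e → ne (ℕₚ.suc-injective (≡.trans (≡.sym (size-inc j m)) e))))))
        (λ F α e → trans (sym (pow-inc θ i α φ (r F))) (h F (inc i α) (λ e' → contradiction (≡.trans (≡.sym (size-inc i α)) e') (λ ()))
          (≡.trans (≡.cong (size (r F) ℕ.+_) (size-inc i α)) (≡.trans (ℕₚ.+-suc (size (r F)) (size α)) (≡.cong suc e)))))

      vanish k {ψ} nf hom h m with span m
      ... | p , np , M , _ , eq = cancel-≉ np (trans (eq ψ (nf , good-if k nf hom (λ F α _ → h F α))) (sum-zero (λ F → 0*ʳ (at F))))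
        where
        at : ∀ F → ψ (r F) ≈ 0#
        at F with size (r F) ℕ.≟ k
        ... | no ne = hom (r F) ne
        ... | yes e = trans (sym (pow-zero θ ψ (r F))) (h F 𝟎 (≡.trans (≡.cong (size (r F) ℕ.+_) (size-𝟎 d)) (≡.trans (ℕₚ.+-identityʳ _) e)))

      Degree : Set
      Degree = Σ Fun λ φ → Good φ × Hom d φ × ∃ λ m → ¬ φ m ≈ 0#

      pairs : List (Fin N × Vec ℕ d)
      pairs = enum (level w) d d

      -- A pair (F, α) is both an unknown, the value at the face monomial R(F) times the monomial α
      -- on `F`, and an equation, the vanishing of θ^α φ at R(F). `good-if` asks only for nonzero α,
      -- so row `i₀` may be dropped.
      degree-from : (i₀ : Fin (length pairs)) → size (proj₂ (List.lookup pairs i₀)) ≡ 0 → Degree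
      degree-from i₀ zero₀ = φ , (nf , good-if d nf hom equations) , hom , E j₁ , φ≉0
        where
        facet : Fin (length pairs) → Fin N
        facet i = proj₁ (List.lookup pairs i)
        expo : Fin (length pairs) → Vec ℕ d
        expo i = proj₂ (List.lookup pairs i)
        rep : Fin (length pairs) → Fin d → ℕ
        rep i j = isNeg (c (facet i) j ∙ w) ℕ.+ lookup (expo i) j
        E : Fin (length pairs) → Mon n
        E i = mono (f (facet i)) (rep i)
        E-face : ∀ i → Face (facet i) (E i)
        E-face i = mono-face (facet i) (rep i)
        E-low : ∀ i → Low w (facet i) (E i)
        E-low i = low-of-≥ w (facet i) (E i) (λ j → ≡.subst (isNeg (c (facet i) j ∙ w) ℕ.≤_) (≡.sym (mono-lookup (facet i) (rep i) j)) (ℕₚ.m≤m+n _ _))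
        -- The intervals are disjoint. Because of this, a nonzero solution of the system gives a
        -- nonzero functional.
        E-inj : ∀ i j → E i ≡ E j → i ≡ j
        E-inj i j e = lookup-unique (enum-unique (level w) (level-unique w) d d) i j (≡.cong₂ _,_ same (lookup-ext exps))
          where
          same : facet i ≡ facet j
          same = locate-unique w gen (E i) (E-face i) (E-low i) (≡.subst (Face (facet j)) (≡.sym e) (E-face j)) (≡.subst (Low w (facet j)) (≡.sym e) (E-low j))
          exps : ∀ l → lookup (expo i) l ≡ lookup (expo j) l
          exps l = ℕₚ.+-cancelˡ-≡ (isNeg (c (facet i) l ∙ w)) _ _ (≡.trans (≡.sym (mono-lookup (facet i) (rep i) l))
            (≡.trans (≡.cong₂ (λ m F → lookup m (f F l)) e same) (≡.trans (mono-lookup (facet j) (rep j) l)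
              (≡.cong (λ F → isNeg (c F l ∙ w) ℕ.+ lookup (expo j) l) (≡.sym same)))))
        E-size : ∀ i → size (E i) ≡ d
        E-size i with ∈-enum⁻ (level w) d (∈-lookup {xs = pairs} i)
        ... | s , F∈ , e = ≡.trans (size-mono (f (facet i)) (rep i)) (≡.trans (sumℕ-+ (λ j → isNeg (c (facet i) j ∙ w)) (lookup (expo i)))
              (≡.trans (≡.cong₂ ℕ._+_ (≡.trans (≡.sym (size-mono (f (facet i)) (λ j → isNeg (c (facet i) j ∙ w)))) (proj₂ (∈-filter⁻ (λ F → size (r F) ℕ.≟ s) {xs = allFin N} F∈)))
                (size-sumℕ (expo i))) e))
        cof = cofactor (λ i j → pow θ (expo i) (δ (E j)) (r (facet i))) i₀
        x : Fin (length pairs) → Carrier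
        x = proj₁ cof
        j₁ : Fin (length pairs)
        j₁ = proj₁ (proj₁ (proj₂ cof))
        φ : Fun
        φ m = sum (λ j → x j * δ (E j) m)
        nf : Vanishes NonFace φ
        nf m p = sum-zero (λ j → 0*ʳ (δ-other (E j) m (λ e → p (facet j) (≡.subst (Face (facet j)) e (E-face j)))))
        hom : Hom d φ
        hom m ne = sum-zero (λ j → 0*ʳ (δ-other (E j) m (λ e → ne (≡.trans (≡.cong size (≡.sym e)) (E-size j)))))
        equations : ∀ F α → size α ≢ 0 → size (r F) ℕ.+ size α ≡ d → pow θ α φ (r F) ≈ 0#
        equations F α α≢0 e = trans (pow-linear θ α x (λ j → δ (E j)) (r F))
            (trans (sum-cong (λ j → *-comm (x j) _)) (≡.subst (λ p → sum (λ j → pow θ (proj₂ p) (δ (E j)) (r (proj₁ p)) * x j) ≈ 0#) (≡.sym (lookup-index mem))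
              (proj₂ (proj₂ cof) (index mem) (λ e' → α≢0 (≡.trans (≡.cong (size ∘ proj₂) (lookup-index mem)) (≡.trans (≡.cong (size ∘ expo) e') zero₀))))))
          where
          mem : (F , α) ∈ pairs
          mem = ≡.subst (λ t → (F , α) ∈ enum (level w) d t) e (∈-enum⁺ (level w) d α (∈-level w F))
        φ≉0 : ¬ φ (E j₁) ≈ 0#
        φ≉0 e = proj₂ (proj₁ (proj₂ cof)) (trans (sym (*-identityʳ (x j₁))) (trans (*-congˡ (sym (δ-same (E j₁))))
          (trans (sym (sum-single (λ j → x j * δ (E j) (E j₁)) j₁ (λ j ne → 0*ʳ (δ-other (E j) (E j₁) (λ e' → ne (E-inj j j₁ e')))))) e)))

      degree′ : Degree
      degree′ = degree-from (index mem) (≡.trans (≡.cong (size ∘ proj₂) (≡.sym (lookup-index mem))) (size-𝟎 d))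
        where
        -- The cone containing -w: its restriction set is the whole facet, leaving exponent zero.
        F₀ : Fin N
        F₀ = proj₁ (cover (minus w))
        negative : ∀ j → c F₀ j ∙ w ℤ.< 0ℤ
        negative j = ℤₚ.≤∧≢⇒< (ℤₚ.neg-cancel-≤ (≡.subst (0ℤ ℤ.≤_) (∙-minus (c F₀ j) w) (proj₂ (cover (minus w)) j))) (gen F₀ j)
        mem : (F₀ , 𝟎) ∈ pairs
        mem = ≡.subst (λ t → (F₀ , 𝟎) ∈ enum (level w) d t) (≡.trans (≡.cong₂ ℕ._+_ (≡.trans (≡.cong size (restriction-full w F₀ negative)) (size-full F₀)) (size-𝟎 d)) (ℕₚ.+-identityʳ d))
          (∈-enum⁺ (level w) d 𝟎 (∈-level w F₀))

      abstract
        degree : Degree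
        degree = degree′

    -- Choose `w` near the negative of an interior point of `F`. Then `F` is the only facet whose
    -- restriction set has size d, so by `span` every value in degree d is, up to a nonzero
    -- denominator, a multiple of `φ (full F)`.
    full-nonzero : ∀ φ → Good φ → Hom d φ → ∀ m → ¬ φ m ≈ 0# → ∀ F → ¬ φ (full F) ≈ 0#
    full-nonzero φ good hom m φm≉0 F e = φm≉0 (go (generic-near (minus (pt (full F)))))
      where
      go : (∃ λ w → Generic w × (∀ F' j → c F' j ∙ minus (pt (full F)) ℤ.< 0ℤ → c F' j ∙ w ℤ.< 0ℤ)) → φ m ≈ 0#
      go (w , gen , near) = let p , np , M , M0 , eq = Spanning.span w gen m in
          cancel-≉ np (trans (eq φ good) (sum-zero (λ F' → term M M0 F')))
        where
        negative : ∀ j → c F j ∙ w ℤ.< 0ℤ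
        negative j = near F j (≡.subst (ℤ._< 0ℤ) (≡.sym (≡.trans (∙-minus (c F j) (pt (full F)))
          (≡.cong ℤ.-_ (≡.trans (pt-coef F (full F) (mono-face F (λ _ → 1)) j) (≡.cong +_ (mono-lookup F (λ _ → 1) j)))))) ℤ.-<+)
        size-m : size m ≡ d
        size-m = decidable-stable (size m ℕ.≟ d) (λ ne → φm≉0 (hom m ne))
        term : ∀ M → (∀ F' → size (restriction w F') ≢ size m → M F' ≈ 0#) → ∀ F' → M F' * φ (restriction w F') ≈ 0#
        term M M0 F' with size (restriction w F') ℕ.≟ size m
        ... | no ne = 0*ˡ (M0 F' ne)
        ... | yes eq = 0*ʳ (trans (reflexive (≡.cong φ (≡.trans (restriction-full w F' negative') (≡.cong full same)))) e)
          where
          negative' : ∀ j → c F' j ∙ w ℤ.< 0ℤ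
          negative' = all-negative w F' (≡.trans eq size-m)
          same : F' ≡ F
          same = all-negative-unique w gen negative' negative

    -- Ψ is the Frobenius twist of φ; since squaring is additive, T (θ i) applied twice kills it.
    module Frobenius (φ : Fun) (good : Good φ) where

      Ψ : Fun
      Ψ m = if evenᵇ m then φ (half m) * φ (half m) else 0#

      Ψ-double : ∀ m → Ψ (m ⊕ m) ≈ φ m * φ m
      Ψ-double m rewrite even-double m | half-double m = refl

      Ψ-even : EvenFun Ψ
      Ψ-even i m with evenᵇ m
      ... | true = even-sq i (φ (half m))
      ... | false = even-0 i

      Ψ-nonface : Vanishes NonFace Ψ
      Ψ-nonface m nf with evenᵇ m in ev
      ... | true = 0*ˡ (proj₁ good (half m) (λ F face → nf F (λ k ne → face k (lookup-half k m ev ne))))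
      ... | false = refl

      Ψ-inc² : ∀ k m → Ψ (inc k (inc k m)) ≡ (if evenᵇ m then φ (inc k (half m)) * φ (inc k (half m)) else 0#)
      Ψ-inc² k m rewrite even-inc² k m | half-inc² k m = ≡.refl

      Ψ-square : ∀ i → Null (T (θ i) (T (θ i) Ψ))
      Ψ-square i m = trans (T-square (θ i) Ψ m) (trans (sum-cong (λ k → *-congˡ (reflexive (Ψ-inc² k m)))) (go (evenᵇ m)))
        where
        go : ∀ b → sum (λ k → (θ i k * θ i k) * (if b then φ (inc k (half m)) * φ (inc k (half m)) else 0#)) ≈ 0#
        go true = trans (sum-cong (λ k → solve 2 (λ a b → (a :* a) :* (b :* b) := (a :* b) :* (a :* b)) refl (θ i k) (φ (inc k (half m)))))
          (trans (sym (sum-square (λ k → θ i k * φ (inc k (half m))))) (0*ˡ (proj₂ good i (half m))))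
        go false = sum-zero (λ k → zeroʳ _)

      Λ : Fun
      Λ = Tn {k = r' ℕ.+ d} suc Ψ

      -- Shifting by `h` is the transpose of multiplication by a monomial, which respects the ideal.
      -- Each `θ i` kills `Λ` because it is among the contracted rows and its square kills `Ψ`.
      Λ-shift-good : ∀ h → Good (λ m → Λ (m ⊕ h))
      Λ-shift-good h = (λ m nf → Tn-vanishes nonface-inc {k = r' ℕ.+ d} suc Ψ-nonface (m ⊕ h) (λ F face → nf F (λ k ne → face k (lookup-⊕-≢0ˡ k m h ne)))) ,
        λ i m → trans (sum-cong (λ k → *-congˡ (reflexive (≡.cong Λ (inc-⊕ k m h))))) (T-Tn-kill {k = r' ℕ.+ d} suc (r' ↑ʳ i) {Ψ} (Ψ-square i) (m ⊕ h))

    ℓ : Fin n → Carrier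
    ℓ = row zero

    -- If the degree functional pairs u with itself through Λ to zero, then, the coefficients of
    -- the generic forms being independent over squares, it kills all products of u.
    pairing-zero : ∀ {k} (u : Fin k → Carrier) (h : Fin k → Mon n) φ → Good φ →
      (∀ ψ → Good ψ → sum (λ i → u i * T ℓ ψ (h i)) ≈ 0#) →
      ∀ y → size y ℕ.+ size y ≡ suc (r' ℕ.+ d) → sum (λ i → u i * φ (y ⊕ h i)) ≈ 0#
    pairing-zero {k} u h φ good kill y size-y = square-zero (trans (sum-square (λ i → u i * φ (y ⊕ h i))) (trans (sum-cong square) at-y))
      where
      open Frobenius φ good
      TΛ : Fun
      TΛ = Tn {k = suc (r' ℕ.+ d)} (λ i → i) Ψ
      -- Applying `kill` to the shifts of `Λ` by the `h j` pairs ℓu, which is zero, with u.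
      double-sum : sum (λ j → sum (λ i → (u j * u i) * TΛ (h i ⊕ h j))) ≈ 0#
      double-sum = sum-zero (λ j → trans (sum-cong (λ i → *-assoc (u j) (u i) (TΛ (h i ⊕ h j)))) (trans (sym (sum-*ˡ (u j) (λ i → u i * TΛ (h i ⊕ h j))))
        (0*ʳ (trans (sum-cong (λ i → *-congˡ (sum-cong (λ l → *-congˡ (reflexive (≡.cong Λ (≡.sym (inc-⊕ l (h i) (h j)))))))))
          (kill (λ m → Λ (m ⊕ h j)) (Λ-shift-good (h j)))))))
      diagonal : sum (λ i → (u i * u i) * TΛ (𝟎 ⊕ (h i ⊕ h i))) ≈ 0#
      diagonal = trans (sum-cong (λ i → *-congˡ (reflexive (≡.cong TΛ (𝟎-⊕ (h i ⊕ h i))))))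
        (trans (sym (sum-symmetric (λ j i → (u j * u i) * TΛ (h i ⊕ h j)) (λ i j → *-cong (*-comm (u i) (u j)) (reflexive (≡.cong TΛ (⊕-comm (h j) (h i))))))) double-sum)
      Ψᵤ : Fun
      Ψᵤ m = sum (λ i → (u i * u i) * Ψ (m ⊕ (h i ⊕ h i)))
      -- The coefficients `u i * u i` are squares, hence even in every variable, so `Tn-extract`
      -- strips all rows, that of ℓ included.
      extracted : ∀ (I : Fin (suc (r' ℕ.+ d)) → Fin n) → Ψᵤ (incs I 𝟎) ≈ 0#
      extracted = Tn-extract {suc (r' ℕ.+ d)} (λ i → i) (λ e → e) {Ψᵤ} (λ i m → even-sum i (λ j → even-* i (even-sq i (u j)) (Ψ-even i _))) 𝟎
        (trans (Tn-shift {suc (r' ℕ.+ d)} (λ i → i) (λ i → u i * u i) (λ i → h i ⊕ h i) Ψ 𝟎) diagonal)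
      at-y : Ψᵤ (y ⊕ y) ≈ 0#
      at-y = ≡.subst (λ m → Ψᵤ m ≈ 0#) (≡.trans (proj₂ dec) (≡.trans (⊕-comm (y ⊕ y) 𝟎) (𝟎-⊕ (y ⊕ y)))) (extracted (proj₁ dec))
        where dec = decompose (suc (r' ℕ.+ d)) (y ⊕ y) (≡.trans (size-⊕ y y) size-y) 𝟎
      square : ∀ i → (u i * φ (y ⊕ h i)) * (u i * φ (y ⊕ h i)) ≈ (u i * u i) * Ψ ((y ⊕ y) ⊕ (h i ⊕ h i))
      square i = trans (solve 2 (λ a b → (a :* b) :* (a :* b) := (a :* a) :* (b :* b)) refl (u i) (φ (y ⊕ h i)))
        (*-congˡ (trans (sym (Ψ-double (y ⊕ h i))) (reflexive (≡.cong Ψ (≡.sym (⊕-double y (h i)))))))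
      square-zero : ∀ {x} → x * x ≈ 0# → x ≈ 0#
      square-zero e with no-zero-divisors e
      ... | inj₁ p = p
      ... | inj₂ p = p

    module Injectivity (w : Vec ℤ d) (gen : Generic w) (m : ℕ) (d≡ : m ℕ.+ m ℕ.+ suc r' ≡ d) where
      open Spanning w gen

      φ : Fun
      φ = proj₁ degree
      φ-good : Good φ
      φ-good = proj₁ (proj₂ degree)

      φ-full : ∀ F → ¬ φ (full F) ≈ 0#
      φ-full = full-nonzero φ φ-good (proj₁ (proj₂ (proj₂ degree))) (proj₁ (proj₂ (proj₂ (proj₂ degree)))) (proj₂ (proj₂ (proj₂ (proj₂ degree))))

      F : Fin (length (level w m)) → Fin N
      F = List.lookup (level w m)

      abstract
       span-ℓ : ∀ i → Span (suc m) (λ ψ → T ℓ ψ (r (F i)))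
       span-ℓ i = span-sum {e = λ k ψ → ℓ k * ψ (inc k (r (F i)))} (λ k → span-scale {e = λ ψ → ψ (inc k (r (F i)))} (ℓ k)
        (≡.subst (λ s → Span s (λ ψ → ψ (inc k (r (F i))))) (≡.trans (size-inc k (r (F i))) (≡.cong suc (level-size w m i))) (span (inc k (r (F i))))))

      dual : Fin N → Mon n
      dual = restriction (minus w)

      -- This fixes the number of rows: the complement of a restriction set of size m has size d -
      -- m, and 2(d - m) = 1 + r' + d.
      dual-size : ∀ i → size (dual (F i)) ℕ.+ size (dual (F i)) ≡ suc (r' ℕ.+ d)
      dual-size i = ≡.subst (λ s → s ℕ.+ s ≡ suc (r' ℕ.+ d)) (≡.sym size≡) (≡.trans (arith m (suc r')) (≡.cong (suc r' ℕ.+_) d≡))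
        where
        size≡ : size (dual (F i)) ≡ m ℕ.+ suc r'
        size≡ = ℕₚ.+-cancelʳ-≡ m _ _ (≡.trans (≡.trans (≡.cong (size (dual (F i)) ℕ.+_) (≡.sym (level-size w m i))) (size-complement w gen (F i)))
          (≡.trans (≡.sym d≡) (≡.trans (ℕₚ.+-assoc m m _) (ℕₚ.+-comm m (m ℕ.+ suc r')))))
        arith : ∀ m r → (m ℕ.+ r) ℕ.+ (m ℕ.+ r) ≡ r ℕ.+ (m ℕ.+ m ℕ.+ r)
        arith m r = ≡.trans (≡.cong (ℕ._+ (m ℕ.+ r)) (ℕₚ.+-comm m r)) (≡.trans (ℕₚ.+-assoc r m _) (≡.cong (r ℕ.+_) (≡.sym (ℕₚ.+-assoc m m r))))

      -- A facet containing the restriction of G lies below G, one containing the dual of F' lies above F'.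
      triangular : ∀ F' G → F' ≢ G → φ (dual F' ⊕ r G) ≈ 0# ⊎ val w F' ℤ.< val w G
      triangular F' G ne with face⊎nonface (dual F' ⊕ r G)
      ... | inj₂ nf = inj₁ (proj₁ φ-good _ nf)
      ... | inj₁ (H , face) = inj₂ (go (H ≟ F') (H ≟ G))
        where
        faceʳ : Face H (r G)
        faceʳ k ne = face k (lookup-⊕-≢0ʳ k (dual F') (r G) ne)
        faceˡ : Face H (dual F')
        faceˡ k ne = face k (lookup-⊕-≢0ˡ k (dual F') (r G) ne)
        below : H ≢ G → val w H ℤ.< val w G
        below = lower w gen (r G) (restriction-low w G) faceʳ
        above : H ≢ F' → val w F' ℤ.< val w H
        above H≢F' = ℤₚ.neg-cancel-< (≡.subst₂ ℤ._<_ (∙-minus (a H) w) (∙-minus (a F') w)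
          (lower (minus w) (minus-generic w gen) (dual F') (restriction-low (minus w) F') faceˡ H≢F'))
        go : Dec (H ≡ F') → Dec (H ≡ G) → val w F' ℤ.< val w G
        go (yes ≡.refl) (yes ≡.refl) = contradiction ≡.refl ne
        go (yes ≡.refl) (no H≢G) = below H≢G
        go (no H≢F') (yes ≡.refl) = above H≢F'
        go (no H≢F') (no H≢G) = ℤₚ.<-trans (above H≢F') (below H≢G)

      -- The matrix of values of φ at `dual (F i) ⊕ r (F l)` is triangular for the order by `val w`,
      -- with diagonal entries `φ (full (F i))`; the induction starts from facets of largest value.
      independent : (u : Fin (length (level w m)) → Carrier) →
        (∀ y → size y ℕ.+ size y ≡ suc (r' ℕ.+ d) → sum (λ i → u i * φ (y ⊕ r (F i))) ≈ 0#) → ∀ i → u i ≈ 0#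
      independent u h i = All.wfRec (spo-noetherian (val-spo w)) _ (λ G → ∀ i → F i ≡ G → u i ≈ 0#) step (F i) i ≡.refl
        where
        step : ∀ G → (∀ {G'} → val w G ℤ.< val w G' → ∀ i → F i ≡ G' → u i ≈ 0#) → ∀ i → F i ≡ G → u i ≈ 0#
        step _ IH i ≡.refl = cancel-≉ (φ-full (F i)) (trans (*-comm _ (u i)) (trans (*-congˡ (reflexive (≡.cong φ (≡.sym (restriction-complement w gen (F i))))))
          (trans (sym (sum-single (λ l → u l * φ (dual (F i) ⊕ r (F l))) i others)) (h (dual (F i)) (dual-size i)))))
          where
          others : ∀ l → l ≢ i → u l * φ (dual (F i) ⊕ r (F l)) ≈ 0#
          others l ne with triangular (F i) (F l) (λ e → ne (≡.sym (lookup-unique (level-unique w m) i l e)))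
          ... | inj₁ e = 0*ʳ e
          ... | inj₂ lt = 0*ˡ (IH lt l ≡.refl)

      -- If the level shrank, the matrix of multiplication by ℓ in terms of restriction monomials
      -- would be wide. Its kernel vector `u'`, multiplied by the denominators `p i` of `span-ℓ`, is
      -- an element killed by ℓ.
      no-drop : ¬ length (level w (suc m)) ℕ.< length (level w m)
      no-drop lt = *-≉ (proj₁ (proj₂ (span-ℓ i₁))) nz (independent u (pairing-zero u (r ∘ F) φ φ-good kill) i₁)
        where
        kernel : Σ (Fin (length (level w m)) → Carrier) λ x → (∃ λ j → ¬ x j ≈ 0#) ×
          (∀ i' → sum (λ i → proj₁ (proj₂ (proj₂ (span-ℓ i))) (List.lookup (level w (suc m)) i') * x i) ≈ 0#)
        kernel = wide-kernel lt (λ i' i → proj₁ (proj₂ (proj₂ (span-ℓ i))) (List.lookup (level w (suc m)) i'))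
        u' : Fin (length (level w m)) → Carrier
        u' = proj₁ kernel
        i₁ : Fin (length (level w m))
        i₁ = proj₁ (proj₁ (proj₂ kernel))
        nz : ¬ u' i₁ ≈ 0#
        nz = proj₂ (proj₁ (proj₂ kernel))
        eqs : ∀ i' → sum (λ i → proj₁ (proj₂ (proj₂ (span-ℓ i))) (List.lookup (level w (suc m)) i') * u' i) ≈ 0#
        eqs = proj₂ (proj₂ kernel)
        p : Fin (length (level w m)) → Carrier
        p i = proj₁ (span-ℓ i)
        M : Fin (length (level w m)) → Fin N → Carrier
        M i = proj₁ (proj₂ (proj₂ (span-ℓ i)))
        u : Fin (length (level w m)) → Carrier
        u i = p i * u' i
        column : ∀ G → sum (λ i → M i G * u' i) ≈ 0#
        column G with size (r G) ℕ.≟ suc m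
        ... | no ne = sum-zero (λ i → 0*ˡ (proj₁ (proj₂ (proj₂ (proj₂ (span-ℓ i)))) G ne))
        ... | yes e = ≡.subst (λ G → sum (λ i → M i G * u' i) ≈ 0#) (≡.sym (lookup-index mem)) (eqs (index mem))
          where
          mem : G ∈ level w (suc m)
          mem = ≡.subst (λ s → G ∈ level w s) e (∈-level w G)
        kill : ∀ ψ → Good ψ → sum (λ i → u i * T ℓ ψ (r (F i))) ≈ 0#
        kill ψ g = begin
          sum (λ i → u i * T ℓ ψ (r (F i)))
            ≈⟨ sum-cong (λ i → trans (*-congʳ (*-comm (p i) (u' i))) (trans (*-assoc (u' i) (p i) _) (*-congˡ (proj₂ (proj₂ (proj₂ (proj₂ (span-ℓ i)))) ψ g)))) ⟩
          sum (λ i → u' i * sum (λ G → M i G * ψ (r G))) ≈⟨ sum-cong (λ i → sum-*ˡ (u' i) (λ G → M i G * ψ (r G))) ⟩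
          sum (λ i → sum (λ G → u' i * (M i G * ψ (r G)))) ≈⟨ sum-comm (λ i G → u' i * (M i G * ψ (r G))) ⟩
          sum (λ G → sum (λ i → u' i * (M i G * ψ (r G))))
            ≈⟨ sum-cong (λ G → trans (sum-cong (λ i → trans (sym (*-assoc (u' i) (M i G) _)) (*-congʳ (*-comm (u' i) (M i G))))) (sym (sum-*ʳ (ψ (r G)) (λ i → M i G * u' i)))) ⟩
          sum (λ G → sum (λ i → M i G * u' i) * ψ (r G)) ≈⟨ sum-zero (λ G → 0*ˡ (column G)) ⟩
          0# ∎

  lefschetz : ∀ {d n N} (fan : Fan d n N) w → FanMonomials.Generic fan w → ∀ m → m ℕ.+ m ℕ.< d →
    length (FanMonomials.level fan w m) ℕ.≤ length (FanMonomials.level fan w (suc m))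
  lefschetz {d} {n} fan w gen m lt = ℕₚ.≮⇒≥ (Lefschetz.Injectivity.no-drop fan (d ℕ.∸ suc (m ℕ.+ m)) 𝔽₂[ _ ] w gen m
    (≡.trans (ℕₚ.+-suc (m ℕ.+ m) _) (ℕₚ.m+[n∸m]≡n lt)))

-- Subsets, and determinants through the exterior algebra

module Determinants where
  open import Data.Integer using (ℤ; +_; -[1+_]; 0ℤ; 1ℤ; _+_; _*_; -_; _-_; ∣_∣)
  import Data.Integer.Properties as ℤₚ
  open import Data.Integer.Tactic.RingSolver using (solve-∀)
  open import Data.Bool using (Bool; true; false)
  open import Data.Fin using (toℕ; punchIn)
  open import Data.Fin.Properties using (suc-injective)
  open import Data.Vec.Properties using (lookup-replicate)
  open import Data.List using (_++_)
  open import Data.List.Membership.Propositional using (_∈_)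
  open import Data.List.Membership.Propositional.Properties using (∈-map⁺; ∈-map⁻; ∈-++⁺ˡ; ∈-++⁺ʳ)
  open import Data.List.Relation.Unary.Any using (here)
  open import Data.List.Relation.Unary.Unique.Propositional using (Unique)
  import Data.List.Relation.Unary.Unique.Propositional.Properties as Uₚ
  open import Data.List.Relation.Unary.AllPairs using ([]; _∷_)
  open import Data.List.Relation.Unary.All using ([])
  open import Relation.Binary.PropositionalEquality using (_≡_; refl; sym; trans; cong; cong₂; subst)
  open IntegerVectors

  -- Sub r n is the type of r-element subsets of Fin n.
  data Sub : ℕ → ℕ → Set where
    done : Sub 0 0
    keep : ∀ {r n} → Sub r n → Sub (suc r) (suc n)
    skip : ∀ {r n} → Sub r n → Sub r (suc n)

  ι : ∀ {r n} → Sub r n → Fin r → Fin n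
  ι (keep A) zero = zero
  ι (keep A) (suc i) = suc (ι A i)
  ι (skip A) i = suc (ι A i)

  ι-injective : ∀ {r n} (A : Sub r n) {i j} → ι A i ≡ ι A j → i ≡ j
  ι-injective (keep A) {zero} {zero} e = refl
  ι-injective (keep A) {suc i} {suc j} e = cong suc (ι-injective A (suc-injective e))
  ι-injective (skip A) e = ι-injective A (suc-injective e)

  _⊑_ : ∀ {r s n} → Sub r n → Sub s n → Set
  A ⊑ B = ∀ i → ∃ λ j → ι B j ≡ ι A i

  ⊑-skip : ∀ {r s n} {A : Sub r n} {B : Sub s n} → skip A ⊑ skip B → A ⊑ B
  ⊑-skip h i = let j , e = h i in j , suc-injective e

  ⊑-keep : ∀ {r s n} {A : Sub r n} {B : Sub s n} → keep A ⊑ keep B → A ⊑ B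
  ⊑-keep h i with h (suc i)
  ... | suc j , e = j , suc-injective e

  ⊑-drop : ∀ {r s n} {A : Sub r n} {B : Sub s n} → skip A ⊑ keep B → A ⊑ B
  ⊑-drop h i with h i
  ... | suc j , e = j , suc-injective e

  ⊑-size : ∀ {r s n} (A : Sub r n) (B : Sub s n) → A ⊑ B → r ℕ.≤ s
  ⊑-size done B h = z≤n
  ⊑-size (keep A) (keep B) h = s≤s (⊑-size A B (⊑-keep h))
  ⊑-size (keep A) (skip B) h with h zero
  ... | _ , ()
  ⊑-size (skip A) (keep B) h = ℕₚ.m≤n⇒m≤1+n (⊑-size A B (⊑-drop h))
  ⊑-size (skip A) (skip B) h = ⊑-size A B (⊑-skip h)

  ⊑-antisym : ∀ {r n} (A B : Sub r n) → A ⊑ B → A ≡ B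
  ⊑-antisym done done h = refl
  ⊑-antisym (keep A) (keep B) h = cong keep (⊑-antisym A B (⊑-keep h))
  ⊑-antisym (keep A) (skip B) h with h zero
  ... | _ , ()
  ⊑-antisym (skip A) (keep B) h = contradiction (⊑-size A B (⊑-drop h)) ℕₚ.1+n≰n
  ⊑-antisym (skip A) (skip B) h = cong skip (⊑-antisym A B (⊑-skip h))

  allSub : ∀ r n → List (Sub r n)
  allSub zero zero = done ∷ []
  allSub (suc r) zero = []
  allSub zero (suc n) = List.map skip (allSub zero n)
  allSub (suc r) (suc n) = List.map keep (allSub r n) ++ List.map skip (allSub (suc r) n)

  ∈-allSub : ∀ {r n} (A : Sub r n) → A ∈ allSub r n
  ∈-allSub done = here refl
  ∈-allSub {zero} (skip A) = ∈-map⁺ skip (∈-allSub A)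
  ∈-allSub {suc r} (skip A) = ∈-++⁺ʳ (List.map keep (allSub r _)) (∈-map⁺ skip (∈-allSub A))
  ∈-allSub (keep A) = ∈-++⁺ˡ (∈-map⁺ keep (∈-allSub A))

  keep-inj : ∀ {r n} {A B : Sub r n} → keep A ≡ keep B → A ≡ B
  keep-inj refl = refl

  skip-inj : ∀ {r n} {A B : Sub r n} → skip A ≡ skip B → A ≡ B
  skip-inj refl = refl

  allSub-unique : ∀ r n → Unique (allSub r n)
  allSub-unique zero zero = [] ∷ []
  allSub-unique (suc r) zero = []
  allSub-unique zero (suc n) = Uₚ.map⁺ skip-inj (allSub-unique zero n)
  allSub-unique (suc r) (suc n) = Uₚ.++⁺ (Uₚ.map⁺ keep-inj (allSub-unique r n)) (Uₚ.map⁺ skip-inj (allSub-unique (suc r) n)) disjoint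
    where
    disjoint : ∀ {A} → A ∈ List.map keep (allSub r n) × A ∈ List.map skip (allSub (suc r) n) → _
    disjoint (p , q) with ∈-map⁻ keep p | ∈-map⁻ skip q
    ... | _ , _ , refl | _ , _ , ()

  support : ∀ {n} {P : Fin n → Set} → (∀ k → Dec (P k)) →
    ∃ λ r → Σ (Sub r n) λ A → (∀ i → P (ι A i)) × (∀ k → P k → ∃ λ i → ι A i ≡ k)
  support {zero} P? = 0 , done , (λ ()) , λ ()
  support {suc n} P? with support (P? ∘ suc) | P? zero
  ... | r , A , sound , complete | yes p = suc r , keep A , (λ { zero → p ; (suc i) → sound i }) ,
          λ { zero _ → zero , refl ; (suc k) pk → let i , e = complete k pk in suc i , cong suc e }
  ... | r , A , sound , complete | no np = r , skip A , sound ,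
          λ { zero p → contradiction p np ; (suc k) pk → let i , e = complete k pk in i , cong suc e }

  all : ∀ n → Sub n n
  all zero = done
  all (suc n) = keep (all n)

  ι-all : ∀ n i → ι (all n) i ≡ i
  ι-all (suc n) zero = refl
  ι-all (suc n) (suc i) = cong suc (ι-all n i)

  -- An element of the exterior algebra, by its coefficients at all coordinate subsets, of every
  -- size at once.
  Form : ℕ → Set
  Form n = Vec Bool n → ℤ

  -- Wedging with a in the exterior algebra, acting on functions of subsets; on r-subsets
  -- this is Laplace expansion along a.
  wedge : ∀ {n} → Vec ℤ n → Form n → Form n
  wedge [] φ [] = 0ℤ
  wedge (a ∷ as) φ (true ∷ A) = a * φ (false ∷ A) - wedge as (λ B → φ (true ∷ B)) A
  wedge (a ∷ as) φ (false ∷ A) = wedge as (λ B → φ (false ∷ B)) A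

  wedge-cong : ∀ {n} (a : Vec ℤ n) {φ ψ : Form n} → (∀ A → φ A ≡ ψ A) → ∀ A → wedge a φ A ≡ wedge a ψ A
  wedge-cong [] h [] = refl
  wedge-cong (a ∷ as) h (true ∷ A) = cong₂ (λ x y → a * x - y) (h (false ∷ A)) (wedge-cong as (λ B → h (true ∷ B)) A)
  wedge-cong (a ∷ as) h (false ∷ A) = wedge-cong as (λ B → h (false ∷ B)) A

  wedge-lin : ∀ {n} (a : Vec ℤ n) (s : ℤ) (φ ψ : Form n) A → wedge a (λ B → s * φ B + ψ B) A ≡ s * wedge a φ A + wedge a ψ A
  wedge-lin [] s φ ψ [] = sym (trans (ℤₚ.+-identityʳ _) (ℤₚ.*-zeroʳ s))
  wedge-lin (a ∷ as) s φ ψ (true ∷ A) rewrite wedge-lin as s (λ B → φ (true ∷ B)) (λ B → ψ (true ∷ B)) A =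
    lemma a s (φ (false ∷ A)) (ψ (false ∷ A)) (wedge as (λ B → φ (true ∷ B)) A) (wedge as (λ B → ψ (true ∷ B)) A)
    where lemma : ∀ a s x y p q → a * (s * x + y) - (s * p + q) ≡ s * (a * x - p) + (a * y - q)
          lemma = solve-∀
  wedge-lin (a ∷ as) s φ ψ (false ∷ A) = wedge-lin as s (λ B → φ (false ∷ B)) (λ B → ψ (false ∷ B)) A

  wedge-zero : ∀ {n} (a : Vec ℤ n) {φ : Form n} → (∀ A → φ A ≡ 0ℤ) → ∀ A → wedge a φ A ≡ 0ℤ
  wedge-zero [] h [] = refl
  wedge-zero (a ∷ as) h (true ∷ A) = cong₂ _-_ (trans (cong (a *_) (h (false ∷ A))) (ℤₚ.*-zeroʳ a)) (wedge-zero as (λ B → h (true ∷ B)) A)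
  wedge-zero (a ∷ as) h (false ∷ A) = wedge-zero as (λ B → h (false ∷ B)) A

  wedge-scale : ∀ {n} (a : Vec ℤ n) (s : ℤ) (φ : Form n) A → wedge a (λ B → s * φ B) A ≡ s * wedge a φ A
  wedge-scale a s φ A = trans (wedge-cong a (λ B → sym (ℤₚ.+-identityʳ (s * φ B))) A) (trans (wedge-lin a s φ (λ _ → 0ℤ) A)
    (trans (cong (λ t → s * wedge a φ A + t) (wedge-zero a (λ _ → refl) A)) (ℤₚ.+-identityʳ (s * wedge a φ A))))

  wedge-sub : ∀ {n} (a : Vec ℤ n) (s : ℤ) (φ ψ : Form n) A → wedge a (λ B → s * φ B - ψ B) A ≡ s * wedge a φ A - wedge a ψ A
  wedge-sub a s φ ψ A = trans (wedge-cong a (λ B → cong (λ t → s * φ B + t) (sym (ℤₚ.-1*i≡-i (ψ B)))) A) (trans (wedge-lin a s φ (λ B → - 1ℤ * ψ B) A)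
    (cong (λ t → s * wedge a φ A + t) (trans (wedge-scale a (- 1ℤ) ψ A) (ℤₚ.-1*i≡-i (wedge a ψ A)))))

  wedge-anticomm : ∀ {n} (a b : Vec ℤ n) (φ : Form n) A → wedge a (wedge b φ) A ≡ - wedge b (wedge a φ) A
  wedge-anticomm [] [] φ [] = refl
  wedge-anticomm (a ∷ as) (b ∷ bs) φ (true ∷ A)
    rewrite wedge-sub as b (λ B → φ (false ∷ B)) (wedge bs (λ B → φ (true ∷ B))) A | wedge-sub bs a (λ B → φ (false ∷ B)) (wedge as (λ B → φ (true ∷ B))) A | wedge-anticomm as bs (λ B → φ (true ∷ B)) A =
    lemma a b (wedge bs (λ B → φ (false ∷ B)) A) (wedge as (λ B → φ (false ∷ B)) A) (wedge bs (wedge as (λ B → φ (true ∷ B))) A)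
    where
    lemma : ∀ a b x y z → a * x - (b * y - - z) ≡ - (b * y - (a * x - z))
    lemma = solve-∀
  wedge-anticomm (a ∷ as) (b ∷ bs) φ (false ∷ A) = wedge-anticomm as bs (λ B → φ (false ∷ B)) A

  wedge-square : ∀ {n} (a : Vec ℤ n) (φ : Form n) A → wedge a (wedge a φ) A ≡ 0ℤ
  wedge-square a φ A = self-neg (wedge-anticomm a a φ A)
    where
    self-neg : ∀ {x} → x ≡ - x → x ≡ 0ℤ
    self-neg {+ zero} e = refl
    self-neg {+ suc _} ()
    self-neg { -[1+ _ ]} ()

  wedge-⊞ : ∀ {n} (s : ℤ) (x y : Vec ℤ n) (φ : Form n) A → wedge ((s ⊡ x) ⊞ y) φ A ≡ s * wedge x φ A + wedge y φ A
  wedge-⊞ s [] [] φ [] = sym (trans (ℤₚ.+-identityʳ _) (ℤₚ.*-zeroʳ s))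
  wedge-⊞ s (x ∷ xs) (y ∷ ys) φ (true ∷ A) rewrite wedge-⊞ s xs ys (λ B → φ (true ∷ B)) A =
    lemma s x y (φ (false ∷ A)) (wedge xs (λ B → φ (true ∷ B)) A) (wedge ys (λ B → φ (true ∷ B)) A)
    where lemma : ∀ s x y t p q → (s * x + y) * t - (s * p + q) ≡ s * (x * t - p) + (y * t - q)
          lemma = solve-∀
  wedge-⊞ s (x ∷ xs) (y ∷ ys) φ (false ∷ A) = wedge-⊞ s xs ys (λ B → φ (false ∷ B)) A

  wedge-𝟘 : ∀ {n} (φ : Form n) A → wedge 𝟘 φ A ≡ 0ℤ
  wedge-𝟘 φ [] = refl
  wedge-𝟘 φ (true ∷ A) = cong (λ t → 0ℤ - t) (wedge-𝟘 (λ B → φ (true ∷ B)) A)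
  wedge-𝟘 φ (false ∷ A) = wedge-𝟘 (λ B → φ (false ∷ B)) A

  wedge-comb : ∀ {k n} (c : Fin k → ℤ) (v : Fin k → Vec ℤ n) (φ : Form n) A → wedge (comb c v) φ A ≡ ∑ (λ j → c j * wedge (v j) φ A)
  wedge-comb {zero} c v φ A = trans (cong (λ x → wedge x φ A) (comb-nil c v)) (trans (wedge-𝟘 φ A) (sym (∑ℤ.sum-nil _)))
  wedge-comb {suc k} c v φ A = trans (cong (λ x → wedge x φ A) (comb-suc c v)) (trans (wedge-⊞ (c zero) (v zero) (comb (c ∘ suc) (v ∘ suc)) φ A)
    (trans (cong (λ t → c zero * wedge (v zero) φ A + t) (wedge-comb (c ∘ suc) (v ∘ suc) φ A)) (sym (∑ℤ.sum-suc (λ j → c j * wedge (v j) φ A)))))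

  wedge-∑ : ∀ {k n} (a : Vec ℤ n) (c : Fin k → ℤ) (φ : Fin k → Form n) A → wedge a (λ B → ∑ (λ j → c j * φ j B)) A ≡ ∑ (λ j → c j * wedge a (φ j) A)
  wedge-∑ {zero} a c φ A = trans (wedge-zero a (λ B → ∑ℤ.sum-nil _) A) (sym (∑ℤ.sum-nil _))
  wedge-∑ {suc k} a c φ A = trans (wedge-cong a (λ B → ∑ℤ.sum-suc (λ j → c j * φ j B)) A) (trans (wedge-lin a (c zero) (φ zero) (λ B → ∑ (λ j → c (suc j) * φ (suc j) B)) A)
    (trans (cong (λ t → c zero * wedge a (φ zero) A + t) (wedge-∑ a (c ∘ suc) (φ ∘ suc) A)) (sym (∑ℤ.sum-suc (λ j → c j * wedge a (φ j) A)))))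

  wedges : ∀ {k n} → (Fin k → Vec ℤ n) → Form n → Form n
  wedges {zero} x φ = φ
  wedges {suc k} x φ = wedges (x ∘ suc) (wedge (x zero) φ)

  wedges-cong : ∀ {k n} (x : Fin k → Vec ℤ n) {φ ψ : Form n} → (∀ A → φ A ≡ ψ A) → ∀ A → wedges x φ A ≡ wedges x ψ A
  wedges-cong {zero} x h = h
  wedges-cong {suc k} x h = wedges-cong (x ∘ suc) (wedge-cong (x zero) h)

  wedges-∑ : ∀ {k m n} (x : Fin k → Vec ℤ n) (c : Fin m → ℤ) (φ : Fin m → Form n) A →
    wedges x (λ B → ∑ (λ j → c j * φ j B)) A ≡ ∑ (λ j → c j * wedges x (φ j) A)
  wedges-∑ {zero} x c φ A = refl
  wedges-∑ {suc k} x c φ A = trans (wedges-cong (x ∘ suc) (wedge-∑ (x zero) c φ) A) (wedges-∑ (x ∘ suc) c (λ j → wedge (x zero) (φ j)) A)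

  wedges-neg : ∀ {k n} (x : Fin k → Vec ℤ n) (φ : Form n) A → wedges x (λ B → - φ B) A ≡ - wedges x φ A
  wedges-neg {zero} x φ A = refl
  wedges-neg {suc k} x φ A = trans (wedges-cong (x ∘ suc) (λ B → trans (wedge-cong (x zero) (λ C → sym (ℤₚ.-1*i≡-i (φ C))) B)
    (trans (wedge-scale (x zero) (- 1ℤ) φ B) (ℤₚ.-1*i≡-i (wedge (x zero) φ B)))) A) (wedges-neg (x ∘ suc) (wedge (x zero) φ) A)

  infix 4 _≡±_
  _≡±_ : ℤ → ℤ → Set
  x ≡± y = x ≡ y ⊎ x ≡ - y

  ±-neg : ∀ {x y} → x ≡± y → - x ≡± y
  ±-neg (inj₁ e) = inj₂ (cong -_ e)
  ±-neg {y = y} (inj₂ e) = inj₁ (trans (cong -_ e) (ℤₚ.neg-involutive y))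

  ±-∣∣ : ∀ {x y} → x ≡± y → ∣ x ∣ ≡ ∣ y ∣
  ±-∣∣ (inj₁ e) = cong ∣_∣ e
  ±-∣∣ {y = y} (inj₂ e) = trans (cong ∣_∣ e) (ℤₚ.∣-i∣≡∣i∣ y)

  wedges-move : ∀ {k n} (b : Fin (suc k) → Vec ℤ n) j (φ : Form n) A → wedges (b ∘ punchIn j) (wedge (b j) φ) A ≡± wedges b φ A
  wedges-move b zero φ A = inj₁ refl
  wedges-move {suc k} b (suc j) φ A = subst (_≡± wedges b φ A)
    (sym (trans (wedges-cong (b ∘ suc ∘ punchIn j) (wedge-anticomm (b zero) (b (suc j)) φ) A) (wedges-neg (b ∘ suc ∘ punchIn j) (wedge (b (suc j)) (wedge (b zero) φ)) A)))
    (±-neg (wedges-move (b ∘ suc) j (wedge (b zero) φ) A))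

  _∣_ : ℤ → ℤ → Set
  x ∣ y = ∃ λ t → y ≡ t * x

  ∣-∑ : ∀ {k D} (c t : Fin k → ℤ) → (∀ j → D ∣ t j) → D ∣ ∑ (λ j → c j * t j)
  ∣-∑ {D = D} c t h = ∑ (λ j → c j * proj₁ (h j)) , trans (∑ℤ.sum-cong (λ j → trans (cong (c j *_) (proj₂ (h j))) (sym (ℤₚ.*-assoc (c j) (proj₁ (h j)) D))))
    (sym (∑ℤ.sum-*ʳ D (λ j → c j * proj₁ (h j))))

  -- Only the action of the vectors on φ matters, so b j may be dropped once it has been applied.
  wedges-divides : ∀ {k n} (b x : Fin k → Vec ℤ n) (φ : Form n) → (∀ i → Σ (Fin k → ℤ) λ c → ∀ A → wedge (x i) φ A ≡ ∑ (λ j → c j * wedge (b j) φ A)) →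
    ∀ A → wedges b φ A ∣ wedges x φ A
  wedges-divides {zero} b x φ h A = 1ℤ , sym (ℤₚ.*-identityˡ (φ A))
  wedges-divides {suc k} b x φ h A = subst (wedges b φ A ∣_) (sym (trans (wedges-cong (x ∘ suc) (proj₂ (h zero)) A) (wedges-∑ (x ∘ suc) (proj₁ (h zero)) (λ j → wedge (b j) φ) A)))
    (∣-∑ (proj₁ (h zero)) (λ j → wedges (x ∘ suc) (wedge (b j) φ) A) each)
    where
    signed-∣ : ∀ {x y z} → x ≡± y → x ∣ z → y ∣ z
    signed-∣ (inj₁ refl) p = p
    signed-∣ {y = y} (inj₂ refl) (t , e) = - t , trans e (trans (sym (ℤₚ.neg-distribʳ-* t y)) (ℤₚ.neg-distribˡ-* t y))
    module _ (j : Fin (suc k)) where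
      reduced : ∀ i → Σ (Fin k → ℤ) λ c → ∀ A → wedge (x (suc i)) (wedge (b j) φ) A ≡ ∑ (λ l → c l * wedge (b (punchIn j l)) (wedge (b j) φ) A)
      reduced i = c ∘ punchIn j , λ A → trans (wedge-anticomm (x (suc i)) (b j) φ A) (trans (cong -_ (trans (wedge-cong (b j) (proj₂ (h (suc i))) A) (wedge-∑ (b j) c (λ l → wedge (b l) φ) A)))
          (trans (sym (∑-neg (λ l → c l * wedge (b j) (wedge (b l) φ) A))) (trans (∑ℤ.sum-cong (λ l → trans (ℤₚ.neg-distribʳ-* (c l) _) (cong (c l *_) (sym (wedge-anticomm (b l) (b j) φ A)))))
          (trans (∑ℤ.sum-remove (λ l → c l * wedge (b l) (wedge (b j) φ) A) j) (trans (cong (_+ rest A) (trans (cong (c j *_) (wedge-square (b j) φ A)) (ℤₚ.*-zeroʳ (c j)))) (ℤₚ.+-identityˡ (rest A)))))))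
        where
        c = proj₁ (h (suc i))
        rest : Vec Bool _ → ℤ
        rest A = ∑ (λ l → c (punchIn j l) * wedge (b (punchIn j l)) (wedge (b j) φ) A)
      each : wedges b φ A ∣ wedges (x ∘ suc) (wedge (b j) φ) A
      each = signed-∣ (wedges-move b j φ A) (wedges-divides (b ∘ punchIn j) (x ∘ suc) (wedge (b j) φ) reduced A)

  members : ∀ {r n} → Sub r n → Vec Bool n
  members done = []
  members (keep A) = true ∷ members A
  members (skip A) = false ∷ members A

  remove : ∀ {r n} → Sub (suc r) n → Fin (suc r) → Sub r n
  remove (keep A) zero = skip A
  remove {suc r} (keep A) (suc j) = keep (remove A j)
  remove (skip A) j = skip (remove A j)

  ι-remove : ∀ {r n} (A : Sub (suc r) n) j i → ι (remove A j) i ≡ ι A (punchIn j i)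
  ι-remove (keep A) zero i = refl
  ι-remove {suc r} (keep A) (suc j) zero = refl
  ι-remove {suc r} (keep A) (suc j) (suc i) = cong suc (ι-remove A j i)
  ι-remove (skip A) j i = cong suc (ι-remove A j i)

  sumZ-cong : ∀ {k} {s t : Fin k → ℤ} → (∀ j → s j ≡ t j) → sumZ s ≡ sumZ t
  sumZ-cong {zero} h = refl
  sumZ-cong {suc k} h = cong₂ _+_ (h zero) (sumZ-cong (h ∘ suc))

  sumZ-neg : ∀ {k} (t : Fin k → ℤ) → sumZ (λ j → - t j) ≡ - sumZ t
  sumZ-neg {zero} t = refl
  sumZ-neg {suc k} t = trans (cong (λ x → - t zero + x) (sumZ-neg (t ∘ suc))) (sym (ℤₚ.neg-distrib-+ (t zero) (sumZ (t ∘ suc))))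

  altSign-0 : ∀ j → altSign j 0ℤ ≡ 0ℤ
  altSign-0 zero = refl
  altSign-0 (suc zero) = refl
  altSign-0 (suc (suc j)) = altSign-0 j

  altSign-suc : ∀ j x → altSign (suc j) x ≡ - altSign j x
  altSign-suc zero x = refl
  altSign-suc (suc zero) x = sym (ℤₚ.neg-involutive x)
  altSign-suc (suc (suc j)) x = altSign-suc j x

  wedge-empty : ∀ {n} (a : Vec ℤ n) (φ : Form n) (A : Sub 0 n) → wedge a φ (members A) ≡ 0ℤ
  wedge-empty [] φ done = refl
  wedge-empty (a ∷ as) φ (skip A) = wedge-empty as (λ B → φ (false ∷ B)) A

  wedge-laplace : ∀ {r n} (a : Vec ℤ n) (φ : Form n) (A : Sub (suc r) n) →
    wedge a φ (members A) ≡ sumZ (λ j → altSign (toℕ j) (lookup a (ι A j) * φ (members (remove A j))))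
  wedge-laplace {zero} (a ∷ as) φ (keep A) = cong (λ t → a * φ (false ∷ members A) - t) (wedge-empty as (λ B → φ (true ∷ B)) A)
  wedge-laplace {suc r} (a ∷ as) φ (keep A) = cong (λ t → a * φ (false ∷ members A) + t) (trans (cong -_ (wedge-laplace as (λ B → φ (true ∷ B)) A))
    (trans (sym (sumZ-neg (λ j → altSign (toℕ j) (lookup as (ι A j) * φ (true ∷ members (remove A j))))))
      (sumZ-cong (λ j → sym (altSign-suc (toℕ j) (lookup as (ι A j) * φ (true ∷ members (remove A j))))))))
  wedge-laplace (a ∷ as) φ (skip A) = wedge-laplace as (λ B → φ (false ∷ B)) A

  det-cong : ∀ k {M M' : Fin k → Fin k → ℤ} → (∀ i j → M i j ≡ M' i j) → det k M ≡ det k M'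
  det-cong zero h = refl
  det-cong (suc k) {M} {M'} h = sumZ-cong (λ j → cong (altSign (toℕ j)) (cong₂ _*_ (h zero j) (det-cong k (λ r c → h (suc r) (punchIn j c)))))

  -- The unit of the exterior algebra.
  point : ∀ {n} → Form n
  point [] = 1ℤ
  point (true ∷ A) = 0ℤ
  point (false ∷ A) = point A

  -- The order of Laplace expansion, with `x zero` applied last; `wedges` applies it first, at the
  -- cost of a sign.
  wedgesʳ : ∀ {k n} → (Fin k → Vec ℤ n) → Form n → Form n
  wedgesʳ {zero} x φ = φ
  wedgesʳ {suc k} x φ = wedge (x zero) (wedgesʳ (x ∘ suc) φ)

  det-wedgesʳ : ∀ {k n} (x : Fin k → Vec ℤ n) (A : Sub k n) → det k (λ i j → lookup (x i) (ι A j)) ≡ wedgesʳ x point (members A)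
  det-wedgesʳ {zero} x A = sym (base A)
    where
    base : ∀ {n} (A : Sub 0 n) → point (members A) ≡ 1ℤ
    base done = refl
    base (skip A) = base A
  det-wedgesʳ {suc k} x A = sym (trans (wedge-laplace (x zero) (wedgesʳ (x ∘ suc) point) A) (sumZ-cong (λ j → cong (λ t → altSign (toℕ j) (lookup (x zero) (ι A j) * t))
    (sym (trans (det-cong k (λ r c → cong (lookup (x (suc r))) (sym (ι-remove A j c)))) (det-wedgesʳ (x ∘ suc) (remove A j)))))))

  infix 4 _≐±_
  _≐±_ : ∀ {n} → Form n → Form n → Set
  φ ≐± ψ = (∀ A → φ A ≡ ψ A) ⊎ (∀ A → φ A ≡ - ψ A)

  ≐±-trans : ∀ {n} {φ ψ χ : Form n} → φ ≐± ψ → ψ ≐± χ → φ ≐± χ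
  ≐±-trans (inj₁ p) (inj₁ q) = inj₁ (λ A → trans (p A) (q A))
  ≐±-trans (inj₁ p) (inj₂ q) = inj₂ (λ A → trans (p A) (q A))
  ≐±-trans (inj₂ p) (inj₁ q) = inj₂ (λ A → trans (p A) (cong -_ (q A)))
  ≐±-trans (inj₂ p) (inj₂ q) = inj₁ (λ A → trans (p A) (trans (cong -_ (q A)) (ℤₚ.neg-involutive _)))

  wedges-± : ∀ {k n} (x : Fin k → Vec ℤ n) {φ ψ : Form n} → φ ≐± ψ → wedges x φ ≐± wedges x ψ
  wedges-± x (inj₁ h) = inj₁ (wedges-cong x h)
  wedges-± x {ψ = ψ} (inj₂ h) = inj₂ (λ A → trans (wedges-cong x h A) (wedges-neg x ψ A))

  wedge-wedges : ∀ {k n} a (x : Fin k → Vec ℤ n) (φ : Form n) → wedge a (wedges x φ) ≐± wedges x (wedge a φ)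
  wedge-wedges {zero} a x φ = inj₁ (λ A → refl)
  wedge-wedges {suc k} a x φ = ≐±-trans (wedge-wedges a (x ∘ suc) (wedge (x zero) φ))
    (wedges-± (x ∘ suc) {wedge a (wedge (x zero) φ)} {wedge (x zero) (wedge a φ)} (inj₂ (wedge-anticomm a (x zero) φ)))

  wedgesʳ-wedges : ∀ {k n} (x : Fin k → Vec ℤ n) (φ : Form n) → wedgesʳ x φ ≐± wedges x φ
  wedgesʳ-wedges {zero} x φ = inj₁ (λ A → refl)
  wedgesʳ-wedges {suc k} x φ = ≐±-trans (wedges-± {suc zero} (λ _ → x zero) (wedgesʳ-wedges (x ∘ suc) φ)) (wedge-wedges (x zero) (x ∘ suc) φ)

  ∣det∣-wedges : ∀ {n} (x : Fin n → Vec ℤ n) → ∣ det n (λ i j → lookup (x i) j) ∣ ≡ ∣ wedges x point (members (all n)) ∣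
  ∣det∣-wedges {n} x = trans (cong ∣_∣ (trans (det-cong n (λ i j → cong (lookup (x i)) (sym (ι-all n j)))) (det-wedgesʳ x (all n)))) (±-∣∣ (at (wedgesʳ-wedges x point)))
    where
    at : wedgesʳ x point ≐± wedges x point → wedgesʳ x point (members (all n)) ≡± wedges x point (members (all n))
    at (inj₁ p) = inj₁ (p (members (all n)))
    at (inj₂ p) = inj₂ (p (members (all n)))

  det-units : ∀ n → det n (λ i j → lookup (unit i) j) ≡ 1ℤ
  det-units zero = refl
  det-units (suc n) = trans (cong₂ _+_ (trans (ℤₚ.*-identityˡ _) (det-units n))
      (trans (sumZ-cong {n} (λ j → trans (cong (altSign (suc (toℕ j))) (trans (cong (_* minor j) (lookup-replicate j 0ℤ)) refl)) (altSign-0 (suc (toℕ j))))) (sumZ-0 n))) refl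
    where
    minor : Fin n → ℤ
    minor j = det n (λ r c → lookup (unit (suc r)) (punchIn (suc j) c))
    sumZ-0 : ∀ k → sumZ {k} (λ _ → 0ℤ) ≡ 0ℤ
    sumZ-0 zero = refl
    sumZ-0 (suc k) = trans (ℤₚ.+-identityˡ _) (sumZ-0 k)

  -- The unit vectors are integer combinations of the `x i`, so by `wedges-divides` the determinant
  -- divides that of the unit matrix, which is 1.
  generating-det : ∀ {n} (x : Fin n → Vec ℤ n) → (∀ z → Σ (Fin n → ℤ) λ c → comb c x ≡ z) → ∣ det n (λ i j → lookup (x i) j) ∣ ≡ 1
  generating-det {n} x gen = trans (∣det∣-wedges x) (ℕₚ.m*n≡1⇒n≡1 ∣ proj₁ divides ∣ ∣ D ∣
      (trans (sym (ℤₚ.abs-* (proj₁ divides) D)) (trans (cong ∣_∣ (sym (proj₂ divides))) (trans (sym (∣det∣-wedges {n} unit)) (cong ∣_∣ (det-units n))))))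
    where
    D : ℤ
    D = wedges x point (members (all n))
    divides : D ∣ wedges unit point (members (all n))
    divides = wedges-divides x unit point (λ i → proj₁ (gen (unit i)) , λ A → trans (cong (λ z → wedge z point A) (sym (proj₂ (gen (unit i))))) (wedge-comb (proj₁ (gen (unit i))) x point A)) (members (all n))

-- The h*-vector counts facets by the size of their restriction sets

module Counting where
  open import Data.Nat using (⌊_/2⌋; ⌈_/2⌉)
  open import Data.Nat.Combinatorics using (_C_; nCk+nC[k+1]≡[n+1]C[k+1]; nCn≡1; nCk≡nC[n∸k])
  open import Data.Integer as ℤ using (ℤ; +_; 0ℤ; 1ℤ; _+_; _*_; -_; _-_)
  import Data.Integer.Properties as ℤₚ
  open import Data.Integer.Tactic.RingSolver using (solve-∀)
  open import Data.Fin using (toℕ)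
  open import Data.Fin.Properties using (injective⇒≤)
  open import Data.Vec using (tabulate)
  open import Data.Vec.Properties using (lookup∘tabulate)
  open import Data.List using (length; filter; allFin)
  open import Data.List.Properties using (length-map; length-++; filter-≐)
  open import Data.List.Membership.Propositional using (_∈_)
  open import Data.List.Membership.Propositional.Properties using (∈-filter⁺; ∈-filter⁻; ∈-allFin; ∈-lookup; ∈-map⁺; ∈-map⁻)
  open import Data.List.Relation.Unary.Any using (index)
  open import Data.List.Relation.Unary.Any.Properties using (lookup-index)
  open import Data.List.Relation.Unary.Unique.Propositional using (Unique)
  import Data.List.Relation.Unary.Unique.Propositional.Properties as Uₚ
  open import Relation.Binary.PropositionalEquality using (_≡_; refl; sym; trans; cong; cong₂; subst; subst₂)
  open IntegerVectors
  open Fans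
  open Monomials
  open FaceMonomials
  open LefschetzProperty using (lefschetz)
  open Determinants using (sumZ-cong; altSign-suc; altSign-0)

  unique-⊆-length : ∀ {A : Set} {xs ys : List A} → Unique xs → (∀ {z} → z ∈ xs → z ∈ ys) → length xs ℕ.≤ length ys
  unique-⊆-length {xs = xs} {ys} u sub = injective⇒≤ {f = λ i → index (sub (∈-lookup {xs = xs} i))}
    (λ {i} {j} e → lookup-unique u i j (trans (lookup-index (sub (∈-lookup {xs = xs} i)))
      (trans (cong (List.lookup ys) e) (sym (lookup-index (sub (∈-lookup {xs = xs} j)))))))

  convolve : (ℕ → ℤ) → (ℕ → ℤ) → ℕ → ℤ
  convolve a g zero = a 0 * g 0
  convolve a g (suc i) = a 0 * g (suc i) + convolve (a ∘ suc) g i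

  convolve-sumZ : ∀ a g i → sumZ {suc i} (λ j → a (toℕ j) * g (i ℕ.∸ toℕ j)) ≡ convolve a g i
  convolve-sumZ a g zero = ℤₚ.+-identityʳ _
  convolve-sumZ a g (suc i) = cong (λ t → a 0 * g (suc i) + t) (convolve-sumZ (a ∘ suc) g i)

  convolve-congˡ : ∀ {a b} g → (∀ j → a j ≡ b j) → ∀ i → convolve a g i ≡ convolve b g i
  convolve-congˡ g h zero = cong (_* g 0) (h 0)
  convolve-congˡ g h (suc i) = cong₂ _+_ (cong (_* g (suc i)) (h 0)) (convolve-congˡ g (h ∘ suc) i)

  convolve-congʳ : ∀ a {g g'} → (∀ j → g j ≡ g' j) → ∀ i → convolve a g i ≡ convolve a g' i
  convolve-congʳ a h zero = cong (a 0 *_) (h 0)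
  convolve-congʳ a h (suc i) = cong₂ _+_ (cong (a 0 *_) (h (suc i))) (convolve-congʳ (a ∘ suc) h i)

  convolve-sub : ∀ a b g i → convolve (λ j → a j - b j) g i ≡ convolve a g i - convolve b g i
  convolve-sub a b g zero = lemma (a 0) (b 0) (g 0)
    where lemma : ∀ a b g → (a - b) * g ≡ a * g - b * g
          lemma = solve-∀
  convolve-sub a b g (suc i) = trans (cong (λ t → (a 0 - b 0) * g (suc i) + t) (convolve-sub (a ∘ suc) (b ∘ suc) g i))
    (lemma (a 0) (b 0) (g (suc i)) (convolve (a ∘ suc) g i) (convolve (b ∘ suc) g i))
    where lemma : ∀ a b g x y → (a - b) * g + (x - y) ≡ a * g + x - (b * g + y)
          lemma = solve-∀

  -- For generating functions, g' = g / (1 - z).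
  PrefixSum : (ℕ → ℤ) → (ℕ → ℤ) → Set
  PrefixSum g g' = g' 0 ≡ g 0 × (∀ t → g' (suc t) ≡ g' t + g (suc t))

  convolve-prefix : ∀ a {g g'} → PrefixSum g g' → ∀ i → convolve a g' (suc i) - convolve a g' i ≡ convolve a g (suc i)
  convolve-prefix a {g} {g'} (p₀ , p) zero rewrite p 0 | p₀ = lemma (a 0) (a 1) (g 0) (g 1)
    where lemma : ∀ a b x y → a * (x + y) + b * x - a * x ≡ a * y + b * x
          lemma = solve-∀
  convolve-prefix a {g} {g'} pp@(p₀ , p) (suc i) rewrite p (suc i) =
    trans (lemma (a 0) (g' (suc i)) (g (suc (suc i))) (convolve (a ∘ suc) g' (suc i)) (convolve (a ∘ suc) g' i))
      (cong (λ t → a 0 * g (suc (suc i)) + t) (convolve-prefix (a ∘ suc) {g} {g'} pp i))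
    where lemma : ∀ a x y s t → a * (x + y) + s - (a * x + t) ≡ a * y + (s - t)
          lemma = solve-∀

  -- The coefficients of (1 - z)^m.
  signed : ℕ → ℕ → ℤ
  signed m j = altSign j (+ (m C j))

  altSign-* : ∀ j x y → altSign j (x * y) ≡ altSign j x * y
  altSign-* zero x y = refl
  altSign-* (suc zero) x y = ℤₚ.neg-distribˡ-* x y
  altSign-* (suc (suc j)) x y = altSign-* j x y

  altSign-+ : ∀ j x y → altSign j (x + y) ≡ altSign j x + altSign j y
  altSign-+ zero x y = refl
  altSign-+ (suc zero) x y = ℤₚ.neg-distrib-+ x y
  altSign-+ (suc (suc j)) x y = altSign-+ j x y

  signed-0 : ∀ m → signed m 0 ≡ 1ℤ
  signed-0 m = cong +_ (nC0≡1 m)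
    where
    nC0≡1 : ∀ n → n C 0 ≡ 1
    nC0≡1 n = trans (nCk≡nC[n∸k] {0} {n} z≤n) (nCn≡1 n)

  signed-suc : ∀ m j → signed (suc m) (suc j) ≡ signed m (suc j) - signed m j
  signed-suc m j = trans (cong (altSign (suc j) ∘ +_) (sym (nCk+nC[k+1]≡[n+1]C[k+1] m j)))
    (trans (altSign-+ (suc j) (+ (m C j)) (+ (m C suc j)))
    (trans (cong (_+ signed m (suc j)) (altSign-suc j (+ (m C j)))) (ℤₚ.+-comm (- signed m j) (signed m (suc j)))))

  -- One factor cancels: (1 - z)^(m+1) · g / (1 - z) = (1 - z)^m · g.
  signed-prefix : ∀ m {g g'} → PrefixSum g g' → ∀ i → convolve (signed (suc m)) g' i ≡ convolve (signed m) g i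
  signed-prefix m (p₀ , p) zero = cong₂ _*_ (trans (signed-0 (suc m)) (sym (signed-0 m))) p₀
  signed-prefix m {g} {g'} pp (suc i) = trans
    (cong₂ _+_ (cong (_* g' (suc i)) (trans (signed-0 (suc m)) (sym (signed-0 m))))
      (trans (convolve-congˡ g' (signed-suc m) i) (convolve-sub (signed m ∘ suc) (signed m) g' i)))
    (trans (sym (ℤₚ.+-assoc (signed m 0 * g' (suc i)) (convolve (signed m ∘ suc) g' i) (- convolve (signed m) g' i))) (convolve-prefix (signed m) {g} {g'} pp i))

  signed-zero : ∀ g i → convolve (signed 0) g i ≡ g i
  signed-zero g zero = ℤₚ.*-identityˡ _
  signed-zero g (suc i) = trans (cong₂ _+_ (ℤₚ.*-identityˡ (g (suc i))) (vanishing (λ j → signed-suc-0 j) i)) (ℤₚ.+-identityʳ _)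
    where
    signed-suc-0 : ∀ j → signed 0 (suc j) ≡ 0ℤ
    signed-suc-0 j = altSign-0 (suc j)
    vanishing : ∀ {a : ℕ → ℤ} → (∀ j → a j ≡ 0ℤ) → ∀ i → convolve a g i ≡ 0ℤ
    vanishing h zero = trans (cong (_* g 0) (h 0)) refl
    vanishing {a} h (suc i) = cong₂ _+_ (trans (cong (_* g (suc i)) (h 0)) refl) (vanishing (h ∘ suc) i)

  hstar-convolve : ∀ d L i → hstar d L i ≡ convolve (signed (suc d)) (λ t → + L t) i
  hstar-convolve d L i = trans (sumZ-cong {suc i} (λ j → altSign-* (toℕ j) (+ (suc d C toℕ j)) (+ L (i ℕ.∸ toℕ j)))) (convolve-sumZ (signed (suc d)) (λ t → + L t) i)

  module _ {A : Set} (B : ℕ → List A) where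

    enum-prefix : ∀ k → PrefixSum (λ t → + length (enum B k t)) (λ t → + length (enum B (suc k) t))
    enum-prefix k = cong +_ (length-map (pad B) (enum B k 0)) , λ t → cong +_ (trans (length-++ (List.map (bump B) (enum B (suc k) t)))
      (cong₂ ℕ._+_ (length-map (bump B) (enum B (suc k) t)) (length-map (pad B) (enum B k (suc t)))))

    -- Each exponent coordinate in `enum` contributes a factor 1 / (1 - z).
    signed-enum : ∀ k m i → convolve (signed (k ℕ.+ m)) (λ t → + length (enum B k t)) i ≡ convolve (signed m) (λ t → + length (B t)) i
    signed-enum zero m i = convolve-congʳ (signed m) (λ t → cong +_ (length-map (_, []) (B t))) i
    signed-enum (suc k) m i = trans (signed-prefix (k ℕ.+ m) {λ t → + length (enum B k t)} {λ t → + length (enum B (suc k) t)} (enum-prefix k) i) (signed-enum k m i)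

  length-filter-⊎ : ∀ {A : Set} {P Q R : A → Set} (P? : ∀ x → Dec (P x)) (Q? : ∀ x → Dec (Q x)) (R? : ∀ x → Dec (R x)) →
    (∀ {x} → Q x → P x) → (∀ {x} → R x → P x) → (∀ {x} → Q x → ¬ R x) → (∀ {x} → P x → ¬ Q x → R x) →
    ∀ xs → length (filter P? xs) ≡ length (filter Q? xs) ℕ.+ length (filter R? xs)
  length-filter-⊎ P? Q? R? QP RP QR PR [] = refl
  length-filter-⊎ P? Q? R? QP RP QR PR (x ∷ xs) with P? x | Q? x | R? x
  ... | yes _ | yes q | yes r = contradiction r (QR q)
  ... | yes _ | yes _ | no _ = cong suc (length-filter-⊎ P? Q? R? QP RP QR PR xs)
  ... | yes _ | no _ | yes _ = trans (cong suc (length-filter-⊎ P? Q? R? QP RP QR PR xs)) (sym (ℕₚ.+-suc _ _))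
  ... | yes p | no nq | no nr = contradiction (PR p nq) nr
  ... | no np | yes q | _ = contradiction (QP q) np
  ... | no np | no _ | yes r = contradiction (RP r) np
  ... | no _ | no _ | no _ = length-filter-⊎ P? Q? R? QP RP QR PR xs

  module Ehrhart {d n N : ℕ} (fan : Fan d n N) where
    open FanMonomials fan

    -- For the fan of the triangulation these are the lattice points of the t-th dilate of P.
    InBall : ℕ → Vec ℤ d → Set
    InBall t z = ∃ λ F → Σ (Fin d → ℕ) λ α → z ≡ pt (mono (f F) α) × sumℕ α ℕ.≤ t

    Enumerates : ℕ → List (Vec ℤ d) → Set
    Enumerates t xs = Unique xs × (∀ z → (z ∈ xs → InBall t z) × (InBall t z → z ∈ xs))

    module _ (w : Vec ℤ d) (gen : Generic w) where

      -- A point of the dilate may have weight less than t. Collecting facets up to a size absorbs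
      -- this slack, and accounts for the last factor of (1 - z)^(d+1); the other d belong to the
      -- exponents.
      upTo-level : ℕ → List (Fin N)
      upTo-level s = filter (λ F → size (restriction w F) ℕ.≤? s) (allFin N)

      level-prefix : PrefixSum (λ t → + length (level w t)) (λ t → + length (upTo-level t))
      level-prefix = cong (+_ ∘ length) (filter-≐ (λ F → size (restriction w F) ℕ.≤? 0) (λ F → size (restriction w F) ℕ.≟ 0) (ℕₚ.n≤0⇒n≡0 , ℕₚ.≤-reflexive) (allFin N)) ,
        λ t → cong +_ (length-filter-⊎ (λ F → size (restriction w F) ℕ.≤? suc t) (λ F → size (restriction w F) ℕ.≤? t) (λ F → size (restriction w F) ℕ.≟ suc t)
          ℕₚ.m≤n⇒m≤1+n ℕₚ.≤-reflexive (λ le e → ℕₚ.1+n≰n (subst (ℕ._≤ t) e le)) (λ le nle → ℕₚ.≤-antisym le (ℕₚ.≰⇒> nle)) (allFin N))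

      rep : Fin N × Vec ℕ d → Fin d → ℕ
      rep (F , α) j = isNeg (c F j ∙ w) ℕ.+ lookup α j

      rep-low : ∀ p → Low w (proj₁ p) (mono (f (proj₁ p)) (rep p))
      rep-low p@(F , α) = low-of-≥ w F (mono (f F) (rep p)) (λ j → subst (isNeg (c F j ∙ w) ℕ.≤_) (sym (mono-lookup F (rep p) j)) (ℕₚ.m≤m+n _ _))

      point : Fin N × Vec ℕ d → Vec ℤ d
      point p = pt (mono (f (proj₁ p)) (rep p))

      point-injective : ∀ {p p'} → point p ≡ point p' → p ≡ p'
      point-injective {p@(F , α)} {p'@(F' , α')} e = cong₂ _,_ same (lookup-ext exps)
        where
        mono≡ : mono (f F) (rep p) ≡ mono (f F') (rep p')
        mono≡ = pt-injective (mono-face F (rep p)) (mono-face F' (rep p')) e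
        same : F ≡ F'
        same = locate-unique w gen (mono (f F) (rep p)) (mono-face F (rep p)) (rep-low p)
          (subst (Face F') (sym mono≡) (mono-face F' (rep p'))) (subst (Low w F') (sym mono≡) (rep-low p'))
        exps : ∀ l → lookup α l ≡ lookup α' l
        exps l = ℕₚ.+-cancelˡ-≡ (isNeg (c F l ∙ w)) _ _ (trans (sym (mono-lookup F (rep p) l))
          (trans (cong₂ (λ m F → lookup m (f F l)) mono≡ same) (trans (mono-lookup F' (rep p') l)
            (cong (λ F → isNeg (c F l ∙ w) ℕ.+ lookup α' l) (sym same)))))

      points : ℕ → List (Vec ℤ d)
      points t = List.map point (enum upTo-level d t)

      size-rep : ∀ F (α : Vec ℕ d) → sumℕ (rep (F , α)) ≡ size (restriction w F) ℕ.+ size α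
      size-rep F α = trans (sumℕ-+ (λ j → isNeg (c F j ∙ w)) (lookup α)) (cong₂ ℕ._+_ (sym (size-mono (f F) (λ j → isNeg (c F j ∙ w)))) (size-sumℕ α))

      -- Each face monomial is R(F) times a monomial on `F` for exactly one facet, the located one;
      -- α is its surplus over R(F).
      points-enumerate : ∀ t → Enumerates t (points t)
      points-enumerate t = Uₚ.map⁺ point-injective (enum-unique upTo-level (λ s → Uₚ.filter⁺ (λ F → size (restriction w F) ℕ.≤? s) (Uₚ.allFin⁺ N)) d t) ,
          λ z → sound z , complete z
        where
        sound : ∀ z → z ∈ points t → InBall t z
        sound z z∈ with ∈-map⁻ point z∈
        ... | (F , α) , p∈ , refl with ∈-enum⁻ upTo-level d p∈
        ...   | s , F∈ , e = F , rep (F , α) , refl , subst₂ ℕ._≤_ (sym (size-rep F α)) e (ℕₚ.+-monoˡ-≤ (size α) (proj₂ (∈-filter⁻ (λ F → size (restriction w F) ℕ.≤? s) {xs = allFin N} F∈)))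
        complete : ∀ z → InBall t z → z ∈ points t
        complete z (F₁ , β , z≡ , le) = subst (_∈ points t) (trans (cong pt (sym mono≡)) (sym z≡)) (∈-map⁺ point mem)
          where
          m = mono (f F₁) β
          loc = locate w gen m (mono-face F₁ β)
          F = proj₁ loc
          α : Vec ℕ d
          α = tabulate (λ j → lookup m (f F j) ℕ.∸ isNeg (c F j ∙ w))
          low≥ : ∀ j → isNeg (c F j ∙ w) ℕ.≤ lookup m (f F j)
          low≥ j with isNeg (c F j ∙ w) ℕ.≟ 0
          ... | yes e = subst (ℕ._≤ lookup m (f F j)) (sym e) z≤n
          ... | no ne = ℕₚ.≤-trans (isNeg≤1 (c F j ∙ w)) (ℕₚ.n≢0⇒n>0 (proj₂ (proj₂ loc) j (neg-isNeg ne)))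
          rep≡ : ∀ j → lookup m (f F j) ≡ rep (F , α) j
          rep≡ j = sym (trans (cong (isNeg (c F j ∙ w) ℕ.+_) (lookup∘tabulate (λ j → lookup m (f F j) ℕ.∸ isNeg (c F j ∙ w)) j)) (ℕₚ.m+[n∸m]≡n (low≥ j)))
          mono≡ : m ≡ mono (f F) (rep (F , α))
          mono≡ = face-ext (proj₁ (proj₂ loc)) (mono-face F (rep (F , α))) (λ j → trans (rep≡ j) (sym (mono-lookup F (rep (F , α)) j)))
          total : size (restriction w F) ℕ.+ size α ℕ.≤ t
          total = subst (ℕ._≤ t) (trans (sym (size-mono (f F₁) β)) (trans (cong size mono≡) (trans (size-mono (f F) (rep (F , α))) (size-rep F α)))) le
          mem : (F , α) ∈ enum upTo-level d t
          mem = subst (λ t → (F , α) ∈ enum upTo-level d t) (ℕₚ.m∸n+n≡m {t} {size α} (ℕₚ.≤-trans (ℕₚ.m≤n+m (size α) (size (restriction w F))) total))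
            (∈-enum⁺ upTo-level d {t ℕ.∸ size α} α (∈-filter⁺ (λ F → size (restriction w F) ℕ.≤? t ℕ.∸ size α) (∈-allFin F) (ℕₚ.m+n≤o⇒m≤o∸n (size (restriction w F)) total)))

      hstar-level : ∀ L → (∀ t → Σ (List (Vec ℤ d)) λ xs → length xs ≡ L t × Enumerates t xs) → ∀ i → hstar d L i ≡ + length (level w i)
      hstar-level L count i = trans (hstar-convolve d L i) (trans (convolve-congʳ (signed (suc d)) (cong +_ ∘ L≡) i)
          (trans (cong (λ k → convolve (signed k) (λ t → + length (enum upTo-level d t)) i) (sym (ℕₚ.+-comm d 1)))
          (trans (signed-enum upTo-level d 1 i) (trans (signed-prefix 0 {λ t → + length (level w t)} {λ t → + length (upTo-level t)} level-prefix i) (signed-zero (λ t → + length (level w t)) i)))))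
        where
        L≡ : ∀ t → L t ≡ length (enum upTo-level d t)
        L≡ t with count t
        ... | xs , len , u , mem = trans (sym len) (trans (ℕₚ.≤-antisym
                (unique-⊆-length u (λ {z} p → proj₂ (proj₂ (points-enumerate t) z) (proj₁ (mem z) p)))
                (unique-⊆-length (proj₁ (points-enumerate t)) (λ {z} p → proj₂ (mem z) (proj₁ (proj₂ (points-enumerate t) z) p))))
                (length-map point (enum upTo-level d t)))

      level-minus : ∀ i → i ℕ.≤ d → level (minus w) (d ℕ.∸ i) ≡ level w i
      level-minus i i≤d = filter-≐ (λ F → size (restriction (minus w) F) ℕ.≟ d ℕ.∸ i) (λ F → size (restriction w F) ℕ.≟ i)
        ((λ {F} e → to F e) , (λ {F} e → from F e)) (allFin N)
        where
        to : ∀ F → size (restriction (minus w) F) ≡ d ℕ.∸ i → size (restriction w F) ≡ i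
        to F e = ℕₚ.+-cancelˡ-≡ (d ℕ.∸ i) _ _ (trans (cong (ℕ._+ size (restriction w F)) (sym e)) (trans (size-complement w gen F) (sym (ℕₚ.m∸n+n≡m i≤d))))
        from : ∀ F → size (restriction w F) ≡ i → size (restriction (minus w) F) ≡ d ℕ.∸ i
        from F e = ℕₚ.+-cancelʳ-≡ i _ _ (trans (cong (size (restriction (minus w) F) ℕ.+_) (sym e)) (trans (size-complement w gen F) (sym (ℕₚ.m∸n+n≡m i≤d))))

    hstar-unimodal : ∀ L → (∀ t → Σ (List (Vec ℤ d)) λ xs → length xs ≡ L t × Enumerates t xs) → Unimodal d (hstar d L)
    hstar-unimodal L count = ⌊ d /2⌋ , ℕₚ.⌊n/2⌋≤n d , up , down
      where
      w = proj₁ (generic-near 𝟘)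
      gen = proj₁ (proj₂ (generic-near 𝟘))
      h≡ : ∀ i → hstar d L i ≡ + length (level w i)
      h≡ = hstar-level w gen L count
      mirror : ∀ i → i ℕ.≤ d → hstar d L i ≡ + length (level w (d ℕ.∸ i))
      mirror i i≤d = trans (hstar-level (minus w) (minus-generic w gen) L count i) (cong (+_ ∘ length)
        (trans (cong (level (minus w)) (sym (ℕₚ.m∸[m∸n]≡n i≤d))) (level-minus w gen (d ℕ.∸ i) (ℕₚ.m∸n≤m d i))))
      up : ∀ i → suc i ℕ.≤ ⌊ d /2⌋ → hstar d L i ℤ.≤ hstar d L (suc i)
      up i le = subst₂ ℤ._≤_ (sym (h≡ i)) (sym (h≡ (suc i))) (ℤ.+≤+ (lefschetz fan w gen i
        (ℕₚ.≤-trans (ℕₚ.+-mono-≤ le (ℕₚ.≤-trans (ℕₚ.≤-trans (ℕₚ.n≤1+n i) le) (ℕₚ.⌊n/2⌋≤⌈n/2⌉ d))) (ℕₚ.≤-reflexive (ℕₚ.⌊n/2⌋+⌈n/2⌉≡n d)))))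
      -- The mirror image of this step goes from e = d - i - 1 to e + 1. From e ≤ i follows 2e < d,
      -- so it lies in the range of `lefschetz`.
      down : ∀ i → ⌊ d /2⌋ ℕ.≤ i → suc i ℕ.≤ d → hstar d L (suc i) ℤ.≤ hstar d L i
      down i le i<d = subst₂ ℤ._≤_ (sym (mirror (suc i) i<d)) (sym (trans (mirror i (ℕₚ.<⇒≤ i<d)) (cong (λ k → + length (level w k)) (sym suc-e))))
          (ℤ.+≤+ (lefschetz fan w gen e (ℕₚ.≤-trans (ℕₚ.+-monoʳ-< e (s≤s e≤i)) (ℕₚ.≤-reflexive e+))))
        where
        e = d ℕ.∸ suc i
        e+ : e ℕ.+ suc i ≡ d
        e+ = ℕₚ.m∸n+n≡m i<d
        suc-e : suc e ≡ d ℕ.∸ i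
        suc-e = sym (ℕₚ.+-∸-assoc 1 i<d)
        d≤ : d ℕ.≤ i ℕ.+ suc i
        d≤ = ℕₚ.≤-trans (ℕₚ.≤-reflexive (sym (ℕₚ.⌊n/2⌋+⌈n/2⌉≡n d))) (ℕₚ.+-mono-≤ le (ℕₚ.≤-trans (⌈≤⌉ d) (s≤s le)))
          where
          ⌈≤⌉ : ∀ n → ⌈ n /2⌉ ℕ.≤ suc ⌊ n /2⌋
          ⌈≤⌉ zero = z≤n
          ⌈≤⌉ (suc zero) = s≤s z≤n
          ⌈≤⌉ (suc (suc n)) = s≤s (⌈≤⌉ n)
        e≤i : e ℕ.≤ i
        e≤i = ℕₚ.+-cancelʳ-≤ (suc i) e i (ℕₚ.≤-trans (ℕₚ.≤-reflexive e+) d≤)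

-- Pulling refines a subdivision with 0/1 walls to a unimodular regular fan

module PullingTriangulation where
  open import Data.Integer as ℤ using (ℤ; +_; 0ℤ; 1ℤ; _+_; _*_; -_; _-_; _≤_; _<_; ∣_∣)
  import Data.Integer.Properties as ℤₚ
  open import Data.Integer.Tactic.RingSolver using (solve-∀)
  open import Data.Fin using (_≟_; toℕ; fromℕ<; punchIn; combine; remQuot)
  open import Data.Fin.Properties as Finₚ using (any?; all?; punchInᵢ≢i; toℕ-fromℕ<; remQuot-combine)
  open import Data.Fin.Induction using (<-wellFounded)
  open import Data.Vec using (tabulate)
  open import Data.Vec.Properties using (lookup∘tabulate; ≡-dec; lookup-replicate)
  open import Data.List using (_++_; length; filter; concatMap; allFin)
  open import Data.List.Membership.Propositional using (_∈_; find; lose)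
  open import Data.List.Membership.Propositional.Properties using (∈-filter⁺; ∈-filter⁻; ∈-lookup; ∈-++⁺ˡ; ∈-++⁺ʳ; ∈-map⁺; ∈-concatMap⁺; ∈-allFin; ∈-tabulate⁺)
  open import Data.List.Relation.Unary.Any as Any using (Any; here; there; index)
  open import Data.List.Relation.Unary.Any.Properties using (lookup-index)
  open import Data.List.Relation.Unary.All as All using (All; []; _∷_)
  import Data.List.Relation.Unary.All.Properties as Allₚ
  import Data.List.Relation.Unary.Unique.Propositional.Properties as Uₚ
  open import Data.Empty using (⊥)
  import Induction.WellFounded as WF
  open import Relation.Nullary.Decidable using (_×-dec_; _→-dec_; ¬?; decidable-stable)
  open import Relation.Binary.Definitions using (Tri; tri<; tri≈; tri>)
  open import Relation.Binary.PropositionalEquality using (_≡_; _≢_; refl; sym; trans; cong; cong₂; subst; subst₂)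
  open IntegerVectors
  open Fans
  open Monomials using (lookup-unique)
  open Determinants

  LexPos : ∀ {m} → Vec ℤ m → Set
  LexPos [] = ⊥
  LexPos (x ∷ xs) = 0ℤ < x ⊎ (x ≡ 0ℤ × LexPos xs)

  -- The weights are built from the last coordinate backwards, each exceeding what the later
  -- coordinates contribute on any of the finitely many vectors.
  lex-weights : ∀ {m k} (x : Fin k → Vec ℤ m) → ∃ λ ρ → ∀ i → LexPos (x i) → 0ℤ < ρ ∙ x i
  lex-weights {zero} x = [] , λ i → absurd (x i)
    where
    absurd : (y : Vec ℤ 0) → LexPos y → 0ℤ < [] ∙ y
    absurd [] ()
  lex-weights {suc m} x = + K ∷ ρ , λ i → positive (x i) (bd i) (pos i)
    where
    rec = lex-weights (Vec.tail ∘ x)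
    ρ = proj₁ rec
    pos = proj₂ rec
    K = proj₁ (bounded (λ i → ∣ ρ ∙ Vec.tail (x i) ∣))
    bd = proj₂ (bounded (λ i → ∣ ρ ∙ Vec.tail (x i) ∣))
    positive : (y : Vec ℤ (suc m)) → ∣ ρ ∙ Vec.tail y ∣ ℕ.< K → (LexPos (Vec.tail y) → 0ℤ < ρ ∙ Vec.tail y) → LexPos y → 0ℤ < (+ K ∷ ρ) ∙ y
    positive (y ∷ ys) lt h (inj₁ y>0) = large K y (ρ ∙ ys) lt y>0
    positive (y ∷ ys) lt h (inj₂ (refl , p)) = subst (0ℤ <_) (sym (trans (cong (_+ ρ ∙ ys) (ℤₚ.*-zeroʳ (+ K))) (ℤₚ.+-identityˡ (ρ ∙ ys)))) (h p)

  lex-positive : ∀ {m} (e : Vec ℤ m) → (∀ l → (∀ l' → l' Fin.< l → lookup e l' ≡ 0ℤ) → 0ℤ ≤ lookup e l) → (∃ λ l → lookup e l ≢ 0ℤ) → LexPos e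
  lex-positive [] h (() , _)
  lex-positive (x ∷ e) h nz with x ℤ.≟ 0ℤ
  ... | no x≢0 = inj₁ (ℤₚ.≤∧≢⇒< (h zero (λ l' ())) (x≢0 ∘ sym))
  ... | yes x≡0 = inj₂ (x≡0 , lex-positive e (λ l p → h (suc l) (λ { zero _ → x≡0 ; (suc l') (s≤s lt) → p l' lt })) (nonzero nz))
    where
    nonzero : (∃ λ l → lookup (x ∷ e) l ≢ 0ℤ) → ∃ λ l → lookup e l ≢ 0ℤ
    nonzero (zero , ne) = contradiction x≡0 ne
    nonzero (suc l , ne) = l , ne

  argmin : ∀ {A : Set} {P : A → Set} (P? : ∀ x → Dec (P x)) (g : A → ℤ) (xs : List A) → (∃ λ x → x ∈ xs × P x) →
    ∃ λ x → x ∈ xs × P x × (∀ {y} → y ∈ xs → P y → g x ≤ g y)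
  argmin {A} {P} P? g (x ∷ xs) ex with Any.any? P? xs
  ... | no none = go ex
    where
    go : (∃ λ y → y ∈ x ∷ xs × P y) → _
    go (y , here refl , py) = y , here refl , py , λ { (here refl) _ → ℤₚ.≤-refl ; (there z∈) pz → contradiction (lose z∈ pz) none }
    go (y , there y∈ , py) = contradiction (lose y∈ py) none
  ... | yes some with argmin P? g xs (find some)
  ...   | m , m∈ , pm , least with P? x
  ...     | no npx = m , there m∈ , pm , λ { (here refl) px → contradiction px npx ; (there y∈) → least y∈ }
  ...     | yes px with g x ℤₚ.≤? g m
  ...       | yes le = x , here refl , px , λ { (here refl) _ → ℤₚ.≤-refl ; (there y∈) py → ℤₚ.≤-trans le (least y∈ py) }
  ...       | no gt = m , there m∈ , pm , λ { (here refl) _ → ℤₚ.<⇒≤ (ℤₚ.≰⇒> gt) ; (there y∈) → least y∈ }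

  -- A regular subdivision of a complete fan in which the wall functionals of a cell take the values 0
  -- and 1 on its rays; π q is the linear piece of the height function on the cell q.
  record Cells (d n : ℕ) : Set where
    field
      v : Fin n → Vec ℤ d
      height : Fin n → ℤ
      cells : ℕ
      π : Fin cells → Vec ℤ d
      walls : Fin cells → List (Vec ℤ d)
      π-le : ∀ q k → π q ∙ v k ≤ height k
      wall-01 : ∀ q k → π q ∙ v k ≡ height k → ∀ {μ} → μ ∈ walls q → μ ∙ v k ≡ 0ℤ ⊎ μ ∙ v k ≡ 1ℤ
      wall-1 : ∀ q k → π q ∙ v k ≡ height k → ∃ λ μ → μ ∈ walls q × μ ∙ v k ≡ 1ℤ
      covers : ∀ z → ∃ λ q → ∀ {μ} → μ ∈ walls q → 0ℤ ≤ μ ∙ z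
      progress : ∀ q z → z ≢ 𝟘 → (∀ {μ} → μ ∈ walls q → 0ℤ ≤ μ ∙ z) →
        ∃ λ k → π q ∙ v k ≡ height k × (∀ {μ} → μ ∈ walls q → μ ∙ z ≡ 0ℤ → μ ∙ v k ≡ 0ℤ)

  -- Pulling: subtract from x the largest possible multiple of each v k in turn.
  module Greedy {d : ℕ} (M : List (Vec ℤ d)) where

    Closed : Vec ℤ d → Set
    Closed x = ∀ {μ} → μ ∈ M → 0ℤ ≤ μ ∙ x

    record Pulled {n : ℕ} (v : Fin n → Vec ℤ d) (I : Fin n → Set) (x : Vec ℤ d) : Set where
      field
        y : Fin n → ℤ
        rest : Vec ℤ d
        decomposition : ∀ u → u ∙ x ≡ ∑ (λ k → y k * (u ∙ v k)) + u ∙ rest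
        y≥0 : ∀ k → 0ℤ ≤ y k
        y-in : ∀ k → y k ≢ 0ℤ → I k
        closed : Closed rest
        tight : ∀ k → I k → ∃ λ μ → μ ∈ M × μ ∙ v k ≡ 1ℤ × μ ∙ rest ≡ 0ℤ × (∀ l → k Fin.< l → y l ≢ 0ℤ → μ ∙ v l ≡ 0ℤ)

    pull : ∀ {n} (v : Fin n → Vec ℤ d) (I : Fin n → Set) → (∀ k → Dec (I k)) →
      (∀ k → I k → ∀ {μ} → μ ∈ M → μ ∙ v k ≡ 0ℤ ⊎ μ ∙ v k ≡ 1ℤ) → (∀ k → I k → ∃ λ μ → μ ∈ M × μ ∙ v k ≡ 1ℤ) →
      ∀ x → Closed x → Pulled v I x
    pull {zero} v I I? w01 w1 x cl = record
      { y = λ () ; rest = x ; decomposition = λ u → sym (trans (cong (_+ u ∙ x) (∑ℤ.sum-nil _)) (ℤₚ.+-identityˡ _))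
      ; y≥0 = λ () ; y-in = λ () ; closed = cl ; tight = λ () }
    pull {suc n} v I I? w01 w1 x cl with I? zero
    ... | no n0 = record
      { y = y' ; rest = P.rest
      ; decomposition = λ u → trans (P.decomposition u) (cong (_+ u ∙ P.rest) (sym (trans (∑ℤ.sum-suc (λ k → y' k * (u ∙ v k))) (ℤₚ.+-identityˡ (∑ (λ k → P.y k * (u ∙ v (suc k))))))))
      ; y≥0 = λ { zero → ℤₚ.≤-refl ; (suc k) → P.y≥0 k }
      ; y-in = λ { zero ne → contradiction refl ne ; (suc k) → P.y-in k }
      ; closed = P.closed
      ; tight = λ { zero i0 → contradiction i0 n0
                  ; (suc k) ik → let μ , μ∈ , e , r , later = P.tight k ik in μ , μ∈ , e , r , λ { zero () ; (suc l) (s≤s lt) → later l lt } } }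
      where
      module P = Pulled (pull (v ∘ suc) (I ∘ suc) (I? ∘ suc) (w01 ∘ suc) (w1 ∘ suc) x cl)
      y' : Fin (suc n) → ℤ
      y' zero = 0ℤ
      y' (suc k) = P.y k
    ... | yes i0 = record
      { y = y' ; rest = P.rest
      ; decomposition = λ u → trans (split u) (cong (_+ u ∙ P.rest) (sym (∑ℤ.sum-suc (λ k → y' k * (u ∙ v k)))))
      ; y≥0 = λ { zero → cl μ∈ ; (suc k) → P.y≥0 k }
      ; y-in = λ { zero _ → i0 ; (suc k) → P.y-in k }
      ; closed = P.closed
      ; tight = λ { zero _ → μ , μ∈ , μ1 , zero-rest , λ { zero () ; (suc l) _ → zero-later l }
                  ; (suc k) ik → let μ , μ∈ , e , r , later = P.tight k ik in μ , μ∈ , e , r , λ { zero () ; (suc l) (s≤s lt) → later l lt } } }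
      where
      -- Among the walls with value 1 on `v zero`, the one smallest on `x` limits the multiple that
      -- can be subtracted; walls with value 0 do not change.
      am = argmin (λ μ → μ ∙ v zero ℤ.≟ 1ℤ) (_∙ x) M (w1 zero i0)
      μ = proj₁ am
      μ∈ = proj₁ (proj₂ am)
      μ1 = proj₁ (proj₂ (proj₂ am))
      t : ℤ
      t = μ ∙ x
      x₁ : Vec ℤ d
      x₁ = x ⊞ ((- t) ⊡ v zero)
      eq₁ : ∀ u → u ∙ x₁ ≡ u ∙ x - t * (u ∙ v zero)
      eq₁ u = trans (∙-⊞ u x _) (cong (λ s → u ∙ x + s) (trans (∙-⊡ u (- t) (v zero)) (sym (ℤₚ.neg-distribˡ-* t (u ∙ v zero)))))
      cl₁ : Closed x₁
      cl₁ {ν} ν∈ with w01 zero i0 ν∈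
      ... | inj₁ e = subst (0ℤ ≤_) (sym (trans (eq₁ ν) (trans (cong (λ s → ν ∙ x - t * s) e) (trans (cong (λ s → ν ∙ x - s) (ℤₚ.*-zeroʳ t)) (ℤₚ.+-identityʳ (ν ∙ x)))))) (cl ν∈)
      ... | inj₂ e = subst (0ℤ ≤_) (sym (trans (eq₁ ν) (cong (λ s → ν ∙ x - s) (trans (cong (t *_) e) (ℤₚ.*-identityʳ t))))) (ℤₚ.i≤j⇒0≤j-i (proj₂ (proj₂ (proj₂ am)) ν∈ e))
      module P = Pulled (pull (v ∘ suc) (I ∘ suc) (I? ∘ suc) (w01 ∘ suc) (w1 ∘ suc) x₁ cl₁)
      y' : Fin (suc n) → ℤ
      y' zero = t
      y' (suc k) = P.y k
      split : ∀ u → u ∙ x ≡ t * (u ∙ v zero) + ∑ (λ k → P.y k * (u ∙ v (suc k))) + u ∙ P.rest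
      split u = trans (lemma (u ∙ x) (t * (u ∙ v zero))) (trans (cong (λ s → t * (u ∙ v zero) + s) (trans (sym (eq₁ u)) (P.decomposition u))) (sym (ℤₚ.+-assoc (t * (u ∙ v zero)) _ _)))
        where lemma : ∀ a b → a ≡ b + (a - b)
              lemma = solve-∀
      -- The limiting wall is zero on `x₁` and nonnegative on every part of its decomposition, so it
      -- vanishes on `rest` and on each later ray in use.
      total : ∑ (λ k → P.y k * (μ ∙ v (suc k))) + μ ∙ P.rest ≡ 0ℤ
      total = trans (sym (P.decomposition μ)) (trans (eq₁ μ) (trans (cong (λ s → t - t * s) μ1) (trans (cong (λ s → t - s) (ℤₚ.*-identityʳ t)) (ℤₚ.+-inverseʳ t))))
      terms≥0 : ∀ k → 0ℤ ≤ P.y k * (μ ∙ v (suc k))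
      terms≥0 k with P.y k ℤ.≟ 0ℤ
      ... | yes e = ℤₚ.≤-reflexive (sym (trans (cong (_* (μ ∙ v (suc k))) e) refl))
      ... | no ne with w01 (suc k) (P.y-in k ne) μ∈
      ...   | inj₁ e = ℤₚ.≤-reflexive (sym (trans (cong (P.y k *_) e) (ℤₚ.*-zeroʳ (P.y k))))
      ...   | inj₂ e = subst (0ℤ ≤_) (sym (trans (cong (P.y k *_) e) (ℤₚ.*-identityʳ (P.y k)))) (P.y≥0 k)
      sum≤0 : ∑ (λ k → P.y k * (μ ∙ v (suc k))) ≤ 0ℤ
      sum≤0 = subst₂ _≤_ (ℤₚ.+-identityʳ _) total (ℤₚ.+-monoʳ-≤ (∑ (λ k → P.y k * (μ ∙ v (suc k)))) (P.closed μ∈))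
      zero-rest : μ ∙ P.rest ≡ 0ℤ
      zero-rest = ℤₚ.≤-antisym (subst₂ _≤_ (ℤₚ.+-identityˡ _) total (ℤₚ.+-monoˡ-≤ (μ ∙ P.rest) (∑-nonneg terms≥0))) (P.closed μ∈)
      zero-later : ∀ l → P.y l ≢ 0ℤ → μ ∙ v (suc l) ≡ 0ℤ
      zero-later l ne with ℤₚ.i*j≡0⇒i≡0∨j≡0 (P.y l) (∑-zero-terms terms≥0 sum≤0 l)
      ... | inj₁ e = contradiction e ne
      ... | inj₂ e = e

  ∣-sum : ∀ {k m} {t : Fin k → ℤ} → (∀ j → m ∣ t j) → m ∣ ∑ t
  ∣-sum {m = m} {t} h = ∑ (λ j → proj₁ (h j)) , trans (∑ℤ.sum-cong (λ j → proj₂ (h j))) (sym (∑ℤ.sum-*ʳ m (λ j → proj₁ (h j))))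

  ∣-isolate : ∀ {r m} (t : Fin r → ℤ) i → m ∣ ∑ t → (∀ j → j ≢ i → m ∣ t j) → m ∣ t i
  ∣-isolate {suc r} {m} t i (s , e) h = s - proj₁ others , trans (lemma (t i) (∑ (t ∘ punchIn i)))
      (trans (cong₂ _-_ (trans (sym (∑ℤ.sum-remove t i)) e) (proj₂ others)) (sym (distrib s (proj₁ others) m)))
    where
    others = ∣-sum {t = t ∘ punchIn i} (λ j → h (punchIn i j) (punchInᵢ≢i i j))
    lemma : ∀ a b → a ≡ a + b - b
    lemma = solve-∀
    distrib : ∀ a b c → (a - b) * c ≡ a * c - b * c
    distrib = solve-∀

  comb≡𝟘 : ∀ {k d} (α : Fin k → ℤ) (b : Fin k → Vec ℤ d) → (∀ i → ∑ (λ j → lookup (b j) i * α j) ≡ 0ℤ) → comb α b ≡ 𝟘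
  comb≡𝟘 α b h = lookup-ext λ i → trans (sym (unit-∙ i (comb α b))) (trans (∙-comb (unit i) α b)
    (trans (∑ℤ.sum-cong (λ j → trans (cong (α j *_) (unit-∙ i (b j))) (ℤₚ.*-comm (α j) (lookup (b j) i)))) (trans (h i) (sym (lookup-replicate i 0ℤ)))))

  module Triangulate {d n : ℕ} (C : Cells d n) where
    open Cells C

    InCell : Fin cells → Fin n → Set
    InCell q k = π q ∙ v k ≡ height k

    -- The certificate of a simplex of the pulling triangulation: v k is separated by a wall from the later vertices.
    Cert : Fin cells → ∀ {r} → Sub r n → Set
    Cert q A = (∀ i → InCell q (ι A i)) ×
      (∀ k → InCell q k → Any (λ μ → μ ∙ v k ≡ 1ℤ × (∀ j → k Fin.< ι A j → μ ∙ v (ι A j) ≡ 0ℤ)) (walls q))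

    Cert? : ∀ q {r} (A : Sub r n) → Dec (Cert q A)
    Cert? q A = all? (λ i → π q ∙ v (ι A i) ℤ.≟ height (ι A i)) ×-dec
      all? (λ k → (π q ∙ v k ℤ.≟ height k) →-dec Any.any? (λ μ → (μ ∙ v k ℤ.≟ 1ℤ) ×-dec all? (λ j → (k Fin.<? ι A j) →-dec (μ ∙ v (ι A j) ℤ.≟ 0ℤ))) (walls q))

    -- By induction along the order of the rays: the wall of `ι A i` is 1 there and 0 on later
    -- vertices, while the coefficients of earlier vertices are already divisible. The modulus 0
    -- gives linear independence, a nonzero modulus integrality of coordinates.
    triangular : ∀ {r} (A : Sub r n) q → Cert q A → ∀ (α : Fin r → ℤ) m → (∀ u → m ∣ (u ∙ comb α (v ∘ ι A))) → ∀ i → m ∣ α i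
    triangular A q (incell , cert) α m div i = WF.All.wfRec <-wellFounded _ (λ k → ∀ i → ι A i ≡ k → m ∣ α i) step (ι A i) i refl
      where
      step : ∀ k → (∀ {k'} → k' Fin.< k → ∀ i → ι A i ≡ k' → m ∣ α i) → ∀ i → ι A i ≡ k → m ∣ α i
      step _ IH i refl with find (cert (ι A i) (incell i))
      ... | μ , _ , μ1 , μ0 = subst (m ∣_) (trans (cong (α i *_) μ1) (ℤₚ.*-identityʳ (α i)))
              (∣-isolate (λ j → α j * (μ ∙ v (ι A j))) i (subst (m ∣_) (∙-comb μ α (v ∘ ι A)) (div μ)) others)
        where
        others : ∀ j → j ≢ i → m ∣ (α j * (μ ∙ v (ι A j)))
        others j ne with Finₚ.<-cmp (ι A j) (ι A i)
        ... | tri≈ _ e _ = contradiction (ι-injective A e) ne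
        ... | tri> _ _ gt = 0ℤ , trans (cong (α j *_) (μ0 j gt)) (ℤₚ.*-zeroʳ (α j))
        ... | tri< lt _ _ with IH lt j refl
        ...   | t , e = t * (μ ∙ v (ι A j)) , trans (cong (_* (μ ∙ v (ι A j))) e) (lemma t m (μ ∙ v (ι A j)))
          where lemma : ∀ a b c → a * b * c ≡ a * c * b
                lemma = solve-∀

    independent : ∀ {r} (A : Sub r n) q → Cert q A → ∀ (α : Fin r → ℤ) → comb α (v ∘ ι A) ≡ 𝟘 → ∀ i → α i ≡ 0ℤ
    independent A q cert α e i = let t , eq = triangular A q cert α 0ℤ (λ u → 0ℤ , trans (cong (u ∙_) e) (∙-𝟘 u)) i in trans eq (ℤₚ.*-zeroʳ t)

    size-bound : ∀ {r} (A : Sub r n) q → Cert q A → r ℕ.≤ d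
    size-bound {r} A q cert = ℕₚ.≮⇒≥ λ lt → go (∑ℤ.wide-kernel lt (λ i j → lookup (v (ι A j)) i))
      where
      go : (Σ (Fin r → ℤ) λ α → (∃ λ j → α j ≢ 0ℤ) × (∀ i → ∑ (λ j → lookup (v (ι A j)) i * α j) ≡ 0ℤ)) → ⊥
      go (α , (j , nz) , eqs) = nz (independent A q cert α (comb≡𝟘 α (v ∘ ι A) eqs) j)

    -- The d + 1 vectors `z` and `v (ι A j)` satisfy an integer relation. Its coefficient at `z` is
    -- nonzero by independence and divides the others by `triangular`.
    coordinates : (A : Sub d n) → ∀ q → Cert q A → ∀ z → Σ (Fin d → ℤ) λ t → comb t (v ∘ ι A) ≡ z
    coordinates A q cert z = go (∑ℤ.wide-kernel (ℕₚ.n<1+n d) (λ i j → lookup (b j) i))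
      where
      b : Fin (suc d) → Vec ℤ d
      b zero = z
      b (suc j) = v (ι A j)
      go : (Σ (Fin (suc d) → ℤ) λ x → (∃ λ j → x j ≢ 0ℤ) × (∀ i → ∑ (λ j → lookup (b j) i * x j) ≡ 0ℤ)) → _
      go (x , (j₁ , nz) , eqs) = (λ j → - t j) , ∙-ext same
        where
        relation : ∀ u → x zero * (u ∙ z) + ∑ (λ j → x (suc j) * (u ∙ v (ι A j))) ≡ 0ℤ
        relation u = trans (sym (∑ℤ.sum-suc (λ j → x j * (u ∙ b j)))) (trans (sym (∙-comb u x b)) (trans (cong (u ∙_) (comb≡𝟘 x b eqs)) (∙-𝟘 u)))
        move : ∀ {p s} → p + s ≡ 0ℤ → s ≡ - p
        move {p} {s} e = trans (lemma p s) (trans (cong (_- p) e) (ℤₚ.+-identityˡ (- p)))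
          where lemma : ∀ p s → s ≡ p + s - p
                lemma = solve-∀
        x₀≢0 : x zero ≢ 0ℤ
        x₀≢0 e = nz (all-zero j₁)
          where
          comb0 : comb (x ∘ suc) (v ∘ ι A) ≡ 𝟘
          comb0 = ∙-ext λ u → trans (∙-comb u (x ∘ suc) (v ∘ ι A)) (trans (move (relation u)) (trans (cong (λ s → - (s * (u ∙ z))) e) (sym (∙-𝟘 u))))
          all-zero : ∀ j → x j ≡ 0ℤ
          all-zero zero = e
          all-zero (suc j) = independent A q cert (x ∘ suc) comb0 j
        div : ∀ j → x zero ∣ x (suc j)
        div = triangular A q cert (x ∘ suc) (x zero) λ u → - (u ∙ z) ,
          trans (∙-comb u (x ∘ suc) (v ∘ ι A)) (trans (move (relation u)) (lemma (x zero) (u ∙ z)))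
          where lemma : ∀ a b → - (a * b) ≡ - b * a
                lemma = solve-∀
        t : Fin d → ℤ
        t j = proj₁ (div j)
        same : ∀ u → u ∙ comb (λ j → - t j) (v ∘ ι A) ≡ u ∙ z
        same u = trans (trans (∙-comb u (λ j → - t j) (v ∘ ι A)) (trans (∑ℤ.sum-cong (λ j → sym (ℤₚ.neg-distribˡ-* (t j) (u ∙ v (ι A j))))) (∑-neg (λ j → t j * (u ∙ v (ι A j))))))
            (sym (cancel (ℤₚ.i*j≡0⇒i≡0∨j≡0 (x zero) factored)))
          where
          S : ℤ
          S = ∑ (λ j → t j * (u ∙ v (ι A j)))
          factored : x zero * (u ∙ z + S) ≡ 0ℤ
          factored = trans (ℤₚ.*-distribˡ-+ (x zero) (u ∙ z) S) (trans (cong (λ s → x zero * (u ∙ z) + s) (trans (∑ℤ.sum-*ˡ (x zero) (λ j → t j * (u ∙ v (ι A j))))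
            (∑ℤ.sum-cong (λ j → trans (lemma (x zero) (t j) (u ∙ v (ι A j))) (cong (_* (u ∙ v (ι A j))) (sym (proj₂ (div j)))))))) (relation u))
            where lemma : ∀ a b c → a * (b * c) ≡ b * a * c
                  lemma = solve-∀
          cancel : x zero ≡ 0ℤ ⊎ u ∙ z + S ≡ 0ℤ → u ∙ z ≡ - S
          cancel (inj₁ e) = contradiction e x₀≢0
          cancel (inj₂ e) = move (trans (ℤₚ.+-comm S (u ∙ z)) e)

    Dual : Sub d n → Set
    Dual A = Σ (Fin d → Vec ℤ d) λ c → (∀ j → c j ∙ v (ι A j) ≡ 1ℤ) × (∀ {i j} → i ≢ j → c i ∙ v (ι A j) ≡ 0ℤ) ×
      (∀ z → comb (λ j → c j ∙ z) (v ∘ ι A) ≡ z)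

    -- The inverse of the vertex matrix, assembled from the integer coordinates of the unit vectors;
    -- `independent` shows that it is also an inverse on the other side.
    dual′ : (A : Sub d n) → ∀ q → Cert q A → Dual A
    dual′ A q cert = c , (λ j → trans (δ-eq j j) (lookup-unit-same j)) , (λ {i} {j} ne → trans (δ-eq i j) (lookup-unit-other ne)) , span
      where
      γ : Fin d → Fin d → ℤ
      γ k = proj₁ (coordinates A q cert (unit k))
      c : Fin d → Vec ℤ d
      c j = tabulate (λ k → γ k j)
      span : ∀ z → comb (λ j → c j ∙ z) (v ∘ ι A) ≡ z
      span z = ∙-ext λ u → trans (∙-comb u (λ j → c j ∙ z) (v ∘ ι A))
        (trans (∑ℤ.sum-cong (λ j → trans (cong (_* (u ∙ v (ι A j))) (∙-tabulate (λ k → γ k j) z)) (∑ℤ.sum-*ʳ (u ∙ v (ι A j)) (λ k → γ k j * lookup z k))))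
        (trans (∑ℤ.sum-comm (λ j k → γ k j * lookup z k * (u ∙ v (ι A j))))
        (trans (∑ℤ.sum-cong (λ k → trans (∑ℤ.sum-cong (λ j → lemma (γ k j) (lookup z k) (u ∙ v (ι A j)))) (trans (sym (∑ℤ.sum-*ˡ (lookup z k) (λ j → γ k j * (u ∙ v (ι A j)))))
          (cong (lookup z k *_) (trans (sym (∙-comb u (γ k) (v ∘ ι A))) (cong (u ∙_) (proj₂ (coordinates A q cert (unit k)))))))))
        (trans (sym (∙-comb u (lookup z) unit)) (cong (u ∙_) (comb-units z))))))
        where lemma : ∀ a b c → a * b * c ≡ b * (a * c)
              lemma = solve-∀
      δ : Fin d → Fin d → ℤ
      δ i j = lookup (unit i) j
      δ-eq : ∀ i j → c i ∙ v (ι A j) ≡ δ i j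
      δ-eq i j = ℤₚ.i-j≡0⇒i≡j _ _ (independent A q cert (λ i → c i ∙ v (ι A j) - δ i j) (∙-ext λ u →
        trans (∙-comb u (λ i → c i ∙ v (ι A j) - δ i j) (v ∘ ι A)) (trans (∑ℤ.sum-cong (λ i → distrib (c i ∙ v (ι A j)) (δ i j) (u ∙ v (ι A i))))
        (trans (∑-sub (λ i → (c i ∙ v (ι A j)) * (u ∙ v (ι A i))) (λ i → δ i j * (u ∙ v (ι A i)))) (trans (cong₂ _-_ (trans (sym (∙-comb u (λ i → c i ∙ v (ι A j)) (v ∘ ι A))) (cong (u ∙_) (span (v (ι A j)))))
          (trans (∑ℤ.sum-single (λ i → δ i j * (u ∙ v (ι A i))) j (λ i ne → trans (cong (_* (u ∙ v (ι A i))) (lookup-unit-other ne)) refl)) (trans (cong (_* (u ∙ v (ι A j))) (lookup-unit-same j)) (ℤₚ.*-identityˡ _))))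
          (trans (ℤₚ.+-inverseʳ (u ∙ v (ι A j))) (sym (∙-𝟘 u))))))) i)
        where distrib : ∀ a b c → (a - b) * c ≡ a * c - b * c
              distrib = solve-∀

    abstract
      dual : (A : Sub d n) → ∀ q → Cert q A → Dual A
      dual = dual′

    IsFacet : Sub d n → Set
    IsFacet A = ∃ λ q → Cert q A

    IsFacet? : ∀ A → Dec (IsFacet A)
    IsFacet? A = any? (λ q → Cert? q A)

    facets : List (Sub d n)
    facets = filter IsFacet? (allSub d n)

    facet : Fin (length facets) → Sub d n
    facet = List.lookup facets

    isFacet : ∀ F → IsFacet (facet F)
    isFacet F = proj₂ (∈-filter⁻ IsFacet? {xs = allSub d n} (∈-lookup {xs = facets} F))

    cell : Fin (length facets) → Fin cells
    cell F = proj₁ (isFacet F)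

    dualOf : ∀ F → Dual (facet F)
    dualOf F = dual (facet F) (cell F) (proj₂ (isFacet F))

    c : Fin (length facets) → Fin d → Vec ℤ d
    c F = proj₁ (dualOf F)

    f : Fin (length facets) → Fin d → Fin n
    f F = ι (facet F)

    f-set : ∀ {F F'} → (∀ j → ∃ λ i → f F' i ≡ f F j) → F ≡ F'
    f-set {F} {F'} h = lookup-unique (Uₚ.filter⁺ IsFacet? (allSub-unique d n)) F F' (⊑-antisym (facet F) (facet F') h)

    c≢𝟘 : ∀ F j → c F j ≢ 𝟘
    c≢𝟘 F j e with trans (sym (proj₁ (proj₂ (dualOf F)) j)) (trans (cong (_∙ v (f F j)) e) (𝟘-∙ (v (f F j))))
    ... | ()

    annihilator : ∀ {r} → r ℕ.< d → (A : Sub r n) → ∃ λ u → u ≢ 𝟘 × (∀ i → u ∙ v (ι A i) ≡ 0ℤ)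
    annihilator {r} lt A = go (∑ℤ.wide-kernel lt (λ i k → lookup (v (ι A i)) k))
      where
      go : (Σ (Fin d → ℤ) λ x → (∃ λ j → x j ≢ 0ℤ) × (∀ i → ∑ (λ j → lookup (v (ι A i)) j * x j) ≡ 0ℤ)) → _
      go (x , (j , nz) , eqs) = tabulate x , (λ e → nz (trans (sym (lookup∘tabulate x j)) (trans (cong (λ t → lookup t j) e) (lookup-replicate j 0ℤ)))) ,
        λ i → trans (∙-tabulate x (v (ι A i))) (trans (∑ℤ.sum-cong (λ j → ℤₚ.*-comm (x j) (lookup (v (ι A i)) j))) (eqs i))

    annihilators : Fin d → List (Vec ℤ d)
    annihilators r = List.map (λ A → proj₁ (annihilator (Finₚ.toℕ<n r) A)) (allSub (toℕ r) n)

    -- A vector on which none of these vanishes lies in the interior of a simplicial cone.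
    tests : List (Vec ℤ d)
    tests = concatMap (λ F → List.tabulate (c F)) (allFin (length facets)) ++ concatMap annihilators (allFin d)

    tests≢𝟘 : ∀ i → List.lookup tests i ≢ 𝟘
    tests≢𝟘 i = All.lookup {P = _≢ 𝟘} (Allₚ.++⁺ (Allₚ.concat⁺ (Allₚ.map⁺ (All.universal (λ F → Allₚ.tabulate⁺ (c≢𝟘 F)) (allFin (length facets)))))
      (Allₚ.concat⁺ (Allₚ.map⁺ (All.universal (λ r → Allₚ.map⁺ (All.universal (λ A → proj₁ (proj₂ (annihilator (Finₚ.toℕ<n r) A))) (allSub (toℕ r) n))) (allFin d)))))
      (∈-lookup {xs = tests} i)

    ∈-tests-c : ∀ F j → c F j ∈ tests
    ∈-tests-c F j = ∈-++⁺ˡ (∈-concatMap⁺ (λ F → List.tabulate (c F)) (lose (∈-allFin F) (∈-tabulate⁺ j)))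

    tests-annihilate : ∀ {r} → r ℕ.< d → (A : Sub r n) → ∃ λ u → u ∈ tests × (∀ i → u ∙ v (ι A i) ≡ 0ℤ)
    tests-annihilate {r} lt A = go (fromℕ< lt) (toℕ-fromℕ< lt) A
      where
      go : ∀ (s : Fin d) {r} → toℕ s ≡ r → (A : Sub r n) → ∃ λ u → u ∈ tests × (∀ i → u ∙ v (ι A i) ≡ 0ℤ)
      go s refl A = proj₁ (annihilator (Finₚ.toℕ<n s) A) ,
        ∈-++⁺ʳ (concatMap (λ F → List.tabulate (c F)) (allFin (length facets))) (∈-concatMap⁺ annihilators (lose (∈-allFin s) (∈-map⁺ (λ A → proj₁ (annihilator (Finₚ.toℕ<n s) A)) (∈-allSub A)))) ,
        proj₂ (proj₂ (annihilator (Finₚ.toℕ<n s) A))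

    InCell? : ∀ q k → Dec (InCell q k)
    InCell? q k = π q ∙ v k ℤ.≟ height k

    record Decomposed (q : Fin cells) (w : Vec ℤ d) : Set where
      field
        y : Fin n → ℤ
        w≡ : ∀ u → u ∙ w ≡ ∑ (λ k → y k * (u ∙ v k))
        y≥0 : ∀ k → 0ℤ ≤ y k
        y-in : ∀ k → y k ≢ 0ℤ → InCell q k
        tight : ∀ k → InCell q k → ∃ λ μ → μ ∈ walls q × μ ∙ v k ≡ 1ℤ × (∀ l → k Fin.< l → y l ≢ 0ℤ → μ ∙ v l ≡ 0ℤ)

    decomposed : ∀ q w → (∀ {μ} → μ ∈ walls q → 0ℤ ≤ μ ∙ w) → Decomposed q w
    decomposed q w closed = finish (Greedy.pull (walls q) v (InCell q) (InCell? q) (wall-01 q) (wall-1 q) w closed)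
      where
      finish : Greedy.Pulled (walls q) v (InCell q) w → Decomposed q w
      finish P = record { y = P.y ; w≡ = w≡ ; y≥0 = P.y≥0 ; y-in = P.y-in
                        ; tight = λ k ink → let μ , μ∈ , μ1 , _ , later = P.tight k ink in μ , μ∈ , μ1 , later }
        where
        module P = Greedy.Pulled P
        contra : (∃ λ k → InCell q k × (∀ {μ} → μ ∈ walls q → μ ∙ P.rest ≡ 0ℤ → μ ∙ v k ≡ 0ℤ)) → ⊥
        contra (k , ink , zero-on) = let μ , μ∈ , μ1 , μr , _ = P.tight k ink in contradiction (trans (sym μ1) (zero-on μ∈ μr)) λ ()
        rest≡𝟘 : P.rest ≡ 𝟘
        rest≡𝟘 = decidable-stable (≡-dec ℤ._≟_ P.rest 𝟘) λ ne → contra (progress q P.rest ne P.closed)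
        w≡ : ∀ u → u ∙ w ≡ ∑ (λ k → P.y k * (u ∙ v k))
        w≡ u = trans (P.decomposition u) (trans (cong (λ s → ∑ (λ k → P.y k * (u ∙ v k)) + s) (trans (cong (u ∙_) rest≡𝟘) (∙-𝟘 u))) (ℤₚ.+-identityʳ _))

    Carried : (Fin n → ℤ) → ∀ {r} → (Fin r → Fin n) → Set
    Carried y g = ∀ k → y k ≢ 0ℤ → ∃ λ i → g i ≡ k

    pairing-zero : ∀ (y : Fin n → ℤ) {r} (g : Fin r → Fin n) u → Carried y g → (∀ i → u ∙ v (g i) ≡ 0ℤ) → ∑ (λ k → y k * (u ∙ v k)) ≡ 0ℤ
    pairing-zero y g u carried zero-on = ∑ℤ.sum-zero vanish
      where
      vanish : ∀ k → y k * (u ∙ v k) ≡ 0ℤ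
      vanish k with y k ℤ.≟ 0ℤ
      ... | yes e = trans (cong (_* (u ∙ v k)) e) refl
      ... | no ne with carried k ne
      ...   | i , refl = trans (cong (y k *_) (zero-on i)) (ℤₚ.*-zeroʳ (y k))

    pairing-coefficient : ∀ (y : Fin n → ℤ) F → Carried y (f F) → ∀ j → ∑ (λ k → y k * (c F j ∙ v k)) ≡ y (f F j)
    pairing-coefficient y F carried j = trans (∑ℤ.sum-single (λ k → y k * (c F j ∙ v k)) (f F j) others)
        (trans (cong (y (f F j) *_) (proj₁ (proj₂ (dualOf F)) j)) (ℤₚ.*-identityʳ _))
      where
      others : ∀ k → k ≢ f F j → y k * (c F j ∙ v k) ≡ 0ℤ
      others k ne with y k ℤ.≟ 0ℤ
      ... | yes e = trans (cong (_* (c F j ∙ v k)) e) refl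
      ... | no nz with carried k nz
      ...   | i , refl = trans (cong (y k *_) (proj₁ (proj₂ (proj₂ (dualOf F))) (λ e → ne (cong (f F) (sym e))))) (ℤₚ.*-zeroʳ (y k))

    -- The support of the pulled coefficients has a certificate by `tight`, so its size is at most
    -- d. If it were smaller, some test functional would vanish on it and therefore on `w`.
    carrier : ∀ q w (D : Decomposed q w) → (∀ {u} → u ∈ tests → u ∙ w ≢ 0ℤ) → ∃ λ F → Carried (Decomposed.y D) (f F)
    carrier q w D gen = go (support (λ k → ¬? (D.y k ℤ.≟ 0ℤ)))
      where
      module D = Decomposed D
      found : ∀ {r} (A : Sub r n) → r ≡ d → Cert q A → Carried D.y (ι A) → ∃ λ F → Carried D.y (f F)
      found A refl cert comp = index A∈ , λ k ne → let i , e = comp k ne in i , trans (cong (λ B → ι B i) (sym (lookup-index A∈))) e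
        where
        A∈ : A ∈ facets
        A∈ = ∈-filter⁺ IsFacet? (∈-allSub A) (q , cert)
      go : (∃ λ r → Σ (Sub r n) λ A → (∀ i → D.y (ι A i) ≢ 0ℤ) × (∀ k → D.y k ≢ 0ℤ → ∃ λ i → ι A i ≡ k)) → ∃ λ F → Carried D.y (f F)
      go (r , A , sound , complete) = found A (ℕₚ.≤-antisym (size-bound A q cert) (ℕₚ.≮⇒≥ not-small)) cert complete
        where
        cert : Cert q A
        cert = (λ i → D.y-in (ι A i) (sound i)) , λ k ink → let μ , μ∈ , μ1 , later = D.tight k ink in
          lose μ∈ (μ1 , λ j lt → later (ι A j) lt (sound j))
        not-small : ¬ r ℕ.< d
        not-small lt = let u , u∈ , zero-on = tests-annihilate lt A in
          gen u∈ (trans (D.w≡ u) (pairing-zero D.y (ι A) u complete zero-on))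

    -- A generic `w` near `z` is carried by a facet with nonnegative coefficients. A functional of
    -- that facet negative on `z` would be negative on `w` too.
    cover′ : ∀ z → ∃ λ F → ∀ j → 0ℤ ≤ c F j ∙ z
    cover′ z = go (generic (List.lookup tests) tests≢𝟘 z)
      where
      go : (∃ λ w → ∀ i → List.lookup tests i ∙ w ≢ 0ℤ × (0ℤ < List.lookup tests i ∙ z → 0ℤ < List.lookup tests i ∙ w) ×
        (List.lookup tests i ∙ z < 0ℤ → List.lookup tests i ∙ w < 0ℤ)) → ∃ λ F → ∀ j → 0ℤ ≤ c F j ∙ z
      go (w , prop) = finish (proj₁ (covers w)) (decomposed (proj₁ (covers w)) w (proj₂ (covers w)))
        where
        finish : ∀ q → Decomposed q w → ∃ λ F → ∀ j → 0ℤ ≤ c F j ∙ z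
        finish q D = found (carrier q w D (λ {u} u∈ → subst (λ u → u ∙ w ≢ 0ℤ) (sym (lookup-index u∈)) (proj₁ (prop (index u∈)))))
          where
          found : (∃ λ F → Carried (Decomposed.y D) (f F)) → ∃ λ F → ∀ j → 0ℤ ≤ c F j ∙ z
          found (F , carried) = F , λ j → ≮0⇒0≤ λ lt → ℤₚ.≤⇒≯
            (subst (0ℤ ≤_) (sym (trans (Decomposed.w≡ D (c F j)) (pairing-coefficient (Decomposed.y D) F carried j))) (Decomposed.y≥0 D (f F j)))
            (subst (λ u → u ∙ w < 0ℤ) (sym (lookup-index (∈-tests-c F j))) (proj₂ (proj₂ (prop (index (∈-tests-c F j))))
              (subst (λ u → u ∙ z < 0ℤ) (lookup-index (∈-tests-c F j)) lt)))

    abstract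
      cover : ∀ z → ∃ λ F → ∀ j → 0ℤ ≤ c F j ∙ z
      cover = cover′

    -- A cell is refined by lowering the height of its k-th ray by ρ k, where ρ decreases fast.
    excess : Fin (length facets) → Fin n → Vec ℤ n
    excess F k = comb (λ j → c F j ∙ v k) (unit ∘ f F) ⊞ ((- 1ℤ) ⊡ unit k)

    ∙-excess : ∀ ρ F k → ρ ∙ excess F k ≡ ∑ (λ j → (c F j ∙ v k) * lookup ρ (f F j)) - lookup ρ k
    ∙-excess ρ F k = trans (∙-⊞ ρ _ _) (cong₂ _+_ (trans (∙-comb ρ (λ j → c F j ∙ v k) (unit ∘ f F)) (∑ℤ.sum-cong (λ j → cong ((c F j ∙ v k) *_) (trans (∙-comm ρ (unit (f F j))) (unit-∙ (f F j) ρ)))))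
      (trans (∙-⊡ ρ (- 1ℤ) (unit k)) (trans (cong (- 1ℤ *_) (trans (∙-comm ρ (unit k)) (unit-∙ k ρ))) (ℤₚ.-1*i≡-i (lookup ρ k)))))

    -- The leading entry is the slack of the linear piece of the cell, positive outside the cell;
    -- only for rays of the same cell does `excess` decide.
    lexvec : Fin (length facets) → Fin n → Vec ℤ (suc n)
    lexvec F k = (height k - π (cell F) ∙ v k) ∷ excess F k

    module Excess (F : Fin (length facets)) (k : Fin n) (k∉F : ∀ j → f F j ≢ k) where

      γ : Fin d → ℤ
      γ j = c F j ∙ v k

      at : ∀ l → lookup (excess F k) l ≡ ∑ (λ j → γ j * lookup (unit l) (f F j)) - lookup (unit l) k
      at l = trans (sym (unit-∙ l (excess F k))) (∙-excess (unit l) F k)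

      at-outside : ∀ l → (∀ j → f F j ≢ l) → l ≢ k → lookup (excess F k) l ≡ 0ℤ
      at-outside l l∉F l≢k = trans (at l) (cong₂ _-_ (∑ℤ.sum-zero (λ j → trans (cong (γ j *_) (lookup-unit-other (λ e → l∉F j (sym e)))) (ℤₚ.*-zeroʳ (γ j)))) (lookup-unit-other l≢k))

      at-k : lookup (excess F k) k ≡ - 1ℤ
      at-k = trans (at k) (cong₂ _-_ (∑ℤ.sum-zero (λ j → trans (cong (γ j *_) (lookup-unit-other (λ e → k∉F j (sym e)))) (ℤₚ.*-zeroʳ (γ j)))) (lookup-unit-same k))

      at-f : ∀ i → lookup (excess F k) (f F i) ≡ γ i
      at-f i = trans (at (f F i)) (trans (cong₂ _-_ (trans (∑ℤ.sum-single (λ j → γ j * lookup (unit (f F i)) (f F j)) i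
          (λ j ne → trans (cong (γ j *_) (lookup-unit-other (λ e → ne (sym (ι-injective (facet F) e))))) (ℤₚ.*-zeroʳ (γ j))))
        (trans (cong (γ i *_) (lookup-unit-same (f F i))) (ℤₚ.*-identityʳ (γ i)))) (lookup-unit-other (k∉F i))) (ℤₚ.+-identityʳ (γ i)))

      Wall : Fin n → Set
      Wall l = ∃ λ μ → μ ∈ walls (cell F) × μ ∙ v l ≡ 1ℤ × (∀ j → l Fin.< f F j → μ ∙ v (f F j) ≡ 0ℤ)

      wall : ∀ l → InCell (cell F) l → Wall l
      wall l inl = find (proj₂ (proj₂ (isFacet F)) l inl)

      expand : ∀ μ → μ ∙ v k ≡ ∑ (λ j → γ j * (μ ∙ v (f F j)))
      expand μ = trans (cong (μ ∙_) (sym (proj₂ (proj₂ (proj₂ (dualOf F))) (v k)))) (∙-comb μ γ (v ∘ f F))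

      -- Before l only zero coefficients occur, after l the wall vanishes.
      module _ (l : Fin n) (early : ∀ j → f F j Fin.< l → γ j ≡ 0ℤ) (W : Wall l) where

        μ : Vec ℤ d
        μ = proj₁ W

        term : ∀ j → f F j ≢ l → γ j * (μ ∙ v (f F j)) ≡ 0ℤ
        term j ne = go (Finₚ.<-cmp (f F j) l)
          where
          go : Tri (f F j Fin.< l) (f F j ≡ l) (l Fin.< f F j) → γ j * (μ ∙ v (f F j)) ≡ 0ℤ
          go (tri< lt _ _) = trans (cong (_* (μ ∙ v (f F j))) (early j lt)) refl
          go (tri≈ _ e _) = contradiction e ne
          go (tri> _ _ gt) = trans (cong (γ j *_) (proj₂ (proj₂ (proj₂ W)) j gt)) (ℤₚ.*-zeroʳ (γ j))

        wall-outside : (∀ j → f F j ≢ l) → μ ∙ v k ≡ 0ℤ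
        wall-outside l∉F = trans (expand μ) (∑ℤ.sum-zero (λ j → term j (l∉F j)))

        wall-inside : ∀ i → f F i ≡ l → μ ∙ v k ≡ γ i
        wall-inside i refl = trans (expand μ) (trans (∑ℤ.sum-single (λ j → γ j * (μ ∙ v (f F j))) i (λ j ne → term j (λ e → ne (ι-injective (facet F) e))))
          (trans (cong (γ i *_) (proj₁ (proj₂ (proj₂ W)))) (ℤₚ.*-identityʳ (γ i))))

      module _ (ink : InCell (cell F) k) where

        wall≥0 : ∀ {μ} → μ ∈ walls (cell F) → 0ℤ ≤ μ ∙ v k
        wall≥0 μ∈ = go (wall-01 (cell F) k ink μ∈)
          where
          go : ∀ {x} → x ≡ 0ℤ ⊎ x ≡ 1ℤ → 0ℤ ≤ x
          go (inj₁ refl) = ℤₚ.≤-refl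
          go (inj₂ refl) = ℤ.+≤+ z≤n

        -- If the entries before `l` vanish, the wall of `l`, which kills the later rays of the
        -- facet, takes on `v k` the value of the entry at `l`; walls are nonnegative there. The
        -- entry -1 at `k` cannot come first, since the wall of `k` would be both 1 and 0 on `v k`.
        first : ∀ l → (∀ l' → l' Fin.< l → lookup (excess F k) l' ≡ 0ℤ) → 0ℤ ≤ lookup (excess F k) l
        first l p = go (Finₚ.<-cmp l k)
          where
          early : ∀ j → f F j Fin.< l → γ j ≡ 0ℤ
          early j lt = trans (sym (at-f j)) (p (f F j) lt)
          inside : l ≢ k → Dec (∃ λ j → f F j ≡ l) → 0ℤ ≤ lookup (excess F k) l
          inside l≢k (no l∉F) = ℤₚ.≤-reflexive (sym (at-outside l (λ j e → l∉F (j , e)) l≢k))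
          inside l≢k (yes (i , e)) = subst (0ℤ ≤_) (trans (wall-inside l early W i e) (trans (sym (at-f i)) (cong (lookup (excess F k)) e))) (wall≥0 (proj₁ (proj₂ W)))
            where
            W : Wall l
            W = wall l (subst (InCell (cell F)) e (proj₁ (proj₂ (isFacet F)) i))
          go : Tri (l Fin.< k) (l ≡ k) (k Fin.< l) → 0ℤ ≤ lookup (excess F k) l
          go (tri< _ l≢k _) = inside l≢k (any? (λ j → f F j ≟ l))
          go (tri> _ _ gt) = contradiction (trans (sym at-k) (p k gt)) λ ()
          go (tri≈ _ l≡k _) = contradiction (trans (sym (proj₁ (proj₂ (proj₂ W)))) (trans (cong (λ t → proj₁ W ∙ v t) l≡k) (wall-outside l early W (λ j e → k∉F j (trans e l≡k))))) λ ()
            where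
            W : Wall l
            W = wall l (subst (InCell (cell F)) (sym l≡k) ink)

      positive : Dec (InCell (cell F) k) → LexPos (lexvec F k)
      positive (no ne) = inj₁ (ℤₚ.≤∧≢⇒< (ℤₚ.i≤j⇒0≤j-i (π-le (cell F) k)) (λ e → ne (sym (ℤₚ.i-j≡0⇒i≡j (height k) (π (cell F) ∙ v k) (sym e)))))
      positive (yes ink) = inj₂ (ℤₚ.i≡j⇒i-j≡0 {height k} (sym ink) , lex-positive (excess F k) (first ink) (k , λ e → contradiction (trans (sym at-k) e) λ ()))

    lexvec-positive : ∀ F k → (∀ j → f F j ≢ k) → LexPos (lexvec F k)
    lexvec-positive F k k∉F = Excess.positive F k k∉F (InCell? (cell F) k)

    Weights : Set
    Weights = Σ ℤ λ ρ₀ → Σ (Vec ℤ n) λ ρ → ∀ F k → (∀ j → f F j ≢ k) → 0ℤ < (ρ₀ ∷ ρ) ∙ lexvec F k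

    weights′ : Weights
    weights′ = split (lex-weights (λ i → lexvec (proj₁ (remQuot {length facets} n i)) (proj₂ (remQuot {length facets} n i))))
      where
      same : ∀ F k → lexvec (proj₁ (remQuot {length facets} n (combine F k))) (proj₂ (remQuot {length facets} n (combine F k))) ≡ lexvec F k
      same F k = cong (λ p → lexvec (proj₁ p) (proj₂ p)) (remQuot-combine {length facets} {n} F k)
      split : (∃ λ ρ → ∀ i → LexPos (lexvec (proj₁ (remQuot {length facets} n i)) (proj₂ (remQuot {length facets} n i))) →
        0ℤ < ρ ∙ lexvec (proj₁ (remQuot {length facets} n i)) (proj₂ (remQuot {length facets} n i))) → Weights
      split (ρ₀ ∷ ρ , p) = ρ₀ , ρ , λ F k k∉F → subst (λ x → 0ℤ < (ρ₀ ∷ ρ) ∙ x) (same F k) (p (combine F k) (subst LexPos (sym (same F k)) (lexvec-positive F k k∉F)))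

    abstract
      weights : Weights
      weights = weights′

    fan : Fan d n (length facets)
    fan = record
      { v = v ; f = f ; c = c
      ; c-same = λ F → proj₁ (proj₂ (dualOf F))
      ; c-other = λ F → proj₁ (proj₂ (proj₂ (dualOf F)))
      ; c-span = λ F → proj₂ (proj₂ (proj₂ (dualOf F)))
      ; ω = ω ; a = a ; a-eq = a-eq ; a-lt = a-lt
      ; cover = cover ; f-set = f-set }
      where
      ρ₀ : ℤ
      ρ₀ = proj₁ weights
      ρ : Vec ℤ n
      ρ = proj₁ (proj₂ weights)
      positive : ∀ F k → (∀ j → f F j ≢ k) → 0ℤ < (ρ₀ ∷ ρ) ∙ lexvec F k
      positive = proj₂ (proj₂ weights)
      ω : Fin n → ℤ
      ω k = ρ₀ * height k - lookup ρ k
      a : Fin (length facets) → Vec ℤ d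
      a F = comb (ω ∘ f F) (c F)
      a-∙ : ∀ F z → a F ∙ z ≡ ∑ (λ j → ω (f F j) * (c F j ∙ z))
      a-∙ F z = comb-∙ z (ω ∘ f F) (c F)
      a-eq : ∀ F j → a F ∙ v (f F j) ≡ ω (f F j)
      a-eq F j = trans (a-∙ F (v (f F j))) (trans (∑ℤ.sum-single (λ i → ω (f F i) * (c F i ∙ v (f F j))) j
        (λ i ne → trans (cong (ω (f F i) *_) (proj₁ (proj₂ (proj₂ (dualOf F))) ne)) (ℤₚ.*-zeroʳ (ω (f F i)))))
        (trans (cong (ω (f F j) *_) (proj₁ (proj₂ (dualOf F)) j)) (ℤₚ.*-identityʳ _)))
      a-lt : ∀ F k → (∀ j → f F j ≢ k) → a F ∙ v k < ω k
      a-lt F k k∉F = 0<⇒< (subst (0ℤ <_) eq (positive F k k∉F))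
        where
        γ : Fin d → ℤ
        γ j = c F j ∙ v k
        heights : π (cell F) ∙ v k ≡ ∑ (λ j → γ j * height (f F j))
        heights = trans (cong (π (cell F) ∙_) (sym (proj₂ (proj₂ (proj₂ (dualOf F))) (v k)))) (trans (∙-comb (π (cell F)) γ (v ∘ f F))
          (∑ℤ.sum-cong (λ j → cong (γ j *_) (proj₁ (proj₂ (isFacet F)) j))))
        eq : (ρ₀ ∷ ρ) ∙ lexvec F k ≡ ω k - a F ∙ v k
        eq = trans (cong₂ (λ p q → ρ₀ * (height k - p) + q) heights (∙-excess ρ F k))
          (trans (lemma ρ₀ (height k) (∑ (λ j → γ j * height (f F j))) (∑ (λ j → γ j * lookup ρ (f F j))) (lookup ρ k))
          (cong (λ t → ω k - t) (trans (cong (_- ∑ (λ j → γ j * lookup ρ (f F j))) (∑ℤ.sum-*ˡ ρ₀ (λ j → γ j * height (f F j))))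
            (trans (sym (∑-sub (λ j → ρ₀ * (γ j * height (f F j))) (λ j → γ j * lookup ρ (f F j))))
            (trans (∑ℤ.sum-cong (λ j → lemma' ρ₀ (γ j) (height (f F j)) (lookup ρ (f F j)))) (sym (a-∙ F (v k))))))))
          where
          lemma : ∀ a h s t b → a * (h - s) + (t - b) ≡ a * h - b - (a * s - t)
          lemma = solve-∀
          lemma' : ∀ a g h b → a * (g * h) - g * b ≡ (a * h - b) * g
          lemma' = solve-∀

-- Lattice points of a dual pair and the subdivision by orthants and dual points

module DualPolytopes where
  open import Data.Bool using (Bool; true; false; if_then_else_)
  open import Data.Integer as ℤ using (ℤ; +_; -[1+_]; 0ℤ; 1ℤ; -1ℤ; _+_; _*_; -_; _-_; _≤_; _<_; ∣_∣; +≤+; -≤+; +<+)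
  import Data.Integer.Properties as ℤₚ
  open import Data.Integer.Tactic.RingSolver using (solve-∀)
  open import Data.Fin using (_≟_)
  open import Data.Fin.Properties using (any?; all?)
  open import Data.Vec using (tabulate; zipWith)
  open import Data.Vec.Properties using (lookup∘tabulate; ≡-dec; lookup-replicate; lookup-zipWith; lookup-map)
  open import Data.List using (_++_; length; filter; allFin; cartesianProductWith; cartesianProduct)
  open import Data.List.Membership.Propositional using (_∈_)
  open import Data.List.Membership.Propositional.Properties
  open import Data.List.Relation.Unary.Any using (here; there; index)
  open import Data.List.Relation.Unary.Any.Properties using (lookup-index)
  open import Data.List.Relation.Unary.All using ([]; _∷_)
  open import Data.List.Relation.Unary.AllPairs using ([]; _∷_)
  open import Data.List.Relation.Unary.Unique.Propositional using (Unique)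
  import Data.List.Relation.Unary.Unique.Propositional.Properties as Uₚ
  open import Relation.Nullary.Decidable using (_×-dec_; ¬?; does)
  open import Relation.Binary.PropositionalEquality using (_≡_; _≢_; refl; sym; trans; cong; cong₂; subst; subst₂)
  open IntegerVectors
  open Fans using (nonzero-coordinate)
  open Monomials using (lookup-unique)
  open PullingTriangulation

  words : List ℤ → ∀ d → List (Vec ℤ d)
  words A zero = [] ∷ []
  words A (suc d) = cartesianProductWith _∷_ A (words A d)

  ∈-words⁺ : ∀ {A d} (x : Vec ℤ d) → (∀ k → lookup x k ∈ A) → x ∈ words A d
  ∈-words⁺ [] h = here refl
  ∈-words⁺ (x ∷ xs) h = ∈-cartesianProductWith⁺ _∷_ (h zero) (∈-words⁺ xs (h ∘ suc))

  ∈-words⁻ : ∀ {A d} {x : Vec ℤ d} → x ∈ words A d → ∀ k → lookup x k ∈ A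
  ∈-words⁻ {A} {suc d} x∈ k with ∈-cartesianProductWith⁻ _∷_ A (words A d) x∈
  ∈-words⁻ {A} {suc d} x∈ zero | a , y , a∈ , y∈ , refl = a∈
  ∈-words⁻ {A} {suc d} x∈ (suc k) | a , y , a∈ , y∈ , refl = ∈-words⁻ y∈ k

  words-unique : ∀ {A} → Unique A → ∀ d → Unique (words A d)
  words-unique u zero = [] ∷ []
  words-unique {A} u (suc d) = Uₚ.cartesianProductWith⁺ _∷_ (λ { refl → refl , refl }) u (words-unique u d)

  trits : List ℤ
  trits = -1ℤ ∷ 0ℤ ∷ 1ℤ ∷ []

  trits-unique : Unique trits
  trits-unique = ((λ ()) ∷ (λ ()) ∷ []) ∷ ((λ ()) ∷ []) ∷ [] ∷ []

  ∈-trits : ∀ x → x ≤ 1ℤ → - x ≤ 1ℤ → x ∈ trits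
  ∈-trits (+ zero) _ _ = there (here refl)
  ∈-trits (+ suc zero) _ _ = there (there (here refl))
  ∈-trits (+ suc (suc _)) (+≤+ (s≤s ())) _
  ∈-trits -[1+ zero ] _ _ = here refl
  ∈-trits -[1+ suc _ ] _ (+≤+ (s≤s ()))

  signs : List ℤ
  signs = 1ℤ ∷ -1ℤ ∷ []

  sign-square : ∀ {s} → s ∈ signs → s * s ≡ 1ℤ
  sign-square (here refl) = refl
  sign-square (there (here refl)) = refl

  trunc : ∀ {d} → Vec Bool d → Vec ℤ d → Vec ℤ d
  trunc = zipWith (λ b x → if b then x else 0ℤ)

  trunc-∙ : ∀ {d} S (u x : Vec ℤ d) → u ∙ trunc S x ≡ trunc S u ∙ x
  trunc-∙ [] [] [] = refl
  trunc-∙ (true ∷ S) (u ∷ us) (x ∷ xs) = cong (λ t → u * x + t) (trunc-∙ S us xs)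
  trunc-∙ (false ∷ S) (u ∷ us) (x ∷ xs) = cong₂ _+_ (ℤₚ.*-zeroʳ u) (trunc-∙ S us xs)

  lookup-trunc : ∀ {d} S (x : Vec ℤ d) k → lookup (trunc S x) k ≡ (if lookup S k then lookup x k else 0ℤ)
  lookup-trunc S x k = lookup-zipWith (λ b x → if b then x else 0ℤ) k S x

  ∙-mono : ∀ {d} (u x u' x' : Vec ℤ d) → (∀ k → lookup u k * lookup x k ≤ lookup u' k * lookup x' k) → u ∙ x ≤ u' ∙ x'
  ∙-mono u x u' x' h = subst₂ _≤_ (sym (∙-∑ u x)) (sym (∙-∑ u' x')) (∑-mono h)

  0≤x≤1 : ∀ {x} → 0ℤ ≤ x → x ≤ 1ℤ → x ≡ 0ℤ ⊎ x ≡ 1ℤ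
  0≤x≤1 {+ zero} _ _ = inj₁ refl
  0≤x≤1 {+ suc zero} _ _ = inj₂ refl
  0≤x≤1 {+ suc (suc _)} _ (+≤+ (s≤s ()))

  norm₁ : ∀ {d} → Vec ℤ d → ℤ
  norm₁ x = ∑ (λ k → + ∣ lookup x k ∣)

  i≤∣i∣ : ∀ i → i ≤ + ∣ i ∣
  i≤∣i∣ (+ n) = ℤₚ.≤-refl
  i≤∣i∣ -[1+ n ] = -≤+

  *≤∣∣ : ∀ {s} → s ∈ signs → ∀ x → s * x ≤ + ∣ x ∣
  *≤∣∣ (here refl) x = subst (_≤ + ∣ x ∣) (sym (ℤₚ.*-identityˡ x)) (i≤∣i∣ x)
  *≤∣∣ (there (here refl)) x = subst (_≤ + ∣ x ∣) (sym (ℤₚ.-1*i≡-i x)) (-i≤∣i∣ x)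
    where
    -i≤∣i∣ : ∀ i → - i ≤ + ∣ i ∣
    -i≤∣i∣ (+ zero) = ℤₚ.≤-refl
    -i≤∣i∣ (+ suc n) = -≤+
    -i≤∣i∣ -[1+ n ] = ℤₚ.≤-refl

  compatible-∣∣ : ∀ {s} → s ∈ signs → ∀ x → 0ℤ ≤ s * x → s * x ≡ + ∣ x ∣
  compatible-∣∣ (here refl) x h = trans (ℤₚ.*-identityˡ x) (nonneg x (subst (0ℤ ≤_) (ℤₚ.*-identityˡ x) h))
    where
    nonneg : ∀ x → 0ℤ ≤ x → x ≡ + ∣ x ∣
    nonneg (+ n) _ = refl
  compatible-∣∣ (there (here refl)) x h = trans (ℤₚ.-1*i≡-i x) (nonpos x (subst (0ℤ ≤_) (ℤₚ.-1*i≡-i x) h))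
    where
    nonpos : ∀ x → 0ℤ ≤ - x → - x ≡ + ∣ x ∣
    nonpos (+ zero) _ = refl
    nonpos -[1+ n ] _ = refl

  -- Membership of `u` in the closed orthant of the sign vector σ.
  Compatible : ∀ {d} → Vec ℤ d → Vec ℤ d → Set
  Compatible σ u = ∀ k → 0ℤ ≤ lookup σ k * lookup u k

  Compatible? : ∀ {d} (σ u : Vec ℤ d) → Dec (Compatible σ u)
  Compatible? σ u = all? (λ k → 0ℤ ℤₚ.≤? lookup σ k * lookup u k)

  ∑-weighted : ∀ {n} {c t : Fin n → ℤ} → (∀ i → 0ℤ ≤ c i) → (∀ i → t i ≤ 1ℤ) → ∑ (λ i → c i * t i) ≤ ∑ c
  ∑-weighted {c = c} {t} c≥0 t≤1 = ∑-mono (λ i → subst (c i * t i ≤_) (ℤₚ.*-identityʳ (c i)) (ℤₚ.*-monoˡ-≤-nonNeg (c i) {{ℤ.nonNegative (c≥0 i)}} (t≤1 i)))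

  cancel-pos : ∀ {p x y} → 0ℤ < p → p * x ≤ p * y → x ≤ y
  cancel-pos {p} {x} {y} 0<p = ℤₚ.*-cancelˡ-≤-pos x y p {{ℤ.positive 0<p}}

  some-positive : ∀ {n} {t : Fin n → ℤ} → 0ℤ < ∑ t → ∃ λ i → 0ℤ < t i
  some-positive {n} {t} h with any? (λ i → 0ℤ ℤₚ.<? t i)
  ... | yes p = p
  ... | no np = contradiction (ℤₚ.<-≤-trans h (subst (∑ t ≤_) (∑ℤ.sum-zero {n} {λ _ → 0ℤ} (λ _ → refl)) (∑-mono (λ i → ℤₚ.≮⇒≥ (λ lt → np (i , lt)))))) (ℤₚ.<-irrefl refl)

  -- V and W are the vertices of P and of its polar dual; bipolar is P°° ⊆ P with denominators cleared,
  -- and truncation is what remains of local anti-blocking.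
  record DualPair (d n m : ℕ) : Set where
    field
      V : Fin n → Vec ℤ d
      W : Fin m → Vec ℤ d
      pairing : ∀ i j → W j ∙ V i ≤ 1ℤ
      bipolar : ∀ z N → 0ℤ < N → (∀ j → W j ∙ z ≤ N) → Σ ℤ λ p → 0ℤ < p × Σ (Fin n → ℤ) λ c → (∀ i → 0ℤ ≤ c i) × ∑ c ≡ p * N ×
        (∀ u → ∑ (λ i → c i * (u ∙ V i)) ≡ p * (u ∙ z))
      truncation : ∀ S i j → W j ∙ trunc S (V i) ≤ 1ℤ

  module DualPairProperties {d n m : ℕ} (DP : DualPair d n m) where
    open DualPair DP

    IsV IsW : Vec ℤ d → Set
    IsV z = ∀ j → W j ∙ z ≤ 1ℤ
    IsW u = ∀ i → u ∙ V i ≤ 1ℤ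

    -- The bounds at the `V i` are averaged over the representation of `z` given by `bipolar`.
    dual-bound : ∀ {u z N} → 0ℤ < N → IsW u → (∀ j → W j ∙ z ≤ N) → u ∙ z ≤ N
    dual-bound {u} {z} {N} 0<N isW h with bipolar z N 0<N h
    ... | p , 0<p , c , c≥0 , total , eq = cancel-pos 0<p (subst₂ _≤_ (eq u) total (∑-weighted c≥0 isW))

    pair-bound : ∀ {u z} → IsW u → IsV z → u ∙ z ≤ 1ℤ
    pair-bound {u} {z} = dual-bound {u} {z} (+<+ (s≤s z≤n))

    trunc-V : ∀ S i → IsV (trunc S (V i))
    trunc-V S i j = truncation S i j

    -- Truncation is self-adjoint, so closure under it passes from P to the polar dual.
    trunc-W : ∀ S {u} → IsW u → IsW (trunc S u)
    trunc-W S {u} isW i = subst (_≤ 1ℤ) (trunc-∙ S u (V i)) (pair-bound {u} {trunc S (V i)} isW (trunc-V S i))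

    W-isW : ∀ j → IsW (W j)
    W-isW j i = pairing i j

    ∙-axis : ∀ s k (x : Vec ℤ d) → x ∙ (s ⊡ unit k) ≡ s * lookup x k
    ∙-axis s k x = trans (∙-⊡ x s (unit k)) (cong (s *_) (trans (∙-comm x (unit k)) (unit-∙ k x)))

    axis-∙ : ∀ s k (x : Vec ℤ d) → (s ⊡ unit k) ∙ x ≡ s * lookup x k
    axis-∙ s k x = trans (∙-comm _ x) (∙-axis s k x)

    -- Truncating to the k-th coordinate bounds the products of the k-th coordinates of W and V by 1; as
    -- both take positive values in each direction, all these coordinates lie in {-1, 0, 1}.
    module Axis (k : Fin d) (s : ℤ) (s∈ : s ∈ signs) where

      product : ∀ i j → (s * lookup (W j) k) * (s * lookup (V i) k) ≤ 1ℤ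
      product i j = subst (_≤ 1ℤ) eq (truncation (mask k) i j)
        where
        mask : ∀ {d} → Fin d → Vec Bool d
        mask zero = true ∷ Vec.replicate _ false
        mask (suc k) = false ∷ mask k
        trunc-false : ∀ {d} (x : Vec ℤ d) → trunc (Vec.replicate _ false) x ≡ 𝟘
        trunc-false [] = refl
        trunc-false (x ∷ xs) = cong (0ℤ ∷_) (trunc-false xs)
        at-mask : ∀ {d} k (u x : Vec ℤ d) → u ∙ trunc (mask k) x ≡ lookup u k * lookup x k
        at-mask zero (u ∷ us) (x ∷ xs) = trans (cong (λ t → u * x + t) (trans (cong (us ∙_) (trunc-false xs)) (∙-𝟘 us))) (ℤₚ.+-identityʳ (u * x))
        at-mask (suc k) (u ∷ us) (x ∷ xs) = trans (cong₂ _+_ (ℤₚ.*-zeroʳ u) (at-mask k us xs)) (ℤₚ.+-identityˡ _)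
        square : ∀ a b c → (a * b) * (a * c) ≡ (a * a) * (b * c)
        square = solve-∀
        eq : W j ∙ trunc (mask k) (V i) ≡ (s * lookup (W j) k) * (s * lookup (V i) k)
        eq = trans (at-mask k (W j) (V i)) (sym (trans (square s (lookup (W j) k) (lookup (V i) k)) (trans (cong (_* (lookup (W j) k * lookup (V i) k)) (sign-square s∈)) (ℤₚ.*-identityˡ _))))

      Reach : ℤ → ℤ → Set
      Reach M N = Σ ℤ λ p → 0ℤ < p × Σ (Fin n → ℤ) λ c → (∀ i → 0ℤ ≤ c i) × ∑ c ≡ p * N × ∑ (λ i → c i * (s * lookup (V i) k)) ≡ p * M

      reach : ∀ M N → 0ℤ < N → (∀ j → (s * lookup (W j) k) * M ≤ N) → Reach M N
      reach M N 0<N h = let p , 0<p , c , c≥0 , total , eq = bipolar ((M * s) ⊡ unit k) N 0<N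
                              (λ j → subst (_≤ N) (sym (trans (∙-axis (M * s) k (W j)) (rearr M s (lookup (W j) k)))) (h j)) in
          p , 0<p , c , c≥0 , total ,
          trans (∑ℤ.sum-cong (λ i → cong (c i *_) (sym (axis-∙ s k (V i))))) (trans (eq (s ⊡ unit k)) (cong (p *_) (trans (∙-axis (M * s) k (s ⊡ unit k))
            (trans (cong ((M * s) *_) (trans (sym (unit-∙ k (s ⊡ unit k))) (trans (∙-axis s k (unit k)) (cong (s *_) (lookup-unit-same k))))) (trans (lemma M s) (trans (cong (M *_) (sign-square s∈)) (ℤₚ.*-identityʳ M)))))))
        where
        rearr : ∀ a b c → a * b * c ≡ (b * c) * a
        rearr = solve-∀
        lemma : ∀ M s → (M * s) * (s * 1ℤ) ≡ M * (s * s)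
        lemma = solve-∀

      -- A small positive multiple of s times the k-th unit vector satisfies all inequalities of the
      -- `W j`, hence is a convex combination of the `V i`.
      some-V : ∃ λ i → 0ℤ < s * lookup (V i) k
      some-V = go (bounded (λ j → ∣ s * lookup (W j) k ∣))
        where
        positive : ∀ {N} → Reach 1ℤ N → ∃ λ i → 0ℤ < s * lookup (V i) k
        positive (p , 0<p , c , c≥0 , _ , eq) = let i , 0<ct = some-positive (subst (0ℤ <_) (sym (trans eq (ℤₚ.*-identityʳ p))) 0<p) in
          i , ℤₚ.≰⇒> λ le → ℤₚ.<⇒≱ 0<ct (subst (c i * (s * lookup (V i) k) ≤_) (ℤₚ.*-zeroʳ (c i)) (ℤₚ.*-monoˡ-≤-nonNeg (c i) {{ℤ.nonNegative (c≥0 i)}} le))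
        go : (∃ λ K → ∀ j → ∣ s * lookup (W j) k ∣ ℕ.< K) → ∃ λ i → 0ℤ < s * lookup (V i) k
        go (K , bd) = positive (reach 1ℤ (+ suc K) (+<+ (s≤s z≤n)) (λ j → subst (_≤ + suc K) (sym (ℤₚ.*-identityʳ (s * lookup (W j) k)))
          (ℤₚ.≤-trans (i≤∣i∣ (s * lookup (W j) k)) (+≤+ (ℕₚ.m≤n⇒m≤1+n (ℕₚ.<⇒≤ (bd j)))))))

      -- Otherwise all positive multiples of that axis vector would lie in P, which is bounded.
      some-W : ∃ λ j → 0ℤ < s * lookup (W j) k
      some-W = decide (any? (λ j → 0ℤ ℤₚ.<? s * lookup (W j) k))
        where
        impossible : ∀ {K} → (∀ i → ∣ s * lookup (V i) k ∣ ℕ.< K) → ¬ Reach (+ suc K) 1ℤ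
        impossible {K} bd (p , 0<p , c , c≥0 , total , eq) = contradiction (cancel-pos {p} {+ suc K} {+ K} 0<p (subst₂ _≤_ eq (trans (sym (∑ℤ.sum-*ʳ (+ K) c)) (cong (_* + K) (trans total (ℤₚ.*-identityʳ p))))
          (∑-mono (λ i → ℤₚ.*-monoˡ-≤-nonNeg (c i) {{ℤ.nonNegative (c≥0 i)}} (ℤₚ.≤-trans (i≤∣i∣ (s * lookup (V i) k)) (+≤+ (ℕₚ.<⇒≤ (bd i)))))))) λ { (+≤+ le) → ℕₚ.1+n≰n le }
        decide : Dec (∃ λ j → 0ℤ < s * lookup (W j) k) → ∃ λ j → 0ℤ < s * lookup (W j) k
        decide (yes p) = p
        decide (no np) = let K , bd = bounded (λ i → ∣ s * lookup (V i) k ∣) in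
          contradiction (reach (+ suc K) 1ℤ (+<+ (s≤s z≤n)) (λ j → ℤₚ.≤-trans (ℤₚ.*-monoʳ-≤-nonNeg (+ suc K) (ℤₚ.≮⇒≥ (λ lt → np (j , lt)))) (+≤+ z≤n))) (impossible bd)

      -- Integrality enters here: a positive `x` is at least 1.
      factor≤1 : ∀ {x y} → 0ℤ < x → x * y ≤ 1ℤ → y ≤ 1ℤ
      factor≤1 {+ suc x} {+ zero} _ _ = +≤+ z≤n
      factor≤1 {+ suc x} {+ suc zero} _ _ = ℤₚ.≤-refl
      factor≤1 {+ suc x} {+ suc (suc y)} _ (+≤+ (s≤s ()))
      factor≤1 {+ suc x} { -[1+ y ]} _ _ = -≤+
      factor≤1 {+ zero} (+<+ ()) _

      V≤1 : ∀ i → s * lookup (V i) k ≤ 1ℤ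
      V≤1 i = let j , pos = some-W in factor≤1 pos (product i j)

      W≤1 : ∀ j → s * lookup (W j) k ≤ 1ℤ
      W≤1 j = let i , pos = some-V in factor≤1 pos (subst (_≤ 1ℤ) (ℤₚ.*-comm (s * lookup (W j) k) (s * lookup (V i) k)) (product i j))

    axis-isW : ∀ {s} k → s ∈ signs → IsW (s ⊡ unit k)
    axis-isW {s} k s∈ i = subst (_≤ 1ℤ) (sym (axis-∙ s k (V i))) (Axis.V≤1 k s s∈ i)

    axis-isV : ∀ {s} k → s ∈ signs → IsV (s ⊡ unit k)
    axis-isV {s} k s∈ j = subst (_≤ 1ℤ) (sym (∙-axis s k (W j))) (Axis.W≤1 k s s∈ j)

    V-coordinate : ∀ {s z} k → s ∈ signs → IsV z → s * lookup z k ≤ 1ℤ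
    V-coordinate {s} {z} k s∈ isV = subst (_≤ 1ℤ) (axis-∙ s k z) (pair-bound {s ⊡ unit k} {z} (axis-isW k s∈) isV)

    V-trits : ∀ {z} → IsV z → z ∈ words trits d
    V-trits {z} isV = ∈-words⁺ z λ k → ∈-trits (lookup z k) (subst (_≤ 1ℤ) (ℤₚ.*-identityˡ _) (V-coordinate k (here refl) isV))
      (subst (_≤ 1ℤ) (ℤₚ.-1*i≡-i _) (V-coordinate k (there (here refl)) isV))

    W-trits : ∀ {u} → IsW u → u ∈ words trits d
    W-trits {u} isW = ∈-words⁺ u λ k → ∈-trits (lookup u k) (subst (_≤ 1ℤ) (trans (∙-axis 1ℤ k u) (ℤₚ.*-identityˡ _)) (pair-bound {u} isW (axis-isV k (here refl))))
      (subst (_≤ 1ℤ) (trans (∙-axis -1ℤ k u) (ℤₚ.-1*i≡-i _)) (pair-bound {u} isW (axis-isV k (there (here refl)))))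

    IsV? : ∀ z → Dec (IsV z)
    IsV? z = all? (λ j → W j ∙ z ℤₚ.≤? 1ℤ)

    IsW? : ∀ u → Dec (IsW u)
    IsW? u = all? (λ i → u ∙ V i ℤₚ.≤? 1ℤ)

    -- All nonzero lattice points of P, beyond the given `V i`, are candidates for rays; a search
    -- among vectors with entries -1, 0, 1 finds them.
    vertexList : List (Vec ℤ d)
    vertexList = filter (λ z → IsV? z ×-dec ¬? (≡-dec ℤ._≟_ z 𝟘)) (words trits d)

    vertex : Fin (length vertexList) → Vec ℤ d
    vertex = List.lookup vertexList

    vertex-injective : ∀ {k l} → vertex k ≡ vertex l → k ≡ l
    vertex-injective {k} {l} = lookup-unique (Uₚ.filter⁺ (λ z → IsV? z ×-dec ¬? (≡-dec ℤ._≟_ z 𝟘)) (words-unique trits-unique d)) k l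

    vertex-props : ∀ k → IsV (vertex k) × vertex k ≢ 𝟘
    vertex-props k = proj₂ (∈-filter⁻ (λ z → IsV? z ×-dec ¬? (≡-dec ℤ._≟_ z 𝟘)) {xs = words trits d} (∈-lookup {xs = vertexList} k))

    vertex-index : ∀ {z} → IsV z → z ≢ 𝟘 → ∃ λ k → vertex k ≡ z
    vertex-index isV nz = let z∈ = ∈-filter⁺ (λ z → IsV? z ×-dec ¬? (≡-dec ℤ._≟_ z 𝟘)) (V-trits isV) (isV , nz) in index z∈ , sym (lookup-index z∈)

    functionals : List (Vec ℤ d)
    functionals = filter IsW? (words trits d)

    ∈-functionals : ∀ {u} → IsW u → u ∈ functionals
    ∈-functionals isW = ∈-filter⁺ IsW? (W-trits isW) isW

    functional-isW : ∀ {u} → u ∈ functionals → IsW u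
    functional-isW u∈ = proj₂ (∈-filter⁻ IsW? {xs = words trits d} u∈)

    cellList : List (Vec ℤ d × Vec ℤ d)
    cellList = filter (λ q → Compatible? (proj₁ q) (proj₂ q)) (cartesianProduct (words signs d) functionals)

    record GoodCell (σ u₀ : Vec ℤ d) : Set where
      constructor goodCell
      field
        σ-sign : ∀ k → lookup σ k ∈ signs
        u₀-isW : IsW u₀
        compatible : Compatible σ u₀

    good-cell : ∀ q → GoodCell (proj₁ (List.lookup cellList q)) (proj₂ (List.lookup cellList q))
    good-cell q = let p∈ , comp = ∈-filter⁻ (λ q → Compatible? (proj₁ q) (proj₂ q)) {xs = cartesianProduct (words signs d) functionals} (∈-lookup {xs = cellList} q)
                      σ∈ , u∈ = ∈-cartesianProduct⁻ (words signs d) functionals p∈ in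
      goodCell (∈-words⁻ σ∈) (functional-isW u∈) comp

    cell-index : ∀ {σ u} → GoodCell σ u → ∃ λ q → List.lookup cellList q ≡ (σ , u)
    cell-index {σ} {u} (goodCell s w c) = let q∈ = ∈-filter⁺ (λ q → Compatible? (proj₁ q) (proj₂ q)) (∈-cartesianProduct⁺ (∈-words⁺ σ s) (∈-functionals w)) c in
      index q∈ , sym (lookup-index q∈)

    compatibles : Vec ℤ d → List (Vec ℤ d)
    compatibles σ = filter (Compatible? σ) functionals

    -- The cell of (σ, u₀) consists of the points of the orthant σ where u₀ is maximal among the compatible u.
    wallsOf : Vec ℤ d → Vec ℤ d → List (Vec ℤ d)
    wallsOf σ u₀ = List.map (λ k → lookup σ k ⊡ unit k) (allFin d) ++ List.map (λ u → u₀ ⊞ (-1ℤ ⊡ u)) (compatibles σ)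

    diff-∙ : ∀ (u₀ u z : Vec ℤ d) → (u₀ ⊞ (-1ℤ ⊡ u)) ∙ z ≡ u₀ ∙ z - u ∙ z
    diff-∙ u₀ u z = trans (⊞-∙ u₀ (-1ℤ ⊡ u) z) (cong (λ t → u₀ ∙ z + t) (trans (⊡-∙ -1ℤ u z) (ℤₚ.-1*i≡-i (u ∙ z))))

    walls-elim : ∀ {σ u₀} (P : Vec ℤ d → Set) → (∀ k → P (lookup σ k ⊡ unit k)) → (∀ u → IsW u → Compatible σ u → P (u₀ ⊞ (-1ℤ ⊡ u))) →
      ∀ {μ} → μ ∈ wallsOf σ u₀ → P μ
    walls-elim {σ} {u₀} P pk pu μ∈ with ∈-++⁻ (List.map (λ k → lookup σ k ⊡ unit k) (allFin d)) μ∈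
    ... | inj₁ p with ∈-map⁻ (λ k → lookup σ k ⊡ unit k) p
    ...   | k , _ , refl = pk k
    walls-elim {σ} {u₀} P pk pu μ∈ | inj₂ p with ∈-map⁻ (λ u → u₀ ⊞ (-1ℤ ⊡ u)) p
    ... | u , u∈ , refl = let u∈' , comp = ∈-filter⁻ (Compatible? σ) {xs = functionals} u∈ in pu u (functional-isW u∈') comp

    wall-axis : ∀ {σ u₀} k → lookup σ k ⊡ unit k ∈ wallsOf σ u₀
    wall-axis {σ} k = ∈-++⁺ˡ (∈-map⁺ (λ k → lookup σ k ⊡ unit k) (∈-allFin k))

    wall-functional : ∀ {σ u₀ u} → IsW u → Compatible σ u → u₀ ⊞ (-1ℤ ⊡ u) ∈ wallsOf σ u₀
    wall-functional {σ} {u₀} {u} isW comp = ∈-++⁺ʳ (List.map (λ k → lookup σ k ⊡ unit k) (allFin d))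
      (∈-map⁺ (λ u → u₀ ⊞ (-1ℤ ⊡ u)) (∈-filter⁺ (Compatible? σ) (∈-functionals {u} isW) comp))

    product-compatible : ∀ {σ x y : Vec ℤ d} k → lookup σ k ∈ signs → 0ℤ ≤ lookup σ k * lookup x k → 0ℤ ≤ lookup σ k * lookup y k → 0ℤ ≤ lookup x k * lookup y k
    product-compatible {σ} {x} {y} k s∈ hx hy = subst (0ℤ ≤_) (trans (square (lookup σ k) (lookup x k) (lookup y k)) (trans (cong (_* (lookup x k * lookup y k)) (sign-square s∈)) (ℤₚ.*-identityˡ _))) (0≤* hx hy)
      where
      square : ∀ a b c → (a * b) * (a * c) ≡ (a * a) * (b * c)
      square = solve-∀

    module InCell {σ u₀ : Vec ℤ d} (good : GoodCell σ u₀) where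
      open GoodCell good

      σ≤norm : ∀ z → σ ∙ z ≤ norm₁ z
      σ≤norm z = subst (_≤ norm₁ z) (sym (∙-∑ σ z)) (∑-mono (λ k → *≤∣∣ (σ-sign k) (lookup z k)))

      -- The sum of σ · z ≤ ‖z‖₁ and u₀ · z ≤ 1. Equality forces both, so the rays of the cell are
      -- the points in the orthant σ with u₀ · z = 1.
      π-bound : ∀ {z} → IsV z → (σ ⊞ u₀) ∙ z ≤ norm₁ z + 1ℤ
      π-bound {z} isV = subst (_≤ norm₁ z + 1ℤ) (sym (⊞-∙ σ u₀ z)) (ℤₚ.+-mono-≤ (σ≤norm z) (pair-bound {u₀} {z} u₀-isW isV))

      tight-u₀ : ∀ {z} → IsV z → (σ ⊞ u₀) ∙ z ≡ norm₁ z + 1ℤ → u₀ ∙ z ≡ 1ℤ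
      tight-u₀ {z} isV e = ℤₚ.≤-antisym (pair-bound {u₀} {z} u₀-isW isV) (ℤₚ.≮⇒≥ λ lt →
        ℤₚ.<-irrefl (trans (sym (⊞-∙ σ u₀ z)) e) (ℤₚ.+-mono-≤-< (σ≤norm z) lt))

      tight-σ : ∀ {z} → IsV z → (σ ⊞ u₀) ∙ z ≡ norm₁ z + 1ℤ → Compatible σ z
      tight-σ {z} isV e k = subst (0ℤ ≤_) (ℤₚ.i-j≡0⇒i≡j (+ ∣ lookup z k ∣) _ (∑-zero-terms (λ k → ℤₚ.i≤j⇒0≤j-i (*≤∣∣ (σ-sign k) (lookup z k)))
          (ℤₚ.≤-reflexive (trans (∑-sub (λ k → + ∣ lookup z k ∣) (λ k → lookup σ k * lookup z k)) (trans (cong (λ t → norm₁ z - t) (sym (∙-∑ σ z))) (ℤₚ.i≡j⇒i-j≡0 {norm₁ z} (sym σ≡))))) k)) (+≤+ z≤n)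
        where
        σ≡ : σ ∙ z ≡ norm₁ z
        σ≡ = ℤₚ.≤-antisym (σ≤norm z) (ℤₚ.≮⇒≥ λ lt → ℤₚ.<-irrefl (trans (sym (⊞-∙ σ u₀ z)) e) (ℤₚ.+-mono-<-≤ lt (pair-bound {u₀} {z} u₀-isW isV)))

      cell-tight : ∀ {z} → Compatible σ z → u₀ ∙ z ≡ 1ℤ → (σ ⊞ u₀) ∙ z ≡ norm₁ z + 1ℤ
      cell-tight {z} comp e = trans (⊞-∙ σ u₀ z) (cong₂ _+_ (trans (∙-∑ σ z) (∑ℤ.sum-cong (λ k → compatible-∣∣ (σ-sign k) (lookup z k) (comp k)))) e)

      compatible-∙ : ∀ {u z} → Compatible σ u → Compatible σ z → 0ℤ ≤ u ∙ z
      compatible-∙ {u} {z} cu cz = subst (0ℤ ≤_) (sym (∙-∑ u z)) (∑-nonneg (λ k → product-compatible {σ} {u} {z} k (σ-sign k) (cu k) (cz k)))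

      -- Both kinds of wall take integer values between 0 and 1. For u₀ - u the value is 1 - u · z,
      -- and u · z is nonnegative because `u` and `z` share an orthant.
      wall-values : ∀ {z} → IsV z → Compatible σ z → u₀ ∙ z ≡ 1ℤ → ∀ {μ} → μ ∈ wallsOf σ u₀ → μ ∙ z ≡ 0ℤ ⊎ μ ∙ z ≡ 1ℤ
      wall-values {z} isV cz e = walls-elim {σ} {u₀} (λ μ → μ ∙ z ≡ 0ℤ ⊎ μ ∙ z ≡ 1ℤ)
        (λ k → subst (λ t → t ≡ 0ℤ ⊎ t ≡ 1ℤ) (sym (axis-∙ (lookup σ k) k z)) (0≤x≤1 (cz k) (V-coordinate {z = z} k (σ-sign k) isV)))
        (λ u isW cu → subst (λ t → t ≡ 0ℤ ⊎ t ≡ 1ℤ) (sym (trans (diff-∙ u₀ u z) (cong (_- u ∙ z) e))) (flip (0≤x≤1 (compatible-∙ {u} {z} cu cz) (pair-bound {u} {z} isW isV))))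
        where
        flip : ∀ {x} → x ≡ 0ℤ ⊎ x ≡ 1ℤ → 1ℤ - x ≡ 0ℤ ⊎ 1ℤ - x ≡ 1ℤ
        flip (inj₁ refl) = inj₂ refl
        flip (inj₂ refl) = inj₁ refl

      wall-one : ∀ {z} → IsV z → z ≢ 𝟘 → Compatible σ z → ∃ λ μ → μ ∈ wallsOf σ u₀ × μ ∙ z ≡ 1ℤ
      wall-one {z} isV nz cz = let k , zk≢0 = nonzero-coordinate z nz in
        lookup σ k ⊡ unit k , wall-axis {σ} {u₀} k , trans (axis-∙ (lookup σ k) k z) (one (σ-sign k) zk≢0 (0≤x≤1 (cz k) (V-coordinate {z = z} k (σ-sign k) isV)))
        where
        one : ∀ {s x} → s ∈ signs → x ≢ 0ℤ → s * x ≡ 0ℤ ⊎ s * x ≡ 1ℤ → s * x ≡ 1ℤ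
        one s∈ ne (inj₂ e) = e
        one {s} {x} s∈ ne (inj₁ e) = contradiction (trans (sym (trans (cong (_* x) (sign-square s∈)) (ℤₚ.*-identityˡ x))) (trans (ℤₚ.*-assoc s s x) (trans (cong (s *_) e) (ℤₚ.*-zeroʳ s)))) ne

    Closed : Vec ℤ d → Vec ℤ d → Vec ℤ d → Set
    Closed σ u₀ z = ∀ {μ} → μ ∈ wallsOf σ u₀ → 0ℤ ≤ μ ∙ z

    signOf : ℤ → ℤ
    signOf (+ _) = 1ℤ
    signOf -[1+ _ ] = -1ℤ

    signOf∈ : ∀ x → signOf x ∈ signs
    signOf∈ (+ _) = here refl
    signOf∈ -[1+ _ ] = there (here refl)

    signOf-* : ∀ x → 0ℤ ≤ signOf x * x
    signOf-* (+ n) = subst (0ℤ ≤_) (sym (ℤₚ.*-identityˡ (+ n))) (+≤+ z≤n)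
    signOf-* -[1+ n ] = subst (0ℤ ≤_) (sym (ℤₚ.-1*i≡-i -[1+ n ])) (+≤+ z≤n)

    -- The signs of `z` determine σ, and u₀ maximises u · z over the compatible dual points, found
    -- as a minimum of negatives; the point 0 shows that there are candidates.
    cell-containing : ∀ z → ∃ λ σ → ∃ λ u₀ → GoodCell σ u₀ × Closed σ u₀ z
    cell-containing z = choose (argmin (Compatible? σ) (λ u → - (u ∙ z)) functionals (𝟘 , ∈-functionals {𝟘} (λ i → subst (_≤ 1ℤ) (sym (𝟘-∙ (V i))) (+≤+ z≤n)) , zero-compatible))
      where
      σ : Vec ℤ d
      σ = tabulate (λ k → signOf (lookup z k))
      zero-compatible : Compatible σ 𝟘
      zero-compatible k = ℤₚ.≤-reflexive (sym (trans (cong (lookup σ k *_) (lookup-replicate k 0ℤ)) (ℤₚ.*-zeroʳ (lookup σ k))))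
      σ-sign : ∀ k → lookup σ k ∈ signs
      σ-sign k = subst (_∈ signs) (sym (lookup∘tabulate (λ k → signOf (lookup z k)) k)) (signOf∈ (lookup z k))
      σz≥0 : ∀ k → 0ℤ ≤ lookup σ k * lookup z k
      σz≥0 k = subst (λ s → 0ℤ ≤ s * lookup z k) (sym (lookup∘tabulate (λ k → signOf (lookup z k)) k)) (signOf-* (lookup z k))
      choose : (∃ λ u₀ → u₀ ∈ functionals × Compatible σ u₀ × (∀ {u} → u ∈ functionals → Compatible σ u → - (u₀ ∙ z) ≤ - (u ∙ z))) → ∃ λ σ → ∃ λ u₀ → GoodCell σ u₀ × Closed σ u₀ z
      choose (u₀ , u₀∈ , comp , best) = σ , u₀ , goodCell σ-sign (functional-isW u₀∈) comp , λ {μ} → walls-elim {σ} {u₀} (λ μ → 0ℤ ≤ μ ∙ z)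
        (λ k → subst (0ℤ ≤_) (sym (axis-∙ (lookup σ k) k z)) (σz≥0 k))
        (λ u isW cu → subst (0ℤ ≤_) (sym (diff-∙ u₀ u z)) (ℤₚ.i≤j⇒0≤j-i (ℤₚ.neg-cancel-≤ (best {u} (∈-functionals {u} isW) cu)))) {μ}

    -- Truncate a vertex occurring in a convex representation of z to the coordinates where it agrees in sign with z.
    module Progress {σ u₀ z : Vec ℤ d} (good : GoodCell σ u₀) (z≢𝟘 : z ≢ 𝟘) (closed : Closed σ u₀ z) where
      open GoodCell good
      open InCell good

      zσ : Compatible σ z
      zσ k = subst (0ℤ ≤_) (axis-∙ (lookup σ k) k z) (closed (wall-axis {σ} {u₀} k))

      u₀-max : ∀ {u} → IsW u → Compatible σ u → u ∙ z ≤ u₀ ∙ z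
      u₀-max {u} isW cu = ℤₚ.0≤i-j⇒j≤i (subst (0ℤ ≤_) (diff-∙ u₀ u z) (closed (wall-functional {σ} {u₀} {u} isW cu)))

      N : ℤ
      N = u₀ ∙ z

      mask : Vec ℤ d → Vec Bool d
      mask x = tabulate (λ k → does (0ℤ ℤₚ.≤? lookup σ k * lookup x k))

      axis-compatible : ∀ k → Compatible σ (lookup σ k ⊡ unit k)
      axis-compatible k l = subst (0ℤ ≤_) (sym (trans (cong (lookup σ l *_) (trans (sym (unit-∙ l (lookup σ k ⊡ unit k))) (∙-axis (lookup σ k) k (unit l))))
          (sym (ℤₚ.*-assoc (lookup σ l) (lookup σ k) (lookup (unit l) k))))) (go (l ≟ k))
        where
        go : Dec (l ≡ k) → 0ℤ ≤ lookup σ l * lookup σ k * lookup (unit l) k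
        go (yes refl) = subst (0ℤ ≤_) (sym (cong₂ _*_ (sign-square (σ-sign l)) (lookup-unit-same l))) (+≤+ z≤n)
        go (no ne) = ℤₚ.≤-reflexive (sym (trans (cong (lookup σ l * lookup σ k *_) (lookup-unit-other ne)) (ℤₚ.*-zeroʳ (lookup σ l * lookup σ k))))

      -- Signed unit vectors are compatible dual points, and one along a nonzero coordinate of `z`
      -- is positive on `z`.
      0<N : 0ℤ < N
      0<N = let k , zk≢0 = nonzero-coordinate z z≢𝟘 in
        ℤₚ.<-≤-trans (ℤₚ.≤∧≢⇒< (zσ k) (λ e → zk≢0 (trans (sym (ℤₚ.*-identityˡ _)) (trans (cong (_* lookup z k) (sym (sign-square (σ-sign k))))
            (trans (ℤₚ.*-assoc (lookup σ k) (lookup σ k) (lookup z k)) (trans (cong (lookup σ k *_) (sym e)) (ℤₚ.*-zeroʳ (lookup σ k))))))))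
          (subst (_≤ N) (axis-∙ (lookup σ k) k z) (u₀-max {lookup σ k ⊡ unit k} (axis-isW k (σ-sign k)) (axis-compatible k)))

      mask-lookup : ∀ x k → lookup (mask x) k ≡ does (0ℤ ℤₚ.≤? lookup σ k * lookup x k)
      mask-lookup x k = lookup∘tabulate (λ k → does (0ℤ ℤₚ.≤? lookup σ k * lookup x k)) k

      masked : ∀ x k → (0ℤ ≤ lookup σ k * lookup x k × lookup (trunc (mask x) x) k ≡ lookup x k) ⊎ (lookup σ k * lookup x k ≤ 0ℤ × lookup (trunc (mask x) x) k ≡ 0ℤ)
      masked x k = subst (λ t → (0ℤ ≤ lookup σ k * lookup x k × t ≡ lookup x k) ⊎ (lookup σ k * lookup x k ≤ 0ℤ × t ≡ 0ℤ))
          (sym (trans (lookup-trunc (mask x) x k) (cong (λ b → if b then lookup x k else 0ℤ) (mask-lookup x k)))) (go (0ℤ ℤₚ.≤? lookup σ k * lookup x k))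
        where
        go : (D : Dec (0ℤ ≤ lookup σ k * lookup x k)) → (0ℤ ≤ lookup σ k * lookup x k × (if does D then lookup x k else 0ℤ) ≡ lookup x k) ⊎ (lookup σ k * lookup x k ≤ 0ℤ × (if does D then lookup x k else 0ℤ) ≡ 0ℤ)
        go (yes p) = inj₁ (p , refl)
        go (no np) = inj₂ (ℤₚ.<⇒≤ (ℤₚ.≰⇒> np) , refl)

      masked-compatible : ∀ x → Compatible σ (trunc (mask x) x)
      masked-compatible x k = go (masked x k)
        where
        go : _ → 0ℤ ≤ lookup σ k * lookup (trunc (mask x) x) k
        go (inj₁ (p , e)) = subst (λ t → 0ℤ ≤ lookup σ k * t) (sym e) p
        go (inj₂ (_ , e)) = subst (λ t → 0ℤ ≤ lookup σ k * t) (sym e) (ℤₚ.≤-reflexive (sym (ℤₚ.*-zeroʳ (lookup σ k))))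

      opposite : ∀ {x y : Vec ℤ d} k → lookup σ k * lookup x k ≤ 0ℤ → 0ℤ ≤ lookup σ k * lookup y k → lookup x k * lookup y k ≤ 0ℤ
      opposite {x} {y} k hx hy = ℤₚ.neg-cancel-≤ (subst (0ℤ ≤_) (trans (square (lookup σ k) (lookup x k) (lookup y k)) (cong -_ (trans (cong (_* (lookup x k * lookup y k)) (sign-square (σ-sign k))) (ℤₚ.*-identityˡ _))))
        (0≤* (ℤₚ.neg-mono-≤ hx) hy))
        where
        square : ∀ a b c → - (a * b) * (a * c) ≡ - ((a * a) * (b * c))
        square = solve-∀

      masked-increases : ∀ x {y : Vec ℤ d} → Compatible σ y → ∀ k → lookup x k * lookup y k ≤ lookup (trunc (mask x) x) k * lookup y k
      masked-increases x {y} cy k = go (masked x k)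
        where
        go : _ → lookup x k * lookup y k ≤ lookup (trunc (mask x) x) k * lookup y k
        go (inj₁ (_ , e)) = ℤₚ.≤-reflexive (cong (_* lookup y k) (sym e))
        go (inj₂ (p , e)) = subst (λ t → lookup x k * lookup y k ≤ t * lookup y k) (sym e) (opposite {x} {y} k p (cy k))

      -- Erasing the coordinates of `W j` whose sign disagrees with σ does not lower its value at
      -- `z` and gives a compatible dual point, to which maximality of u₀ applies. Hence `z` lies in
      -- N times P.
      W-bound : ∀ j → W j ∙ z ≤ N
      W-bound j = ℤₚ.≤-trans (∙-mono (W j) z (trunc (mask (W j)) (W j)) z (masked-increases (W j) {z} zσ))
        (u₀-max {trunc (mask (W j)) (W j)} (trunc-W (mask (W j)) {W j} (W-isW j)) (masked-compatible (W j)))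

      support : Vec Bool d
      support = Vec.map (λ x → does (¬? (x ℤ.≟ 0ℤ))) z

      on-support : ∀ x k → (lookup z k ≡ 0ℤ × lookup (trunc support x) k ≡ 0ℤ) ⊎ (lookup z k ≢ 0ℤ × lookup (trunc support x) k ≡ lookup x k)
      on-support x k = subst (λ t → (lookup z k ≡ 0ℤ × t ≡ 0ℤ) ⊎ (lookup z k ≢ 0ℤ × t ≡ lookup x k))
          (sym (trans (lookup-trunc support x k) (cong (λ b → if b then lookup x k else 0ℤ) (lookup-map k (λ x → does (¬? (x ℤ.≟ 0ℤ))) z)))) (go (lookup z k ℤ.≟ 0ℤ))
        where
        go : (D : Dec (lookup z k ≡ 0ℤ)) → (lookup z k ≡ 0ℤ × (if does (¬? D) then lookup x k else 0ℤ) ≡ 0ℤ) ⊎ (lookup z k ≢ 0ℤ × (if does (¬? D) then lookup x k else 0ℤ) ≡ lookup x k)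
        go (yes p) = inj₁ (p , refl)
        go (no np) = inj₂ (np , refl)

      -- The mask brings `V i` into the orthant σ; restricting to the support of `z` makes every
      -- coordinate wall that vanishes on `z` vanish here as well.
      vtx : Fin n → Vec ℤ d
      vtx i = trunc support (trunc (mask (V i)) (V i))

      vtx-isV : ∀ i → IsV (vtx i)
      vtx-isV i j = subst (_≤ 1ℤ) (sym (trunc-∙ support (W j) (trunc (mask (V i)) (V i)))) (pair-bound {trunc support (W j)} {trunc (mask (V i)) (V i)} (trunc-W support {W j} (W-isW j)) (trunc-V (mask (V i)) i))

      vtx-compatible : ∀ i → Compatible σ (vtx i)
      vtx-compatible i k = go (on-support (trunc (mask (V i)) (V i)) k)
        where
        go : _ → 0ℤ ≤ lookup σ k * lookup (vtx i) k
        go (inj₁ (_ , e)) = subst (λ t → 0ℤ ≤ lookup σ k * t) (sym e) (ℤₚ.≤-reflexive (sym (ℤₚ.*-zeroʳ (lookup σ k))))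
        go (inj₂ (_ , e)) = subst (λ t → 0ℤ ≤ lookup σ k * t) (sym e) (masked-compatible (V i) k)

      on-support-∙ : ∀ u → trunc support u ∙ z ≡ u ∙ z
      on-support-∙ u = trans (∙-∑ (trunc support u) z) (trans (∑ℤ.sum-cong (λ k → go k (on-support u k))) (sym (∙-∑ u z)))
        where
        go : ∀ k → _ → lookup (trunc support u) k * lookup z k ≡ lookup u k * lookup z k
        go k (inj₁ (zk , _)) = trans (cong (lookup (trunc support u) k *_) zk) (trans (ℤₚ.*-zeroʳ (lookup (trunc support u) k)) (sym (trans (cong (lookup u k *_) zk) (ℤₚ.*-zeroʳ (lookup u k)))))
        go k (inj₂ (_ , e)) = cong (_* lookup z k) e

      on-support-V : ∀ {u} → Compatible σ u → ∀ i → trunc support u ∙ V i ≤ u ∙ vtx i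
      on-support-V {u} cu i = subst (trunc support u ∙ V i ≤_) (sym (trunc-∙ support u (trunc (mask (V i)) (V i))))
          (subst₂ _≤_ (∙-comm (V i) (trunc support u)) (∙-comm (trunc (mask (V i)) (V i)) (trunc support u))
            (∙-mono (V i) (trunc support u) (trunc (mask (V i)) (V i)) (trunc support u) (masked-increases (V i) {trunc support u} supp-compatible)))
        where
        supp-compatible : Compatible σ (trunc support u)
        supp-compatible k = go (on-support u k)
          where
          go : _ → 0ℤ ≤ lookup σ k * lookup (trunc support u) k
          go (inj₁ (_ , e)) = subst (λ t → 0ℤ ≤ lookup σ k * t) (sym e) (ℤₚ.≤-reflexive (sym (ℤₚ.*-zeroʳ (lookup σ k))))
          go (inj₂ (_ , e)) = subst (λ t → 0ℤ ≤ lookup σ k * t) (sym e) (cu k)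

      Representation : Set
      Representation = Σ ℤ λ p → 0ℤ < p × Σ (Fin n → ℤ) λ c → (∀ i → 0ℤ ≤ c i) × ∑ c ≡ p * N × (∀ u → ∑ (λ i → c i * (u ∙ V i)) ≡ p * (u ∙ z))

      -- For each such `u` the weighted sum of the values at the truncated vertices is at least the
      -- total weight, while no value exceeds 1. So every vertex of positive weight is tight, and
      -- one index serves all `u`.
      pick : Representation → ∃ λ i → ∀ {u} → IsW u → Compatible σ u → u ∙ z ≡ N → u ∙ vtx i ≡ 1ℤ
      pick (p , 0<p , c , c≥0 , total , eq) = let i , 0<ci = some-positive (subst (0ℤ <_) (sym total) (0<* 0<p 0<N)) in i , λ {u} isW cu e → tight {u} isW cu e i 0<ci
        where
        tight : ∀ {u} → IsW u → Compatible σ u → u ∙ z ≡ N → ∀ i → 0ℤ < c i → u ∙ vtx i ≡ 1ℤ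
        tight {u} isW cu e i 0<ci = sym (ℤₚ.i-j≡0⇒i≡j 1ℤ (u ∙ vtx i) (cancel (ℤₚ.i*j≡0⇒i≡0∨j≡0 (c i) (∑-zero-terms (λ i → 0≤* (c≥0 i) (ℤₚ.i≤j⇒0≤j-i (pair-bound {u} {vtx i} isW (vtx-isV i)))) slack i))))
          where
          cancel : c i ≡ 0ℤ ⊎ 1ℤ - u ∙ vtx i ≡ 0ℤ → 1ℤ - u ∙ vtx i ≡ 0ℤ
          cancel (inj₁ ci≡0) = contradiction 0<ci (ℤₚ.<-irrefl (sym ci≡0))
          cancel (inj₂ e') = e'
          lower : p * N ≤ ∑ (λ i → c i * (u ∙ vtx i))
          lower = subst (_≤ ∑ (λ i → c i * (u ∙ vtx i))) (trans (eq (trunc support u)) (cong (p *_) (trans (on-support-∙ u) e)))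
            (∑-mono (λ i → ℤₚ.*-monoˡ-≤-nonNeg (c i) {{ℤ.nonNegative (c≥0 i)}} (on-support-V {u} cu i)))
          slack : ∑ (λ i → c i * (1ℤ - u ∙ vtx i)) ≤ 0ℤ
          slack = subst (_≤ 0ℤ) (sym (trans (∑ℤ.sum-cong (λ i → trans (*-sub (c i) 1ℤ (u ∙ vtx i)) (cong (_- c i * (u ∙ vtx i)) (ℤₚ.*-identityʳ (c i))))) (∑-sub c (λ i → c i * (u ∙ vtx i)))))
            (ℤₚ.i≤j⇒i-j≤0 (subst (_≤ ∑ (λ i → c i * (u ∙ vtx i))) (sym total) lower))

      progress′ : ∃ λ x → IsV x × x ≢ 𝟘 × (σ ⊞ u₀) ∙ x ≡ norm₁ x + 1ℤ × (∀ {μ} → μ ∈ wallsOf σ u₀ → μ ∙ z ≡ 0ℤ → μ ∙ x ≡ 0ℤ)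
      progress′ = finish (pick (bipolar z N 0<N W-bound))
        where
        finish : (∃ λ i → ∀ {u} → IsW u → Compatible σ u → u ∙ z ≡ N → u ∙ vtx i ≡ 1ℤ) → _
        finish (i , tight) = vtx i , vtx-isV i , (λ e → contradiction (trans (sym u₀1) (trans (cong (u₀ ∙_) e) (∙-𝟘 u₀))) λ ()) , cell-tight {vtx i} (vtx-compatible i) u₀1 ,
            λ {μ} → walls-elim {σ} {u₀} (λ μ → μ ∙ z ≡ 0ℤ → μ ∙ vtx i ≡ 0ℤ) axis functional {μ}
          where
          u₀1 : u₀ ∙ vtx i ≡ 1ℤ
          u₀1 = tight {u₀} u₀-isW compatible refl
          axis : ∀ k → (lookup σ k ⊡ unit k) ∙ z ≡ 0ℤ → (lookup σ k ⊡ unit k) ∙ vtx i ≡ 0ℤ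
          axis k e = trans (axis-∙ (lookup σ k) k (vtx i)) (go (on-support (trunc (mask (V i)) (V i)) k))
            where
            go : _ → lookup σ k * lookup (vtx i) k ≡ 0ℤ
            go (inj₁ (_ , e')) = trans (cong (lookup σ k *_) e') (ℤₚ.*-zeroʳ (lookup σ k))
            go (inj₂ (zk≢0 , _)) = contradiction (trans (sym (trans (cong (_* lookup z k) (sign-square (σ-sign k))) (ℤₚ.*-identityˡ _))) (trans (ℤₚ.*-assoc (lookup σ k) (lookup σ k) (lookup z k))
              (trans (cong (lookup σ k *_) (trans (sym (axis-∙ (lookup σ k) k z)) e)) (ℤₚ.*-zeroʳ (lookup σ k))))) zk≢0
          functional : ∀ u → IsW u → Compatible σ u → (u₀ ⊞ (-1ℤ ⊡ u)) ∙ z ≡ 0ℤ → (u₀ ⊞ (-1ℤ ⊡ u)) ∙ vtx i ≡ 0ℤ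
          functional u isW cu e = trans (diff-∙ u₀ u (vtx i)) (cong₂ _-_ u₀1 (tight {u} isW cu (sym (ℤₚ.i-j≡0⇒i≡j N (u ∙ z) (trans (sym (diff-∙ u₀ u z)) e)))))

    cellComplex : Cells d (length vertexList)
    cellComplex = record
      { v = vertex
      ; height = λ k → norm₁ (vertex k) + 1ℤ
      ; cells = length cellList
      ; π = λ q → σ q ⊞ u₀ q
      ; walls = λ q → wallsOf (σ q) (u₀ q)
      ; π-le = λ q k → InCell.π-bound (good-cell q) {vertex k} (proj₁ (vertex-props k))
      ; wall-01 = λ q k e → InCell.wall-values (good-cell q) {vertex k} (proj₁ (vertex-props k)) (InCell.tight-σ (good-cell q) {vertex k} (proj₁ (vertex-props k)) e) (InCell.tight-u₀ (good-cell q) {vertex k} (proj₁ (vertex-props k)) e)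
      ; wall-1 = λ q k e → InCell.wall-one (good-cell q) {vertex k} (proj₁ (vertex-props k)) (proj₂ (vertex-props k)) (InCell.tight-σ (good-cell q) {vertex k} (proj₁ (vertex-props k)) e)
      ; covers = covers
      ; progress = progress }
      where
      σ u₀ : Fin (length cellList) → Vec ℤ d
      σ q = proj₁ (List.lookup cellList q)
      u₀ q = proj₂ (List.lookup cellList q)
      covers : ∀ z → ∃ λ q → Closed (σ q) (u₀ q) z
      covers z = let s , u , good , closed = cell-containing z
                     q , e = cell-index good in
        q , subst (λ p → Closed (proj₁ p) (proj₂ p) z) (sym e) (λ {μ} → closed {μ})
      progress : ∀ q z → z ≢ 𝟘 → Closed (σ q) (u₀ q) z → ∃ λ k → (σ q ⊞ u₀ q) ∙ vertex k ≡ norm₁ (vertex k) + 1ℤ × (∀ {μ} → μ ∈ wallsOf (σ q) (u₀ q) → μ ∙ z ≡ 0ℤ → μ ∙ vertex k ≡ 0ℤ)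
      progress q z z≢𝟘 closed = let x , isV , x≢𝟘 , tight , zero-on = Progress.progress′ {σ q} {u₀ q} {z} (good-cell q) z≢𝟘 (λ {μ} → closed {μ})
                                    k , e = vertex-index {x} isV x≢𝟘 in
        k , subst (λ x → (σ q ⊞ u₀ q) ∙ x ≡ norm₁ x + 1ℤ) (sym e) tight , λ {μ} μ∈ e0 → subst (λ x → μ ∙ x ≡ 0ℤ) (sym e) (zero-on μ∈ e0)

-- Rational points and integer weights

module RationalPoints where
  import Data.Nat.Coprimality as Coprime
  open import Data.Integer as ℤ using (ℤ; +_; 0ℤ; 1ℤ)
  import Data.Integer.Properties as ℤₚ
  open import Data.Rational as ℚ using (ℚ; 0ℚ; 1ℚ; mkℚ; ↥_; ↧_)
  import Data.Rational.Properties as ℚₚ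
  import Data.Rational.Unnormalised as ℚᵘ
  import Data.Rational.Unnormalised.Properties as ℚᵘₚ
  open import Data.Vec using (zipWith; replicate)
  open import Data.Vec.Properties using (lookup-replicate; lookup-zipWith; lookup-map)
  open import Relation.Binary.PropositionalEquality using (_≡_; refl; sym; trans; cong; cong₂; subst; subst₂)
  open IntegerVectors

  fromℤ : ℤ → ℚ
  fromℤ z = z ℚ./ 1

  -- The normal form of an integer as a fraction, on which rational operations compute; `fromℤ` has
  -- to normalise first.
  integral : ℤ → ℚ
  integral z = mkℚ z 0 (Coprime.sym (Coprime.1-coprimeTo ℤ.∣ z ∣))

  fromℤ-integral : ∀ z → fromℤ z ≡ integral z
  fromℤ-integral z = ℚₚ.↥p/↧p≡p (integral z)

  fromℤ-+ : ∀ x y → fromℤ x ℚ.+ fromℤ y ≡ fromℤ (x ℤ.+ y)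
  fromℤ-+ x y = trans (cong₂ ℚ._+_ (fromℤ-integral x) (fromℤ-integral y)) (cong fromℤ (cong₂ ℤ._+_ (ℤₚ.*-identityʳ x) (ℤₚ.*-identityʳ y)))

  fromℤ-* : ∀ x y → fromℤ x ℚ.* fromℤ y ≡ fromℤ (x ℤ.* y)
  fromℤ-* x y = cong₂ ℚ._*_ (fromℤ-integral x) (fromℤ-integral y)

  fromℤ-≤ : ∀ {x y} → x ℤ.≤ y → fromℤ x ℚ.≤ fromℤ y
  fromℤ-≤ {x} {y} le = subst₂ ℚ._≤_ (sym (fromℤ-integral x)) (sym (fromℤ-integral y)) (ℚ.*≤* (subst₂ ℤ._≤_ (sym (ℤₚ.*-identityʳ x)) (sym (ℤₚ.*-identityʳ y)) le))

  fromℤ-≤⁻ : ∀ {x y} → fromℤ x ℚ.≤ fromℤ y → x ℤ.≤ y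
  fromℤ-≤⁻ {x} {y} le = subst₂ ℤ._≤_ (ℤₚ.*-identityʳ x) (ℤₚ.*-identityʳ y) (ℚₚ.drop-*≤* (subst₂ ℚ._≤_ (fromℤ-integral x) (fromℤ-integral y) le))

  fromℤ-< : ∀ {x y} → x ℤ.< y → fromℤ x ℚ.< fromℤ y
  fromℤ-< lt = ℚₚ.≰⇒> (λ le → ℤₚ.<⇒≱ lt (fromℤ-≤⁻ le))

  reciprocal : ∀ t → 0ℤ ℤ.< t → Σ ℚ λ r → 0ℚ ℚ.≤ r × r ℚ.* fromℤ t ≡ 1ℚ
  reciprocal t 0<t = r , ℚₚ.<⇒≤ (ℚₚ.positive⁻¹ r {{ℚₚ.1/pos⇒pos (fromℤ t) {{pos}}}}) , ℚₚ.*-inverseˡ (fromℤ t) {{nz}}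
    where
    pos : ℚ.Positive (fromℤ t)
    pos = ℚ.positive (fromℤ-< 0<t)
    nz : ℚ.NonZero (fromℤ t)
    nz = ℚₚ.pos⇒nonZero (fromℤ t) {{pos}}
    r : ℚ
    r = ℚ.1/_ (fromℤ t) {{nz}}

  *-mono-≤ : ∀ {r x y} → 0ℚ ℚ.≤ r → x ℚ.≤ y → r ℚ.* x ℚ.≤ r ℚ.* y
  *-mono-≤ {r} 0≤r = ℚₚ.*-monoˡ-≤-nonNeg r {{ℚ.nonNegative 0≤r}}

  *-nonneg : ∀ {x y} → 0ℚ ℚ.≤ x → 0ℚ ℚ.≤ y → 0ℚ ℚ.≤ x ℚ.* y
  *-nonneg {x} {y} hx hy = subst (ℚ._≤ x ℚ.* y) (ℚₚ.*-zeroʳ x) (*-mono-≤ hx hy)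

  sumF-cong : ∀ {k} {s t : Fin k → ℚ} → (∀ i → s i ≡ t i) → sumF s ≡ sumF t
  sumF-cong {zero} h = refl
  sumF-cong {suc k} h = cong₂ ℚ._+_ (h zero) (sumF-cong (h ∘ suc))

  sumF-mono : ∀ {k} {s t : Fin k → ℚ} → (∀ i → s i ℚ.≤ t i) → sumF s ℚ.≤ sumF t
  sumF-mono {zero} h = ℚₚ.≤-refl
  sumF-mono {suc k} h = ℚₚ.+-mono-≤ (h zero) (sumF-mono (h ∘ suc))

  sumF-*ˡ : ∀ {k} r (t : Fin k → ℚ) → r ℚ.* sumF t ≡ sumF (λ i → r ℚ.* t i)
  sumF-*ˡ {zero} r t = ℚₚ.*-zeroʳ r
  sumF-*ˡ {suc k} r t = trans (ℚₚ.*-distribˡ-+ r (t zero) (sumF (t ∘ suc))) (cong (r ℚ.* t zero ℚ.+_) (sumF-*ˡ r (t ∘ suc)))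

  sumF-*ʳ : ∀ {k} r (t : Fin k → ℚ) → sumF t ℚ.* r ≡ sumF (λ i → t i ℚ.* r)
  sumF-*ʳ r t = trans (ℚₚ.*-comm (sumF t) r) (trans (sumF-*ˡ r t) (sumF-cong (λ i → ℚₚ.*-comm r (t i))))

  sumF-fromℤ : ∀ {k} (t : Fin k → ℤ) → sumF (λ i → fromℤ (t i)) ≡ fromℤ (∑ t)
  sumF-fromℤ {zero} t = cong fromℤ (sym (∑ℤ.sum-nil t))
  sumF-fromℤ {suc k} t = trans (cong (fromℤ (t zero) ℚ.+_) (sumF-fromℤ (t ∘ suc))) (trans (fromℤ-+ (t zero) (∑ (t ∘ suc))) (cong fromℤ (sym (∑ℤ.sum-suc t))))

  sumF-nonneg : ∀ {k} {t : Fin k → ℚ} → (∀ i → 0ℚ ℚ.≤ t i) → 0ℚ ℚ.≤ sumF t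
  sumF-nonneg {zero} h = ℚₚ.≤-refl
  sumF-nonneg {suc k} {t} h = subst (ℚ._≤ sumF t) (ℚₚ.+-identityˡ 0ℚ) (ℚₚ.+-mono-≤ (h zero) (sumF-nonneg (h ∘ suc)))

  sumF-zero-terms : ∀ {k} {t : Fin k → ℚ} → (∀ i → 0ℚ ℚ.≤ t i) → sumF t ℚ.≤ 0ℚ → ∀ i → t i ≡ 0ℚ
  sumF-zero-terms {suc k} {t} h le zero = ℚₚ.≤-antisym (ℚₚ.≤-trans (subst (ℚ._≤ sumF t) (ℚₚ.+-identityʳ (t zero)) (ℚₚ.+-mono-≤ (ℚₚ.≤-refl {t zero}) (sumF-nonneg (h ∘ suc)))) le) (h zero)
  sumF-zero-terms {suc k} {t} h le (suc i) = sumF-zero-terms (h ∘ suc) (ℚₚ.≤-trans (subst (ℚ._≤ sumF t) (ℚₚ.+-identityˡ (sumF (t ∘ suc))) (ℚₚ.+-mono-≤ (h zero) (ℚₚ.≤-refl {sumF (t ∘ suc)}))) le) i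

  interchange : ∀ a b c d → (a ℚ.+ b) ℚ.+ (c ℚ.+ d) ≡ (a ℚ.+ c) ℚ.+ (b ℚ.+ d)
  interchange a b c d = trans (ℚₚ.+-assoc a b (c ℚ.+ d)) (trans (cong (a ℚ.+_) (trans (sym (ℚₚ.+-assoc b c d)) (trans (cong (ℚ._+ d) (ℚₚ.+-comm b c)) (ℚₚ.+-assoc c b d)))) (sym (ℚₚ.+-assoc a c (b ℚ.+ d))))

  sumF-+ : ∀ {k} (s t : Fin k → ℚ) → sumF (λ i → s i ℚ.+ t i) ≡ sumF s ℚ.+ sumF t
  sumF-+ {zero} s t = sym (ℚₚ.+-identityˡ 0ℚ)
  sumF-+ {suc k} s t = trans (cong (s zero ℚ.+ t zero ℚ.+_) (sumF-+ (s ∘ suc) (t ∘ suc))) (interchange (s zero) (t zero) (sumF (s ∘ suc)) (sumF (t ∘ suc)))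

  dot-scaleˡ : ∀ {d} r (x y : Pt d) → dot (scale r x) y ≡ r ℚ.* dot x y
  dot-scaleˡ r [] [] = sym (ℚₚ.*-zeroʳ r)
  dot-scaleˡ r (x ∷ xs) (y ∷ ys) = trans (cong₂ ℚ._+_ (ℚₚ.*-assoc r x y) (dot-scaleˡ r xs ys)) (sym (ℚₚ.*-distribˡ-+ r (x ℚ.* y) (dot xs ys)))

  dot-+ˡ : ∀ {d} (x x' y : Pt d) → dot (zipWith ℚ._+_ x x') y ≡ dot x y ℚ.+ dot x' y
  dot-+ˡ [] [] [] = sym (ℚₚ.+-identityˡ 0ℚ)
  dot-+ˡ (x ∷ xs) (x' ∷ xs') (y ∷ ys) = trans (cong₂ ℚ._+_ (ℚₚ.*-distribʳ-+ y x x') (dot-+ˡ xs xs' ys)) (interchange (x ℚ.* y) (x' ℚ.* y) (dot xs ys) (dot xs' ys))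

  dot-0ˡ : ∀ {d} (y : Pt d) → dot (replicate d 0ℚ) y ≡ 0ℚ
  dot-0ˡ [] = refl
  dot-0ˡ (y ∷ ys) = trans (cong₂ ℚ._+_ (ℚₚ.*-zeroˡ y) (dot-0ˡ ys)) (ℚₚ.+-identityˡ 0ℚ)

  dot-comm : ∀ {d} (x y : Pt d) → dot x y ≡ dot y x
  dot-comm [] [] = refl
  dot-comm (x ∷ xs) (y ∷ ys) = cong₂ ℚ._+_ (ℚₚ.*-comm x y) (dot-comm xs ys)

  dot-embed : ∀ {d} (x y : Vec ℤ d) → dot (embed x) (embed y) ≡ fromℤ (x ∙ y)
  dot-embed [] [] = refl
  dot-embed (x ∷ xs) (y ∷ ys) = trans (cong₂ ℚ._+_ (fromℤ-* x y) (dot-embed xs ys)) (fromℤ-+ (x ℤ.* y) (xs ∙ ys))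

  dot-sumV : ∀ {d k} (f : Fin k → Pt d) y → dot (sumV f) y ≡ sumF (λ i → dot (f i) y)
  dot-sumV {k = zero} f y = dot-0ˡ y
  dot-sumV {k = suc k} f y = trans (dot-+ˡ (f zero) (sumV (f ∘ suc)) y) (cong (dot (f zero) y ℚ.+_) (dot-sumV (f ∘ suc) y))

  lookup-sumV : ∀ {d k} (f : Fin k → Pt d) j → lookup (sumV f) j ≡ sumF (λ i → lookup (f i) j)
  lookup-sumV {k = zero} f j = lookup-replicate j 0ℚ
  lookup-sumV {k = suc k} f j = trans (lookup-zipWith ℚ._+_ j (f zero) (sumV (f ∘ suc))) (cong (lookup (f zero) j ℚ.+_) (lookup-sumV (f ∘ suc) j))

  dot-convex : ∀ {d k} (X : Fin k → Pt d) {ok x} (conv : InConvSupp X ok x) y → dot x y ≡ sumF (λ i → proj₁ conv i ℚ.* dot (X i) y)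
  dot-convex X (c , c≥0 , total , eq , _) y = trans (cong (λ x → dot x y) (sym eq)) (trans (dot-sumV (λ i → scale (c i) (X i)) y) (sumF-cong (λ i → dot-scaleˡ (c i) (X i) y)))

  convex-bound : ∀ {d k} (X : Fin k → Pt d) {x} → InConv X x → ∀ y B → (∀ i → dot (X i) y ℚ.≤ B) → dot x y ℚ.≤ B
  convex-bound X conv@(c , c≥0 , total , eq , _) y B h = subst₂ ℚ._≤_ (sym (dot-convex X conv y)) (trans (sym (sumF-*ʳ B c)) (trans (cong (ℚ._* B) total) (ℚₚ.*-identityˡ B)))
    (sumF-mono (λ i → *-mono-≤ (c≥0 i) (h i)))

  lookup-embed : ∀ {d} (z : Vec ℤ d) j → lookup (embed z) j ≡ fromℤ (lookup z j)
  lookup-embed z j = lookup-map j fromℤ z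

  lookup-scale : ∀ {d} r (x : Pt d) j → lookup (scale r x) j ≡ r ℚ.* lookup x j
  lookup-scale r x j = lookup-map j (r ℚ.*_) x

  lookup-comb : ∀ {k d} (c : Fin k → ℤ) (X : Fin k → Vec ℤ d) j → lookup (comb c X) j ≡ ∑ (λ i → c i ℤ.* lookup (X i) j)
  lookup-comb c X j = trans (sym (unit-∙ j (comb c X))) (trans (∙-comb (unit j) c X) (∑ℤ.sum-cong (λ i → cong (c i ℤ.*_) (unit-∙ j (X i)))))

  integral-convex : ∀ {k d} (X : Fin k → Vec ℤ d) (c : Fin k → ℤ) → (∀ i → 0ℤ ℤ.≤ c i) → ∀ {q} → 0ℤ ℤ.< q → ∑ c ≡ q →
    ∀ {x : Pt d} → scale (fromℤ q) x ≡ embed (comb c X) → InConv (λ i → embed (X i)) x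
  integral-convex {k} {d} X c c≥0 {q} 0<q total {x} eq = go (reciprocal q 0<q)
    where
    go : (Σ ℚ λ r → 0ℚ ℚ.≤ r × r ℚ.* fromℤ q ≡ 1ℚ) → InConv (λ i → embed (X i)) x
    go (r , r≥0 , rq) = (λ i → r ℚ.* fromℤ (c i)) , (λ i → *-nonneg r≥0 (fromℤ-≤ (c≥0 i))) ,
        trans (sym (sumF-*ˡ r (λ i → fromℤ (c i)))) (trans (cong (r ℚ.*_) (trans (sumF-fromℤ c) (cong fromℤ total))) rq) ,
        lookup-ext coordinate , λ _ _ → record {}
      where
      coordinate : ∀ j → lookup (sumV (λ i → scale (r ℚ.* fromℤ (c i)) (embed (X i)))) j ≡ lookup x j
      coordinate j = trans (lookup-sumV (λ i → scale (r ℚ.* fromℤ (c i)) (embed (X i))) j)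
        (trans (sumF-cong (λ i → trans (lookup-scale (r ℚ.* fromℤ (c i)) (embed (X i)) j) (trans (cong (r ℚ.* fromℤ (c i) ℚ.*_) (lookup-embed (X i) j))
          (trans (ℚₚ.*-assoc r (fromℤ (c i)) (fromℤ (lookup (X i) j))) (cong (r ℚ.*_) (fromℤ-* (c i) (lookup (X i) j)))))))
        (trans (sym (sumF-*ˡ r (λ i → fromℤ (c i ℤ.* lookup (X i) j)))) (trans (cong (r ℚ.*_) (trans (sumF-fromℤ (λ i → c i ℤ.* lookup (X i) j)) (trans (cong fromℤ (sym (lookup-comb c X j)))
          (trans (sym (lookup-embed (comb c X) j)) (trans (cong (λ y → lookup y j) (sym eq)) (lookup-scale (fromℤ q) x j))))))
        (trans (sym (ℚₚ.*-assoc r (fromℤ q) (lookup x j))) (trans (cong (ℚ._* lookup x j) rq) (ℚₚ.*-identityˡ (lookup x j)))))))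

  clear-denominator : ∀ x → fromℤ (↧ x) ℚ.* x ≡ fromℤ (↥ x)
  clear-denominator x@(mkℚ m n-1 _) = trans (cong (ℚ._* x) (fromℤ-integral (↧ x))) (trans (ℚₚ.toℚᵘ-injective (ℚᵘₚ.≃-trans (ℚₚ.toℚᵘ-homo-* (integral (↧ x)) x)
    (ℚᵘ.*≡* (trans (ℤₚ.*-identityʳ (+ suc n-1 ℤ.* m)) (trans (ℤₚ.*-comm (+ suc n-1) m) (cong (λ t → m ℤ.* + t) (sym (ℕₚ.*-identityˡ (suc n-1))))))))) (sym (fromℤ-integral m)))

  common-denominator : ∀ {d} (x : Pt d) → Σ ℤ λ q → 0ℤ ℤ.< q × Σ (Vec ℤ d) λ z → scale (fromℤ q) x ≡ embed z
  common-denominator [] = 1ℤ , ℤ.+<+ (s≤s z≤n) , [] , refl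
  common-denominator (x ∷ xs) with common-denominator xs
  ... | q , 0<q , z , eq = q ℤ.* ↧ x , 0<* 0<q (ℤ.+<+ (s≤s z≤n)) , (q ℤ.* ↥ x) ∷ (↧ x ⊡ z) , cong₂ _∷_ head tail
    where
    head : fromℤ (q ℤ.* ↧ x) ℚ.* x ≡ fromℤ (q ℤ.* ↥ x)
    head = trans (cong (ℚ._* x) (sym (fromℤ-* q (↧ x)))) (trans (ℚₚ.*-assoc (fromℤ q) (fromℤ (↧ x)) x) (trans (cong (fromℤ q ℚ.*_) (clear-denominator x)) (fromℤ-* q (↥ x))))
    tail : scale (fromℤ (q ℤ.* ↧ x)) xs ≡ embed (↧ x ⊡ z)
    tail = lookup-ext λ j → trans (lookup-scale (fromℤ (q ℤ.* ↧ x)) xs j) (trans (cong (ℚ._* lookup xs j) (trans (cong fromℤ (ℤₚ.*-comm q (↧ x))) (sym (fromℤ-* (↧ x) q))))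
      (trans (ℚₚ.*-assoc (fromℤ (↧ x)) (fromℤ q) (lookup xs j)) (trans (cong (fromℤ (↧ x) ℚ.*_) (trans (sym (lookup-scale (fromℤ q) xs j)) (trans (cong (λ y → lookup y j) eq) (lookup-embed z j))))
      (trans (fromℤ-* (↧ x) (lookup z j)) (trans (cong fromℤ (sym (lookup-map j (↧ x ℤ.*_) z))) (sym (lookup-embed (↧ x ⊡ z) j)))))))

-- Farkas' lemma and the bipolar theorem

module PolarDuality where
  open import Data.Bool using (Bool; true; false; if_then_else_)
  open import Data.Integer as ℤ using (ℤ; +_; -[1+_]; 0ℤ; 1ℤ; -1ℤ; ∣_∣)
  import Data.Integer.Properties as ℤₚ
  open import Data.Integer.Tactic.RingSolver using (solve-∀)
  open import Data.Rational as ℚ using (ℚ; 0ℚ; 1ℚ)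
  import Data.Rational.Properties as ℚₚ
  open import Data.Vec using (tabulate; map)
  open import Data.Vec.Properties using (lookup-replicate; lookup-map; lookup∘tabulate; ≡-dec)
  open import Data.Empty using (⊥; ⊥-elim)
  open import Relation.Binary.PropositionalEquality using (_≡_; _≢_; refl; sym; trans; cong; cong₂; subst; subst₂)
  open IntegerVectors
  open Fans using (nonzero-coordinate)
  open RationalPoints
  open DualPolytopes using (DualPair; trunc; lookup-trunc)

  square≥0 : ∀ x → 0ℤ ℤ.≤ x ℤ.* x
  square≥0 (+ n) = 0≤* {+ n} {+ n} (ℤ.+≤+ z≤n) (ℤ.+≤+ z≤n)
  square≥0 -[1+ n ] = ℤ.+≤+ z≤n

  ∙-self : ∀ {d} (b : Vec ℤ d) → b ≢ 𝟘 → 0ℤ ℤ.< b ∙ b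
  ∙-self b ne = let k , bk≢0 = nonzero-coordinate b ne in
    ℤₚ.<-≤-trans (ℤₚ.≤∧≢⇒< (square≥0 (lookup b k)) (λ e → bk≢0 (root (ℤₚ.i*j≡0⇒i≡0∨j≡0 (lookup b k) (sym e)))))
      (subst (lookup b k ℤ.* lookup b k ℤ.≤_) (sym (∙-∑ b b)) (∑-term≤ (λ k → square≥0 (lookup b k)) k))
    where
    root : ∀ {x} → x ≡ 0ℤ ⊎ x ≡ 0ℤ → x ≡ 0ℤ
    root (inj₁ e) = e
    root (inj₂ e) = e

  Nonnegative-combination : ∀ {n d} → (Fin n → Vec ℤ d) → Vec ℤ d → Set
  Nonnegative-combination {n} a b = Σ ℤ λ p → 0ℤ ℤ.< p × Σ (Fin n → ℤ) λ c → (∀ i → 0ℤ ℤ.≤ c i) × (∀ u → ∑ (λ i → c i ℤ.* (u ∙ a i)) ≡ p ℤ.* (u ∙ b))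

  Separated : ∀ {n d} → (Fin n → Vec ℤ d) → Vec ℤ d → Set
  Separated a b = ∃ λ x → (∀ i → a i ∙ x ℤ.≤ 0ℤ) × 0ℤ ℤ.< b ∙ x

  -- Farkas' lemma by induction on the number of generators (Bartl): if x separates b from all
  -- generators but a zero, eliminate a zero by projecting along x.
  farkas : ∀ {n d} (a : Fin n → Vec ℤ d) b → Nonnegative-combination a b ⊎ Separated a b
  farkas {zero} a b = go (≡-dec ℤ._≟_ b 𝟘)
    where
    go : Dec (b ≡ 𝟘) → Nonnegative-combination a b ⊎ Separated a b
    go (yes refl) = inj₁ (1ℤ , ℤ.+<+ (s≤s z≤n) , (λ ()) , (λ ()) , λ u → trans (∑ℤ.sum-nil _) (sym (trans (ℤₚ.*-identityˡ (u ∙ 𝟘)) (∙-𝟘 u))))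
    go (no ne) = inj₂ (b , (λ ()) , ∙-self b ne)
  farkas {suc n} {d} a b = first (farkas (a ∘ suc) b)
    where
    first : Nonnegative-combination (a ∘ suc) b ⊎ Separated (a ∘ suc) b → Nonnegative-combination a b ⊎ Separated a b
    first (inj₁ (p , 0<p , c , c≥0 , eq)) = inj₁ (p , 0<p , c' , (λ { zero → ℤₚ.≤-refl ; (suc i) → c≥0 i }) ,
        λ u → trans (∑ℤ.sum-suc (λ i → c' i ℤ.* (u ∙ a i))) (trans (ℤₚ.+-identityˡ _) (eq u)))
      where
      c' : Fin (suc n) → ℤ
      c' zero = 0ℤ
      c' (suc i) = c i
    first (inj₂ (x₀ , neg , pos)) = second (a zero ∙ x₀ ℤₚ.≤? 0ℤ)
      where
      second : Dec (a zero ∙ x₀ ℤ.≤ 0ℤ) → Nonnegative-combination a b ⊎ Separated a b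
      second (yes le) = inj₂ (x₀ , (λ { zero → le ; (suc i) → neg i }) , pos)
      second (no gt) = third (farkas (λ i → project (a (suc i))) (project b))
        where
        t : ℤ
        t = a zero ∙ x₀
        0<t : 0ℤ ℤ.< t
        0<t = ℤₚ.≰⇒> gt
        project : Vec ℤ d → Vec ℤ d
        project y = (t ⊡ y) ⊞ ((ℤ.- (y ∙ x₀)) ⊡ a zero)
        ∙-project : ∀ u y → u ∙ project y ≡ t ℤ.* (u ∙ y) ℤ.- (y ∙ x₀) ℤ.* (u ∙ a zero)
        ∙-project u y = trans (∙-⊞ u (t ⊡ y) ((ℤ.- (y ∙ x₀)) ⊡ a zero)) (cong₂ ℤ._+_ (∙-⊡ u t y)
          (trans (∙-⊡ u (ℤ.- (y ∙ x₀)) (a zero)) (sym (ℤₚ.neg-distribˡ-* (y ∙ x₀) (u ∙ a zero)))))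
        third : Nonnegative-combination (λ i → project (a (suc i))) (project b) ⊎ Separated (λ i → project (a (suc i))) (project b) → Nonnegative-combination a b ⊎ Separated a b
        third (inj₁ (p , 0<p , c , c≥0 , eq)) = inj₁ (p ℤ.* t , 0<* 0<p 0<t , c' , c'≥0 , λ u → trans (∑ℤ.sum-suc (λ i → c' i ℤ.* (u ∙ a i))) (total u))
          where
          S : ℤ
          S = ∑ (λ i → c i ℤ.* (a (suc i) ∙ x₀))
          c' : Fin (suc n) → ℤ
          c' zero = p ℤ.* (b ∙ x₀) ℤ.- S
          c' (suc i) = c i ℤ.* t
          c'≥0 : ∀ i → 0ℤ ℤ.≤ c' i
          c'≥0 zero = ℤₚ.i≤j⇒0≤j-i (ℤₚ.≤-trans (subst (S ℤ.≤_) (∑ℤ.sum-zero {n} {λ _ → 0ℤ} (λ _ → refl)) (∑-mono (λ i → subst (c i ℤ.* (a (suc i) ∙ x₀) ℤ.≤_) (ℤₚ.*-zeroʳ (c i))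
            (ℤₚ.*-monoˡ-≤-nonNeg (c i) {{ℤ.nonNegative (c≥0 i)}} (neg i))))) (ℤₚ.<⇒≤ (0<* 0<p pos)))
          c'≥0 (suc i) = 0≤* (c≥0 i) (ℤₚ.<⇒≤ 0<t)
          total : ∀ u → (p ℤ.* (b ∙ x₀) ℤ.- S) ℤ.* (u ∙ a zero) ℤ.+ ∑ (λ i → c i ℤ.* t ℤ.* (u ∙ a (suc i))) ≡ p ℤ.* t ℤ.* (u ∙ b)
          total u = trans (cong (λ s → (p ℤ.* (b ∙ x₀) ℤ.- S) ℤ.* (u ∙ a zero) ℤ.+ s) expand)
              (trans (lemma p (b ∙ x₀) S (u ∙ a zero) (p ℤ.* (u ∙ project b))) (trans (cong (λ s → p ℤ.* (b ∙ x₀) ℤ.* (u ∙ a zero) ℤ.+ p ℤ.* s) (∙-project u b)) (lemma₂ p (b ∙ x₀) (u ∙ a zero) t (u ∙ b))))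
            where
            lemma : ∀ p x S y e → (p ℤ.* x ℤ.- S) ℤ.* y ℤ.+ (e ℤ.+ S ℤ.* y) ≡ p ℤ.* x ℤ.* y ℤ.+ e
            lemma = solve-∀
            lemma₂ : ∀ p x y t z → p ℤ.* x ℤ.* y ℤ.+ p ℤ.* (t ℤ.* z ℤ.- x ℤ.* y) ≡ p ℤ.* t ℤ.* z
            lemma₂ = solve-∀
            term : ∀ c t y x z → c ℤ.* t ℤ.* y ≡ c ℤ.* (t ℤ.* y ℤ.- x ℤ.* z) ℤ.+ c ℤ.* x ℤ.* z
            term = solve-∀
            expand : ∑ (λ i → c i ℤ.* t ℤ.* (u ∙ a (suc i))) ≡ p ℤ.* (u ∙ project b) ℤ.+ S ℤ.* (u ∙ a zero)
            expand = trans (∑ℤ.sum-cong (λ i → trans (term (c i) t (u ∙ a (suc i)) (a (suc i) ∙ x₀) (u ∙ a zero)) (cong (λ s → c i ℤ.* s ℤ.+ c i ℤ.* (a (suc i) ∙ x₀) ℤ.* (u ∙ a zero)) (sym (∙-project u (a (suc i)))))))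
              (trans (∑ℤ.sum-+ (λ i → c i ℤ.* (u ∙ project (a (suc i)))) (λ i → c i ℤ.* (a (suc i) ∙ x₀) ℤ.* (u ∙ a zero))) (cong₂ ℤ._+_ (eq u) (sym (∑ℤ.sum-*ʳ (u ∙ a zero) (λ i → c i ℤ.* (a (suc i) ∙ x₀))))))
        third (inj₂ (x₁ , neg₁ , pos₁)) = inj₂ (x , negative , subst (0ℤ ℤ.<_) (sym (along b)) pos₁)
          where
          x : Vec ℤ d
          x = (t ⊡ x₁) ⊞ ((ℤ.- (a zero ∙ x₁)) ⊡ x₀)
          ∙-x : ∀ y → y ∙ x ≡ t ℤ.* (y ∙ x₁) ℤ.- (a zero ∙ x₁) ℤ.* (y ∙ x₀)
          ∙-x y = trans (∙-⊞ y (t ⊡ x₁) ((ℤ.- (a zero ∙ x₁)) ⊡ x₀)) (cong₂ ℤ._+_ (∙-⊡ y t x₁) (trans (∙-⊡ y (ℤ.- (a zero ∙ x₁)) x₀) (sym (ℤₚ.neg-distribˡ-* (a zero ∙ x₁) (y ∙ x₀)))))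
          along : ∀ y → y ∙ x ≡ project y ∙ x₁
          along y = trans (∙-x y) (trans (cong₂ ℤ._-_ (cong (t ℤ.*_) (∙-comm y x₁)) (trans (ℤₚ.*-comm (a zero ∙ x₁) (y ∙ x₀)) (cong ((y ∙ x₀) ℤ.*_) (∙-comm (a zero) x₁))))
            (trans (sym (∙-project x₁ y)) (∙-comm x₁ (project y))))
          negative : ∀ i → a i ∙ x ℤ.≤ 0ℤ
          negative zero = ℤₚ.≤-reflexive (trans (∙-x (a zero)) (trans (cong (λ s → s ℤ.- (a zero ∙ x₁) ℤ.* t) (ℤₚ.*-comm t (a zero ∙ x₁))) (ℤₚ.+-inverseʳ ((a zero ∙ x₁) ℤ.* t))))
          negative (suc i) = subst (ℤ._≤ 0ℤ) (sym (along (a (suc i)))) (neg₁ i)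

  comb-unit : ∀ {k d} (X : Fin k → Vec ℤ d) i → comb (lookup (unit i)) X ≡ X i
  comb-unit X i = ∙-ext λ u → trans (∙-comb u (lookup (unit i)) X) (trans (∑ℤ.sum-single (λ j → lookup (unit i) j ℤ.* (u ∙ X j)) i
    (λ j ne → trans (cong (ℤ._* (u ∙ X j)) (lookup-unit-other (ne ∘ sym))) refl)) (trans (cong (ℤ._* (u ∙ X i)) (lookup-unit-same i)) (ℤₚ.*-identityˡ (u ∙ X i))))

  unit≥0 : ∀ {d} (i j : Fin d) → 0ℤ ℤ.≤ lookup (unit i) j
  unit≥0 zero zero = ℤ.+≤+ z≤n
  unit≥0 zero (suc j) = ℤₚ.≤-reflexive (sym (lookup-replicate j 0ℤ))
  unit≥0 (suc i) zero = ℤₚ.≤-refl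
  unit≥0 (suc i) (suc j) = unit≥0 i j

  scale-1 : ∀ {d} (x : Pt d) → scale (fromℤ 1ℤ) x ≡ x
  scale-1 x = lookup-ext λ j → trans (lookup-scale (fromℤ 1ℤ) x j) (ℚₚ.*-identityˡ (lookup x j))

  vertex-convex : ∀ {k d} (X : Fin k → Vec ℤ d) i → InConv (λ j → embed (X j)) (embed (X i))
  vertex-convex X i = integral-convex X (lookup (unit i)) (unit≥0 i) (ℤ.+<+ (s≤s z≤n))
    (trans (∑ℤ.sum-single (lookup (unit i)) i (λ j ne → lookup-unit-other (ne ∘ sym))) (lookup-unit-same i)) (trans (scale-1 (embed (X i))) (cong embed (sym (comb-unit X i))))

  abs₁ : ∀ {d} → Vec ℤ d → ℤ
  abs₁ [] = 0ℤ
  abs₁ (x ∷ xs) = + ∣ x ∣ ℤ.+ abs₁ xs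

  abs₁≥0 : ∀ {d} (x : Vec ℤ d) → 0ℤ ℤ.≤ abs₁ x
  abs₁≥0 [] = ℤₚ.≤-refl
  abs₁≥0 (x ∷ xs) = 0≤+ {+ ∣ x ∣} (ℤ.+≤+ z≤n) (abs₁≥0 xs)

  abs₁≤0 : ∀ {d} (x : Vec ℤ d) → abs₁ x ℤ.≤ 0ℤ → x ≡ 𝟘
  abs₁≤0 [] _ = refl
  abs₁≤0 (x ∷ xs) le = cong₂ _∷_ (ℤₚ.∣i∣≡0⇒i≡0 (ℤₚ.+-injective (ℤₚ.≤-antisym (ℤₚ.≤-trans (subst (ℤ._≤ + ∣ x ∣ ℤ.+ abs₁ xs) (ℤₚ.+-identityʳ (+ ∣ x ∣)) (ℤₚ.+-monoʳ-≤ (+ ∣ x ∣) (abs₁≥0 xs))) le) (ℤ.+≤+ z≤n))))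
    (abs₁≤0 xs (ℤₚ.≤-trans (subst (ℤ._≤ + ∣ x ∣ ℤ.+ abs₁ xs) (ℤₚ.+-identityˡ (abs₁ xs)) (ℤₚ.+-monoˡ-≤ (abs₁ xs) (ℤ.+≤+ {0} {∣ x ∣} z≤n))) le))

  sgn : ℤ → ℤ
  sgn (+ _) = 1ℤ
  sgn -[1+ _ ] = -1ℤ

  sgn-* : ∀ x → sgn x ℤ.* x ≡ + ∣ x ∣
  sgn-* (+ n) = ℤₚ.*-identityˡ (+ n)
  sgn-* -[1+ n ] = ℤₚ.-1*i≡-i -[1+ n ]

  -- The corner of the cube of half-width ε on which the functional `y` takes its maximum ε‖y‖₁.
  corner : ∀ {d} → ℚ → Vec ℤ d → Pt d
  corner ε y = map (λ a → ε ℚ.* fromℤ (sgn a)) y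

  dot-corner : ∀ {d} ε (y : Vec ℤ d) → dot (corner ε y) (embed y) ≡ ε ℚ.* fromℤ (abs₁ y)
  dot-corner ε [] = sym (ℚₚ.*-zeroʳ ε)
  dot-corner ε (y ∷ ys) = trans (cong₂ ℚ._+_ (trans (ℚₚ.*-assoc ε (fromℤ (sgn y)) (fromℤ y)) (cong (ε ℚ.*_) (trans (fromℤ-* (sgn y) y) (cong fromℤ (sgn-* y))))) (dot-corner ε ys))
    (trans (sym (ℚₚ.*-distribˡ-+ ε (fromℤ (+ ∣ y ∣)) (fromℤ (abs₁ ys)))) (cong (ε ℚ.*_) (fromℤ-+ (+ ∣ y ∣) (abs₁ ys))))

  corner-bound : ∀ {d} ε → 0ℚ ℚ.≤ ε → (y : Vec ℤ d) → ∀ j → ℚ.∣ lookup (corner ε y) j ∣ ℚ.≤ ε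
  corner-bound ε ε≥0 y j = subst (λ x → ℚ.∣ x ∣ ℚ.≤ ε) (sym (lookup-map j (λ a → ε ℚ.* fromℤ (sgn a)) y)) (go (lookup y j))
    where
    go : ∀ a → ℚ.∣ ε ℚ.* fromℤ (sgn a) ∣ ℚ.≤ ε
    go (+ _) = ℚₚ.≤-reflexive (trans (cong ℚ.∣_∣ (ℚₚ.*-identityʳ ε)) (ℚₚ.0≤p⇒∣p∣≡p ε≥0))
    go -[1+ _ ] = ℚₚ.≤-reflexive (trans (cong ℚ.∣_∣ (trans (sym (ℚₚ.neg-distribʳ-* ε 1ℚ)) (cong ℚ.-_ (ℚₚ.*-identityʳ ε)))) (trans (ℚₚ.∣-p∣≡∣p∣ ε) (ℚₚ.0≤p⇒∣p∣≡p ε≥0)))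

  module ReflexiveDuality {d n : ℕ} (V : Fin n → LPt d) (interior : ZeroInInterior V) {m : ℕ} (W : Fin m → LPt d)
    (polar : ∀ y → (InPolar V y → InP W y) × (InP W y → InPolar V y)) where

    W-polar : ∀ j → InPolar V (embed (W j))
    W-polar j = proj₂ (polar (embed (W j))) (vertex-convex W j)

    InP⇒≤ : ∀ z → InP V (embed z) → ∀ j → W j ∙ z ℤ.≤ 1ℤ
    InP⇒≤ z inP j = fromℤ-≤⁻ (subst (ℚ._≤ fromℤ 1ℤ) (trans (dot-embed z (W j)) (cong fromℤ (∙-comm z (W j)))) (W-polar j (embed z) inP))

    -- The point y/t belongs to the polar dual, hence is a convex combination of the `W j`.
    polar-bound : ∀ y t → 0ℤ ℤ.< t → (∀ i → V i ∙ y ℤ.≤ t) → ∀ z N → (∀ j → W j ∙ z ℤ.≤ N) → y ∙ z ℤ.≤ t ℤ.* N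
    polar-bound y t 0<t hV z N hW = go (reciprocal t 0<t)
      where
      go : (Σ ℚ λ r → 0ℚ ℚ.≤ r × r ℚ.* fromℤ t ≡ 1ℚ) → y ∙ z ℤ.≤ t ℤ.* N
      go (r , r≥0 , rt) = fromℤ-≤⁻ (subst₂ ℚ._≤_ lhs (fromℤ-* t N) (*-mono-≤ (fromℤ-≤ (ℤₚ.<⇒≤ 0<t)) bound))
        where
        y/t : Pt d
        y/t = scale r (embed y)
        dot-y/t : ∀ (x : Vec ℤ d) → dot y/t (embed x) ≡ r ℚ.* fromℤ (y ∙ x)
        dot-y/t x = trans (dot-scaleˡ r (embed y) (embed x)) (cong (r ℚ.*_) (dot-embed y x))
        inPolar : InPolar V y/t
        inPolar x inP = convex-bound (λ i → embed (V i)) inP y/t 1ℚ λ i →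
          subst₂ ℚ._≤_ (sym (trans (dot-comm (embed (V i)) y/t) (trans (dot-y/t (V i)) (cong (λ s → r ℚ.* fromℤ s) (∙-comm y (V i)))))) rt (*-mono-≤ r≥0 (fromℤ-≤ (hV i)))
        bound : r ℚ.* fromℤ (y ∙ z) ℚ.≤ fromℤ N
        bound = subst (ℚ._≤ fromℤ N) (dot-y/t z) (convex-bound (λ j → embed (W j)) (proj₁ (polar y/t) inPolar) (embed z) (fromℤ N)
          λ j → subst (ℚ._≤ fromℤ N) (sym (dot-embed (W j) z)) (fromℤ-≤ (hW j)))
        lhs : fromℤ t ℚ.* (r ℚ.* fromℤ (y ∙ z)) ≡ fromℤ (y ∙ z)
        lhs = trans (sym (ℚₚ.*-assoc (fromℤ t) r (fromℤ (y ∙ z)))) (trans (cong (ℚ._* fromℤ (y ∙ z)) (trans (ℚₚ.*-comm (fromℤ t) r) rt)) (ℚₚ.*-identityˡ (fromℤ (y ∙ z))))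

    -- The case where `polar-bound` cannot divide by t. At a corner of a cube inside P the
    -- functional has value ε‖y‖₁, which is at most t ≤ 0.
    interior-bound : ∀ y t → (∀ i → V i ∙ y ℤ.≤ t) → t ℤ.≤ 0ℤ → t ≡ 0ℤ × y ≡ 𝟘
    interior-bound y t hV t≤0 = ℤₚ.≤-antisym t≤0 (fromℤ-≤⁻ (ℚₚ.≤-trans (*-nonneg ε≥0 (fromℤ-≤ (abs₁≥0 y))) corner≤t)) , abs₁≤0 y (fromℤ-≤⁻ (ℚₚ.*-cancelˡ-≤-pos ε {{ℚ.positive 0<ε}}
        (subst (ε ℚ.* fromℤ (abs₁ y) ℚ.≤_) (sym (ℚₚ.*-zeroʳ ε)) (ℚₚ.≤-trans corner≤t (fromℤ-≤ t≤0)))))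
      where
      ε : ℚ
      ε = proj₁ interior
      0<ε : 0ℚ ℚ.< ε
      0<ε = proj₁ (proj₂ interior)
      ε≥0 : 0ℚ ℚ.≤ ε
      ε≥0 = ℚₚ.<⇒≤ 0<ε
      corner≤t : ε ℚ.* fromℤ (abs₁ y) ℚ.≤ fromℤ t
      corner≤t = subst (ℚ._≤ fromℤ t) (dot-corner ε y) (convex-bound (λ i → embed (V i)) (proj₂ (proj₂ interior) (corner ε y) (corner-bound ε ε≥0 y)) (embed y) (fromℤ t)
        λ i → subst (ℚ._≤ fromℤ t) (sym (dot-embed (V i) y)) (fromℤ-≤ (hV i)))

    Representation : Vec ℤ d → ℤ → Set
    Representation z N = Σ ℤ λ p → 0ℤ ℤ.< p × Σ (Fin n → ℤ) λ c → (∀ i → 0ℤ ℤ.≤ c i) × ∑ c ≡ p ℤ.* N × (∀ u → ∑ (λ i → c i ℤ.* (u ∙ V i)) ≡ p ℤ.* (u ∙ z))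

    -- Farkas' lemma for the cone over P, with an extra coordinate 1. A separating (s, y) has V i ·
    -- y ≤ -s for all i but z · y > -sN; `polar-bound` refutes this for -s > 0 and `interior-bound`
    -- otherwise.
    bipolar : ∀ z N → 0ℤ ℤ.< N → (∀ j → W j ∙ z ℤ.≤ N) → Representation z N
    bipolar z N 0<N hW = go (farkas (λ i → 1ℤ ∷ V i) (N ∷ z))
      where
      go : Nonnegative-combination (λ i → 1ℤ ∷ V i) (N ∷ z) ⊎ Separated (λ i → 1ℤ ∷ V i) (N ∷ z) → Representation z N
      go (inj₁ (p , 0<p , c , c≥0 , eq)) = p , 0<p , c , c≥0 ,
        trans (∑ℤ.sum-cong (λ i → sym (trans (cong (c i ℤ.*_) (trans (cong (λ s → 1ℤ ℤ.* 1ℤ ℤ.+ s) (𝟘-∙ (V i))) refl)) (ℤₚ.*-identityʳ (c i)))))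
          (trans (eq (1ℤ ∷ 𝟘)) (cong (p ℤ.*_) (trans (cong (λ s → 1ℤ ℤ.* N ℤ.+ s) (𝟘-∙ z)) (trans (ℤₚ.+-identityʳ (1ℤ ℤ.* N)) (ℤₚ.*-identityˡ N))))) ,
        λ u → trans (∑ℤ.sum-cong (λ i → cong (c i ℤ.*_) (sym (ℤₚ.+-identityˡ (u ∙ V i))))) (trans (eq (0ℤ ∷ u)) (cong (p ℤ.*_) (ℤₚ.+-identityˡ (u ∙ z))))
      go (inj₂ (s ∷ y , neg , pos)) = ⊥-elim (contra (t ℤₚ.≤? 0ℤ))
        where
        t : ℤ
        t = ℤ.- s
        hV : ∀ i → V i ∙ y ℤ.≤ t
        hV i = ℤₚ.0≤i-j⇒j≤i (subst (0ℤ ℤ.≤_) (trans (cong (λ q → ℤ.- (q ℤ.+ V i ∙ y)) (ℤₚ.*-identityˡ s)) (ℤₚ.neg-distrib-+ s (V i ∙ y))) (ℤₚ.neg-mono-≤ (neg i)))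
        contra : Dec (t ℤ.≤ 0ℤ) → ⊥
        contra (yes t≤0) = let t≡0 , y≡𝟘 = interior-bound y t hV t≤0 in
          ℤₚ.<-irrefl (sym (trans (cong₂ (λ q x → N ℤ.* q ℤ.+ z ∙ x) (trans (sym (ℤₚ.neg-involutive s)) (cong ℤ.-_ t≡0)) y≡𝟘) (trans (cong₂ ℤ._+_ (ℤₚ.*-zeroʳ N) (∙-𝟘 z)) refl))) pos
        contra (no t≰0) = ℤₚ.≤⇒≯ (subst (ℤ._≤ 0ℤ) eq (ℤₚ.i≤j⇒i-j≤0 (polar-bound y t (ℤₚ.≰⇒> t≰0) hV z N hW))) pos
          where
          lemma : ∀ s N q → q ℤ.- (ℤ.- s) ℤ.* N ≡ N ℤ.* s ℤ.+ q
          lemma = solve-∀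
          eq : y ∙ z ℤ.- t ℤ.* N ≡ N ℤ.* s ℤ.+ z ∙ y
          eq = trans (cong (ℤ._- t ℤ.* N) (∙-comm y z)) (lemma s N (z ∙ y))

  isNegᵇ : ℤ → Bool
  isNegᵇ (+ _) = false
  isNegᵇ -[1+ _ ] = true

  lookup-tabulated : ∀ {d} {g : Fin d → ℚ} {x : Pt d} → x ≡ tabulate g → ∀ j → lookup x j ≡ g j
  lookup-tabulated {g = g} refl j = lookup∘tabulate g j

  flip-true : ∀ {d} σ (x : Pt d) j → σ j ≡ true → lookup (flipSign σ x) j ≡ ℚ.- lookup x j
  flip-true σ x j e rewrite lookup-tabulated {x = flipSign σ x} refl j | e = refl

  flip-false : ∀ {d} σ (x : Pt d) j → σ j ≡ false → lookup (flipSign σ x) j ≡ lookup x j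
  flip-false σ x j e rewrite lookup-tabulated {x = flipSign σ x} refl j | e = refl

  module _ {d n : ℕ} (V : Fin n → LPt d) (lab : LocallyAntiBlocking V) where

    -- The orthant of `V i` is reflected to the nonnegative one, where truncation replaces some
    -- coordinates by 0 and so lowers the point.
    trunc-InP : ∀ S i → InP V (embed (trunc S (V i)))
    trunc-InP S i = subst (InP V) (lookup-ext unflip) (proj₁ (lab σ (absolute (V i)) (absolute T) (subst (InP V) (sym (lookup-ext flipped)) (vertex-convex V i) , nonneg (V i)) (nonneg T) smaller))
      where
      T : Vec ℤ d
      T = trunc S (V i)
      σ : Fin d → Bool
      σ k = isNegᵇ (lookup (V i) k)
      absolute : Vec ℤ d → Pt d
      absolute x = embed (Vec.map (λ a → + ∣ a ∣) x)
      lookup-absolute : ∀ x k → lookup (absolute x) k ≡ fromℤ (+ ∣ lookup x k ∣)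
      lookup-absolute x k = trans (lookup-embed (Vec.map (λ a → + ∣ a ∣) x) k) (cong fromℤ (lookup-map k (λ a → + ∣ a ∣) x))
      nonneg : ∀ x → NonNeg (absolute x)
      nonneg x k = subst (0ℚ ℚ.≤_) (sym (lookup-absolute x k)) (fromℤ-≤ {0ℤ} {+ ∣ lookup x k ∣} (ℤ.+≤+ z≤n))
      choice : ∀ k → lookup T k ≡ lookup (V i) k ⊎ lookup T k ≡ 0ℤ
      choice k = subst (λ t → t ≡ lookup (V i) k ⊎ t ≡ 0ℤ) (sym (lookup-trunc S (V i) k)) (go (lookup S k))
        where
        go : ∀ b → (if b then lookup (V i) k else 0ℤ) ≡ lookup (V i) k ⊎ (if b then lookup (V i) k else 0ℤ) ≡ 0ℤ
        go true = inj₁ refl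
        go false = inj₂ refl
      smaller : ∀ k → lookup (absolute T) k ℚ.≤ lookup (absolute (V i)) k
      smaller k = subst₂ ℚ._≤_ (sym (lookup-absolute T k)) (sym (lookup-absolute (V i) k)) (fromℤ-≤ (go (choice k)))
        where
        go : lookup T k ≡ lookup (V i) k ⊎ lookup T k ≡ 0ℤ → + ∣ lookup T k ∣ ℤ.≤ + ∣ lookup (V i) k ∣
        go (inj₁ e) = ℤₚ.≤-reflexive (cong (λ t → + ∣ t ∣) e)
        go (inj₂ e) = subst (λ t → + ∣ t ∣ ℤ.≤ + ∣ lookup (V i) k ∣) (sym e) (ℤ.+≤+ z≤n)
      sign-abs : ∀ x k → (lookup x k ≡ lookup (V i) k ⊎ lookup x k ≡ 0ℤ) → lookup (flipSign σ (absolute x)) k ≡ lookup (embed x) k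
      sign-abs x k ch = trans (go (lookup (V i) k) refl ch) (sym (lookup-embed x k))
        where
        go : ∀ a → lookup (V i) k ≡ a → (lookup x k ≡ lookup (V i) k ⊎ lookup x k ≡ 0ℤ) → lookup (flipSign σ (absolute x)) k ≡ fromℤ (lookup x k)
        go (+ a) e ch = trans (flip-false σ (absolute x) k (cong isNegᵇ e)) (trans (lookup-absolute x k) (cong fromℤ (value ch)))
          where
          value : (lookup x k ≡ lookup (V i) k ⊎ lookup x k ≡ 0ℤ) → + ∣ lookup x k ∣ ≡ lookup x k
          value (inj₁ e') = subst (λ t → + ∣ t ∣ ≡ t) (sym (trans e' e)) refl
          value (inj₂ e') = subst (λ t → + ∣ t ∣ ≡ t) (sym e') refl
        go -[1+ a ] e ch = trans (flip-true σ (absolute x) k (cong isNegᵇ e)) (trans (cong ℚ.-_ (lookup-absolute x k)) (value ch))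
          where
          value : (lookup x k ≡ lookup (V i) k ⊎ lookup x k ≡ 0ℤ) → ℚ.- fromℤ (+ ∣ lookup x k ∣) ≡ fromℤ (lookup x k)
          value (inj₁ e') = subst (λ t → ℚ.- fromℤ (+ ∣ t ∣) ≡ fromℤ t) (sym (trans e' e)) refl
          value (inj₂ e') = subst (λ t → ℚ.- fromℤ (+ ∣ t ∣) ≡ fromℤ t) (sym e') refl
      unflip : ∀ k → lookup (flipSign σ (absolute T)) k ≡ lookup (embed T) k
      unflip k = sign-abs T k (choice k)
      flipped : ∀ k → lookup (flipSign σ (absolute (V i))) k ≡ lookup (embed (V i)) k
      flipped k = sign-abs (V i) k (inj₁ refl)

  reflexive-dualPair : ∀ {d n} (V : Fin n → LPt d) → (R : Reflexive V) → LocallyAntiBlocking V → DualPair d n (proj₁ (proj₂ R))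
  reflexive-dualPair V (interior , m , W , polar) lab = record
    { V = V ; W = W
    ; pairing = λ i j → InP⇒≤ (V i) (vertex-convex V i) j
    ; bipolar = bipolar
    ; truncation = λ S i j → InP⇒≤ (trunc S (V i)) (trunc-InP V lab S i) j }
    where open ReflexiveDuality V interior W polar

-- The triangulation of P and the lattice points of its dilates

module Assembly where
  open import Data.Integer as ℤ using (ℤ; +_; 0ℤ; 1ℤ; ∣_∣)
  import Data.Integer.Properties as ℤₚ
  open import Data.Integer.Tactic.RingSolver using (solve-∀)
  open import Data.Rational as ℚ using (ℚ; 0ℚ)
  import Data.Rational.Properties as ℚₚ
  open import Data.Fin.Properties using (any?)
  open import Data.Vec using (zipWith)
  open import Data.Vec.Properties using (lookup-replicate; lookup-map; ≡-dec)
  open import Data.List using (length)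
  open import Data.List.Relation.Unary.Any using (here)
  open import Data.List.Relation.Unary.All using ([])
  open import Data.List.Relation.Unary.AllPairs using ([]; _∷_)
  open import Relation.Binary.PropositionalEquality using (_≡_; _≢_; refl; sym; trans; cong; cong₂; subst; subst₂)
  open IntegerVectors
  open RationalPoints
  open PolarDuality
  open DualPolytopes
  open PullingTriangulation
  open Determinants
  open Monomials using (mono; sumℕ)
  open FaceMonomials
  open Counting
  open Fans

  sumV-cong : ∀ {d k} {f g : Fin k → Pt d} → (∀ i → f i ≡ g i) → sumV f ≡ sumV g
  sumV-cong {k = zero} h = refl
  sumV-cong {k = suc k} h = cong₂ (zipWith ℚ._+_) (h zero) (sumV-cong (h ∘ suc))

  InConv-cong : ∀ {d k} {X Y : Fin k → Pt d} {x} → (∀ i → X i ≡ Y i) → InConv X x → InConv Y x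
  InConv-cong h (c , c≥0 , total , eq , ok) = c , c≥0 , total , trans (sumV-cong (λ i → cong (scale (c i)) (sym (h i)))) eq , ok

  embed-⊡ : ∀ {d} t (x : Vec ℤ d) → embed (t ⊡ x) ≡ scale (fromℤ t) (embed x)
  embed-⊡ t x = lookup-ext λ j → trans (lookup-embed (t ⊡ x) j) (trans (cong fromℤ (lookup-map j (t ℤ.*_) x)) (trans (sym (fromℤ-* t (lookup x j)))
    (trans (cong (fromℤ t ℚ.*_) (sym (lookup-embed x j))) (sym (lookup-scale (fromℤ t) (embed x) j)))))

  ∑-sumℕ : ∀ {k} (α : Fin k → ℕ) → ∑ (λ j → + α j) ≡ + sumℕ α
  ∑-sumℕ {zero} α = ∑ℤ.sum-nil _
  ∑-sumℕ {suc k} α = trans (∑ℤ.sum-suc (λ j → + α j)) (cong (λ t → + α zero ℤ.+ t) (∑-sumℕ (α ∘ suc)))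

  module Theorem {d n : ℕ} (V : Fin n → LPt d) (R : Reflexive V) (lab : LocallyAntiBlocking V) where

    DP : DualPair d n (proj₁ (proj₂ R))
    DP = reflexive-dualPair V R lab

    open DualPair DP using (W; bipolar)
    open DualPairProperties DP
    module Tri = Triangulate cellComplex
    open Tri using (facets; facet; cell; isFacet)
    open FanMonomials Tri.fan

    facetCount : ℕ
    facetCount = length facets

    W-polar : ∀ j → InPolar V (embed (W j))
    W-polar j = proj₂ (proj₂ (proj₂ (proj₂ R)) (embed (W j))) (vertex-convex W j)

    -- The dual point u₀ of the cell. It is 1 on the rays of the facet, so on the cone it computes
    -- the sum of the coordinates, and top ≤ 1 cuts out the simplex.
    top : Fin facetCount → Vec ℤ d
    top F = proj₂ (List.lookup cellList (cell F))

    top-isW : ∀ F → IsW (top F)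
    top-isW F = GoodCell.u₀-isW (good-cell (cell F))

    top-vertex : ∀ F j → top F ∙ v (f F j) ≡ 1ℤ
    top-vertex F j = InCell.tight-u₀ (good-cell (cell F)) {v (f F j)} (proj₁ (vertex-props (f F j))) (proj₁ (proj₂ (isFacet F)) j)

    top-total : ∀ F z → top F ∙ z ≡ ∑ (λ j → c F j ∙ z)
    top-total F z = trans (cong (top F ∙_) (sym (c-span F z))) (trans (∙-comb (top F) (λ j → c F j ∙ z) (v ∘ f F))
      (∑ℤ.sum-cong (λ j → trans (cong ((c F j ∙ z) ℤ.*_) (top-vertex F j)) (ℤₚ.*-identityʳ (c F j ∙ z)))))

    InDil-of : ∀ z t → (∀ j → W j ∙ z ℤ.≤ + suc t) → InDil (suc t) V (embed z)
    InDil-of z t h = go (bipolar z (+ suc t) (ℤ.+<+ (s≤s z≤n)) h)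
      where
      T : ℤ
      T = + suc t
      go : (Σ ℤ λ p → 0ℤ ℤ.< p × Σ (Fin n → ℤ) λ c → (∀ i → 0ℤ ℤ.≤ c i) × ∑ c ≡ p ℤ.* T × (∀ u → ∑ (λ i → c i ℤ.* (u ∙ V i)) ≡ p ℤ.* (u ∙ z))) → InDil (suc t) V (embed z)
      go (p , 0<p , c , c≥0 , total , eq) = InConv-cong (λ i → embed-⊡ T (V i))
        (integral-convex (λ i → T ⊡ V i) c c≥0 (0<* 0<p (ℤ.+<+ (s≤s z≤n))) total (trans (sym (embed-⊡ (p ℤ.* T) z)) (cong embed (∙-ext λ u →
          trans (∙-⊡ u (p ℤ.* T) z) (sym (trans (∙-comb u c (λ i → T ⊡ V i)) (trans (∑ℤ.sum-cong (λ i → trans (cong (c i ℤ.*_) (∙-⊡ u T (V i))) (swap (c i) T (u ∙ V i))))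
            (trans (sym (∑ℤ.sum-*ˡ T (λ i → c i ℤ.* (u ∙ V i)))) (trans (cong (T ℤ.*_) (eq u)) (rearr T p (u ∙ z)))))))))))
        where
        swap : ∀ a b c → a ℤ.* (b ℤ.* c) ≡ b ℤ.* (a ℤ.* c)
        swap = solve-∀
        rearr : ∀ a b c → a ℤ.* (b ℤ.* c) ≡ b ℤ.* a ℤ.* c
        rearr = solve-∀

    InP-of : ∀ z → IsV z → InP V (embed z)
    InP-of z isV = InConv-cong (λ i → scale-1 (embed (V i))) (InDil-of z 0 isV)

    InDil⇒≤ : ∀ z t → InDil t V (embed z) → ∀ j → W j ∙ z ℤ.≤ + t
    InDil⇒≤ z t inDil j = fromℤ-≤⁻ (subst (ℚ._≤ fromℤ (+ t)) (trans (dot-embed z (W j)) (cong fromℤ (∙-comm z (W j))))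
      (convex-bound (λ i → scale (fromℤ (+ t)) (embed (V i))) inDil (embed (W j)) (fromℤ (+ t)) λ i →
        subst₂ ℚ._≤_ (sym (dot-scaleˡ (fromℤ (+ t)) (embed (V i)) (embed (W j)))) (ℚₚ.*-identityʳ (fromℤ (+ t)))
          (*-mono-≤ (fromℤ-≤ {0ℤ} {+ t} (ℤ.+≤+ z≤n)) (W-polar j (embed (V i)) (vertex-convex V i)))))

    -- The apex is the interior point 0, listed first so that the rows of the edge matrix are the
    -- rays.
    simplex : Fin facetCount → Simplex d
    simplex F zero = 𝟘
    simplex F (suc j) = v (f F j)

    unimodular : Unimodular simplex
    unimodular F = trans (cong ∣_∣ (det-cong d (λ r k → trans (cong (λ t → lookup (v (f F r)) k ℤ.- t) (lookup-replicate k 0ℤ)) (ℤₚ.+-identityʳ (lookup (v (f F r)) k)))))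
      (generating-det (v ∘ f F) (λ z → (λ j → c F j ∙ z) , c-span F z))

    simplex⊆P : ∀ F k → InP V (embed (simplex F k))
    simplex⊆P F zero = InP-of 𝟘 (λ j → subst (ℤ._≤ 1ℤ) (sym (∙-𝟘 (W j))) (ℤ.+≤+ z≤n))
    simplex⊆P F (suc j) = InP-of (v (f F j)) (proj₁ (vertex-props (f F j)))

    -- After clearing denominators, q x = z, the coordinates of `z` in its cone are the weights of
    -- the rays. The apex takes the remainder q - top · z, nonnegative because `top F` lies in the
    -- polar dual.
    covering : ∀ x → InP V x → ∃ λ F → InConv (simplexPts (simplex F)) x
    covering x inP = go (common-denominator x)
      where
      go : (Σ ℤ λ q → 0ℤ ℤ.< q × Σ (Vec ℤ d) λ z → scale (fromℤ q) x ≡ embed z) → ∃ λ F → InConv (simplexPts (simplex F)) x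
      go (q , 0<q , z , eq) = F , integral-convex (simplex F) coef coef≥0 0<q total (trans eq (cong embed (sym combination)))
        where
        W≤q : ∀ j → W j ∙ z ℤ.≤ q
        W≤q j = fromℤ-≤⁻ (subst₂ ℚ._≤_ (trans (sym (dot-scaleˡ (fromℤ q) x (embed (W j)))) (trans (cong (λ y → dot y (embed (W j))) eq) (trans (dot-embed z (W j)) (cong fromℤ (∙-comm z (W j))))))
          (ℚₚ.*-identityʳ (fromℤ q)) (*-mono-≤ (fromℤ-≤ (ℤₚ.<⇒≤ 0<q)) (W-polar j x inP)))
        F : Fin facetCount
        F = proj₁ (cover z)
        coef : Fin (suc d) → ℤ
        coef zero = q ℤ.- top F ∙ z
        coef (suc j) = c F j ∙ z
        coef≥0 : ∀ k → 0ℤ ℤ.≤ coef k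
        coef≥0 zero = ℤₚ.i≤j⇒0≤j-i (dual-bound {top F} {z} 0<q (top-isW F) W≤q)
        coef≥0 (suc j) = proj₂ (cover z) j
        total : ∑ coef ≡ q
        total = trans (∑ℤ.sum-suc coef) (trans (cong (λ t → q ℤ.- top F ∙ z ℤ.+ t) (sym (top-total F z))) (lemma q (top F ∙ z)))
          where
          lemma : ∀ a b → a ℤ.- b ℤ.+ b ≡ a
          lemma = solve-∀
        combination : comb coef (simplex F) ≡ z
        combination = ∙-ext λ u → trans (∙-comb u coef (simplex F)) (trans (∑ℤ.sum-suc (λ k → coef k ℤ.* (u ∙ simplex F k)))
          (trans (cong₂ ℤ._+_ (trans (cong (coef zero ℤ.*_) (∙-𝟘 u)) (ℤₚ.*-zeroʳ (coef zero))) (trans (sym (∙-comb u (λ j → c F j ∙ z) (v ∘ f F))) (cong (u ∙_) (c-span F z)))) (ℤₚ.+-identityˡ (u ∙ z))))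

    heightAt : Fin facetCount → Fin (suc d) → ℤ
    heightAt F zero = 0ℤ
    heightAt F (suc j) = ω (f F j)

    own-height : ∀ F k → simplex F k ∙ a F ≡ heightAt F k
    own-height F zero = 𝟘-∙ (a F)
    own-height F (suc j) = trans (∙-comm (v (f F j)) (a F)) (a-eq F j)

    below-height : ∀ F G k → simplex F k ∙ a G ℤ.≤ heightAt F k
    below-height F G zero = ℤₚ.≤-reflexive (𝟘-∙ (a G))
    below-height F G (suc j) = subst (ℤ._≤ ω (f F j)) (∙-comm (a G) (v (f F j))) (a-le G (f F j))

    tight-common : ∀ F G k → simplex F k ∙ a G ≡ heightAt F k → ∃ λ l → simplex F k ≡ simplex G l
    tight-common F G zero e = zero , refl
    tight-common F G (suc j) e = let l , e' = a-tight G (f F j) (trans (∙-comm (a G) (v (f F j))) e) in suc l , cong v (sym e')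

    average : ∀ F {x} → InConv (simplexPts (simplex F)) x → (Fin (suc d) → ℤ) → ℚ
    average F conv h = sumF (λ k → proj₁ conv k ℚ.* fromℤ (h k))

    dot-average : ∀ F G {x} (conv : InConv (simplexPts (simplex F)) x) → dot x (embed (a G)) ≡ average F conv (λ k → simplex F k ∙ a G)
    dot-average F G conv = trans (dot-convex (simplexPts (simplex F)) conv (embed (a G))) (sumF-cong (λ k → cong (proj₁ conv k ℚ.*_) (dot-embed (simplex F k) (a G))))

    own-average : ∀ F {x} (conv : InConv (simplexPts (simplex F)) x) → dot x (embed (a F)) ≡ average F conv (heightAt F)
    own-average F conv = trans (dot-average F F conv) (sumF-cong (λ k → cong (λ t → proj₁ conv k ℚ.* fromℤ t) (own-height F k)))

    average-bound : ∀ F G {x} → InConv (simplexPts (simplex F)) x → dot x (embed (a G)) ℚ.≤ dot x (embed (a F))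
    average-bound F G conv = subst₂ ℚ._≤_ (sym (dot-average F G conv)) (sym (own-average F conv)) (sumF-mono (λ k → *-mono-≤ (proj₁ (proj₂ conv) k) (fromℤ-≤ (below-height F G k))))

    -- By `average-bound` in both directions the linear pieces `a F` and `a G` agree at `x`. A
    -- vertex of `F` with positive weight then has no slack under `a G`, so it is a vertex of `G`.
    intersection : ∀ F G x → InConv (simplexPts (simplex F)) x → InConv (simplexPts (simplex G)) x →
      InConvSupp (simplexPts (simplex F)) (λ k → ∃ λ l → simplex F k ≡ simplex G l) x
    intersection F G x conv@(coef , coef≥0 , total , eq , _) conv' = coef , coef≥0 , total , eq , common
      where
      slack : Fin (suc d) → ℤ
      slack k = heightAt F k ℤ.- simplex F k ∙ a G
      t : Fin (suc d) → ℚ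
      t k = coef k ℚ.* fromℤ (slack k)
      t≥0 : ∀ k → 0ℚ ℚ.≤ t k
      t≥0 k = *-nonneg (coef≥0 k) (fromℤ-≤ (ℤₚ.i≤j⇒0≤j-i (below-height F G k)))
      P : ℚ
      P = dot x (embed (a G))
      sum-t : sumF t ℚ.+ P ≡ dot x (embed (a F))
      sum-t = trans (cong (sumF t ℚ.+_) (dot-average F G conv)) (trans (sym (sumF-+ t (λ k → coef k ℚ.* fromℤ (simplex F k ∙ a G))))
        (trans (sumF-cong (λ k → trans (sym (ℚₚ.*-distribˡ-+ (coef k) (fromℤ (slack k)) (fromℤ (simplex F k ∙ a G)))) (cong (coef k ℚ.*_) (trans (fromℤ-+ (slack k) (simplex F k ∙ a G)) (cong fromℤ (lemma (heightAt F k) (simplex F k ∙ a G)))))))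
        (sym (own-average F conv))))
        where
        lemma : ∀ p q → p ℤ.- q ℤ.+ q ≡ p
        lemma = solve-∀
      sum≤0 : sumF t ℚ.≤ 0ℚ
      sum≤0 = subst₂ ℚ._≤_ (trans (ℚₚ.+-assoc (sumF t) P (ℚ.- P)) (trans (cong (sumF t ℚ.+_) (ℚₚ.+-inverseʳ P)) (ℚₚ.+-identityʳ (sumF t)))) (ℚₚ.+-inverseʳ P)
        (ℚₚ.+-mono-≤ (subst (ℚ._≤ P) (sym sum-t) (average-bound G F conv')) (ℚₚ.≤-refl {ℚ.- P}))
      common : ∀ k → coef k ≢ 0ℚ → ∃ λ l → simplex F k ≡ simplex G l
      common k ne = tight-common F G k (sym (ℤₚ.i-j≡0⇒i≡j (heightAt F k) (simplex F k ∙ a G) (ℤₚ.≤-antisym (fromℤ-≤⁻ slack≤0) (ℤₚ.i≤j⇒0≤j-i (below-height F G k)))))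
        where
        instance
          pos : ℚ.Positive (coef k)
          pos = ℚ.positive (ℚₚ.≰⇒> (λ le → ne (ℚₚ.≤-antisym le (coef≥0 k))))
        slack≤0 : fromℤ (slack k) ℚ.≤ fromℤ 0ℤ
        slack≤0 = ℚₚ.*-cancelˡ-≤-pos (coef k) (ℚₚ.≤-reflexive (trans (sumF-zero-terms t≥0 sum≤0 k) (sym (ℚₚ.*-zeroʳ (coef k)))))

    triangulation : IsTriangulation V simplex
    triangulation = (λ F e → contradiction (trans (sym (unimodular F)) e) λ ()) , simplex⊆P , covering , intersection

    IsVertex : LPt d → Set
    IsVertex z = ∃ λ k → vertex k ≡ z

    IsVertex? : ∀ z → Dec (IsVertex z)
    IsVertex? z = any? (λ k → ≡-dec ℤ._≟_ (vertex k) z)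

    weightOf : ∀ {z} → Dec (IsVertex z) → ℚ
    weightOf (yes (k , _)) = fromℤ (ω k)
    -- The origin, the common apex, is not a ray and receives its height here; the linear pieces are
    -- 0 there.
    weightOf (no _) = 0ℚ

    weight : LPt d → ℚ
    weight z = weightOf (IsVertex? z)

    weight-𝟘 : weight 𝟘 ≡ 0ℚ
    weight-𝟘 = go (IsVertex? 𝟘)
      where
      go : (D : Dec (IsVertex 𝟘)) → weightOf D ≡ 0ℚ
      go (yes (k , e)) = contradiction e (proj₂ (vertex-props k))
      go (no _) = refl

    weight-vertex : ∀ k → weight (vertex k) ≡ fromℤ (ω k)
    weight-vertex k = go (IsVertex? (vertex k))
      where
      go : (D : Dec (IsVertex (vertex k))) → weightOf D ≡ fromℤ (ω k)
      go (yes (l , e)) = cong (λ i → fromℤ (ω i)) (vertex-injective e)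
      go (no none) = contradiction (k , refl) none

    affine : ∀ F z → dot (embed (a F)) (embed z) ℚ.+ 0ℚ ≡ fromℤ (a F ∙ z)
    affine F z = trans (ℚₚ.+-identityʳ (dot (embed (a F)) (embed z))) (dot-embed (a F) z)

    regular : Regular simplex
    regular = weight , λ F → embed (a F) , 0ℚ , on F , strictly F
      where
      on : ∀ F k → dot (embed (a F)) (embed (simplex F k)) ℚ.+ 0ℚ ≡ weight (simplex F k)
      on F zero = trans (affine F 𝟘) (trans (cong fromℤ (∙-𝟘 (a F))) (sym weight-𝟘))
      on F (suc j) = trans (affine F (v (f F j))) (trans (cong fromℤ (a-eq F j)) (sym (weight-vertex (f F j))))
      strictly : ∀ F G l → (∀ k → simplex G l ≢ simplex F k) → dot (embed (a F)) (embed (simplex G l)) ℚ.+ 0ℚ ℚ.< weight (simplex G l)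
      strictly F G zero ne = contradiction refl (ne zero)
      strictly F G (suc l) ne = subst₂ ℚ._<_ (sym (affine F (v (f G l)))) (sym (weight-vertex (f G l))) (fromℤ-< (a-lt F (f G l) (λ j e → ne (suc j) (cong v (sym e)))))

    open Ehrhart Tri.fan

    pt-mono : ∀ F α → pt (mono (f F) α) ≡ comb (λ j → + α j) (v ∘ f F)
    pt-mono F α = trans (sym (c-span F (pt (mono (f F) α)))) (comb-cong (v ∘ f F) (λ j → trans (pt-coef F (mono (f F) α) (mono-face F α) j) (cong +_ (mono-lookup F α j))))

    ball⇒≤ : ∀ {t z} → InBall t z → ∀ j → W j ∙ z ℤ.≤ + t
    ball⇒≤ {t} {z} (F , α , refl , le) j = subst (ℤ._≤ + t) (sym (trans (cong (W j ∙_) (pt-mono F α)) (∙-comb (W j) (λ i → + α i) (v ∘ f F))))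
      (ℤₚ.≤-trans (∑-weighted (λ i → ℤ.+≤+ z≤n) (λ i → proj₁ (vertex-props (f F i)) j)) (subst (ℤ._≤ + t) (sym (∑-sumℕ α)) (ℤ.+≤+ le)))

    -- The coordinates in the cone containing `z` add up to `top F ∙ z`, which `dual-bound` limits
    -- for a positive dilation factor.
    ≤⇒ball : ∀ {t z} → (∀ j → W j ∙ z ℤ.≤ + suc t) → InBall (suc t) z
    ≤⇒ball {t} {z} h = F , α , trans (sym (c-span F z)) (trans (comb-cong (v ∘ f F) (λ j → sym (α-eq j))) (sym (pt-mono F α))) ,
        ℤₚ.drop‿+≤+ (subst (ℤ._≤ + suc t) (trans (top-total F z) (trans (∑ℤ.sum-cong (λ j → sym (α-eq j))) (∑-sumℕ α))) (dual-bound {top F} {z} (ℤ.+<+ (s≤s z≤n)) (top-isW F) h))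
      where
      F : Fin facetCount
      F = proj₁ (cover z)
      α : Fin d → ℕ
      α j = ∣ c F j ∙ z ∣
      α-eq : ∀ j → + α j ≡ c F j ∙ z
      α-eq j = ℤₚ.0≤i⇒+∣i∣≡i (proj₂ (cover z) j)

    ball-zero : ∀ z → InBall 0 z → z ≡ 𝟘
    ball-zero z (F , α , z≡ , le) = trans z≡ (trans (pt-mono F α) (∙-ext λ u → trans (∙-comb u (λ j → + α j) (v ∘ f F)) (trans (∑ℤ.sum-zero (λ j → trans (cong (λ t → + t ℤ.* (u ∙ v (f F j))) (zero-terms α (ℕₚ.n≤0⇒n≡0 le) j)) refl)) (sym (∙-𝟘 u)))))
      where
      zero-terms : ∀ {k} (α : Fin k → ℕ) → sumℕ α ≡ 0 → ∀ j → α j ≡ 0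
      zero-terms {suc k} α e zero = ℕₚ.m+n≡0⇒m≡0 (α zero) e
      zero-terms {suc k} α e (suc j) = zero-terms (α ∘ suc) (ℕₚ.m+n≡0⇒n≡0 (α zero) e) j

    zero-ball : InBall 0 𝟘
    zero-ball = F , (λ _ → 0) , sym (trans (pt-mono F (λ _ → 0)) (∙-ext λ u → trans (∙-comb u (λ _ → 0ℤ) (v ∘ f F)) (trans (∑ℤ.sum-zero (λ j → refl)) (sym (∙-𝟘 u))))) , ℕₚ.≤-reflexive (zeros d)
      where
      F : Fin facetCount
      F = proj₁ (cover 𝟘)
      zeros : ∀ k → sumℕ {k} (λ _ → 0) ≡ 0
      zeros zero = refl
      zeros (suc k) = zeros k

    -- `IsEhrhart` prescribes the value at 0 separately, so that dilate gets its own list,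
    -- consisting of the origin.
    counts : ∀ L → IsEhrhart V L → ∀ t → Σ (List (Vec ℤ d)) λ xs → length xs ≡ L t × Enumerates t xs
    counts L (L0 , _) zero = 𝟘 ∷ [] , sym L0 , [] ∷ [] , λ z → (λ { (here refl) → zero-ball }) , λ b → here (ball-zero z b)
    counts L (_ , count) (suc t) = go (count t)
      where
      go : CountsLatticePts V (suc t) (L (suc t)) → Σ (List (Vec ℤ d)) λ xs → length xs ≡ L (suc t) × Enumerates (suc t) xs
      go (xs , unique , len , mem) = xs , len , unique , λ z →
        (λ z∈ → ≤⇒ball {t} {z} (InDil⇒≤ z (suc t) (proj₁ (mem z) z∈))) , λ b → proj₂ (mem z) (InDil-of z t (ball⇒≤ {suc t} {z} b))

    has-triangulation : Σ ℕ λ N → Σ (Fin N → Simplex d) λ T → IsTriangulation V T × Regular T × Unimodular T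
    has-triangulation = facetCount , simplex , triangulation , regular , unimodular

    h*-unimodal : ∀ L → IsEhrhart V L → Unimodal d (hstar d L)
    h*-unimodal L eh = hstar-unimodal L (counts L eh)

theorem3p4 : (d n : ℕ) (V : Fin n → LPt d) →
    Reflexive V → LocallyAntiBlocking V →
    (Σ ℕ λ N → Σ (Fin N → Simplex d) λ T →
    IsTriangulation V T × Regular T × Unimodular T) ×
    (∀ (L : ℕ → ℕ) → IsEhrhart V L → Unimodal d (hstar d L))
theorem3p4 d n V R lab = has-triangulation , h*-unimodal
  where open Assembly.Theorem V R lab
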